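{- For each odd integer $b\ge1$, the collection $\zeta(b+2),\zeta(b+4),\dots,\zeta(8b-3),\zeta(8b-1)$ (i.e. $\zeta(s)$ for all odd $s$ with $b+2\le s\le 8b-1$) contains at least one irrational number.
   Context: $\zeta(s)=\sum_{m\ge1}m^{ -s}$ denotes the Riemann zeta function. -}

module Defs where

open import Data.Nat as ℕ using (ℕ; zero; suc; _^_)
open import Data.Nat.Properties using (m^n≢0)
open import Data.Integer using (+_)
open import Data.Rational using (ℚ; _/_; _+_; _-_; ∣_∣; _<_; 0ℚ)
open import Data.Product using (Σ; ∃; _×_)
open import Relation.Binary.PropositionalEquality using (_≡_)

Odd : ℕ → Set
Odd n = ∃ λ k → n ≡ suc (2 ℕ.* k)

invPow : ℕ → ℕ → ℚ
invPow k s = _/_ (+ 1) (suc k ^ s) {{m^n≢0 (suc k) s}}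

zetaPartial : ℕ → ℕ → ℚ
zetaPartial s zero = 0ℚ
zetaPartial s (suc n) = zetaPartial s n + invPow n s

ConvergesTo : (ℕ → ℚ) → ℚ → Set
ConvergesTo f r = ∀ (ε : ℚ) → 0ℚ < ε → ∃ λ N → ∀ n → N ℕ.≤ n → ∣ f n - r ∣ < ε

ZetaRational : ℕ → Set
ZetaRational s = ∃ λ (r : ℚ) → ConvergesTo (zetaPartial s) r

{-# OPTIONS --safe #-}
-- Let p = 24 m + r be a large prime and put g = f^b / t, where
--
--   f(t) = ∏_{l=1}^{24m} (t - l)(t + p + l) / (∏_{l=1}^{p-1} (t + l)² · ∏_{e=1}^{5} ∏_{l=em}^{p-em} (t + l)).
--
-- Expanding g in partial fractions, whose poles have order at most 7 b, turns
-- X = ∑_{t≥1} [x^(b-1)] (g(t + x) - g(-p - t - x)) into a rational combination of 1 and of ζ(s) for odd s with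
-- b + 2 ≤ s ≤ 8 b - 1: the even values cancel between the two halves, and ζ(b) because the residues of g sum to zero.
-- A quotient w of factorials clears the denominators of this combination; prime by prime this is an inequality between
-- sums of floors ⌊j m / q⌋, which only depends on the Farey interval containing m / q and so needs finitely many checks.
-- On the other hand w |X| ≤ poly(m) / 2^(b m).  Hence if all these ζ(s) are rational with common denominator D, then
-- the integer D w X vanishes for large p.  But X ≠ 0: in the p-adic metric every contribution to X is integral
-- except that of the simple pole at t = 0, which is a unit divided by p^b.
module Submission where

open import Defs
open import Data.Bool using (Bool; true; false; if_then_else_; T; _∧_)
open import Data.Empty using (⊥; ⊥-elim)
open import Data.Integer using (ℤ; +_; -[1+_]; 0ℤ; 1ℤ) renaming (_+_ to _+ℤ_; _*_ to _*ℤ_; -_ to -ℤ_; _-_ to _-ℤ_; ∣_∣ to ∣_∣ℤ; _≤_ to _≤ℤ_; _<_ to _<ℤ_; _≟_ to _≟ℤ_)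
import Data.Integer as ℤ
import Data.Integer.Properties as ℤP
import Data.Integer.Tactic.RingSolver as ℤSolver
open import Data.List using (List; []; _∷_; _++_; foldr; length; concatMap)
import Data.List.Properties as ListP
open import Data.List.Relation.Unary.All using (All; []; _∷_)
import Data.List.Relation.Unary.All as All
import Data.List.Relation.Unary.All.Properties as AllP
open import Data.Nat using (ℕ; zero; suc; _+_; _*_; _∸_; _^_; _≤_; _<_; z≤n; s≤s; NonZero; _/_; _%_; _!; _⊔_; _≤ᵇ_; _<ᵇ_)
import Data.Nat as ℕ
import Data.Nat.Properties as ℕP
import Data.Nat.Coprimality as Coprimality
import Data.Nat.DivMod as DM
open import Data.Nat.Divisibility using (_∣_; divides; _∣?_; ∣-trans; ∣m⇒∣m*n; ∣m∣n⇒∣m+n; ∣m+n∣m⇒∣n)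
import Data.Nat.Divisibility as Div
open import Data.Nat.ListAction using (product; sum)
open import Data.Nat.Primality using (Prime; euclidsLemma; prime⇒irreducible; prime⇒nonZero; prime⇒nonTrivial)
open import Data.Nat.Primality.Factorisation using (PrimeFactorisation; factorise)
import Data.Nat.Tactic.RingSolver as ℕSolver
open import Data.Product using (Σ; ∃; _×_; _,_; proj₁; proj₂)
open import Data.Rational using (ℚ; 0ℚ; 1ℚ; toℚᵘ; fromℚᵘ; ↥_; ↧ₙ_) renaming (_+_ to _⊕_; _*_ to _⊗_; -_ to ⊖_; _-_ to _⊝_; _≤_ to _≤ℚ_; _<_ to _<ℚ_; ∣_∣ to ∣_∣ℚ)
import Data.Rational as ℚ
import Data.Rational.Properties as ℚP
import Data.Rational.Unnormalised as ℚᵘ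
import Data.Rational.Unnormalised.Properties as ℚᵘP
open import Data.Sum using (_⊎_; inj₁; inj₂)
open import Data.Unit using (tt)
open import Function using (_∘_)
open import Level using (0ℓ)
open import Relation.Binary.Definitions using (tri<; tri≈; tri>)
open import Relation.Binary.PropositionalEquality using (_≡_; _≢_; refl; sym; trans; cong; cong₂; subst; subst₂; module ≡-Reasoning)
open import Relation.Nullary using (¬_; Dec; yes; no; contradiction)
open import Relation.Nullary.Decidable using (dec⇒maybe)
open import Tactic.RingSolver using (solve-∀)
open import Tactic.RingSolver.Core.AlmostCommutativeRing using (AlmostCommutativeRing; fromCommutativeRing)

-- Rational arithmetic

-- A pole of order `j` contributes `ζ(j + b - 1)` to the coefficient of `x^(b-1)`, hence the range
-- up to `7 b + b - 1`. As `b - 1` is even, the reflected half carries the sign `(-1)^j`, so odd `j`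
-- are doubled. The zeros of order `b` remove all terms with `t ≤ 24 m`, which makes the sum small.
-- No real number is formed: the values that cancel enter only through differences of partial sums
-- whose ranges differ by a bounded number of terms. These tend to 0 even for the harmonic series,
-- which is what `ζ(b)` becomes for `b = 1`. Nor is `g` evaluated as a function: it is a formal list
-- of partial fractions, read off through power series built by multiplying and dividing by `d + x`.
-- The obstacle is that block ends such as `p - e m` are not multiples of `m`, so the floors do not
-- scale exactly. They are wrong only if a multiple of the prime power `q` lies in some
-- `[j m, j m + 24]` with `j ≤ 72`. The product of all these integers is polynomial in `m`, and its
-- 26th power in the multiplier absorbs every such error.

ℚ-ring : AlmostCommutativeRing 0ℓ 0ℓ
ℚ-ring = fromCommutativeRing ℚP.+-*-commutativeRing (λ x → dec⇒maybe (0ℚ ℚP.≟ x))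

abstract
  -- Opaque, so that large integers are not normalised as fractions during type checking; outside
  -- this block it is known only through the lemmas stated here.
  ι : ℤ → ℚ
  ι i = fromℚᵘ (ℚᵘ.mkℚᵘ i 0)

  ι-toℚᵘ : ∀ i → toℚᵘ (ι i) ℚᵘ.≃ ℚᵘ.mkℚᵘ i 0
  ι-toℚᵘ i = ℚP.toℚᵘ-fromℚᵘ (ℚᵘ.mkℚᵘ i 0)

  ι-injective : ∀ {i j} → ι i ≡ ι j → i ≡ j
  ι-injective {i} {j} eq with ℚP.fromℚᵘ-injective {ℚᵘ.mkℚᵘ i 0} {ℚᵘ.mkℚᵘ j 0} eq
  ... | ℚᵘ.*≡* e = trans (sym (ℤP.*-identityʳ i)) (trans e (ℤP.*-identityʳ j))

  ι-0 : ι 0ℤ ≡ 0ℚ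
  ι-0 = refl

  ι-1 : ι 1ℤ ≡ 1ℚ
  ι-1 = refl

ν : ℕ → ℚ
ν n = ι (+ n)

module _ where
  open import Relation.Binary.Reasoning.Setoid ℚᵘP.≃-setoid

  ι-+ : ∀ i j → ι (i +ℤ j) ≡ ι i ⊕ ι j
  ι-+ i j = ℚP.toℚᵘ-injective (begin
    toℚᵘ (ι (i +ℤ j))                 ≈⟨ ι-toℚᵘ (i +ℤ j) ⟩
    ℚᵘ.mkℚᵘ (i +ℤ j) 0                ≈⟨ ℚᵘ.*≡* (lemma i j) ⟩
    ℚᵘ.mkℚᵘ i 0 ℚᵘ.+ ℚᵘ.mkℚᵘ j 0      ≈⟨ ℚᵘP.+-cong {toℚᵘ (ι i)} {ℚᵘ.mkℚᵘ i 0} {toℚᵘ (ι j)} {ℚᵘ.mkℚᵘ j 0} (ι-toℚᵘ i) (ι-toℚᵘ j) ⟨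
    toℚᵘ (ι i) ℚᵘ.+ toℚᵘ (ι j)        ≈⟨ ℚP.toℚᵘ-homo-+ (ι i) (ι j) ⟨
    toℚᵘ (ι i ⊕ ι j)                  ∎)
    where
    lemma : ∀ i j → (i +ℤ j) *ℤ + 1 ≡ (i *ℤ + 1 +ℤ j *ℤ + 1) *ℤ + 1
    lemma = ℤSolver.solve-∀

  ι-* : ∀ i j → ι (i *ℤ j) ≡ ι i ⊗ ι j
  ι-* i j = ℚP.toℚᵘ-injective (begin
    toℚᵘ (ι (i *ℤ j))                 ≈⟨ ι-toℚᵘ (i *ℤ j) ⟩
    ℚᵘ.mkℚᵘ i 0 ℚᵘ.* ℚᵘ.mkℚᵘ j 0      ≈⟨ ℚᵘP.*-cong {toℚᵘ (ι i)} {ℚᵘ.mkℚᵘ i 0} {toℚᵘ (ι j)} {ℚᵘ.mkℚᵘ j 0} (ι-toℚᵘ i) (ι-toℚᵘ j) ⟨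
    toℚᵘ (ι i) ℚᵘ.* toℚᵘ (ι j)        ≈⟨ ℚP.toℚᵘ-homo-* (ι i) (ι j) ⟨
    toℚᵘ (ι i ⊗ ι j)                  ∎)

  ι-neg : ∀ i → ι (-ℤ i) ≡ ⊖ ι i
  ι-neg i = ℚP.toℚᵘ-injective (begin
    toℚᵘ (ι (-ℤ i))       ≈⟨ ι-toℚᵘ (-ℤ i) ⟩
    ℚᵘ.- ℚᵘ.mkℚᵘ i 0      ≈⟨ ℚᵘP.-‿cong {toℚᵘ (ι i)} {ℚᵘ.mkℚᵘ i 0} (ι-toℚᵘ i) ⟨
    ℚᵘ.- toℚᵘ (ι i)       ≈⟨ ℚP.toℚᵘ-homo‿- (ι i) ⟨
    toℚᵘ (⊖ ι i)          ∎)

ι-mono-≤ : ∀ {i j} → i ≤ℤ j → ι i ≤ℚ ι j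
ι-mono-≤ {i} {j} i≤j = ℚP.toℚᵘ-cancel-≤ (ℚᵘP.≤-trans (ℚᵘP.≤-reflexive (ι-toℚᵘ i))
  (ℚᵘP.≤-trans {ℚᵘ.mkℚᵘ i 0} {ℚᵘ.mkℚᵘ j 0} (ℚᵘ.*≤* (ℤP.*-monoʳ-≤-nonNeg (+ 1) i≤j)) (ℚᵘP.≤-reflexive (ℚᵘP.≃-sym (ι-toℚᵘ j)))))

ι-cancel-< : ∀ {i j} → ι i <ℚ ι j → i <ℤ j
ι-cancel-< {i} {j} lt with i ℤP.<? j
... | yes p = p
... | no ¬p = contradiction (ℚP.<-≤-trans lt (ι-mono-≤ (ℤP.≮⇒≥ ¬p))) (ℚP.<-irrefl refl)

ν-+ : ∀ m n → ν (m + n) ≡ ν m ⊕ ν n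
ν-+ m n = ι-+ (+ m) (+ n)

ν-* : ∀ m n → ν (m * n) ≡ ν m ⊗ ν n
ν-* m n = trans (cong ι (ℤP.pos-* m n)) (ι-* (+ m) (+ n))

ν-mono-≤ : ∀ {m n} → m ≤ n → ν m ≤ℚ ν n
ν-mono-≤ m≤n = ι-mono-≤ (ℤ.+≤+ m≤n)

ν-mono-< : ∀ {m n} → m < n → ν m <ℚ ν n
ν-mono-< {m} {n} m<n with ℚP.<-cmp (ν m) (ν n)
... | tri< p _ _ = p
... | tri≈ _ e _ = contradiction (ℤP.+-injective (ι-injective e)) (ℕP.<⇒≢ m<n)
... | tri> _ _ p = contradiction (ℚP.<-≤-trans p (ν-mono-≤ (ℕP.<⇒≤ m<n))) (ℚP.<-irrefl refl)

0≤ν : ∀ n → 0ℚ ≤ℚ ν n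
0≤ν n = subst (_≤ℚ ν n) ι-0 (ν-mono-≤ z≤n)

0<ν : ∀ {n} → 0 < n → 0ℚ <ℚ ν n
0<ν {n} p = subst (_<ℚ ν n) ι-0 (ν-mono-< p)

ν≢0 : ∀ {n} → 0 < n → ν n ≢ 0ℚ
ν≢0 p e = ℚP.<-irrefl (sym e) (0<ν p)

ι≢0 : ∀ {i} → i ≢ 0ℤ → ι i ≢ 0ℚ
ι≢0 p e = p (ι-injective (trans e (sym ι-0)))

∣ι∣ : ∀ i → ∣ ι i ∣ℚ ≡ ν ∣ i ∣ℤ
∣ι∣ (+ n) = ℚP.0≤p⇒∣p∣≡p (0≤ν n)
∣ι∣ -[1+ n ] = trans (cong ∣_∣ℚ (ι-neg (+ suc n))) (trans (ℚP.∣-p∣≡∣p∣ (ν (suc n))) (ℚP.0≤p⇒∣p∣≡p (0≤ν (suc n))))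

-- The junk value is inv 0 = 0.
inv : ℚ → ℚ
inv x with x ℚP.≟ 0ℚ
... | yes _ = 0ℚ
... | no x≢0 = ℚ.1/_ x {{ℚ.≢-nonZero x≢0}}

inv-r : ∀ {x} → x ≢ 0ℚ → x ⊗ inv x ≡ 1ℚ
inv-r {x} x≢0 with x ℚP.≟ 0ℚ
... | yes e = contradiction e x≢0
... | no x≢0′ = ℚP.*-inverseʳ x {{ℚ.≢-nonZero x≢0′}}

⊗-cancelˡ : ∀ {x y z} → x ≢ 0ℚ → x ⊗ y ≡ x ⊗ z → y ≡ z
⊗-cancelˡ {x} {y} {z} x≢0 e = begin
  y                     ≡⟨ help x≢0 y ⟩
  inv x ⊗ (x ⊗ y)       ≡⟨ cong (inv x ⊗_) e ⟩
  inv x ⊗ (x ⊗ z)       ≡⟨ help x≢0 z ⟨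
  z                     ∎
  where
  open ≡-Reasoning
  rearr : ∀ a b c → c ⊗ (a ⊗ b) ≡ a ⊗ c ⊗ b
  rearr = solve-∀ ℚ-ring
  help : ∀ {x} → x ≢ 0ℚ → ∀ y → y ≡ inv x ⊗ (x ⊗ y)
  help {x} x≢0 y = sym (trans (rearr x y (inv x)) (trans (cong (_⊗ y) (inv-r x≢0)) (ℚP.*-identityˡ y)))

⊗≢0 : ∀ {x y} → x ≢ 0ℚ → y ≢ 0ℚ → x ⊗ y ≢ 0ℚ
⊗≢0 {x} {y} x≢0 y≢0 e = y≢0 (⊗-cancelˡ x≢0 (trans e (sym (ℚP.*-zeroʳ x))))

0<⇒≢0 : ∀ {x} → 0ℚ <ℚ x → x ≢ 0ℚ
0<⇒≢0 p e = ℚP.<-irrefl (sym e) p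

⊗-mono-≤ : ∀ {a b c d} → 0ℚ ≤ℚ a → 0ℚ ≤ℚ d → a ≤ℚ b → c ≤ℚ d → a ⊗ c ≤ℚ b ⊗ d
⊗-mono-≤ {a} {b} {c} {d} 0≤a 0≤d a≤b c≤d = ℚP.≤-trans
  (ℚP.*-monoˡ-≤-nonNeg a {{ℚ.nonNegative 0≤a}} c≤d) (ℚP.*-monoʳ-≤-nonNeg d {{ℚ.nonNegative 0≤d}} a≤b)

⊗-monoˡ : ∀ {a c d} → 0ℚ ≤ℚ a → c ≤ℚ d → a ⊗ c ≤ℚ a ⊗ d
⊗-monoˡ {a} 0≤a = ℚP.*-monoˡ-≤-nonNeg a {{ℚ.nonNegative 0≤a}}

0≤⊗ : ∀ {a b} → 0ℚ ≤ℚ a → 0ℚ ≤ℚ b → 0ℚ ≤ℚ a ⊗ b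
0≤⊗ {a} {b} 0≤a 0≤b = subst (_≤ℚ a ⊗ b) (ℚP.*-zeroʳ a) (⊗-monoˡ 0≤a 0≤b)

0<⊗ : ∀ {a b} → 0ℚ <ℚ a → 0ℚ <ℚ b → 0ℚ <ℚ a ⊗ b
0<⊗ {a} {b} 0<a 0<b = subst (_<ℚ a ⊗ b) (ℚP.*-zeroʳ a) (ℚP.*-monoʳ-<-pos a {{ℚ.positive 0<a}} 0<b)

⊗-cancelˡ-≤ : ∀ {a c d} → 0ℚ <ℚ a → a ⊗ c ≤ℚ a ⊗ d → c ≤ℚ d
⊗-cancelˡ-≤ {a} 0<a = ℚP.*-cancelˡ-≤-pos a {{ℚ.positive 0<a}}

0<1ℚ : 0ℚ <ℚ 1ℚ
0<1ℚ = ℚ.*<* (ℤ.+<+ (s≤s z≤n))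

0<inv : ∀ {x} → 0ℚ <ℚ x → 0ℚ <ℚ inv x
0<inv {x} 0<x with ℚP.<-cmp 0ℚ (inv x)
... | tri< p _ _ = p
... | tri≈ _ e _ = contradiction (trans (sym (ℚP.*-zeroʳ x)) (trans (cong (x ⊗_) e) (inv-r (0<⇒≢0 0<x)))) (λ ())
... | tri> _ _ p = contradiction (ℚP.<-trans 0<1ℚ (subst₂ _<ℚ_ (inv-r (0<⇒≢0 0<x)) (ℚP.*-zeroʳ x) (ℚP.*-monoʳ-<-pos x {{ℚ.positive 0<x}} p))) (ℚP.<-irrefl refl)

∣⊗∣ : ∀ x y → ∣ x ⊗ y ∣ℚ ≡ ∣ x ∣ℚ ⊗ ∣ y ∣ℚ
∣⊗∣ = ℚP.∣p*q∣≡∣p∣*∣q∣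

⊕-mono : ∀ {a b c d} → a ≤ℚ b → c ≤ℚ d → a ⊕ c ≤ℚ b ⊕ d
⊕-mono = ℚP.+-mono-≤

infixr 8 _^ℚ_
_^ℚ_ : ℚ → ℕ → ℚ
x ^ℚ zero = 1ℚ
x ^ℚ suc n = x ⊗ x ^ℚ n

ν-^ : ∀ m n → ν (m ^ n) ≡ ν m ^ℚ n
ν-^ m zero = ι-1
ν-^ m (suc n) = trans (ν-* m (m ^ n)) (cong (ν m ⊗_) (ν-^ m n))

^ℚ-+ : ∀ x m n → x ^ℚ (m + n) ≡ x ^ℚ m ⊗ x ^ℚ n
^ℚ-+ x zero n = sym (ℚP.*-identityˡ _)
^ℚ-+ x (suc m) n = trans (cong (x ⊗_) (^ℚ-+ x m n)) (sym (ℚP.*-assoc x _ _))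

invPow-spec : ∀ k s → ν (suc k ^ s) ⊗ invPow k s ≡ 1ℚ
invPow-spec k s = ℚP.toℚᵘ-injective (begin
  toℚᵘ (ν n ⊗ invPow k s)                    ≈⟨ ℚP.toℚᵘ-homo-* (ν n) (invPow k s) ⟩
  toℚᵘ (ν n) ℚᵘ.* toℚᵘ (invPow k s)          ≈⟨ ℚᵘP.*-cong {toℚᵘ (ν n)} {ℚᵘ.mkℚᵘ (+ n) 0} {toℚᵘ (invPow k s)} (ι-toℚᵘ (+ n)) (lem n {{ℕP.m^n≢0 (suc k) s}}) ⟩
  ℚᵘ.mkℚᵘ (+ n) 0 ℚᵘ.* ℚᵘ._/_ (+ 1) n {{nz}} ≈⟨ lem2 n {{ℕP.m^n≢0 (suc k) s}} ⟩
  ℚᵘ.1ℚᵘ ∎)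
  where
  open import Relation.Binary.Reasoning.Setoid ℚᵘP.≃-setoid
  n = suc k ^ s
  nz = ℕP.m^n≢0 (suc k) s
  lem : ∀ n .{{_ : NonZero n}} → toℚᵘ (+ 1 ℚ./ n) ℚᵘ.≃ (+ 1) ℚᵘ./ n
  lem (suc n) = ℚP.toℚᵘ-fromℚᵘ (ℚᵘ.mkℚᵘ (+ 1) n)
  lem2 : ∀ n .{{_ : NonZero n}} → ℚᵘ.mkℚᵘ (+ n) 0 ℚᵘ.* ((+ 1) ℚᵘ./ n) ℚᵘ.≃ ℚᵘ.1ℚᵘ
  lem2 (suc n) = ℚᵘ.*≡* (cong +_ (lem3 n))
    where
    lem3 : ∀ n → suc n * 1 * 1 ≡ suc (n + 0 + 0)
    lem3 = ℕSolver.solve-∀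

-- Partial fractions

Series : Set
Series = ℕ → ℚ

-- Multiplication of a power series in `x` by `d + x`.
shiftMul : ℚ → Series → Series
shiftMul d g zero = d ⊗ g 0
shiftMul d g (suc i) = d ⊗ g (suc i) ⊕ g i

-- Division by `d + x`, where `e = 1 / d`: the recursion solves `d h(i+1) + h(i) = g(i+1)` for `h`.
shiftDiv : ℚ → Series → Series
shiftDiv e g zero = e ⊗ g 0
shiftDiv e g (suc i) = e ⊗ (g (suc i) ⊝ shiftDiv e g i)

δ : ℕ → Series
δ zero zero = 1ℚ
δ zero (suc i) = 0ℚ
δ (suc n) zero = 0ℚ
δ (suc n) (suc i) = δ n i

δ-diag : ∀ n → δ n n ≡ 1ℚ
δ-diag zero = refl
δ-diag (suc n) = δ-diag n

δ-off : ∀ m n → m ≢ n → δ m n ≡ 0ℚ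
δ-off zero zero p = contradiction refl p
δ-off zero (suc n) p = refl
δ-off (suc m) zero p = refl
δ-off (suc m) (suc n) p = δ-off m n (p ∘ cong suc)

shiftMul-shiftDiv : ∀ {d} → d ≢ 0ℚ → ∀ g i → shiftMul d (shiftDiv (inv d) g) i ≡ g i
shiftMul-shiftDiv {d} d≢0 g zero = begin
  d ⊗ (inv d ⊗ g 0)   ≡⟨ ℚP.*-assoc d (inv d) (g 0) ⟨
  d ⊗ inv d ⊗ g 0     ≡⟨ cong (_⊗ g 0) (inv-r d≢0) ⟩
  1ℚ ⊗ g 0            ≡⟨ ℚP.*-identityˡ (g 0) ⟩
  g 0                 ∎
  where open ≡-Reasoning
shiftMul-shiftDiv {d} d≢0 g (suc i) = begin
  d ⊗ (inv d ⊗ (a ⊝ b)) ⊕ b   ≡⟨ cong (_⊕ b) (ℚP.*-assoc d (inv d) _) ⟨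
  d ⊗ inv d ⊗ (a ⊝ b) ⊕ b     ≡⟨ cong (λ z → z ⊗ (a ⊝ b) ⊕ b) (inv-r d≢0) ⟩
  1ℚ ⊗ (a ⊝ b) ⊕ b            ≡⟨ lem a b ⟩
  a                           ∎
  where
  open ≡-Reasoning
  a = g (suc i)
  b = shiftDiv (inv d) g i
  lem : ∀ a b → 1ℚ ⊗ (a ⊝ b) ⊕ b ≡ a
  lem = solve-∀ ℚ-ring

shiftMul-0-δ : ∀ n i → shiftMul 0ℚ (δ n) i ≡ δ (suc n) i
shiftMul-0-δ n zero = ℚP.*-zeroˡ (δ n 0)
shiftMul-0-δ n (suc i) = trans (cong (_⊕ δ n i) (ℚP.*-zeroˡ (δ n (suc i)))) (ℚP.+-identityˡ (δ n i))

-- Formal sums of partial fractions: (c , k , j) stands for c / (t + k)^j.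
PF : Set
PF = List (ℚ × ℤ × ℕ)

-- The linear functional with value `φ k j` on `(t + k)^(-j)`. Formal sums are only ever compared
-- through such functionals, so the order and repetition of list entries do not matter.
lin : (ℤ → ℕ → ℚ) → PF → ℚ
lin φ [] = 0ℚ
lin φ ((c , k , j) ∷ f) = c ⊗ φ k j ⊕ lin φ f

lin-++ : ∀ φ f g → lin φ (f ++ g) ≡ lin φ f ⊕ lin φ g
lin-++ φ [] g = sym (ℚP.+-identityˡ _)
lin-++ φ ((c , k , j) ∷ f) g = trans (cong (c ⊗ φ k j ⊕_) (lin-++ φ f g)) (sym (ℚP.+-assoc (c ⊗ φ k j) (lin φ f) (lin φ g)))

lin-cong : ∀ {φ ψ} f → All (λ (c , k , j) → φ k j ≡ ψ k j) f → lin φ f ≡ lin ψ f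
lin-cong [] [] = refl
lin-cong ((c , k , j) ∷ f) (e ∷ es) = cong₂ _⊕_ (cong (c ⊗_) e) (lin-cong f es)

lin-+ : ∀ φ ψ f → lin (λ k j → φ k j ⊕ ψ k j) f ≡ lin φ f ⊕ lin ψ f
lin-+ φ ψ [] = refl
lin-+ φ ψ ((c , k , j) ∷ f) = trans (cong (c ⊗ (φ k j ⊕ ψ k j) ⊕_) (lin-+ φ ψ f)) (lem c (φ k j) (ψ k j) (lin φ f) (lin ψ f))
  where
  lem : ∀ c x y u v → c ⊗ (x ⊕ y) ⊕ (u ⊕ v) ≡ c ⊗ x ⊕ u ⊕ (c ⊗ y ⊕ v)
  lem = solve-∀ ℚ-ring

lin-⊗ : ∀ a φ f → lin (λ k j → a ⊗ φ k j) f ≡ a ⊗ lin φ f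
lin-⊗ a φ [] = sym (ℚP.*-zeroʳ a)
lin-⊗ a φ ((c , k , j) ∷ f) = trans (cong (c ⊗ (a ⊗ φ k j) ⊕_) (lin-⊗ a φ f)) (lem a c (φ k j) (lin φ f))
  where
  lem : ∀ a c x u → c ⊗ (a ⊗ x) ⊕ a ⊗ u ≡ a ⊗ (c ⊗ x ⊕ u)
  lem = solve-∀ ℚ-ring

lin-shiftMul : ∀ d (φ : ℤ → ℕ → Series) f i →
  shiftMul d (λ i → lin (λ k j → φ k j i) f) i ≡ lin (λ k j → shiftMul d (φ k j) i) f
lin-shiftMul d φ f zero = sym (lin-⊗ d _ f)
lin-shiftMul d φ f (suc i) = sym (trans (lin-+ _ _ f) (cong (_⊕ lin (λ k j → φ k j i) f) (lin-⊗ d _ f)))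

-- Expands `c / ((t + k)^j (t + u))` by the identity `(u - k) / ((t + k)^(j+1) (t + u)) = 1 / (t +
-- k)^(j+1) - 1 / ((t + k)^j (t + u))`.
divT : ℤ → ℚ → ℤ → ℕ → PF
divT u c k zero = (c , u , 1) ∷ []
divT u c k (suc j) with k ≟ℤ u
... | yes _ = (c , k , suc (suc j)) ∷ []
... | no _ = (c ⊗ inv (ι (u -ℤ k)) , k , suc j) ∷ divT u (⊖ (c ⊗ inv (ι (u -ℤ k)))) k j

divPF : ℤ → PF → PF
divPF u = concatMap (λ (c , k , j) → divT u c k j)

-- The constants arising from the simple poles are dropped.
mulT : ℤ → ℚ → ℤ → ℕ → PF
mulT u c k zero = []
mulT u c k (suc zero) = (c ⊗ ι (u -ℤ k) , k , 1) ∷ []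
mulT u c k (suc (suc j)) = (c , k , suc j) ∷ (c ⊗ ι (u -ℤ k) , k , suc (suc j)) ∷ []

mulPF : ℤ → PF → PF
mulPF u = concatMap (λ (c , k , j) → mulT u c k j)

unitPF : PF
unitPF = (1ℚ , 0ℤ , 0) ∷ []

divs : List ℤ → PF
divs = foldr divPF unitPF

muls : List ℤ → PF → PF
muls vs f = foldr mulPF f vs

-- For proper fractions this is the coefficient of `1/t` at infinity, and it is also the constant
-- that `mulPF` drops; the first reading is used to show that the second is 0.
residueSum : PF → ℚ
residueSum = lin (λ _ j → δ 1 j)

-- Ψ u, Φ are the values of P_u β(k,j) and Q β(k,j) in a model where β(k,j) represents (t + k)^(-j) and P_u / Q represents t + u.
record Model (N : ℕ) (Ψ : ℤ → ℤ → ℕ → ℚ) (Φ : ℤ → ℕ → ℚ) : Set where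
  field
    shift : ∀ u k j → Ψ u k j ≡ Ψ k k j ⊕ ι (u -ℤ k) ⊗ Φ k j
    -- The bound serves the Laurent model, where every function is multiplied by `x^N` and `x^(N-j)`
    -- is a power series only for `j ≤ N`.
    lower : ∀ k j → suc j ≤ N → Ψ k k (suc j) ≡ Φ k j
    unit : ∀ k k′ → Φ k 0 ≡ Φ k′ 0

module _ {N Ψ Φ} (M : Model N Ψ Φ) where
  open Model M

  -- In any model `shift` plays the role of `t + u = (t + k) + (u - k)`; the terms of lower order
  -- then cancel, and the factor `u - k` cancels its inverse.
  lin-divT : ∀ u c k j → suc j ≤ N → lin (Ψ u) (divT u c k j) ≡ c ⊗ Φ k j
  lin-divT u c k zero le = trans (ℚP.+-identityʳ _) (cong (c ⊗_) (trans (lower u 0 le) (unit u k)))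
  lin-divT u c k (suc j) le with k ≟ℤ u
  ... | yes refl = trans (ℚP.+-identityʳ _) (cong (c ⊗_) (lower k (suc j) le))
  ... | no k≢u = begin
    c ⊗ w ⊗ Ψ u k (suc j) ⊕ lin (Ψ u) (divT u (⊖ (c ⊗ w)) k j)
      ≡⟨ cong₂ (λ x y → c ⊗ w ⊗ x ⊕ y) (trans (shift u k (suc j)) (cong (_⊕ d ⊗ Φ k (suc j)) (lower k j (ℕP.<⇒≤ le))))
               (lin-divT u (⊖ (c ⊗ w)) k j (ℕP.<⇒≤ le)) ⟩
    c ⊗ w ⊗ (Φ k j ⊕ d ⊗ Φ k (suc j)) ⊕ (⊖ (c ⊗ w)) ⊗ Φ k j
      ≡⟨ lem c w d (Φ k j) (Φ k (suc j)) ⟩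
    d ⊗ w ⊗ (c ⊗ Φ k (suc j))
      ≡⟨ cong (_⊗ (c ⊗ Φ k (suc j))) (inv-r (ι≢0 (λ e → k≢u (sym (ℤP.i-j≡0⇒i≡j u k e))))) ⟩
    1ℚ ⊗ (c ⊗ Φ k (suc j))
      ≡⟨ ℚP.*-identityˡ _ ⟩
    c ⊗ Φ k (suc j) ∎
    where
    open ≡-Reasoning
    d = ι (u -ℤ k)
    w = inv d
    lem : ∀ c w d x y → c ⊗ w ⊗ (x ⊕ d ⊗ y) ⊕ (⊖ (c ⊗ w)) ⊗ x ≡ d ⊗ w ⊗ (c ⊗ y)
    lem = solve-∀ ℚ-ring

  lin-divPF : ∀ u f → All (λ (c , k , j) → suc j ≤ N) f → lin (Ψ u) (divPF u f) ≡ lin Φ f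
  lin-divPF u [] [] = refl
  lin-divPF u ((c , k , j) ∷ f) (le ∷ les) =
    trans (lin-++ (Ψ u) (divT u c k j) (divPF u f)) (cong₂ _⊕_ (lin-divT u c k j le) (lin-divPF u f les))

  lin-mulT : ∀ u c k j → 1 ≤ j → j ≤ N → c ⊗ Ψ u k j ≡ lin Φ (mulT u c k j) ⊕ c ⊗ δ 1 j ⊗ Φ 0ℤ 0
  lin-mulT u c k (suc zero) _ le = begin
    c ⊗ Ψ u k 1                                       ≡⟨ cong (c ⊗_) (trans (shift u k 1) (cong (_⊕ _) (trans (lower k 0 le) (unit k 0ℤ)))) ⟩
    c ⊗ (Φ 0ℤ 0 ⊕ d ⊗ Φ k 1)                          ≡⟨ lem c d (Φ 0ℤ 0) (Φ k 1) ⟩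
    c ⊗ d ⊗ Φ k 1 ⊕ 0ℚ ⊕ c ⊗ 1ℚ ⊗ Φ 0ℤ 0              ∎
    where
    open ≡-Reasoning
    d = ι (u -ℤ k)
    lem : ∀ c d x y → c ⊗ (x ⊕ d ⊗ y) ≡ c ⊗ d ⊗ y ⊕ 0ℚ ⊕ c ⊗ 1ℚ ⊗ x
    lem = solve-∀ ℚ-ring
  lin-mulT u c k (suc (suc j)) _ le = begin
    c ⊗ Ψ u k (suc (suc j))                           ≡⟨ cong (c ⊗_) (trans (shift u k (suc (suc j))) (cong (_⊕ _) (lower k (suc j) le))) ⟩
    c ⊗ (Φ k (suc j) ⊕ d ⊗ Φ k (suc (suc j)))         ≡⟨ lem c d (Φ k (suc j)) (Φ k (suc (suc j))) (Φ 0ℤ 0) ⟩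
    c ⊗ Φ k (suc j) ⊕ (c ⊗ d ⊗ Φ k (suc (suc j)) ⊕ 0ℚ) ⊕ c ⊗ 0ℚ ⊗ Φ 0ℤ 0 ∎
    where
    open ≡-Reasoning
    d = ι (u -ℤ k)
    lem : ∀ c d x y z → c ⊗ (x ⊕ d ⊗ y) ≡ c ⊗ x ⊕ (c ⊗ d ⊗ y ⊕ 0ℚ) ⊕ c ⊗ 0ℚ ⊗ z
    lem = solve-∀ ℚ-ring

  -- A simple pole gives `c (t + u) / (t + k) = c + c (u - k) / (t +
  -- k)`; the constants `c` left out of `mulPF` add up to the last term.
  lin-mulPF : ∀ u f → All (λ (c , k , j) → 1 ≤ j × j ≤ N) f →
    lin (Ψ u) f ≡ lin Φ (mulPF u f) ⊕ residueSum f ⊗ Φ 0ℤ 0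
  lin-mulPF u [] [] = sym (trans (ℚP.+-identityˡ (0ℚ ⊗ Φ 0ℤ 0)) (ℚP.*-zeroˡ (Φ 0ℤ 0)))
  lin-mulPF u ((c , k , j) ∷ f) ((le₁ , le₂) ∷ les) = begin
    c ⊗ Ψ u k j ⊕ lin (Ψ u) f
      ≡⟨ cong₂ _⊕_ (lin-mulT u c k j le₁ le₂) (lin-mulPF u f les) ⟩
    (A ⊕ c ⊗ δ 1 j ⊗ z) ⊕ (B ⊕ residueSum f ⊗ z)
      ≡⟨ lem A B (c ⊗ δ 1 j) (residueSum f) z ⟩
    A ⊕ B ⊕ (c ⊗ δ 1 j ⊕ residueSum f) ⊗ z
      ≡⟨ cong (_⊕ (c ⊗ δ 1 j ⊕ residueSum f) ⊗ z) (lin-++ Φ (mulT u c k j) (mulPF u f)) ⟨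
    lin Φ (mulT u c k j ++ mulPF u f) ⊕ (c ⊗ δ 1 j ⊕ residueSum f) ⊗ z ∎
    where
    open ≡-Reasoning
    A = lin Φ (mulT u c k j)
    B = lin Φ (mulPF u f)
    z = Φ 0ℤ 0
    lem : ∀ A B x y z → (A ⊕ x ⊗ z) ⊕ (B ⊕ y ⊗ z) ≡ A ⊕ B ⊕ (x ⊕ y) ⊗ z
    lem = solve-∀ ℚ-ring

cntℤ : ℤ → List ℤ → ℕ
cntℤ k [] = 0
cntℤ k (u ∷ us) with k ≟ℤ u
... | yes _ = suc (cntℤ k us)
... | no _ = cntℤ k us

Bounded : List ℤ → ℚ × ℤ × ℕ → Set
Bounded us (c , k , j) = j ≤ cntℤ k us

cntℤ-here : ∀ k us → cntℤ k (k ∷ us) ≡ suc (cntℤ k us)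
cntℤ-here k us with k ≟ℤ k
... | yes _ = refl
... | no p = contradiction refl p

cntℤ-there : ∀ k u us → k ≢ u → cntℤ k (u ∷ us) ≡ cntℤ k us
cntℤ-there k u us p with k ≟ℤ u
... | yes e = contradiction e p
... | no _ = refl

divT-bounded : ∀ us u c k j → Bounded us (c , k , j) → All (Bounded (u ∷ us)) (divT u c k j)
divT-bounded us u c k zero b = subst (1 ≤_) (sym (cntℤ-here u us)) (s≤s z≤n) ∷ []
divT-bounded us u c k (suc j) b with k ≟ℤ u
... | yes refl = subst (suc (suc j) ≤_) (sym (cntℤ-here k us)) (s≤s b) ∷ []
... | no p = subst (suc j ≤_) (sym (cntℤ-there k u us p)) b ∷ divT-bounded us u _ k j (ℕP.<⇒≤ b)

mulT-bounded : ∀ us u c k j → Bounded us (c , k , j) → All (Bounded us) (mulT u c k j)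
mulT-bounded us u c k zero b = []
mulT-bounded us u c k (suc zero) b = b ∷ []
mulT-bounded us u c k (suc (suc j)) b = ℕP.<⇒≤ b ∷ b ∷ []

All-concatMap : ∀ {A B : Set} {P : A → Set} {R : B → Set} (h : A → List B) → (∀ x → P x → All R (h x)) →
  ∀ xs → All P xs → All R (concatMap h xs)
All-concatMap h hyp [] [] = []
All-concatMap h hyp (x ∷ xs) (p ∷ ps) = AllP.++⁺ (hyp x p) (All-concatMap h hyp xs ps)

divs-bounded : ∀ us → All (Bounded us) (divs us)
divs-bounded [] = z≤n ∷ []
divs-bounded (u ∷ us) = All-concatMap _ (λ (c , k , j) → divT-bounded us u c k j) (divs us) (divs-bounded us)

muls-bounded : ∀ us vs f → All (Bounded us) f → All (Bounded us) (muls vs f)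
muls-bounded us [] f b = b
muls-bounded us (v ∷ vs) f b = All-concatMap _ (λ (c , k , j) → mulT-bounded us v c k j) (muls vs f) (muls-bounded us vs f b)

Proper : ℚ × ℤ × ℕ → Set
Proper (c , k , j) = 1 ≤ j

divT-proper : ∀ u c k j → All Proper (divT u c k j)
divT-proper u c k zero = s≤s z≤n ∷ []
divT-proper u c k (suc j) with k ≟ℤ u
... | yes _ = s≤s z≤n ∷ []
... | no _ = s≤s z≤n ∷ divT-proper u _ k j

mulT-proper : ∀ u c k j → All Proper (mulT u c k j)
mulT-proper u c k zero = []
mulT-proper u c k (suc zero) = s≤s z≤n ∷ []
mulT-proper u c k (suc (suc j)) = s≤s z≤n ∷ s≤s z≤n ∷ []

divPF-proper : ∀ u f → All Proper (divPF u f)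
divPF-proper u [] = []
divPF-proper u ((c , k , j) ∷ f) = AllP.++⁺ (divT-proper u c k j) (divPF-proper u f)

muls-proper : ∀ vs f → All Proper f → All Proper (muls vs f)
muls-proper [] f p = p
muls-proper (v ∷ vs) f p = All-concatMap _ (λ (c , k , j) _ → mulT-proper v c k j) (muls vs f) (muls-proper vs f p)

cntℤ≤length : ∀ k us → cntℤ k us ≤ length us
cntℤ≤length k [] = z≤n
cntℤ≤length k (u ∷ us) with k ≟ℤ u
... | yes _ = s≤s (cntℤ≤length k us)
... | no _ = ℕP.m≤n⇒m≤1+n (cntℤ≤length k us)

-- Order of vanishing at infinity.

orderMul : ℚ → Series → Series
orderMul u g zero = g 0
orderMul u g (suc i) = g (suc i) ⊕ u ⊗ g i

-- With `s = 1/t`, this multiplies by `s` and `orderMul u` multiplies by `1 + u s`; their quotient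
-- is `t + u`, as a `Model` requires.
delay : Series → Series
delay g zero = 0ℚ
delay g (suc i) = g i

-- Coefficients of (t + k)^(-j) in powers of 1/t.
atInfinity : ℚ → ℕ → Series
atInfinity k zero i = δ 0 i
atInfinity k (suc j) zero = 0ℚ
atInfinity k (suc j) (suc i) = atInfinity k j i ⊝ k ⊗ atInfinity k (suc j) i

modelAtInfinity : ∀ N i → Model N (λ u k j → orderMul (ι u) (atInfinity (ι k) j) i) (λ k j → delay (atInfinity (ι k) j) i)
modelAtInfinity N i = record { shift = shift i ; lower = lower i ; unit = unit i }
  where
  shift : ∀ i u k j → orderMul (ι u) (atInfinity (ι k) j) i ≡ orderMul (ι k) (atInfinity (ι k) j) i ⊕ ι (u -ℤ k) ⊗ delay (atInfinity (ι k) j) i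
  shift zero u k j = sym (trans (cong (atInfinity (ι k) j 0 ⊕_) (ℚP.*-zeroʳ (ι (u -ℤ k)))) (ℚP.+-identityʳ (atInfinity (ι k) j 0)))
  shift (suc i) u k j = trans (lem (atInfinity (ι k) j (suc i)) (ι u) (ι k) (atInfinity (ι k) j i))
      (cong (λ z → atInfinity (ι k) j (suc i) ⊕ ι k ⊗ atInfinity (ι k) j i ⊕ z ⊗ atInfinity (ι k) j i) (sym (trans (ι-+ u (-ℤ k)) (cong (ι u ⊕_) (ι-neg k)))))
    where
    lem : ∀ a u k b → a ⊕ u ⊗ b ≡ a ⊕ k ⊗ b ⊕ (u ⊝ k) ⊗ b
    lem = solve-∀ ℚ-ring
  lower : ∀ i k j → suc j ≤ N → orderMul (ι k) (atInfinity (ι k) (suc j)) i ≡ delay (atInfinity (ι k) j) i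
  lower zero k j _ = refl
  lower (suc i) k j _ = lem (atInfinity (ι k) j i) (ι k) (atInfinity (ι k) (suc j) i)
    where
    lem : ∀ a k b → a ⊝ k ⊗ b ⊕ k ⊗ b ≡ a
    lem = solve-∀ ℚ-ring
  unit : ∀ i k k′ → delay (atInfinity (ι k) 0) i ≡ delay (atInfinity (ι k′) 0) i
  unit zero k k′ = refl
  unit (suc i) k k′ = refl

evInfinity : PF → Series
evInfinity f i = lin (λ k j → atInfinity (ι k) j i) f

lin-orderMul : ∀ u f i → lin (λ k j → orderMul u (atInfinity (ι k) j) i) f ≡ orderMul u (evInfinity f) i
lin-orderMul u f zero = refl
lin-orderMul u f (suc i) = trans (lin-+ _ _ f) (cong (evInfinity f (suc i) ⊕_) (lin-⊗ u _ f))

lin-delay : ∀ f i → lin (λ k j → delay (atInfinity (ι k) j) i) f ≡ delay (evInfinity f) i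
lin-delay f zero = lin-0 f
  where
  lin-0 : ∀ f → lin (λ _ _ → 0ℚ) f ≡ 0ℚ
  lin-0 [] = refl
  lin-0 ((c , k , j) ∷ f) = trans (cong₂ _⊕_ (ℚP.*-zeroʳ c) (lin-0 f)) refl
lin-delay f (suc i) = refl

OrderAtLeast : ℕ → Series → Set
OrderAtLeast M g = ∀ i → i < M → g i ≡ 0ℚ

orderMul-order : ∀ u g M → OrderAtLeast M (orderMul u g) → OrderAtLeast M g
orderMul-order u g M h zero lt = h zero lt
orderMul-order u g M h (suc i) lt = begin
  g (suc i)             ≡⟨ lem (g (suc i)) (u ⊗ g i) ⟩
  g (suc i) ⊕ u ⊗ g i ⊝ u ⊗ g i ≡⟨ cong₂ _⊝_ (h (suc i) lt) (trans (cong (u ⊗_) (orderMul-order u g M h i (ℕP.<⇒≤ lt))) (ℚP.*-zeroʳ u)) ⟩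
  0ℚ ⊝ 0ℚ               ≡⟨⟩
  0ℚ                    ∎
  where
  open ≡-Reasoning
  lem : ∀ a b → a ≡ a ⊕ b ⊝ b
  lem = solve-∀ ℚ-ring

-- Multiplying the quotient back by `1 + u s` gives the previous series delayed by one place, and a
-- factor with constant term 1 does not change the order; so each division raises the order by one.
divs-order : ∀ us → OrderAtLeast (length us) (evInfinity (divs us))
divs-order [] i ()
divs-order (u ∷ us) = orderMul-order (ι u) _ (suc (length us)) step
  where
  step : OrderAtLeast (suc (length us)) (orderMul (ι u) (evInfinity (divs (u ∷ us))))
  step i lt = trans (sym (lin-orderMul (ι u) (divs (u ∷ us)) i))
    (trans (lin-divPF (modelAtInfinity (suc (length us)) i) u (divs us)
              (All.map (λ {(c , k , j)} b → s≤s (ℕP.≤-trans b (cntℤ≤length k us))) (divs-bounded us)))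
    (trans (lin-delay (divs us) i) (ord i lt)))
    where
    ord : ∀ i → i < suc (length us) → delay (evInfinity (divs us)) i ≡ 0ℚ
    ord zero _ = refl
    ord (suc i) (s≤s lt) = divs-order us i lt

residueSum-atInfinity : ∀ f → All Proper f → residueSum f ≡ evInfinity f 1
residueSum-atInfinity f p = lin-cong f (All.map (λ {(c , k , j)} → lem k j) p)
  where
  lem : ∀ k j → 1 ≤ j → δ 1 j ≡ atInfinity (ι k) j 1
  lem k (suc zero) _ = sym (trans (cong (λ z → 1ℚ ⊝ z) (ℚP.*-zeroʳ (ι k))) refl)
  lem k (suc (suc j)) _ = sym (trans (cong (λ z → 0ℚ ⊝ z) (ℚP.*-zeroʳ (ι k))) refl)

-- The degree hypothesis leaves order at least 2 before each multiplication. The residue sum then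
-- vanishes, so `mulPF` drops nothing and the order falls by exactly one place.
muls-order : ∀ u us vs M → length vs + suc M ≤ length (u ∷ us) → OrderAtLeast (suc M) (evInfinity (muls vs (divs (u ∷ us))))
muls-order u us [] M le i lt = divs-order (u ∷ us) i (ℕP.≤-trans lt le)
muls-order u us (v ∷ vs) M le i lt = sym (begin
  0ℚ ≡⟨ ord (suc i) (s≤s lt) ⟨
  orderMul (ι v) (evInfinity f) (suc i) ≡⟨ lin-orderMul (ι v) f (suc i) ⟨
  lin _ f ≡⟨ lin-mulPF (modelAtInfinity N (suc i)) v f (All.zip (pr , All.map (λ {(c , k , j)} b → ℕP.≤-trans b (cntℤ≤length k (u ∷ us))) (muls-bounded (u ∷ us) vs _ (divs-bounded (u ∷ us))))) ⟩
  lin _ (mulPF v f) ⊕ residueSum f ⊗ δ 0 i ≡⟨ cong (λ z → lin (λ k j → atInfinity (ι k) j i) (mulPF v f) ⊕ z ⊗ δ 0 i) res ⟩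
  evInfinity (mulPF v f) i ⊕ 0ℚ ⊗ δ 0 i ≡⟨ lem (evInfinity (mulPF v f) i) (δ 0 i) ⟩
  evInfinity (mulPF v f) i ∎)
  where
  open ≡-Reasoning
  N = length (u ∷ us)
  f = muls vs (divs (u ∷ us))
  pr = muls-proper vs _ (divPF-proper u (divs us))
  IH : OrderAtLeast (suc (suc M)) (evInfinity f)
  IH = muls-order u us vs (suc M) (subst (_≤ length (u ∷ us)) (sym (ℕP.+-suc (length vs) (suc M))) le)
  res : residueSum f ≡ 0ℚ
  res = trans (residueSum-atInfinity f pr) (IH 1 (s≤s (s≤s z≤n)))
  ord : ∀ i → i < suc (suc M) → orderMul (ι v) (evInfinity f) i ≡ 0ℚ
  ord zero lt = IH 0 lt
  ord (suc i) lt = trans (cong₂ (λ x y → x ⊕ ι v ⊗ y) (IH (suc i) lt) (IH i (ℕP.<⇒≤ lt))) (trans (ℚP.+-identityˡ _) (ℚP.*-zeroʳ (ι v)))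
  lem : ∀ a b → a ⊕ 0ℚ ⊗ b ≡ a
  lem = solve-∀ ℚ-ring

muls-residueSum : ∀ u us vs → length vs + 2 ≤ length (u ∷ us) → residueSum (muls vs (divs (u ∷ us))) ≡ 0ℚ
muls-residueSum u us vs le = trans (residueSum-atInfinity _ (muls-proper vs _ (divPF-proper u (divs us)))) (muls-order u us vs 1 le 1 (s≤s (s≤s z≤n)))

-- Laurent expansions at integer points.

iterDiv : ℚ → ℕ → ℕ → Series
iterDiv e N zero = δ N
iterDiv e N (suc j) = shiftDiv e (iterDiv e N j)

-- x^N (a + k + x)^(-j) as a power series in x.
laurent : ℤ → ℕ → ℤ → ℕ → Series
laurent a N k j with (a +ℤ k) ≟ℤ 0ℤ
... | yes _ = δ (N ∸ j)
... | no _ = iterDiv (inv (ι (a +ℤ k))) N j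

modelLaurent : ∀ a N i → Model N (λ u k j → shiftMul (ι (a +ℤ u)) (laurent a N k j) i) (λ k j → laurent a N k j i)
modelLaurent a N i = record { shift = λ u k j → shift i u k (laurent a N k j) ; lower = lower ; unit = unit }
  where
  split : ∀ u k → ι (a +ℤ u) ≡ ι (a +ℤ k) ⊕ ι (u -ℤ k)
  split u k = trans (cong ι (lem a u k)) (ι-+ (a +ℤ k) (u -ℤ k))
    where
    lem : ∀ a u k → a +ℤ u ≡ (a +ℤ k) +ℤ (u -ℤ k)
    lem = ℤSolver.solve-∀
  shift : ∀ i u k g → shiftMul (ι (a +ℤ u)) g i ≡ shiftMul (ι (a +ℤ k)) g i ⊕ ι (u -ℤ k) ⊗ g i
  shift zero u k g = trans (cong (_⊗ g 0) (split u k)) (ℚP.*-distribʳ-+ (g 0) (ι (a +ℤ k)) (ι (u -ℤ k)))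
  shift (suc i) u k g = trans (cong (λ z → z ⊗ g (suc i) ⊕ g i) (split u k)) (lem (ι (a +ℤ k)) (ι (u -ℤ k)) (g (suc i)) (g i))
    where
    lem : ∀ x y g h → (x ⊕ y) ⊗ g ⊕ h ≡ x ⊗ g ⊕ h ⊕ y ⊗ g
    lem = solve-∀ ℚ-ring
  lower : ∀ k j → suc j ≤ N → shiftMul (ι (a +ℤ k)) (laurent a N k (suc j)) i ≡ laurent a N k j i
  lower k j le with (a +ℤ k) ≟ℤ 0ℤ
  ... | yes e = trans (cong (λ z → shiftMul z (δ (N ∸ suc j)) i) (trans (cong ι e) ι-0))
                 (trans (shiftMul-0-δ (N ∸ suc j) i) (cong (λ z → δ z i) (sym (ℕP.+-∸-assoc 1 le))))
  ... | no ne = shiftMul-shiftDiv (ι≢0 ne) _ i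
  unit : ∀ k k′ → laurent a N k 0 i ≡ laurent a N k′ 0 i
  unit k k′ = trans (lem k) (sym (lem k′))
    where
    lem : ∀ k → laurent a N k 0 i ≡ δ N i
    lem k with (a +ℤ k) ≟ℤ 0ℤ
    ... | yes _ = refl
    ... | no _ = refl

-- The expansion of `f` at `t = a + x`, multiplied by `x^N` so that poles of order up to `N` give
-- power series.
ev : ℤ → ℕ → PF → Series
ev a N f i = lin (λ k j → laurent a N k j i) f

ev-unit : ∀ a N i → ev a N unitPF i ≡ δ N i
ev-unit a N i = trans (ℚP.+-identityʳ (1ℚ ⊗ laurent a N 0ℤ 0 i)) (trans (ℚP.*-identityˡ (laurent a N 0ℤ 0 i)) lem)
  where
  lem : laurent a N 0ℤ 0 i ≡ δ N i
  lem with (a +ℤ 0ℤ) ≟ℤ 0ℤ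
  ... | yes _ = refl
  ... | no _ = refl

ev-div : ∀ a N u us → length (u ∷ us) ≤ N → ∀ i → shiftMul (ι (a +ℤ u)) (ev a N (divs (u ∷ us))) i ≡ ev a N (divs us) i
ev-div a N u us le i = trans (lin-shiftMul (ι (a +ℤ u)) (laurent a N) (divs (u ∷ us)) i)
  (lin-divPF (modelLaurent a N i) u (divs us)
    (All.map (λ {(c , k , j)} b → ℕP.≤-trans (s≤s (ℕP.≤-trans b (cntℤ≤length k us))) le) (divs-bounded us)))

-- The dropped constants amount to a multiple of `residueSum`, which vanishes by the degree
-- hypothesis.
ev-mul : ∀ a u us v vs → suc (length vs) + 2 ≤ length (u ∷ us) → let N = length (u ∷ us) ; f = divs (u ∷ us) in
  ∀ i → ev a N (muls (v ∷ vs) f) i ≡ shiftMul (ι (a +ℤ v)) (ev a N (muls vs f)) i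
ev-mul a u us v vs le i = sym (begin
  shiftMul (ι (a +ℤ v)) (ev a N g) i
    ≡⟨ lin-shiftMul (ι (a +ℤ v)) (laurent a N) g i ⟩
  lin (λ k j → shiftMul (ι (a +ℤ v)) (laurent a N k j) i) g
    ≡⟨ lin-mulPF (modelLaurent a N i) v g (All.zip (muls-proper vs _ (divPF-proper u (divs us)) ,
         All.map (λ {(c , k , j)} b → ℕP.≤-trans b (cntℤ≤length k (u ∷ us))) (muls-bounded (u ∷ us) vs _ (divs-bounded (u ∷ us))))) ⟩
  ev a N (mulPF v g) i ⊕ residueSum g ⊗ laurent a N 0ℤ 0 i
    ≡⟨ cong (λ z → ev a N (mulPF v g) i ⊕ z ⊗ laurent a N 0ℤ 0 i) (muls-residueSum u us vs (ℕP.≤-trans (ℕP.n≤1+n _) le)) ⟩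
  ev a N (mulPF v g) i ⊕ 0ℚ ⊗ laurent a N 0ℤ 0 i
    ≡⟨ lem (ev a N (mulPF v g) i) (laurent a N 0ℤ 0 i) ⟩
  ev a N (mulPF v g) i ∎)
  where
  open ≡-Reasoning
  N = length (u ∷ us)
  g = muls vs (divs (u ∷ us))
  lem : ∀ a b → a ⊕ 0ℚ ⊗ b ≡ a
  lem = solve-∀ ℚ-ring

iterDiv-low : ∀ e N j i → i < N → iterDiv e N j i ≡ 0ℚ
iterDiv-low e N zero i lt = δ-off N i (λ p → ℕP.<-irrefl (sym p) lt)
iterDiv-low e N (suc j) zero lt = trans (cong (e ⊗_) (iterDiv-low e N j 0 lt)) (ℚP.*-zeroʳ e)
iterDiv-low e N (suc j) (suc i) lt = trans (cong₂ (λ x y → e ⊗ (x ⊝ y)) (iterDiv-low e N j (suc i) lt) (iterDiv-low e N (suc j) i (ℕP.<⇒≤ lt))) (ℚP.*-zeroʳ e)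

laurent-low : ∀ a N k j i → a +ℤ k ≢ 0ℤ → i < N → laurent a N k j i ≡ 0ℚ
laurent-low a N k j i ne lt with (a +ℤ k) ≟ℤ 0ℤ
... | yes e = contradiction e ne
... | no _ = iterDiv-low _ N j i lt

lin-zero : ∀ {φ} f → All (λ (c , k , j) → φ k j ≡ 0ℚ) f → lin φ f ≡ 0ℚ
lin-zero [] [] = refl
lin-zero ((c , k , j) ∷ f) (e ∷ es) = trans (cong₂ (λ x y → c ⊗ x ⊕ y) e (lin-zero f es)) (trans (ℚP.+-identityʳ (c ⊗ 0ℚ)) (ℚP.*-zeroʳ c))

-- Taylor coefficients of (1 + x)^(-j).
bin : ℕ → ℕ → ℤ
bin zero zero = + 1
bin zero (suc i) = 0ℤ
bin (suc j) zero = bin j zero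
bin (suc j) (suc i) = bin j (suc i) -ℤ bin (suc j) i

-- This is `(d + x)^(-j) = d^(-j) (1 + x/d)^(-j)` with `e = 1 / d`.
iterDiv-explicit : ∀ e N j i → iterDiv e N j (N + i) ≡ ι (bin j i) ⊗ e ^ℚ (j + i)
iterDiv-explicit e N zero zero = trans (cong (δ N) (ℕP.+-identityʳ N)) (trans (δ-diag N) (sym (trans (ℚP.*-identityʳ (ι (+ 1))) ι-1)))
iterDiv-explicit e N zero (suc i) = trans (δ-off N (N + suc i) (λ p → ℕP.<-irrefl p (ℕP.m<m+n N (s≤s z≤n))))
  (sym (trans (cong (_⊗ e ^ℚ suc i) ι-0) (ℚP.*-zeroˡ (e ^ℚ suc i))))
iterDiv-explicit e N (suc j) zero = begin
  shiftDiv e (iterDiv e N j) (N + 0)       ≡⟨ first N refl ⟩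
  e ⊗ iterDiv e N j (N + 0)                ≡⟨ cong (e ⊗_) (iterDiv-explicit e N j 0) ⟩
  e ⊗ (ι (bin j 0) ⊗ e ^ℚ (j + 0))         ≡⟨ lem e (ι (bin j 0)) (e ^ℚ (j + 0)) ⟩
  ι (bin j 0) ⊗ (e ⊗ e ^ℚ (j + 0))         ∎
  where
  open ≡-Reasoning
  lem : ∀ e x y → e ⊗ (x ⊗ y) ≡ x ⊗ (e ⊗ y)
  lem = solve-∀ ℚ-ring
  lem₂ : ∀ a → a ⊝ 0ℚ ≡ a
  lem₂ = solve-∀ ℚ-ring
  first : ∀ M → M ≡ N → shiftDiv e (iterDiv e N j) (M + 0) ≡ e ⊗ iterDiv e N j (M + 0)
  first zero _ = refl
  first (suc M) eq = cong (e ⊗_) (trans (cong (iterDiv e N j (suc M + 0) ⊝_) (iterDiv-low e N (suc j) (M + 0) (subst (M + 0 <_) eq (s≤s (ℕP.≤-reflexive (ℕP.+-identityʳ M))))))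
                       (lem₂ (iterDiv e N j (suc M + 0))))
iterDiv-explicit e N (suc j) (suc i) = begin
  shiftDiv e (iterDiv e N j) (N + suc i)
    ≡⟨ cong (shiftDiv e (iterDiv e N j)) (ℕP.+-suc N i) ⟩
  e ⊗ (iterDiv e N j (suc (N + i)) ⊝ iterDiv e N (suc j) (N + i))
    ≡⟨ cong₂ (λ x y → e ⊗ (x ⊝ y)) (trans (cong (iterDiv e N j) (sym (ℕP.+-suc N i))) (iterDiv-explicit e N j (suc i))) (iterDiv-explicit e N (suc j) i) ⟩
  e ⊗ (ι (bin j (suc i)) ⊗ e ^ℚ (j + suc i) ⊝ ι (bin (suc j) i) ⊗ e ^ℚ (suc j + i))
    ≡⟨ cong (λ z → e ⊗ (ι (bin j (suc i)) ⊗ e ^ℚ (j + suc i) ⊝ ι (bin (suc j) i) ⊗ e ^ℚ z)) (sym (ℕP.+-suc j i)) ⟩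
  e ⊗ (ι (bin j (suc i)) ⊗ e ^ℚ (j + suc i) ⊝ ι (bin (suc j) i) ⊗ e ^ℚ (j + suc i))
    ≡⟨ lem e (ι (bin j (suc i))) (ι (bin (suc j) i)) (e ^ℚ (j + suc i)) ⟩
  (ι (bin j (suc i)) ⊝ ι (bin (suc j) i)) ⊗ (e ⊗ e ^ℚ (j + suc i))
    ≡⟨ cong (_⊗ (e ⊗ e ^ℚ (j + suc i))) (sym (trans (ι-+ (bin j (suc i)) (-ℤ bin (suc j) i)) (cong (ι (bin j (suc i)) ⊕_) (ι-neg (bin (suc j) i))))) ⟩
  ι (bin (suc j) (suc i)) ⊗ (e ⊗ e ^ℚ (j + suc i)) ∎
  where
  open ≡-Reasoning
  lem : ∀ e x y z → e ⊗ (x ⊗ z ⊝ y ⊗ z) ≡ (x ⊝ y) ⊗ (e ⊗ z)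
  lem = solve-∀ ℚ-ring

laurent-explicit : ∀ a N k j i → a +ℤ k ≢ 0ℤ → laurent a N k j (N + i) ≡ ι (bin j i) ⊗ inv (ι (a +ℤ k)) ^ℚ (j + i)
laurent-explicit a N k j i ne with (a +ℤ k) ≟ℤ 0ℤ
... | yes e = contradiction e ne
... | no _ = iterDiv-explicit _ N j i

bin-1 : ∀ i → ∣ bin 1 i ∣ℤ ≡ 1
bin-1 zero = refl
bin-1 (suc i) = trans (cong ∣_∣ℤ (ℤP.+-identityˡ (-ℤ bin 1 i))) (trans (ℤP.∣-i∣≡∣i∣ (bin 1 i)) (bin-1 i))

indicator : ℤ → ℕ → ℤ → ℕ → ℚ
indicator k j k′ j′ with k ≟ℤ k′
... | yes _ = δ j j′
... | no _ = 0ℚ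

-- The list may contain the pair `(k , j)` many times; this is the collected coefficient of
-- `(t + k)^(-j)`.
coef : PF → ℤ → ℕ → ℚ
coef f k j = lin (indicator k j) f

-- In the expansion at `t = -k`, multiplied by `x^N`, all other poles contribute only from `x^N` on;
-- below that degree the principal part at `-k` stands alone.
coef-ev : ∀ N f k j → 1 ≤ j → j ≤ N → All (λ (c , k , j) → j ≤ N) f → coef f k j ≡ ev (-ℤ k) N f (N ∸ j)
coef-ev N f k j 1≤j j≤N b = lin-cong f (All.map (λ {(c , k′ , j′)} → lem k′ j′) b)
  where
  δ-reflect : ∀ j j′ → j ≤ N → j′ ≤ N → δ j j′ ≡ δ (N ∸ j′) (N ∸ j)
  δ-reflect j j′ p q with j ℕP.≟ j′
  ... | yes refl = trans (δ-diag j) (sym (δ-diag (N ∸ j)))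
  ... | no ne = trans (δ-off j j′ ne) (sym (δ-off (N ∸ j′) (N ∸ j) (λ e → ne (ℕP.∸-cancelˡ-≡ p q (sym e)))))
  lem : ∀ k′ j′ → j′ ≤ N → indicator k j k′ j′ ≡ laurent (-ℤ k) N k′ j′ (N ∸ j)
  lem k′ j′ q with k ≟ℤ k′ | (-ℤ k +ℤ k′) ≟ℤ 0ℤ
  ... | yes _ | yes _ = δ-reflect j j′ j≤N q
  ... | yes refl | no ne = contradiction (ℤP.+-inverseˡ k) ne
  ... | no ne | yes e = contradiction (sym (ℤP.i-j≡0⇒i≡j k′ k (trans (ℤP.+-comm k′ (-ℤ k)) e))) ne
  ... | no _ | no _ = sym (iterDiv-low _ N j′ (N ∸ j) (ℕP.∸-monoʳ-< 1≤j j≤N))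

-- Valuations

sumTo : ℕ → (ℕ → ℕ) → ℕ
sumTo zero f = 0
sumTo (suc K) f = f (suc K) + sumTo K f

sumTo-+ : ∀ K f g → sumTo K (λ i → f i + g i) ≡ sumTo K f + sumTo K g
sumTo-+ zero f g = refl
sumTo-+ (suc K) f g = trans (cong (λ z → f (suc K) + g (suc K) + z) (sumTo-+ K f g)) (lem (f (suc K)) (g (suc K)) (sumTo K f) (sumTo K g))
  where
  lem : ∀ a b c d → a + b + (c + d) ≡ a + c + (b + d)
  lem = ℕSolver.solve-∀

sumTo-mono : ∀ K f g → (∀ i → 1 ≤ i → i ≤ K → f i ≤ g i) → sumTo K f ≤ sumTo K g
sumTo-mono zero f g h = z≤n
sumTo-mono (suc K) f g h = ℕP.+-mono-≤ (h (suc K) (s≤s z≤n) ℕP.≤-refl) (sumTo-mono K f g (λ i p q → h i p (ℕP.m≤n⇒m≤1+n q)))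

sumTo-* : ∀ K n f → sumTo K (λ i → n * f i) ≡ n * sumTo K f
sumTo-* zero n f = sym (ℕP.*-zeroʳ n)
sumTo-* (suc K) n f = trans (cong (λ z → n * f (suc K) + z) (sumTo-* K n f)) (sym (ℕP.*-distribˡ-+ n (f (suc K)) (sumTo K f)))

sumTo-cong : ∀ K f g → (∀ i → 1 ≤ i → i ≤ K → f i ≡ g i) → sumTo K f ≡ sumTo K g
sumTo-cong zero f g h = refl
sumTo-cong (suc K) f g h = cong₂ _+_ (h (suc K) (s≤s z≤n) ℕP.≤-refl) (sumTo-cong K f g (λ i p q → h i p (ℕP.m≤n⇒m≤1+n q)))

sumTo-const : ∀ K n → sumTo K (λ _ → n) ≡ K * n
sumTo-const zero n = refl
sumTo-const (suc K) n = cong (λ z → n + z) (sumTo-const K n)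

ind : ℕ → ℕ → ℕ
ind q d with q ∣? d
... | yes _ = 1
... | no _ = 0

ind-yes : ∀ {q d} → q ∣ d → ind q d ≡ 1
ind-yes {q} {d} p with q ∣? d
... | yes _ = refl
... | no ¬p = contradiction p ¬p

ind-no : ∀ {q d} → ¬ q ∣ d → ind q d ≡ 0
ind-no {q} {d} p with q ∣? d
... | yes p′ = contradiction p′ p
... | no _ = refl

cntDiv : ℕ → ℤ → List ℤ → ℕ
cntDiv q a [] = 0
cntDiv q a (u ∷ us) = ind q ∣ a +ℤ u ∣ℤ + cntDiv q a us

cntDiv-++ : ∀ q a us vs → cntDiv q a (us ++ vs) ≡ cntDiv q a us + cntDiv q a vs
cntDiv-++ q a [] vs = refl
cntDiv-++ q a (u ∷ us) vs = trans (cong (λ z → ind q ∣ a +ℤ u ∣ℤ + z) (cntDiv-++ q a us vs)) (sym (ℕP.+-assoc (ind q ∣ a +ℤ u ∣ℤ) (cntDiv q a us) (cntDiv q a vs)))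

module Adic (π : ℕ) (pr : Prime π) where

  instance
    π≢0 : NonZero π
    π≢0 = prime⇒nonZero pr

  P : ℚ
  P = ν π

  P≢0 : P ≢ 0ℚ
  P≢0 = ν≢0 (ℕ.>-nonZero⁻¹ π)

  P^≢0 : ∀ n → P ^ℚ n ≢ 0ℚ
  P^≢0 zero = λ ()
  P^≢0 (suc n) = ⊗≢0 P≢0 (P^≢0 n)

  π^≢0 : ∀ n → NonZero (π ^ n)
  π^≢0 n = ℕP.m^n≢0 π n

  -- The localisation of the integers at `π`; any denominator prime to `π` may serve as witness, so
  -- fractions need not be reduced.
  Integral : ℚ → Set
  Integral x = Σ ℤ λ n → Σ ℕ λ d → (¬ π ∣ d) × (ν d ⊗ x ≡ ι n)

  π∤1 : ¬ π ∣ 1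
  π∤1 p = ℕP.<⇒≱ (ℕ.nonTrivial⇒n>1 π {{prime⇒nonTrivial pr}}) (Div.∣⇒≤ p)

  π∤* : ∀ {m n} → ¬ π ∣ m → ¬ π ∣ n → ¬ π ∣ m * n
  π∤* {m} {n} p q r with euclidsLemma m n pr r
  ... | inj₁ x = p x
  ... | inj₂ y = q y

  integral-ι : ∀ n → Integral (ι n)
  integral-ι n = n , 1 , π∤1 , trans (cong (_⊗ ι n) ι-1) (ℚP.*-identityˡ (ι n))

  integral-0 : Integral 0ℚ
  integral-0 = subst Integral ι-0 (integral-ι 0ℤ)

  integral-1 : Integral 1ℚ
  integral-1 = subst Integral ι-1 (integral-ι 1ℤ)

  integral-+ : ∀ {x y} → Integral x → Integral y → Integral (x ⊕ y)
  integral-+ {x} {y} (m , c , p , e) (n , d , q , f) = m *ℤ + d +ℤ n *ℤ + c , c * d , π∤* p q , (begin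
    ν (c * d) ⊗ (x ⊕ y)                   ≡⟨ cong (_⊗ (x ⊕ y)) (ν-* c d) ⟩
    ν c ⊗ ν d ⊗ (x ⊕ y)                   ≡⟨ lem (ν c) (ν d) x y ⟩
    ν c ⊗ x ⊗ ν d ⊕ ν d ⊗ y ⊗ ν c         ≡⟨ cong₂ (λ u v → u ⊗ ν d ⊕ v ⊗ ν c) e f ⟩
    ι m ⊗ ν d ⊕ ι n ⊗ ν c                 ≡⟨ cong₂ _⊕_ (ι-* m (+ d)) (ι-* n (+ c)) ⟨
    ι (m *ℤ + d) ⊕ ι (n *ℤ + c)           ≡⟨ ι-+ (m *ℤ + d) (n *ℤ + c) ⟨
    ι (m *ℤ + d +ℤ n *ℤ + c)              ∎)
    where
    open ≡-Reasoning
    lem : ∀ c d x y → c ⊗ d ⊗ (x ⊕ y) ≡ c ⊗ x ⊗ d ⊕ d ⊗ y ⊗ c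
    lem = solve-∀ ℚ-ring

  integral-* : ∀ {x y} → Integral x → Integral y → Integral (x ⊗ y)
  integral-* {x} {y} (m , c , p , e) (n , d , q , f) = m *ℤ n , c * d , π∤* p q , (begin
    ν (c * d) ⊗ (x ⊗ y)                   ≡⟨ cong (_⊗ (x ⊗ y)) (ν-* c d) ⟩
    ν c ⊗ ν d ⊗ (x ⊗ y)                   ≡⟨ lem (ν c) (ν d) x y ⟩
    ν c ⊗ x ⊗ (ν d ⊗ y)                   ≡⟨ cong₂ _⊗_ e f ⟩
    ι m ⊗ ι n                             ≡⟨ ι-* m n ⟨
    ι (m *ℤ n)                            ∎)
    where
    open ≡-Reasoning
    lem : ∀ c d x y → c ⊗ d ⊗ (x ⊗ y) ≡ c ⊗ x ⊗ (d ⊗ y)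
    lem = solve-∀ ℚ-ring

  integral-neg : ∀ {x} → Integral x → Integral (⊖ x)
  integral-neg {x} p = subst Integral (trans (cong (_⊗ x) (trans (ι-neg 1ℤ) (cong ⊖_ ι-1))) (lem x)) (integral-* (integral-ι (-ℤ 1ℤ)) p)
    where
    lem : ∀ x → (⊖ 1ℚ) ⊗ x ≡ ⊖ x
    lem = solve-∀ ℚ-ring

  integral-P^ : ∀ n → Integral (P ^ℚ n)
  integral-P^ n = subst Integral (ν-^ π n) (integral-ι (+ (π ^ n)))

  integral-inv : ∀ u → ¬ π ∣ ∣ u ∣ℤ → Integral (inv (ι u))
  integral-inv (+ zero) p = contradiction (Div._∣0 π) p
  integral-inv (+ suc n) p = 1ℤ , suc n , p , trans (inv-r (ι≢0 (λ ()))) (sym ι-1)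
  integral-inv -[1+ n ] p = -ℤ 1ℤ , suc n , p , (begin
    ν (suc n) ⊗ x               ≡⟨ lem (ν (suc n)) x ⟩
    ⊖ ((⊖ ν (suc n)) ⊗ x)       ≡⟨ cong (λ z → ⊖ (z ⊗ x)) (ι-neg (+ suc n)) ⟨
    ⊖ (ι -[1+ n ] ⊗ x)          ≡⟨ cong ⊖_ (inv-r (ι≢0 (λ ()))) ⟩
    ⊖ 1ℚ                        ≡⟨ trans (ι-neg 1ℤ) (cong ⊖_ ι-1) ⟨
    ι (-ℤ 1ℤ)                   ∎)
    where
    open ≡-Reasoning
    x = inv (ι -[1+ n ])
    lem : ∀ a x → a ⊗ x ≡ ⊖ ((⊖ a) ⊗ x)
    lem = solve-∀ ℚ-ring

  -- The π-adic valuation of x is at least a - b.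
  Val : ℕ → ℕ → ℚ → Set
  Val a b x = Σ ℚ λ y → Integral y × (P ^ℚ b ⊗ x ≡ P ^ℚ a ⊗ y)

  val-+ : ∀ {a b x y} → Val a b x → Val a b y → Val a b (x ⊕ y)
  val-+ {a} {b} {x} {y} (u , iu , e) (v , iv , f) = u ⊕ v , integral-+ iu iv ,
    trans (ℚP.*-distribˡ-+ (P ^ℚ b) x y) (trans (cong₂ _⊕_ e f) (sym (ℚP.*-distribˡ-+ (P ^ℚ a) u v)))

  val-* : ∀ {a b c d x y} → Val a b x → Val c d y → Val (a + c) (b + d) (x ⊗ y)
  val-* {a} {b} {c} {d} {x} {y} (u , iu , e) (v , iv , f) = u ⊗ v , integral-* iu iv , (begin
    P ^ℚ (b + d) ⊗ (x ⊗ y)              ≡⟨ cong (_⊗ (x ⊗ y)) (^ℚ-+ P b d) ⟩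
    P ^ℚ b ⊗ P ^ℚ d ⊗ (x ⊗ y)           ≡⟨ lem (P ^ℚ b) (P ^ℚ d) x y ⟩
    P ^ℚ b ⊗ x ⊗ (P ^ℚ d ⊗ y)           ≡⟨ cong₂ _⊗_ e f ⟩
    P ^ℚ a ⊗ u ⊗ (P ^ℚ c ⊗ v)           ≡⟨ lem (P ^ℚ a) (P ^ℚ c) u v ⟨
    P ^ℚ a ⊗ P ^ℚ c ⊗ (u ⊗ v)           ≡⟨ cong (_⊗ (u ⊗ v)) (^ℚ-+ P a c) ⟨
    P ^ℚ (a + c) ⊗ (u ⊗ v)              ∎)
    where
    open ≡-Reasoning
    lem : ∀ c d x y → c ⊗ d ⊗ (x ⊗ y) ≡ c ⊗ x ⊗ (d ⊗ y)
    lem = solve-∀ ℚ-ring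

  val-0 : ∀ a b → Val a b 0ℚ
  val-0 a b = 0ℚ , integral-0 , trans (ℚP.*-zeroʳ (P ^ℚ b)) (sym (ℚP.*-zeroʳ (P ^ℚ a)))

  val-integral : ∀ {x} → Integral x → Val 0 0 x
  val-integral {x} i = x , i , refl

  integral-val : ∀ {a b x} → b ≤ a → Val a b x → Integral x
  integral-val {a} {b} {x} le (y , iy , e) = subst Integral (sym (⊗-cancelˡ (P^≢0 b) (trans e (trans (cong (λ z → P ^ℚ z ⊗ y) (sym (ℕP.m+[n∸m]≡n le)))
      (trans (cong (_⊗ y) (^ℚ-+ P b (a ∸ b))) (ℚP.*-assoc (P ^ℚ b) (P ^ℚ (a ∸ b)) y))))))
    (integral-* (integral-P^ (a ∸ b)) iy)

  private
    swap : ∀ b k x → b ⊗ (k ⊗ x) ≡ k ⊗ (b ⊗ x)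
    swap = solve-∀ ℚ-ring

  record Factor (d : ℤ) (w : ℕ) : Set where
    constructor factor
    field
      cofactor : ℤ
      factored : ι d ≡ P ^ℚ w ⊗ ι cofactor

  -- All coefficients of `g(π^K x)` have valuation at least `a - b`. The rescaling makes linear
  -- factors homogeneous: if `d = π^w u` with `w ≤ K`, then `d + π^K x = π^w (u + π^(K-w) x)`.
  Good : ℕ → ℕ → ℕ → Series → Set
  Good K a b g = ∀ i → Val a b (P ^ℚ (K * i) ⊗ g i)

  step-power : ∀ K i → P ^ℚ (K * suc i) ≡ P ^ℚ K ⊗ P ^ℚ (K * i)
  step-power K i = trans (cong (P ^ℚ_) (ℕP.*-suc K i)) (^ℚ-+ P K (K * i))

  power-split : ∀ {w K} → w ≤ K → P ^ℚ K ≡ P ^ℚ w ⊗ P ^ℚ (K ∸ w)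
  power-split {w} {K} le = trans (cong (P ^ℚ_) (sym (ℕP.m+[n∸m]≡n le))) (^ℚ-+ P w (K ∸ w))

  -- After the rescaling the factor is `π^w` times an integral polynomial.
  good-mul : ∀ {K a b g d w} → w ≤ K → Factor d w → Good K a b g → Good K (w + a) b (shiftMul (ι d) g)
  good-mul {K} {a} {b} {g} {d} {w} le (factor u e) h zero with h 0
  ... | y , iy , f = ι u ⊗ y , integral-* (integral-ι u) iy , (begin
    B ⊗ (K0 ⊗ (ι d ⊗ g 0))              ≡⟨ cong (λ z → B ⊗ (K0 ⊗ (z ⊗ g 0))) e ⟩
    B ⊗ (K0 ⊗ (W ⊗ ι u ⊗ g 0))          ≡⟨ lem B K0 W (ι u) (g 0) ⟩
    W ⊗ ι u ⊗ (B ⊗ (K0 ⊗ g 0))          ≡⟨ cong (W ⊗ ι u ⊗_) f ⟩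
    W ⊗ ι u ⊗ (A ⊗ y)                   ≡⟨ lem₂ W (ι u) A y ⟩
    W ⊗ A ⊗ (ι u ⊗ y)                   ≡⟨ cong (_⊗ (ι u ⊗ y)) (^ℚ-+ P w a) ⟨
    P ^ℚ (w + a) ⊗ (ι u ⊗ y)            ∎)
    where
    open ≡-Reasoning
    A = P ^ℚ a
    B = P ^ℚ b
    W = P ^ℚ w
    K0 = P ^ℚ (K * 0)
    lem : ∀ B k W u g → B ⊗ (k ⊗ (W ⊗ u ⊗ g)) ≡ W ⊗ u ⊗ (B ⊗ (k ⊗ g))
    lem = solve-∀ ℚ-ring
    lem₂ : ∀ W u A y → W ⊗ u ⊗ (A ⊗ y) ≡ W ⊗ A ⊗ (u ⊗ y)
    lem₂ = solve-∀ ℚ-ring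
  good-mul {K} {a} {b} {g} {d} {w} le (factor u e) h (suc i) with h (suc i) | h i
  ... | y , iy , f | z , iz , f′ = ι u ⊗ y ⊕ P ^ℚ (K ∸ w) ⊗ z , integral-+ (integral-* (integral-ι u) iy) (integral-* (integral-P^ (K ∸ w)) iz) , (begin
    B ⊗ (k₁ ⊗ (ι d ⊗ g (suc i) ⊕ g i))              ≡⟨ lem B k₁ (ι d) (g (suc i)) (g i) ⟩
    ι d ⊗ (B ⊗ (k₁ ⊗ g (suc i))) ⊕ k₁ ⊗ (B ⊗ g i)   ≡⟨ cong₂ (λ x y → x ⊗ (B ⊗ (k₁ ⊗ g (suc i))) ⊕ y ⊗ (B ⊗ g i)) e (trans (step-power K i) (cong (_⊗ k₀) (power-split le))) ⟩
    W ⊗ ι u ⊗ (B ⊗ (k₁ ⊗ g (suc i))) ⊕ W ⊗ R ⊗ k₀ ⊗ (B ⊗ g i) ≡⟨ cong₂ (λ x y → W ⊗ ι u ⊗ x ⊕ y) f (trans (lem₃ W R k₀ B (g i)) (cong (W ⊗ R ⊗_) f′)) ⟩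
    W ⊗ ι u ⊗ (A ⊗ y) ⊕ W ⊗ R ⊗ (A ⊗ z)             ≡⟨ lem₂ W (ι u) A y R z ⟩
    W ⊗ A ⊗ (ι u ⊗ y ⊕ R ⊗ z)                       ≡⟨ cong (_⊗ (ι u ⊗ y ⊕ R ⊗ z)) (^ℚ-+ P w a) ⟨
    P ^ℚ (w + a) ⊗ (ι u ⊗ y ⊕ R ⊗ z)                ∎)
    where
    open ≡-Reasoning
    A = P ^ℚ a
    B = P ^ℚ b
    W = P ^ℚ w
    R = P ^ℚ (K ∸ w)
    k₁ = P ^ℚ (K * suc i)
    k₀ = P ^ℚ (K * i)
    lem : ∀ B k d g h → B ⊗ (k ⊗ (d ⊗ g ⊕ h)) ≡ d ⊗ (B ⊗ (k ⊗ g)) ⊕ k ⊗ (B ⊗ h)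
    lem = solve-∀ ℚ-ring
    lem₂ : ∀ W u A y R z → W ⊗ u ⊗ (A ⊗ y) ⊕ W ⊗ R ⊗ (A ⊗ z) ≡ W ⊗ A ⊗ (u ⊗ y ⊕ R ⊗ z)
    lem₂ = solve-∀ ℚ-ring
    lem₃ : ∀ W R k B g → W ⊗ R ⊗ k ⊗ (B ⊗ g) ≡ W ⊗ R ⊗ (B ⊗ (k ⊗ g))
    lem₃ = solve-∀ ℚ-ring

  -- Here the constant term `u` of that integral polynomial is a unit, so its inverse power series
  -- is integral too.
  good-div : ∀ {K a b g g′ d w} → w ≤ K → (F : Factor d w) → ¬ π ∣ ∣ Factor.cofactor F ∣ℤ →
    (∀ i → shiftMul (ι d) g′ i ≡ g i) → Good K a b g → Good K a (w + b) g′
  good-div {K} {a} {b} {g} {g′} {d} {w} le (factor u e) nu eq h = go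
    where
    open ≡-Reasoning
    A = P ^ℚ a
    B = P ^ℚ b
    W = P ^ℚ w
    R = P ^ℚ (K ∸ w)
    v = inv (ι u)
    iv = integral-inv u nu
    u≢0 : ι u ≢ 0ℚ
    u≢0 = ι≢0 λ { refl → nu (Div._∣0 π) }
    lem : ∀ u v W x → u ⊗ v ⊗ (W ⊗ x) ≡ v ⊗ (W ⊗ u ⊗ x)
    lem = solve-∀ ℚ-ring
    solveFor : ∀ x y → ι d ⊗ x ≡ y → W ⊗ x ≡ v ⊗ y
    solveFor x y p = begin
      W ⊗ x                 ≡⟨ ℚP.*-identityˡ (W ⊗ x) ⟨
      1ℚ ⊗ (W ⊗ x)          ≡⟨ cong (_⊗ (W ⊗ x)) (inv-r u≢0) ⟨
      ι u ⊗ v ⊗ (W ⊗ x)     ≡⟨ lem (ι u) v W x ⟩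
      v ⊗ (W ⊗ ι u ⊗ x)     ≡⟨ cong (λ z → v ⊗ (z ⊗ x)) e ⟨
      v ⊗ (ι d ⊗ x)         ≡⟨ cong (v ⊗_) p ⟩
      v ⊗ y                 ∎
    lem₁ : ∀ W B k x → W ⊗ B ⊗ (k ⊗ x) ≡ B ⊗ (k ⊗ (W ⊗ x))
    lem₁ = solve-∀ ℚ-ring
    lem₂ : ∀ B k v y → B ⊗ (k ⊗ (v ⊗ y)) ≡ v ⊗ (B ⊗ (k ⊗ y))
    lem₂ = solve-∀ ℚ-ring
    lem₃ : ∀ B k x y → B ⊗ (k ⊗ (x ⊝ y)) ≡ B ⊗ (k ⊗ x) ⊝ k ⊗ (B ⊗ y)
    lem₃ = solve-∀ ℚ-ring
    lem₄ : ∀ W R k B x → W ⊗ R ⊗ k ⊗ (B ⊗ x) ≡ R ⊗ (W ⊗ B ⊗ (k ⊗ x))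
    lem₄ = solve-∀ ℚ-ring
    lem₅ : ∀ v A y R z → v ⊗ (A ⊗ y ⊝ R ⊗ (A ⊗ z)) ≡ A ⊗ (v ⊗ (y ⊕ (⊖ (R ⊗ z))))
    lem₅ = solve-∀ ℚ-ring
    lem₆ : ∀ v A y → v ⊗ (A ⊗ y) ≡ A ⊗ (v ⊗ y)
    lem₆ = solve-∀ ℚ-ring
    go : Good K a (w + b) g′
    go zero with h 0
    ... | y , iy , f = v ⊗ y , integral-* iv iy , (begin
      P ^ℚ (w + b) ⊗ (k₀ ⊗ g′ 0)    ≡⟨ cong (_⊗ (k₀ ⊗ g′ 0)) (^ℚ-+ P w b) ⟩
      W ⊗ B ⊗ (k₀ ⊗ g′ 0)           ≡⟨ lem₁ W B k₀ (g′ 0) ⟩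
      B ⊗ (k₀ ⊗ (W ⊗ g′ 0))         ≡⟨ cong (λ z → B ⊗ (k₀ ⊗ z)) (solveFor (g′ 0) (g 0) (eq 0)) ⟩
      B ⊗ (k₀ ⊗ (v ⊗ g 0))          ≡⟨ lem₂ B k₀ v (g 0) ⟩
      v ⊗ (B ⊗ (k₀ ⊗ g 0))          ≡⟨ cong (v ⊗_) f ⟩
      v ⊗ (A ⊗ y)                   ≡⟨ lem₆ v A y ⟩
      A ⊗ (v ⊗ y)                   ∎)
      where k₀ = P ^ℚ (K * 0)
    go (suc i) with h (suc i) | go i
    ... | y , iy , f | z , iz , f′ = v ⊗ (y ⊕ (⊖ (R ⊗ z))) ,
      integral-* iv (integral-+ iy (integral-neg (integral-* (integral-P^ (K ∸ w)) iz))) , (begin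
      P ^ℚ (w + b) ⊗ (k₁ ⊗ g′ (suc i))        ≡⟨ cong (_⊗ (k₁ ⊗ g′ (suc i))) (^ℚ-+ P w b) ⟩
      W ⊗ B ⊗ (k₁ ⊗ g′ (suc i))               ≡⟨ lem₁ W B k₁ (g′ (suc i)) ⟩
      B ⊗ (k₁ ⊗ (W ⊗ g′ (suc i)))             ≡⟨ cong (λ z → B ⊗ (k₁ ⊗ z)) (solveFor (g′ (suc i)) (g (suc i) ⊝ g′ i) (trans (lem₇ (ι d ⊗ g′ (suc i)) (g′ i)) (cong (_⊝ g′ i) (eq (suc i))))) ⟩
      B ⊗ (k₁ ⊗ (v ⊗ (g (suc i) ⊝ g′ i)))     ≡⟨ lem₂ B k₁ v (g (suc i) ⊝ g′ i) ⟩
      v ⊗ (B ⊗ (k₁ ⊗ (g (suc i) ⊝ g′ i)))     ≡⟨ cong (v ⊗_) (lem₃ B k₁ (g (suc i)) (g′ i)) ⟩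
      v ⊗ (B ⊗ (k₁ ⊗ g (suc i)) ⊝ k₁ ⊗ (B ⊗ g′ i)) ≡⟨ cong₂ (λ x y → v ⊗ (x ⊝ y ⊗ (B ⊗ g′ i))) f (trans (step-power K i) (cong (_⊗ k₀) (power-split le))) ⟩
      v ⊗ (A ⊗ y ⊝ W ⊗ R ⊗ k₀ ⊗ (B ⊗ g′ i))   ≡⟨ cong (λ z → v ⊗ (A ⊗ y ⊝ z)) (trans (lem₄ W R k₀ B (g′ i)) (cong (R ⊗_) (trans (cong (_⊗ (k₀ ⊗ g′ i)) (sym (^ℚ-+ P w b))) f′))) ⟩
      v ⊗ (A ⊗ y ⊝ R ⊗ (A ⊗ z))               ≡⟨ lem₅ v A y R z ⟩
      A ⊗ (v ⊗ (y ⊕ (⊖ (R ⊗ z))))             ∎)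
      where
      k₁ = P ^ℚ (K * suc i)
      k₀ = P ^ℚ (K * i)
      lem₇ : ∀ a b → a ≡ a ⊕ b ⊝ b
      lem₇ = solve-∀ ℚ-ring

  -- The factor `x` becomes `π^K x`, so a pole at the point itself costs `K`, exactly what
  -- `weight K 0` charges.
  good-div0 : ∀ {K a b g g′} → (∀ i → shiftMul (ι 0ℤ) g′ i ≡ g i) → Good K a b g → Good K a (K + b) g′
  good-div0 {K} {a} {b} {g} {g′} eq h i with h (suc i)
  ... | y , iy , f = y , iy , (begin
    P ^ℚ (K + b) ⊗ (k₀ ⊗ g′ i)      ≡⟨ cong₂ (λ x z → x ⊗ (k₀ ⊗ z)) (^ℚ-+ P K b) (trans (sym (trans (cong (_⊕ g′ i) (trans (cong (_⊗ g′ (suc i)) ι-0) (ℚP.*-zeroˡ (g′ (suc i))))) (ℚP.+-identityˡ (g′ i)))) (eq (suc i))) ⟩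
    P ^ℚ K ⊗ B ⊗ (k₀ ⊗ g (suc i))   ≡⟨ lem (P ^ℚ K) B k₀ (g (suc i)) ⟩
    B ⊗ (P ^ℚ K ⊗ k₀ ⊗ g (suc i))   ≡⟨ cong (λ z → B ⊗ (z ⊗ g (suc i))) (step-power K i) ⟨
    B ⊗ (P ^ℚ (K * suc i) ⊗ g (suc i)) ≡⟨ f ⟩
    P ^ℚ a ⊗ y                      ∎)
    where
    open ≡-Reasoning
    B = P ^ℚ b
    k₀ = P ^ℚ (K * i)
    lem : ∀ K B k g → K ⊗ B ⊗ (k ⊗ g) ≡ B ⊗ (K ⊗ k ⊗ g)
    lem = solve-∀ ℚ-ring

  good-δ : ∀ K N → Good K (K * N) 0 (δ N)
  good-δ K N i with N ℕP.≟ i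
  ... | yes refl = 1ℚ , integral-1 , trans (ℚP.*-identityˡ (P ^ℚ (K * N) ⊗ δ N N)) (cong (P ^ℚ (K * N) ⊗_) (δ-diag N))
  ... | no ne = 0ℚ , integral-0 , trans (ℚP.*-identityˡ (P ^ℚ (K * i) ⊗ δ N i)) (trans (cong (P ^ℚ (K * i) ⊗_) (δ-off N i ne)) (trans (ℚP.*-zeroʳ (P ^ℚ (K * i))) (sym (ℚP.*-zeroʳ (P ^ℚ (K * N))))))

  -- The exponent of `π` in `d`, capped at `K`. Counting it level by level lets valuations be
  -- compared separately for each prime power `π^i`.
  weight : ℕ → ℕ → ℕ
  weight K d = sumTo K (λ i → ind (π ^ i) d)

  weight-spec : ∀ K d → weight K d ≤ K × (π ^ weight K d ∣ d) × (weight K d < K → ¬ π ^ suc (weight K d) ∣ d)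
  weight-spec zero d = z≤n , Div.1∣ d , λ ()
  weight-spec (suc K) d with π ^ suc K ∣? d | weight-spec K d
  ... | yes p | le , dv , mx = subst (λ w → w ≤ suc K × (π ^ w ∣ d) × (w < suc K → ¬ π ^ suc w ∣ d)) (cong suc (sym full)) (ℕP.≤-refl , p , λ lt → contradiction lt (ℕP.<-irrefl refl))
    where
    full : weight K d ≡ K
    full with ℕP.m≤n⇒m<n∨m≡n le
    ... | inj₂ e = e
    ... | inj₁ lt = contradiction (∣-trans (pow-∣ (ℕP.m≤n⇒m≤1+n lt)) p) (mx lt)
      where
      pow-∣ : ∀ {m n} → m ≤ n → π ^ m ∣ π ^ n
      pow-∣ {m} {n} le = divides (π ^ (n ∸ m)) (trans (cong (π ^_) (sym (ℕP.m∸n+n≡m le))) (ℕP.^-distribˡ-+-* π (n ∸ m) m))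
  ... | no ¬p | le , dv , mx = ℕP.m≤n⇒m≤1+n le , dv , mx′
    where
    mx′ : weight K d < suc K → ¬ π ^ suc (weight K d) ∣ d
    mx′ lt with ℕP.m≤n⇒m<n∨m≡n le
    ... | inj₁ lt′ = mx lt′
    ... | inj₂ e = subst (λ w → ¬ π ^ suc w ∣ d) (sym e) ¬p

  ∣∣-factor : ∀ w d → π ^ w ∣ ∣ d ∣ℤ → Factor d w
  ∣∣-factor w (+ n) (divides q e) = factor (+ q) (trans (cong ν (trans e (ℕP.*-comm q (π ^ w)))) (trans (ν-* (π ^ w) q) (cong (_⊗ ν q) (ν-^ π w))))
  ∣∣-factor w -[1+ n ] (divides q e) = factor (-ℤ (+ q)) (begin
    ι -[1+ n ]                 ≡⟨ ι-neg (+ suc n) ⟩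
    ⊖ ν (suc n)                ≡⟨ cong ⊖_ (trans (cong ν (trans e (ℕP.*-comm q (π ^ w)))) (trans (ν-* (π ^ w) q) (cong (_⊗ ν q) (ν-^ π w)))) ⟩
    ⊖ (P ^ℚ w ⊗ ν q)           ≡⟨ ℚP.neg-distribʳ-* (P ^ℚ w) (ν q) ⟩
    P ^ℚ w ⊗ (⊖ ν q)           ≡⟨ cong (P ^ℚ w ⊗_) (ι-neg (+ q)) ⟨
    P ^ℚ w ⊗ ι (-ℤ (+ q))      ∎)
    where open ≡-Reasoning

  -- Below `π^(K+1)` the cap is not felt, so the whole power of `π` is removed and the cofactor is a
  -- unit.
  unit-factor : ∀ K d → d ≢ 0ℤ → ∣ d ∣ℤ < π ^ suc K → Σ (Factor d (weight K ∣ d ∣ℤ)) λ F → ¬ π ∣ ∣ Factor.cofactor F ∣ℤ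
  unit-factor K d d≢0 lt = F , λ { p → top (∣-trans (mult p) (Div.∣-reflexive (sym abs-eq))) }
    where
    w = weight K ∣ d ∣ℤ
    sp = weight-spec K ∣ d ∣ℤ
    F = ∣∣-factor w d (proj₁ (proj₂ sp))
    u = Factor.cofactor F
    abs-eq : ∣ d ∣ℤ ≡ π ^ w * ∣ u ∣ℤ
    abs-eq = trans (cong ∣_∣ℤ (ι-injective (trans (Factor.factored F) (trans (cong (_⊗ ι u) (sym (ν-^ π w))) (sym (ι-* (+ (π ^ w)) u)))))) (ℤP.∣i*j∣≡∣i∣*∣j∣ (+ (π ^ w)) u)
    mult : π ∣ ∣ u ∣ℤ → π ^ suc w ∣ π ^ w * ∣ u ∣ℤ
    mult p = subst (_∣ π ^ w * ∣ u ∣ℤ) (ℕP.*-comm (π ^ w) π) (Div.*-monoʳ-∣ (π ^ w) p)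
    top : ¬ π ^ suc w ∣ ∣ d ∣ℤ
    top with ℕP.m≤n⇒m<n∨m≡n (proj₁ sp)
    ... | inj₁ lt′ = proj₂ (proj₂ sp) lt′
    ... | inj₂ e = λ p → ℕP.<⇒≱ (subst (λ w → ∣ d ∣ℤ < π ^ suc w) (sym e) lt) (Div.∣⇒≤ {{ℕ.≢-nonZero (λ z → d≢0 (ℤP.∣i∣≡0⇒i≡0 z))}} p)

  weight-0 : ∀ K → weight K 0 ≡ K
  weight-0 zero = refl
  weight-0 (suc K) = cong₂ _+_ (ind-yes (Div._∣0 (π ^ suc K))) (weight-0 K)

  total : ℕ → ℤ → List ℤ → ℕ
  total K a us = sumTo K (λ i → cntDiv (π ^ i) a us)

  total-∷ : ∀ K a u us → total K a (u ∷ us) ≡ weight K ∣ a +ℤ u ∣ℤ + total K a us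
  total-∷ K a u us = sumTo-+ K (λ i → ind (π ^ i) ∣ a +ℤ u ∣ℤ) (λ i → cntDiv (π ^ i) a us)

  total-[] : ∀ K a → total K a [] ≡ 0
  total-[] zero a = refl
  total-[] (suc K) a = total-[] K a

  good-divs : ∀ K a N us → length us ≤ N → All (λ u → ∣ a +ℤ u ∣ℤ < π ^ suc K) us → Good K (K * N) (total K a us) (ev a N (divs us))
  good-divs K a N [] _ _ i = subst₂ (λ b x → Val (K * N) b (P ^ℚ (K * i) ⊗ x)) (sym (total-[] K a)) (sym (ev-unit a N i)) (good-δ K N i)
  good-divs K a N (u ∷ us) le (lt ∷ lts) with (a +ℤ u) ≟ℤ 0ℤ
  ... | yes e = subst (λ b → Good K (K * N) b (ev a N (divs (u ∷ us)))) (sym (trans (total-∷ K a u us) (cong (_+ total K a us) (trans (cong (λ z → weight K ∣ z ∣ℤ) e) (weight-0 K)))))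
      (good-div0 {K} {K * N} {total K a us} {ev a N (divs us)} {ev a N (divs (u ∷ us))} (λ i → trans (cong (λ z → shiftMul (ι z) (ev a N (divs (u ∷ us))) i) (sym e)) (ev-div a N u us le i)) (good-divs K a N us (ℕP.<⇒≤ le) lts))
  ... | no ne = subst (λ b → Good K (K * N) b (ev a N (divs (u ∷ us)))) (sym (total-∷ K a u us))
      (good-div {K} {K * N} {total K a us} {ev a N (divs us)} {ev a N (divs (u ∷ us))} (proj₁ (weight-spec K ∣ a +ℤ u ∣ℤ)) (proj₁ uf) (proj₂ uf) (ev-div a N u us le) (good-divs K a N us (ℕP.<⇒≤ le) lts))
    where uf = unit-factor K (a +ℤ u) ne lt

  good-muls : ∀ K a u us vs → length vs + 2 ≤ length (u ∷ us) → All (λ u → ∣ a +ℤ u ∣ℤ < π ^ suc K) (u ∷ us) → let N = length (u ∷ us) in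
    Good K (total K a vs + K * N) (total K a (u ∷ us)) (ev a N (muls vs (divs (u ∷ us))))
  good-muls K a u us [] le lts = subst (λ z → Good K (z + K * length (u ∷ us)) (total K a (u ∷ us)) (ev a (length (u ∷ us)) (divs (u ∷ us)))) (sym (total-[] K a)) (good-divs K a (length (u ∷ us)) (u ∷ us) ℕP.≤-refl lts)
  good-muls K a u us (v ∷ vs) le lts i = subst₂ (λ z x → Val z (total K a (u ∷ us)) (P ^ℚ (K * i) ⊗ x)) (sym (trans (cong (_+ K * N) (total-∷ K a v vs)) (ℕP.+-assoc (weight K ∣ a +ℤ v ∣ℤ) (total K a vs) (K * N))))
      (sym (ev-mul a u us v vs le i))
      (good-mul {K} {total K a vs + K * N} {total K a (u ∷ us)} {ev a N (muls vs (divs (u ∷ us)))} (proj₁ sp) (∣∣-factor _ (a +ℤ v) (proj₁ (proj₂ sp))) (good-muls K a u us vs (ℕP.<⇒≤ le) lts) i)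
    where
    N = length (u ∷ us)
    sp = weight-spec K ∣ a +ℤ v ∣ℤ

  -- The coefficient sits at degree `N - j` of the expansion at `-k`. Of the gain `K N` in
  -- `good-muls`, the rescaling takes `K (N - j)` there, and `K j` remains in favour of poles of
  -- high order.
  val-coef : ∀ K u us vs k j → length vs + 2 ≤ length (u ∷ us) → All (λ u → ∣ -ℤ k +ℤ u ∣ℤ < π ^ suc K) (u ∷ us) → 1 ≤ j → j ≤ length (u ∷ us) →
    Val (total K (-ℤ k) vs + K * j) (total K (-ℤ k) (u ∷ us)) (coef (muls vs (divs (u ∷ us))) k j)
  val-coef K u us vs k j le lts 1≤j j≤N with good-muls K (-ℤ k) u us vs le lts (length (u ∷ us) ∸ j)
  ... | y , iy , e = y , iy , ⊗-cancelˡ (P^≢0 (K * (N ∸ j))) (begin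
    C ⊗ (B ⊗ coef f k j)                                  ≡⟨ swap C B (coef f k j) ⟩
    B ⊗ (C ⊗ coef f k j)                                  ≡⟨ cong (λ z → B ⊗ (C ⊗ z)) (coef-ev N f k j 1≤j j≤N (All.map (λ {(c , k , j)} b → ℕP.≤-trans b (cntℤ≤length k (u ∷ us))) (muls-bounded (u ∷ us) vs _ (divs-bounded (u ∷ us))))) ⟩
    B ⊗ (C ⊗ ev (-ℤ k) N f (N ∸ j))                       ≡⟨ e ⟩
    P ^ℚ (t + K * N) ⊗ y                                  ≡⟨ cong (λ z → P ^ℚ z ⊗ y) expo ⟩
    P ^ℚ (K * (N ∸ j) + (t + K * j)) ⊗ y                  ≡⟨ cong (_⊗ y) (^ℚ-+ P (K * (N ∸ j)) (t + K * j)) ⟩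
    C ⊗ P ^ℚ (t + K * j) ⊗ y                              ≡⟨ ℚP.*-assoc C (P ^ℚ (t + K * j)) y ⟩
    C ⊗ (P ^ℚ (t + K * j) ⊗ y)                            ∎)
    where
    open ≡-Reasoning
    N = length (u ∷ us)
    f = muls vs (divs (u ∷ us))
    t = total K (-ℤ k) vs
    B = P ^ℚ total K (-ℤ k) (u ∷ us)
    C = P ^ℚ (K * (N ∸ j))
    lem : ∀ K t x j → t + K * (x + j) ≡ K * x + (t + K * j)
    lem = ℕSolver.solve-∀
    expo : t + K * N ≡ K * (N ∸ j) + (t + K * j)
    expo = trans (cong (λ z → t + K * z) (sym (ℕP.m∸n+n≡m j≤N))) (lem K t (N ∸ j) j)

  val-mono : ∀ {a b a′ b′ x} → a′ + b ≤ a + b′ → Val a b x → Val a′ b′ x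
  val-mono {a} {b} {a′} {b′} {x} le (y , iy , e) = P ^ℚ (a + b′ ∸ (a′ + b)) ⊗ y , integral-* (integral-P^ (a + b′ ∸ (a′ + b))) iy , ⊗-cancelˡ (P^≢0 b) (begin
    P ^ℚ b ⊗ (P ^ℚ b′ ⊗ x)                    ≡⟨ swap (P ^ℚ b) (P ^ℚ b′) x ⟩
    P ^ℚ b′ ⊗ (P ^ℚ b ⊗ x)                    ≡⟨ cong (P ^ℚ b′ ⊗_) e ⟩
    P ^ℚ b′ ⊗ (P ^ℚ a ⊗ y)                    ≡⟨ swap (P ^ℚ b′) (P ^ℚ a) y ⟩
    P ^ℚ a ⊗ (P ^ℚ b′ ⊗ y)                    ≡⟨ ℚP.*-assoc (P ^ℚ a) (P ^ℚ b′) y ⟨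
    P ^ℚ a ⊗ P ^ℚ b′ ⊗ y                      ≡⟨ cong (_⊗ y) (^ℚ-+ P a b′) ⟨
    P ^ℚ (a + b′) ⊗ y                         ≡⟨ cong (λ z → P ^ℚ z ⊗ y) (ℕP.m+[n∸m]≡n le) ⟨
    P ^ℚ (a′ + b + r) ⊗ y                     ≡⟨ cong (_⊗ y) (trans (^ℚ-+ P (a′ + b) r) (cong (_⊗ P ^ℚ r) (^ℚ-+ P a′ b))) ⟩
    P ^ℚ a′ ⊗ P ^ℚ b ⊗ P ^ℚ r ⊗ y             ≡⟨ lem (P ^ℚ a′) (P ^ℚ b) (P ^ℚ r) y ⟩
    P ^ℚ b ⊗ (P ^ℚ a′ ⊗ (P ^ℚ r ⊗ y))         ∎)
    where
    open ≡-Reasoning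
    r = a + b′ ∸ (a′ + b)
    lem : ∀ a b r y → a ⊗ b ⊗ r ⊗ y ≡ b ⊗ (a ⊗ (r ⊗ y))
    lem = solve-∀ ℚ-ring

-- Floor inequalities on Farey intervals

∧-T : ∀ {x y} → T (x ∧ y) → T x × T y
∧-T {true} {true} _ = tt , tt

-- Searches the Stern–Brocot tree between a/b and c/d, testing the left ends of the Farey intervals of order J.
farey : ((ℕ → ℕ) → Bool) → ℕ → ℕ → ℕ → ℕ → ℕ → ℕ → Bool
farey test J zero a b c d = false
farey test J (suc n) a zero c d = false
farey test J (suc n) a b@(suc _) c d =
  if J <ᵇ b + d then test (λ j → (j * a) / b) else (farey test J n a b (a + c) (b + d) ∧ farey test J n (a + c) (b + d) c d)

div-unique : ∀ x n q .{{_ : NonZero q}} → x * q ≤ n → n < suc x * q → n / q ≡ x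
div-unique x n q lo hi = ℕP.≤-antisym (ℕP.≤-pred (DM.m<n*o⇒m/o<n hi)) (subst (_≤ n / q) (DM.m*n/n≡m x q) (DM./-monoˡ-≤ q lo))

floor-< : ∀ n q .{{_ : NonZero q}} → n < suc (n / q) * q
floor-< n q = subst (_< suc (n / q) * q) (sym (DM.m≡m%n+[m/n]*n n q)) (ℕP.+-monoˡ-< (n / q * q) (DM.m%n<n n q))

-- Otherwise `X / j` with `X = ⌊j a / b⌋ + 1` lies strictly between `a/b` and `c/d`. Then
-- `X b - j a ≥ 1` and `j c - X d ≥ 1`; multiplied by `d` and `b` and added, these give
-- `j = j (b c - a d) ≥ b + d > J`.
farey-leaf : ∀ J a b c d m q .{{_ : NonZero b}} .{{_ : NonZero q}} → b * c ≡ a * d + 1 → a * q ≤ m * b → m * d < c * q →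
  J < b + d → ∀ j → j ≤ J → (j * m) / q ≡ (j * a) / b
farey-leaf J a b c d m q det lo hi big j j≤J = div-unique x (j * m) q low (ℕP.≰⇒> high)
  where
  open ℕP.≤-Reasoning
  x = (j * a) / b
  low : x * q ≤ j * m
  low = ℕP.*-cancelʳ-≤ (x * q) (j * m) b (begin
    x * q * b   ≡⟨ l₁ x q b ⟩
    x * b * q   ≤⟨ ℕP.*-monoˡ-≤ q (DM.m/n*n≤m (j * a) b) ⟩
    j * a * q   ≡⟨ ℕP.*-assoc j a q ⟩
    j * (a * q) ≤⟨ ℕP.*-monoʳ-≤ j lo ⟩
    j * (m * b) ≡⟨ ℕP.*-assoc j m b ⟨
    j * m * b   ∎)
    where
    l₁ : ∀ x q b → x * q * b ≡ x * b * q
    l₁ = ℕSolver.solve-∀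
  high : ¬ (suc x * q ≤ j * m)
  high le = ℕP.<⇒≱ big (ℕP.≤-trans (ℕP.+-cancelˡ-≤ (j * (a * d)) (b + d) j chain) j≤J)
    where
    X = suc x
    X>ja : suc (j * a) ≤ X * b
    X>ja = floor-< (j * a) b
    jc : suc (X * d) ≤ j * c
    jc = ℕP.≰⇒> λ le′ → ℕP.<⇒≱ (hi′ j (ℕ.>-nonZero⁻¹ q) le) (begin
      j * (c * q)   ≡⟨ ℕP.*-assoc j c q ⟨
      j * c * q     ≤⟨ ℕP.*-monoˡ-≤ q le′ ⟩
      X * d * q     ≡⟨ l₂ X d q ⟩
      X * q * d     ≤⟨ ℕP.*-monoˡ-≤ d le ⟩
      j * m * d     ≡⟨ ℕP.*-assoc j m d ⟩
      j * (m * d)   ∎)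
      where
      l₂ : ∀ X d q → X * d * q ≡ X * q * d
      l₂ = ℕSolver.solve-∀
      hi′ : ∀ j → 0 < q → X * q ≤ j * m → j * (m * d) < j * (c * q)
      hi′ zero (s≤s z≤n) ()
      hi′ (suc j) _ _ = ℕP.*-monoʳ-< (suc j) hi
    l₃ : ∀ j a d b X → j * a * d + d + (X * d * b + b) ≡ (suc (j * a)) * d + (suc (X * d)) * b
    l₃ = ℕSolver.solve-∀
    l₄ : ∀ b j c → j * c * b ≡ j * (b * c)
    l₄ = ℕSolver.solve-∀
    chain : j * (a * d) + (b + d) ≤ j * (a * d) + j
    chain = ℕP.+-cancelʳ-≤ (X * d * b) (j * (a * d) + (b + d)) (j * (a * d) + j) (begin
      j * (a * d) + (b + d) + X * d * b        ≡⟨ l₅ j a d b (X * d * b) ⟩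
      j * a * d + d + (X * d * b + b)          ≡⟨ l₃ j a d b X ⟩
      (suc (j * a)) * d + (suc (X * d)) * b    ≤⟨ ℕP.+-mono-≤ (ℕP.*-monoˡ-≤ d X>ja) (ℕP.*-monoˡ-≤ b jc) ⟩
      X * b * d + j * c * b                    ≡⟨ cong₂ _+_ (l₆ X b d) (trans (l₄ b j c) (cong (j *_) det)) ⟩
      X * d * b + j * (a * d + 1)              ≡⟨ l₇ (X * d * b) j (a * d) ⟩
      j * (a * d) + j + X * d * b              ∎)
      where
      l₅ : ∀ j a d b z → j * (a * d) + (b + d) + z ≡ j * a * d + d + (z + b)
      l₅ = ℕSolver.solve-∀
      l₆ : ∀ X b d → X * b * d ≡ X * d * b
      l₆ = ℕSolver.solve-∀
      l₇ : ∀ z j y → z + j * (y + 1) ≡ j * y + j + z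
      l₇ = ℕSolver.solve-∀

-- The determinant `b c - a d = 1` is inherited by both halves around the mediant, and `m / q` lies
-- in one of them.
farey-sound : ∀ test J n a b c d m q .{{_ : NonZero q}} → T (farey test J n a b c d) → 0 < b → b * c ≡ a * d + 1 → a * q ≤ m * b → m * d < c * q →
  Σ (ℕ → ℕ) λ φ → T (test φ) × (∀ j → j ≤ J → (j * m) / q ≡ φ j)
farey-sound test J (suc n) a b@(suc b₀) c d m q ok 0<b det lo hi with J <ᵇ b + d in eq
... | true = (λ j → (j * a) / b) , ok , farey-leaf J a b c d m q det lo hi (ℕP.<ᵇ⇒< J (b + d) (subst T (sym eq) tt))
... | false with m * (b + d) ℕP.<? (a + c) * q
...   | yes lt = farey-sound test J n a b (a + c) (b + d) m q (proj₁ (∧-T ok)) 0<b (trans (l₁ b a c) (trans (cong (λ z → b * a + z) det) (l₂ b a d))) lo lt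
  where
  l₁ : ∀ b a c → b * (a + c) ≡ b * a + b * c
  l₁ = ℕSolver.solve-∀
  l₂ : ∀ b a d → b * a + (a * d + 1) ≡ a * (b + d) + 1
  l₂ = ℕSolver.solve-∀
...   | no nlt = farey-sound test J n (a + c) (b + d) c d m q (proj₂ (∧-T {farey test J n a b (a + c) (b + d)} ok)) (s≤s z≤n)
      (trans (l₁ b c d) (trans (cong (_+ d * c) det) (l₂ a d c))) (ℕP.≮⇒≥ nlt) hi
  where
  l₁ : ∀ b c d → (b + d) * c ≡ b * c + d * c
  l₁ = ℕSolver.solve-∀
  l₂ : ∀ a d c → a * d + 1 + d * c ≡ (a + c) * d + 1
  l₂ = ℕSolver.solve-∀

sumℤ : (ℕ → ℤ) → List ℕ → ℤ
sumℤ f [] = 0ℤ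
sumℤ f (i ∷ is) = f i +ℤ sumℤ f is

sumℕ : (ℕ → ℕ) → List ℕ → ℕ
sumℕ f [] = 0
sumℕ f (i ∷ is) = f i + sumℕ f is

-- Ends (pos) and starts (neg) of the pole blocks, with the zero blocks reversed, in units of m and shifted by 24.
pos neg : List ℕ
pos = 48 ∷ 48 ∷ 48 ∷ 47 ∷ 46 ∷ 45 ∷ 44 ∷ 43 ∷ 0 ∷ []
neg = 24 ∷ 24 ∷ 24 ∷ 25 ∷ 26 ∷ 27 ∷ 28 ∷ 29 ∷ 72 ∷ []

-- The multiplier is ∏ (j m)! over plus, divided by ∏ (j m)! over minus; found by linear programming.
plus minus : List ℕ
plus = 4 ∷ 4 ∷ 4 ∷ 6 ∷ 7 ∷ 15 ∷ 16 ∷ 17 ∷ 18 ∷ 19 ∷ 20 ∷ 24 ∷ 24 ∷ 24 ∷ 24 ∷ 24 ∷ 24 ∷ []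
minus = 1 ∷ 1 ∷ 1 ∷ 1 ∷ 1 ∷ 1 ∷ 2 ∷ 2 ∷ 2 ∷ 3 ∷ 3 ∷ 3 ∷ 3 ∷ 5 ∷ 5 ∷ 8 ∷ 8 ∷ 8 ∷ 8 ∷ 8 ∷ 8 ∷ 8 ∷ 9 ∷ 12 ∷ 12 ∷ 12 ∷ 12 ∷ 12 ∷ 12 ∷ 13 ∷ []

-- With f j = ⌊j m / q⌋ this is ⌊((i - c) m - 1) / q⌋ up to the rounding at multiples of q.
relFloor : (ℕ → ℕ) → ℕ → ℕ → ℤ
relFloor f c i = if c <ᵇ i then + f (i ∸ c) else -[1+ f (c ∸ i) ]

-- Surplus, for one copy of `f`, of pole factors over zero factors divisible by `q`, in the
-- translate that places boundary `c` just below a multiple of `q`, apart from rounding.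
excess : (ℕ → ℕ) → ℕ → ℤ
excess f c = sumℤ (relFloor f c) pos -ℤ sumℤ (relFloor f c) neg

-- Legendre's count at level `q` for the factorial quotient.
supply : (ℕ → ℕ) → ℤ
supply f = + sumℕ f plus -ℤ + sumℕ f minus

isZero : ℕ → Bool
isZero zero = true
isZero (suc _) = false

-- The 1 reserves one unit per copy of `f` and per level for the denominators of the partial zeta
-- sums. The 8 is the eighth power of the lcm in the multiplier, available in the situation analysed
-- in `bonus-enough`.
slackOK : (ℕ → ℕ) → ℕ → Bool
slackOK f c = excess f c +ℤ + 1 ℤ.≤ᵇ supply f +ℤ (if isZero (f 24) then + 8 else 0ℤ)

allb : (ℕ → Bool) → List ℕ → Bool
allb f [] = true
allb f (i ∷ is) = f i ∧ allb f is

-- The distinct entries of `neg`; by `level-at` these translates are the extremal ones.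
cands : List ℕ
cands = 24 ∷ 25 ∷ 26 ∷ 27 ∷ 28 ∷ 29 ∷ 72 ∷ []

leafTest : (ℕ → ℕ) → Bool
leafTest φ = allb (slackOK φ) cands

BaseSlack : (ℕ → ℕ) → ℕ → Set
BaseSlack φ c = excess φ c +ℤ + 1 ≤ℤ supply φ +ℤ (if isZero (φ 24) then + 8 else 0ℤ)

allb-All : ∀ {P : ℕ → Set} f → (∀ i → T (f i) → P i) → ∀ L → T (allb f L) → All P L
allb-All f h [] _ = []
allb-All f h (i ∷ is) ok = h i (proj₁ (∧-T {f i} ok)) ∷ allb-All f h is (proj₂ (∧-T {f i} ok))

abstract
  leaf-exists : ∀ m q .{{_ : NonZero q}} → m < q →
    Σ (ℕ → ℕ) λ φ → All (BaseSlack φ) cands × (∀ j → j ≤ 72 → (j * m) / q ≡ φ j)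
  leaf-exists m q lt = proj₁ leaf , allb-All (slackOK (proj₁ leaf)) (λ i → ℤP.≤ᵇ⇒≤) cands (proj₁ (proj₂ leaf)) , proj₂ (proj₂ leaf)
    where
    leaf : Σ (ℕ → ℕ) λ φ → T (leafTest φ) × (∀ j → j ≤ 72 → (j * m) / q ≡ φ j)
    -- The finite check itself: `tt` forces the search from 0/1 to 1/1 to be evaluated, with fuel 80
    -- and denominators up to 72, the largest index used.
    leaf = farey-sound leafTest 72 80 0 1 1 1 m q tt (s≤s z≤n) refl z≤n
      (subst₂ _<_ (sym (ℕP.*-identityʳ m)) (sym (ℕP.*-identityˡ q)) lt)

-- The inequality at a single prime power, with rounding errors.

pos-∸ : ∀ {m n} → m ≤ n → + (n ∸ m) ≡ + n -ℤ + m
pos-∸ {m} {n} le = sym (trans (ℤP.m-n≡m⊖n n m) (ℤP.⊖-≥ le))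

floor-suc : ∀ q x .{{_ : NonZero q}} → suc x / q ≡ x / q + ind q (suc x)
floor-suc q x with q ∣? suc x
... | no ¬d = trans (div-unique (x / q) (suc x) q (ℕP.m≤n⇒m≤1+n (DM.m/n*n≤m x q))
      (ℕP.≤∧≢⇒< (floor-< x q) (λ e → ¬d (divides (suc (x / q)) e)))) (sym (ℕP.+-identityʳ (x / q)))
... | yes (divides zero ())
... | yes (divides (suc c) e) = trans (trans (cong (_/ q) e) (DM.m*n/n≡m (suc c) q)) (trans (sym (ℕP.+-comm c 1)) (cong (_+ 1) (sym
      (div-unique c x q (ℕP.≤-pred (subst (suc (c * q) ≤_) (sym e) (ℕP.+-monoˡ-≤ (c * q) (ℕ.>-nonZero⁻¹ q)))) (subst (x <_) e ℕP.≤-refl)))))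

-- Budget for rounding when an argument moves from `z` to at most `z + s`. The point `z` itself is
-- included, since `j m` and `j m - 1` have different floors exactly when `q` divides `j m`.
ties : ℕ → ℕ → ℕ → ℕ
ties q z zero = ind q z
ties q z (suc s) = ind q (z + suc s) + ties q z s

floor-plus : ∀ q z s .{{_ : NonZero q}} → (z + s) / q ≤ z / q + ties q z s
floor-plus q z zero = subst (λ w → w / q ≤ z / q + ind q z) (sym (ℕP.+-identityʳ z)) (ℕP.m≤m+n (z / q) (ind q z))
floor-plus q z (suc s) = begin
  (z + suc s) / q                          ≡⟨ cong (_/ q) (ℕP.+-suc z s) ⟩
  suc (z + s) / q                          ≡⟨ floor-suc q (z + s) ⟩
  (z + s) / q + ind q (suc (z + s))        ≤⟨ ℕP.+-monoˡ-≤ (ind q (suc (z + s))) (floor-plus q z s) ⟩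
  z / q + ties q z s + ind q (suc (z + s)) ≡⟨ lem (z / q) (ties q z s) (ind q (suc (z + s))) ⟩
  z / q + (ind q (suc (z + s)) + ties q z s) ≡⟨ cong (λ w → z / q + (ind q w + ties q z s)) (sym (ℕP.+-suc z s)) ⟩
  z / q + (ind q (z + suc s) + ties q z s) ∎
  where
  open ℕP.≤-Reasoning
  lem : ∀ a b c → a + b + c ≡ a + (c + b)
  lem = ℕSolver.solve-∀

ties-mono : ∀ q z {s t} → s ≤ t → ties q z s ≤ ties q z t
ties-mono q z {s} {t} le = go s t (ℕP.≤⇒≤′ le)
  where
  go : ∀ s t → s ℕ.≤′ t → ties q z s ≤ ties q z t
  go s .s ℕ.≤′-refl = ℕP.≤-refl
  go s (suc t) (ℕ.≤′-step p) = ℕP.≤-trans (go s t p) (ℕP.m≤n+m (ties q z t) (ind q (z + suc t)))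

ind≤ties : ∀ q z s → ind q z ≤ ties q z s
ind≤ties q z s = ties-mono q z {0} {s} z≤n

ties-member : ∀ q z s → q ∣ (z + s) → 1 ≤ ties q z s
ties-member q z zero d = ℕP.≤-reflexive (sym (ind-yes (subst (q ∣_) (ℕP.+-identityʳ z) d)))
ties-member q z (suc s) d = ℕP.≤-trans (ℕP.≤-reflexive (sym (ind-yes d))) (ℕP.m≤m+n (ind q (z + suc s)) (ties q z s))

sumTo-member : ∀ K f j → 1 ≤ j → j ≤ K → f j ≤ sumTo K f
sumTo-member zero f (suc j) _ ()
sumTo-member (suc K) f j p le with ℕP.m≤n⇒m<n∨m≡n le
... | inj₂ refl = ℕP.m≤m+n (f (suc K)) (sumTo K f)
... | inj₁ lt = ℕP.≤-trans (sumTo-member K f j p (ℕP.≤-pred lt)) (ℕP.m≤n+m (sumTo K f) (f (suc K)))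

argmax : ∀ (ρ : ℕ → ℕ) {P : ℕ → Set} i is → All P (i ∷ is) → Σ ℕ λ c → P c × All (λ i → ρ i ≤ ρ c) (i ∷ is)
argmax ρ i [] (p ∷ []) = i , p , ℕP.≤-refl ∷ []
argmax ρ i (i′ ∷ is) (p ∷ ps) with argmax ρ i′ is ps
... | c , pc , ms with ρ i ℕP.≤? ρ c
...   | yes le = c , pc , le ∷ ms
...   | no nle = i , p , ℕP.≤-refl ∷ All.map (λ le → ℕP.≤-trans le (ℕP.<⇒≤ (ℕP.≰⇒> nle))) ms

sumℤ-mono : ∀ {f g : ℕ → ℤ} L → All (λ i → f i ≤ℤ g i) L → sumℤ f L ≤ℤ sumℤ g L
sumℤ-mono [] [] = ℤP.≤-refl
sumℤ-mono (i ∷ is) (p ∷ ps) = ℤP.+-mono-≤ p (sumℤ-mono is ps)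

sumℤ-cong : ∀ {f g : ℕ → ℤ} L → All (λ i → f i ≡ g i) L → sumℤ f L ≡ sumℤ g L
sumℤ-cong [] [] = refl
sumℤ-cong (i ∷ is) (p ∷ ps) = cong₂ _+ℤ_ p (sumℤ-cong is ps)

sumℤ-affine : ∀ (h : ℕ → ℤ) a L → sumℤ (λ i → h i +ℤ a) L ≡ sumℤ h L +ℤ + length L *ℤ a
sumℤ-affine h a [] = refl
sumℤ-affine h a (i ∷ is) = trans (cong (h i +ℤ a +ℤ_) (sumℤ-affine h a is)) (trans (lem (h i) a (sumℤ h is) (+ length is)) (cong (λ z → h i +ℤ sumℤ h is +ℤ z *ℤ a) (sym (ℤP.pos-+ 1 (length is)))))
  where
  lem : ∀ h a s n → h +ℤ a +ℤ (s +ℤ n *ℤ a) ≡ h +ℤ s +ℤ (+ 1 +ℤ n) *ℤ a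
  lem = ℤSolver.solve-∀

sumℤ-linear : ∀ (h : ℕ → ℤ) k L → sumℤ (λ i → h i +ℤ + i *ℤ k) L ≡ sumℤ h L +ℤ + sum L *ℤ k
sumℤ-linear h k [] = refl
sumℤ-linear h k (i ∷ is) = trans (cong (h i +ℤ + i *ℤ k +ℤ_) (sumℤ-linear h k is)) (trans (lem (h i) (+ i) k (sumℤ h is) (+ sum is)) (cong (λ z → h i +ℤ sumℤ h is +ℤ z *ℤ k) (sym (ℤP.pos-+ i (sum is)))))
  where
  lem : ∀ h i k s n → h +ℤ i *ℤ k +ℤ (s +ℤ n *ℤ k) ≡ h +ℤ s +ℤ (i +ℤ n) *ℤ k
  lem = ℤSolver.solve-∀

+sumℕ : ∀ f L → + sumℕ f L ≡ sumℤ (λ i → + f i) L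
+sumℕ f [] = refl
+sumℕ f (i ∷ is) = trans (ℤP.pos-+ (f i) (sumℕ f is)) (cong (+ f i +ℤ_) (+sumℕ f is))

all≤ : ∀ n L → {T (allb (λ i → i ≤ᵇ n) L)} → All (_≤ n) L
all≤ n [] = []
all≤ n (i ∷ is) {ok} = ℕP.≤ᵇ⇒≤ i n (proj₁ (∧-T {i ≤ᵇ n} ok)) ∷ all≤ n is {proj₂ (∧-T {i ≤ᵇ n} ok)}

atMost : ℕ → ℕ → ℕ
atMost q m with q ℕP.≤? m
... | yes _ = 1
... | no _ = 0

-- Passing from `m` to `m % q` changes each floor by an amount affine in `i`; such a change cancels
-- between two lists up to the difference of their sums.
rel-split : ∀ (f φ : ℕ → ℕ) k → (∀ j → j ≤ 72 → f j ≡ φ j + j * k) → ∀ c → c ≤ 72 → ∀ i → i ≤ 72 → relFloor f c i ≡ relFloor φ c i +ℤ -ℤ (+ c *ℤ + k) +ℤ + i *ℤ + k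
rel-split f φ k f-split c c≤ i i≤ with c <ᵇ i in eq
... | true = trans (cong +_ (f-split (i ∸ c) (ℕP.≤-trans (ℕP.m∸n≤m i c) i≤))) (trans (ℤP.pos-+ (φ (i ∸ c)) ((i ∸ c) * k))
    (trans (cong (+ φ (i ∸ c) +ℤ_) (trans (ℤP.pos-* (i ∸ c) k) (cong (_*ℤ + k) (pos-∸ c<i)))) (l₁ (+ φ (i ∸ c)) (+ i) (+ c) (+ k))))
  where
  c<i = ℕP.<⇒≤ (ℕP.<ᵇ⇒< c i (subst T (sym eq) tt))
  l₁ : ∀ φ i c k → φ +ℤ (i -ℤ c) *ℤ k ≡ φ +ℤ -ℤ (c *ℤ k) +ℤ i *ℤ k
  l₁ = ℤSolver.solve-∀
... | false = trans (cong -[1+_] (f-split (c ∸ i) (ℕP.≤-trans (ℕP.m∸n≤m c i) c≤))) (trans (cong -ℤ_ (ℤP.pos-+ (suc (φ (c ∸ i))) ((c ∸ i) * k)))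
    (trans (cong (λ z → -ℤ (+ suc (φ (c ∸ i)) +ℤ z)) (trans (ℤP.pos-* (c ∸ i) k) (cong (_*ℤ + k) (pos-∸ i≤c)))) (l₁ (+ suc (φ (c ∸ i))) (+ i) (+ c) (+ k))))
  where
  i≤c : i ≤ c
  i≤c = ℕP.≮⇒≥ (λ lt → subst T eq (ℕP.<⇒<ᵇ lt))
  l₁ : ∀ φ i c k → -ℤ (φ +ℤ (c -ℤ i) *ℤ k) ≡ -ℤ φ +ℤ -ℤ (c *ℤ k) +ℤ i *ℤ k
  l₁ = ℤSolver.solve-∀

module LevelAt (m r q : ℕ) .{{q≢0 : NonZero q}} (0<m : 0 < m) (r≤23 : r ≤ 23) (q≤p : q ≤ 24 * m + r) where

  -- Boundaries beyond 29 are measured from `p = 24 m + r` and, as exclusive ends, lie one further;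
  -- hence the offset `r + 1` there and 0 at the others.
  ε : ℕ → ℕ
  ε i = if 29 <ᵇ i then suc r else 0

  x : ℕ → ℕ
  x i = i * m + ε i

  f : ℕ → ℕ
  f j = (j * m) / q

  tie : ℕ → ℕ
  tie j = ties q (j * m) 24

  abstract
    -- Opaque, because it would unfold to 72 times 25 divisibility tests.
    τ : ℕ
    τ = sumTo 72 tie

    τ-def : τ ≡ sumTo 72 tie
    τ-def = refl

  tie≤τ : ∀ j → 1 ≤ j → j ≤ 72 → tie j ≤ τ
  tie≤τ j 1≤j j≤72 = subst (tie j ≤_) (sym τ-def) (sumTo-member 72 tie j 1≤j j≤72)

  x-diff : ∀ i i′ → i ≤ i′ → Σ ℕ λ s → s ≤ 24 × (x i′ ≡ x i + ((i′ ∸ i) * m + s)) × (i ≡ i′ → s ≡ 0)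
  x-diff i i′ le = ε i′ ∸ ε i , ℕP.≤-trans (ℕP.m∸n≤m (ε i′) (ε i)) (ε≤24 i′) , eq , λ { refl → ℕP.n∸n≡0 (ε i) }
    where
    ε≤24 : ∀ i → ε i ≤ 24
    ε≤24 i with 29 <ᵇ i
    ... | true = s≤s r≤23
    ... | false = z≤n
    ε-mono : ε i ≤ ε i′
    ε-mono with 29 <ᵇ i in e | 29 <ᵇ i′ in e′
    ... | false | _ = z≤n
    ... | true | true = ℕP.≤-refl
    ... | true | false = contradiction (ℕP.<⇒<ᵇ (ℕP.<-≤-trans (ℕP.<ᵇ⇒< 29 i (subst T (sym e) tt)) le)) (subst (λ b → ¬ T b) (sym e′) (λ z → z))
    lem : ∀ i d m e s → (i + d) * m + (e + s) ≡ i * m + e + (d * m + s)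
    lem = ℕSolver.solve-∀
    eq : x i′ ≡ x i + ((i′ ∸ i) * m + (ε i′ ∸ ε i))
    eq = trans (cong₂ (λ u v → u * m + v) (sym (ℕP.m+[n∸m]≡n le)) (sym (ℕP.m+[n∸m]≡n ε-mono))) (lem i (i′ ∸ i) m (ε i) (ε i′ ∸ ε i))

  module _ (y g c : ℕ) (top : x c + y + 1 ≡ q * g) (c≤72 : c ≤ 72) where

    -- As `x c + y` is -1 modulo `q`, the floor at `i` depends only on the distance from `c`; this
    -- is a multiple of `m` up to an offset of at most 24, which `τ` covers.
    two-sided : ∀ i → i ≤ 72 → (+ ((x i + y) / q) ≤ℤ relFloor f c i +ℤ (+ g +ℤ + τ)) × (relFloor f c i +ℤ + g ≤ℤ + ((x i + y) / q) +ℤ + τ)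
    two-sided i i≤72 with c <ᵇ i in eq
    ... | true = subst₂ _≤ℤ_ refl (trans (ℤP.pos-+ (f j) (g + τ)) (cong (+ f j +ℤ_) (ℤP.pos-+ g τ))) (ℤ.+≤+ upper) ,
                 subst₂ _≤ℤ_ (ℤP.pos-+ (f j) g) (ℤP.pos-+ ((x i + y) / q) τ) (ℤ.+≤+ lower)
      where
      open ℕP.≤-Reasoning
      c<i = ℕP.<ᵇ⇒< c i (subst T (sym eq) tt)
      j = i ∸ c
      xd = x-diff c i (ℕP.<⇒≤ c<i)
      s = proj₁ xd
      1≤j : 1 ≤ j
      1≤j = ℕP.m<n⇒0<n∸m c<i
      j≤72 : j ≤ 72
      j≤72 = ℕP.≤-trans (ℕP.m∸n≤m i c) i≤72
      tj≤τ : tie j ≤ τ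
      tj≤τ = tie≤τ j 1≤j j≤72
      0<jm : 0 < j * m
      0<jm = ℕP.*-mono-≤ 1≤j 0<m
      w = j * m + s ∸ 1
      sucw : suc w ≡ j * m + s
      sucw = ℕP.m+[n∸m]≡n (ℕP.≤-trans 0<jm (ℕP.m≤m+n (j * m) s))
      sum-eq : x i + y ≡ w + g * q
      sum-eq = ℕP.suc-injective (trans (cong (λ z → suc (z + y)) (proj₁ (proj₂ (proj₂ xd)))) (trans (l₁ (x c) (j * m + s) y) (trans (cong₂ (λ u v → u + v) (sym sucw) (trans top (ℕP.*-comm q g))) refl)))
        where
        l₁ : ∀ a b y → suc (a + b + y) ≡ b + (a + y + 1)
        l₁ = ℕSolver.solve-∀
      fl-eq : (x i + y) / q ≡ w / q + g
      fl-eq = trans (cong (_/ q) sum-eq) (trans (DM.+-distrib-/-∣ʳ w (divides g refl)) (cong (λ z → w / q + z) (DM.m*n/n≡m g q)))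
      w≤ : w ≤ j * m + 24
      w≤ = ℕP.≤-trans (ℕP.m∸n≤m (j * m + s) 1) (ℕP.+-monoʳ-≤ (j * m) (proj₁ (proj₂ xd)))
      upper : (x i + y) / q ≤ f j + (g + τ)
      upper = begin
        (x i + y) / q          ≡⟨ fl-eq ⟩
        w / q + g              ≤⟨ ℕP.+-monoˡ-≤ g (ℕP.≤-trans (DM./-monoˡ-≤ q w≤) (floor-plus q (j * m) 24)) ⟩
        f j + tie j + g        ≤⟨ ℕP.+-monoˡ-≤ g (ℕP.+-monoʳ-≤ (f j) tj≤τ) ⟩
        f j + τ + g            ≡⟨ trans (ℕP.+-assoc (f j) τ g) (cong (λ z → f j + z) (ℕP.+-comm τ g)) ⟩
        f j + (g + τ)          ∎
      jm-1 = j * m ∸ 1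
      sucjm : suc jm-1 ≡ j * m
      sucjm = ℕP.m+[n∸m]≡n 0<jm
      lower : f j + g ≤ (x i + y) / q + τ
      lower = begin
        f j + g                            ≡⟨ cong (λ z → z / q + g) (sym sucjm) ⟩
        suc jm-1 / q + g                   ≡⟨ cong (_+ g) (floor-suc q jm-1) ⟩
        jm-1 / q + ind q (suc jm-1) + g    ≡⟨ cong (λ z → jm-1 / q + ind q z + g) sucjm ⟩
        jm-1 / q + ind q (j * m) + g       ≤⟨ ℕP.+-monoˡ-≤ g (ℕP.+-mono-≤ (DM./-monoˡ-≤ q (ℕP.∸-monoˡ-≤ 1 (ℕP.m≤m+n (j * m) s))) (ℕP.≤-trans (ind≤ties q (j * m) 24) tj≤τ)) ⟩
        w / q + τ + g                      ≡⟨ trans (ℕP.+-assoc (w / q) τ g) (trans (cong (λ z → w / q + z) (ℕP.+-comm τ g)) (sym (ℕP.+-assoc (w / q) g τ))) ⟩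
        w / q + g + τ                      ≡⟨ cong (_+ τ) fl-eq ⟨
        (x i + y) / q + τ                  ∎
    ... | false = upper , lower
      where
      open ℕP.≤-Reasoning
      i≤c : i ≤ c
      i≤c = ℕP.≮⇒≥ (λ lt → subst T eq (ℕP.<⇒<ᵇ lt))
      j = c ∸ i
      xd = x-diff i c i≤c
      s = proj₁ xd
      A = j * m + s
      a = A / q
      X = x i + y
      total-eq : suc (X + A) ≡ q * g
      total-eq = trans (l₁ (x i) y A) (trans (cong (λ z → z + y + 1) (sym (proj₁ (proj₂ (proj₂ xd))))) top)
        where
        l₁ : ∀ a y b → suc (a + y + b) ≡ a + b + y + 1
        l₁ = ℕSolver.solve-∀
      -- From `X + A + 1 = q g` the remainders of `X` and `A` add up to `q - 1`, so the floors are
      -- complementary.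
      fl-eq : X / q + suc a ≡ g
      fl-eq = ℕP.≤-antisym
        (ℕP.≤-pred (ℕP.*-cancelʳ-< q (X / q + suc a) (suc g) (begin-strict
          (X / q + suc a) * q              ≡⟨ l₂ (X / q) a q ⟩
          X / q * q + a * q + q            ≤⟨ ℕP.+-monoˡ-≤ q (ℕP.+-mono-≤ (DM.m/n*n≤m X q) (DM.m/n*n≤m A q)) ⟩
          X + A + q                        <⟨ ℕP.n<1+n (X + A + q) ⟩
          suc (X + A) + q                  ≡⟨ cong (_+ q) total-eq ⟩
          q * g + q                        ≡⟨ l₃ q g ⟩
          suc g * q                        ∎)))
        (ℕP.≤-pred (ℕP.*-cancelʳ-< q g (suc (X / q + suc a)) (begin-strict
          g * q                            ≡⟨ ℕP.*-comm g q ⟩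
          q * g                            ≡⟨ total-eq ⟨
          suc (X + A)                      <⟨ ℕP.≤-reflexive (cong suc (sym (ℕP.+-suc X A))) ⟩
          suc X + suc A                    ≤⟨ ℕP.+-mono-≤ (floor-< X q) (floor-< A q) ⟩
          suc (X / q) * q + suc a * q      ≡⟨ l₄ (X / q) a q ⟩
          suc (X / q + suc a) * q          ∎)))
        where
        l₂ : ∀ u a q → (u + suc a) * q ≡ u * q + a * q + q
        l₂ = ℕSolver.solve-∀
        l₃ : ∀ q g → q * g + q ≡ suc g * q
        l₃ = ℕSolver.solve-∀
        l₄ : ∀ u a q → suc u * q + suc a * q ≡ suc (u + suc a) * q
        l₄ = ℕSolver.solve-∀
      a≤ : a ≤ f j + τ
      a≤ with ℕP.m≤n⇒m<n∨m≡n i≤c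
      ... | inj₂ i≡c = subst (λ z → z / q ≤ f j + τ) (sym (trans (cong (λ z → j * m + z) (proj₂ (proj₂ (proj₂ xd)) i≡c)) (ℕP.+-identityʳ (j * m)))) (ℕP.m≤m+n (f j) τ)
      ... | inj₁ i<c = ℕP.≤-trans (DM./-monoˡ-≤ q (ℕP.+-monoʳ-≤ (j * m) (proj₁ (proj₂ xd)))) (ℕP.≤-trans (floor-plus q (j * m) 24) (ℕP.+-monoʳ-≤ (f j) (tie≤τ j (ℕP.m<n⇒0<n∸m i<c) (ℕP.≤-trans (ℕP.m∸n≤m c i) c≤72))))
      fj≤a : f j ≤ a
      fj≤a = DM./-monoˡ-≤ q (ℕP.m≤m+n (j * m) s)
      neg-eq : ∀ n → -[1+ n ] ≡ -ℤ (+ 1 +ℤ + n)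
      neg-eq n = cong -ℤ_ (ℤP.pos-+ 1 n)
      G-eq : + g ≡ + (X / q) +ℤ (+ 1 +ℤ + a)
      G-eq = trans (cong +_ (sym fl-eq)) (trans (ℤP.pos-+ (X / q) (suc a)) (cong (+ (X / q) +ℤ_) (ℤP.pos-+ 1 a)))
      upper : + (X / q) ≤ℤ -[1+ f j ] +ℤ (+ g +ℤ + τ)
      upper = subst₂ _≤ℤ_ (ℤP.+-identityʳ (+ (X / q))) (sym (trans (cong₂ (λ u v → u +ℤ (v +ℤ + τ)) (neg-eq (f j)) G-eq) (l₁ (+ f j) (+ (X / q)) (+ a) (+ τ))))
        (ℤP.+-monoʳ-≤ (+ (X / q)) {0ℤ} (ℤP.+-mono-≤ (ℤP.i≤j⇒0≤j-i (ℤ.+≤+ fj≤a)) (ℤ.+≤+ (z≤n {τ}))))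
        where
        l₁ : ∀ f x a t → -ℤ (+ 1 +ℤ f) +ℤ ((x +ℤ (+ 1 +ℤ a)) +ℤ t) ≡ x +ℤ ((a -ℤ f) +ℤ t)
        l₁ = ℤSolver.solve-∀
      lower : -[1+ f j ] +ℤ + g ≤ℤ + (X / q) +ℤ + τ
      lower = subst₂ _≤ℤ_ (sym (trans (cong₂ _+ℤ_ (neg-eq (f j)) G-eq) (l₁ (+ f j) (+ (X / q)) (+ a)))) refl
        (ℤP.+-monoʳ-≤ (+ (X / q)) (subst₂ _≤ℤ_ refl (l₂ (+ f j) (+ τ)) (ℤP.+-monoˡ-≤ (-ℤ + f j) (subst (+ a ≤ℤ_) (ℤP.pos-+ (f j) τ) (ℤ.+≤+ a≤)))))
        where
        l₁ : ∀ f x a → -ℤ (+ 1 +ℤ f) +ℤ (x +ℤ (+ 1 +ℤ a)) ≡ x +ℤ (a -ℤ f)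
        l₁ = ℤSolver.solve-∀
        l₂ : ∀ f t → f +ℤ t -ℤ f ≡ t
        l₂ = ℤSolver.solve-∀

  bonus : ℕ
  bonus = atMost q m + τ

  Slack : ℕ → Set
  Slack c = excess f c +ℤ + 1 ≤ℤ supply f +ℤ + (8 * bonus)

  slack-all : All (λ c → Slack c × c ≤ 72) neg
  slack-all = spread (All.zip (from-leaf cands (all≤ 72 cands) (proj₁ (proj₂ leaf)) , all≤ 72 cands))
    where
    spread : ∀ {P : ℕ → Set} → All P cands → All P neg
    spread (a ∷ b ∷ c ∷ d ∷ e ∷ g ∷ h ∷ []) = a ∷ a ∷ a ∷ b ∷ c ∷ d ∷ e ∷ g ∷ h ∷ []
    m′ k : ℕ
    m′ = m % q
    k = m / q
    leaf = leaf-exists m′ q (DM.m%n<n m q)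
    φ : ℕ → ℕ
    φ = proj₁ leaf
    f-split : ∀ j → j ≤ 72 → f j ≡ φ j + j * k
    f-split j le = trans (cong (_/ q) (trans (cong (j *_) (DM.m≡m%n+[m/n]*n m q)) (l₁ j m′ k q)))
      (trans (DM.+-distrib-/-∣ʳ (j * m′) (divides (j * k) refl)) (cong₂ _+_ (proj₂ (proj₂ leaf) j le) (DM.m*n/n≡m (j * k) q)))
      where
      l₁ : ∀ j a k q → j * (a + k * q) ≡ j * a + j * k * q
      l₁ = ℕSolver.solve-∀
    sum-split : ∀ c → c ≤ 72 → ∀ L → All (_≤ 72) L → sumℤ (relFloor f c) L ≡ sumℤ (relFloor φ c) L +ℤ + length L *ℤ -ℤ (+ c *ℤ + k) +ℤ + sum L *ℤ + k
    sum-split c c≤ L ≤s = trans (sumℤ-cong L (All.map (λ {i} → rel-split f φ k f-split c c≤ i) ≤s)) (trans (sumℤ-linear _ (+ k) L) (cong (_+ℤ + sum L *ℤ + k) (sumℤ-affine (relFloor φ c) (-ℤ (+ c *ℤ + k)) L)))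
    D D′ : ℤ
    D = + sum pos -ℤ + sum neg
    D′ = + sum plus -ℤ + sum minus
    excess-split : ∀ c → c ≤ 72 → excess f c ≡ excess φ c +ℤ D *ℤ + k
    excess-split c c≤ = trans (cong₂ _-ℤ_ (sum-split c c≤ pos (all≤ 72 pos)) (sum-split c c≤ neg (all≤ 72 neg)))
        (l₁ (sumℤ (relFloor φ c) pos) (sumℤ (relFloor φ c) neg) (+ length pos) (-ℤ (+ c *ℤ + k)) (+ sum pos) (+ sum neg) (+ k))
      where
      l₁ : ∀ u v n w s s′ k → (u +ℤ n *ℤ w +ℤ s *ℤ k) -ℤ (v +ℤ n *ℤ w +ℤ s′ *ℤ k) ≡ u -ℤ v +ℤ (s -ℤ s′) *ℤ k
      l₁ = ℤSolver.solve-∀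
    supply-part : ∀ L → All (_≤ 72) L → + sumℕ f L ≡ + sumℕ φ L +ℤ + sum L *ℤ + k
    supply-part L ≤s = trans (+sumℕ f L) (trans (sumℤ-cong L (All.map (λ {j} le → trans (cong +_ (f-split j le)) (trans (ℤP.pos-+ (φ j) (j * k)) (cong (+ φ j +ℤ_) (ℤP.pos-* j k)))) ≤s))
      (trans (sumℤ-linear (λ j → + φ j) (+ k) L) (cong (_+ℤ + sum L *ℤ + k) (sym (+sumℕ φ L)))))
    supply-split : supply f ≡ supply φ +ℤ D *ℤ + k
    supply-split = trans (cong₂ _-ℤ_ (supply-part plus (all≤ 72 plus)) (supply-part minus (all≤ 72 minus)))
        (trans (l₁ (+ sumℕ φ plus) (+ sumℕ φ minus) (+ sum plus) (+ sum minus) (+ k)) (cong (λ d → supply φ +ℤ d *ℤ + k) D′≡D))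
      where
      -- Both differences are 90. This balance removes `k = m / q` from the inequality and reduces
      -- it to `m < q`.
      D′≡D : D′ ≡ D
      D′≡D = refl
      l₁ : ∀ u v s s′ k → (u +ℤ s *ℤ k) -ℤ (v +ℤ s′ *ℤ k) ≡ u -ℤ v +ℤ (s -ℤ s′) *ℤ k
      l₁ = ℤSolver.solve-∀
    -- `φ 24 = 0` means `24 (m % q) < q`. Either `q ≤ m`, and the lcm pays, or
    -- `24 m < q ≤ 24 m + r`, and then `q` itself is a tie of `24 m`.
    bonus-enough : (if isZero (φ 24) then + 8 else 0ℤ) ≤ℤ + (8 * bonus)
    bonus-enough with isZero (φ 24) in eq
    ... | false = ℤ.+≤+ z≤n
    ... | true = ℤ.+≤+ (ℕP.*-monoʳ-≤ 8 one)
      where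
      φ24 : φ 24 ≡ 0
      φ24 with φ 24
      ... | zero = refl
      ... | suc _ = contradiction (sym eq) (λ ())
      one : 1 ≤ bonus
      one with q ℕP.≤? m
      ... | yes _ = s≤s z≤n
      ... | no q≰m = ℕP.≤-trans (ties-member q (24 * m) (q ∸ 24 * m) (divides 1 (trans (ℕP.m+[n∸m]≡n (ℕP.<⇒≤ 24m<q)) (sym (ℕP.*-identityˡ q)))))
          (ℕP.≤-trans (ties-mono q (24 * m) small) (tie≤τ 24 (s≤s z≤n) (ℕP.m≤m+n 24 48)))
        where
        m<q = ℕP.≰⇒> q≰m
        24m<q : 24 * m < q
        24m<q = DM.m/n≡0⇒m<n (trans (cong (λ z → (24 * z) / q) (sym (DM.m<n⇒m%n≡m m<q))) (trans (proj₂ (proj₂ leaf) 24 (ℕP.m≤m+n 24 48)) φ24))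
        small : q ∸ 24 * m ≤ 24
        small = ℕP.≤-trans (ℕP.m≤n+o⇒m∸n≤o q (24 * m) q≤p) (ℕP.m≤n⇒m≤1+n r≤23)
    from-leaf : ∀ L → All (_≤ 72) L → All (BaseSlack φ) L → All Slack L
    from-leaf [] [] _ = []
    from-leaf (c ∷ L) (c≤ ∷ ≤s) (h ∷ hs) = single ∷ from-leaf L ≤s hs
      where
      base : excess φ c +ℤ + 1 ≤ℤ supply φ +ℤ + (8 * bonus)
      base = ℤP.≤-trans h (ℤP.+-monoʳ-≤ (supply φ) bonus-enough)
      l₁ : ∀ u v → u +ℤ v +ℤ + 1 ≡ u +ℤ + 1 +ℤ v
      l₁ = ℤSolver.solve-∀
      l₂ : ∀ s b v → s +ℤ b +ℤ v ≡ s +ℤ v +ℤ b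
      l₂ = ℤSolver.solve-∀
      single : Slack c
      single = subst₂ _≤ℤ_ (sym (trans (cong (_+ℤ + 1) (excess-split c c≤)) (l₁ (excess φ c) (D *ℤ + k)))) (trans (l₂ (supply φ) (+ (8 * bonus)) (D *ℤ + k)) (cong (_+ℤ + (8 * bonus)) (sym supply-split))) (ℤP.+-monoˡ-≤ (D *ℤ + k) base)

  -- Raise `y` until `x c + y` is -1 modulo `q`. No start crosses a multiple of `q`, since `c` has
  -- the largest residue among them, while floors at ends can only grow; so the extremal translate
  -- bounds all others. The nine ends and nine starts cost `τ` each, in all `18 τ`.
  level-at : ∀ y c → Slack c → c ≤ 72 → All (λ i → (x i + y) % q ≤ (x c + y) % q) neg →
    sumℕ (λ i → (x i + y) / q) pos + sumℕ f minus + 1 ≤ sumℕ (λ i → (x i + y) / q) neg + sumℕ f plus + (8 * bonus + 18 * τ)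
  level-at y c slack c≤72 maxs = ℤP.drop‿+≤+ (subst₂ _≤ℤ_ (sym lhs) (sym rhs) final)
    where
    ρ = (x c + y) % q
    d = q ∸ suc ρ
    y′ = y + d
    g = suc ((x c + y) / q)
    ρ<q = DM.m%n<n (x c + y) q
    top : x c + y′ + 1 ≡ q * g
    top = trans (cong (λ z → z + 1) (sym (ℕP.+-assoc (x c) y d))) (trans (cong (λ z → z + d + 1) (DM.m≡m%n+[m/n]*n (x c + y) q))
      (trans (l₁ ρ ((x c + y) / q) q d) (trans (cong (λ z → z + (x c + y) / q * q) (ℕP.m+[n∸m]≡n ρ<q)) (l₂ ((x c + y) / q) q))))
      where
      l₁ : ∀ ρ a q d → ρ + a * q + d + 1 ≡ suc ρ + d + a * q
      l₁ = ℕSolver.solve-∀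
      l₂ : ∀ a q → q + a * q ≡ q * suc a
      l₂ = ℕSolver.solve-∀
    two = two-sided y′ g c top c≤72
    pos-step : ∀ i → i ≤ 72 → + ((x i + y) / q) ≤ℤ relFloor f c i +ℤ (+ g +ℤ + τ)
    pos-step i le = ℤP.≤-trans (ℤ.+≤+ (DM./-monoˡ-≤ q (ℕP.+-monoʳ-≤ (x i) (ℕP.m≤m+n y d)))) (proj₁ (two i le))
    neg-step : ∀ i → i ≤ 72 → (x i + y) % q ≤ ρ → relFloor f c i +ℤ (+ g -ℤ + τ) ≤ℤ + ((x i + y) / q)
    neg-step i le ρi≤ = subst₂ _≤ℤ_ (l₁ (relFloor f c i) (+ g) (+ τ)) (trans (l₂ (+ ((x i + y′) / q)) (+ τ)) (cong +_ same)) (ℤP.+-monoˡ-≤ (-ℤ + τ) (proj₂ (two i le)))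
      where
      l₁ : ∀ a g t → a +ℤ g -ℤ t ≡ a +ℤ (g -ℤ t)
      l₁ = ℤSolver.solve-∀
      l₂ : ∀ a t → a +ℤ t -ℤ t ≡ a
      l₂ = ℤSolver.solve-∀
      X = x i + y
      same : (x i + y′) / q ≡ X / q
      same = div-unique (X / q) (x i + y′) q (ℕP.≤-trans (DM.m/n*n≤m X q) (ℕP.+-monoʳ-≤ (x i) (ℕP.m≤m+n y d))) (begin-strict
        x i + (y + d)                    ≡⟨ ℕP.+-assoc (x i) y d ⟨
        X + d                            ≡⟨ cong (_+ d) (DM.m≡m%n+[m/n]*n X q) ⟩
        X % q + X / q * q + d            ≡⟨ l₃ (X % q) (X / q * q) d ⟩
        X % q + d + X / q * q            <⟨ ℕP.+-monoˡ-< (X / q * q) (ℕP.≤-trans (s≤s (ℕP.+-monoˡ-≤ d ρi≤)) (ℕP.≤-reflexive (ℕP.m+[n∸m]≡n ρ<q))) ⟩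
        q + X / q * q                    ∎)
        where
        open ℕP.≤-Reasoning
        l₃ : ∀ a b d → a + b + d ≡ a + d + b
        l₃ = ℕSolver.solve-∀
    F⁺ = sumℤ (relFloor f c) pos
    F⁻ = sumℤ (relFloor f c) neg
    S⁺ = + sumℕ (λ i → (x i + y) / q) pos
    S⁻ = + sumℕ (λ i → (x i + y) / q) neg
    hi : S⁺ ≤ℤ F⁺ +ℤ + 9 *ℤ (+ g +ℤ + τ)
    hi = subst₂ _≤ℤ_ (sym (+sumℕ (λ i → (x i + y) / q) pos)) (sumℤ-affine (relFloor f c) (+ g +ℤ + τ) pos) (sumℤ-mono pos (All.map (λ {i} → pos-step i) (all≤ 72 pos)))
    lo : F⁻ +ℤ + 9 *ℤ (+ g -ℤ + τ) ≤ℤ S⁻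
    lo = subst₂ _≤ℤ_ (sumℤ-affine (relFloor f c) (+ g -ℤ + τ) neg) (sym (+sumℕ (λ i → (x i + y) / q) neg)) (sumℤ-mono neg (All.map (λ {i} (le , ρi) → neg-step i le ρi) (All.zip (all≤ 72 neg , maxs))))
    M = + sumℕ f minus
    Pl = + sumℕ f plus
    E = + (8 * bonus)
    final : S⁺ +ℤ M +ℤ + 1 ≤ℤ S⁻ +ℤ Pl +ℤ (E +ℤ + 18 *ℤ + τ)
    final = ℤP.≤-trans (ℤP.+-monoˡ-≤ (+ 1) (ℤP.+-monoˡ-≤ M hi)) (ℤP.≤-trans (subst₂ _≤ℤ_ (l₁ F⁺ F⁻ (+ g) (+ τ) M) (l₂ F⁻ Pl M E (+ g) (+ τ)) (ℤP.+-monoˡ-≤ (F⁻ +ℤ + 9 *ℤ (+ g +ℤ + τ) +ℤ M) slack))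
      (subst₂ _≤ℤ_ refl (l₃ S⁻ Pl E (+ τ)) (ℤP.+-monoˡ-≤ (Pl +ℤ E +ℤ + 18 *ℤ + τ) lo)))
      where
      l₁ : ∀ F⁺ F⁻ g t M → F⁺ -ℤ F⁻ +ℤ + 1 +ℤ (F⁻ +ℤ + 9 *ℤ (g +ℤ t) +ℤ M) ≡ F⁺ +ℤ + 9 *ℤ (g +ℤ t) +ℤ M +ℤ + 1
      l₁ = ℤSolver.solve-∀
      l₂ : ∀ F⁻ Pl M E g t → Pl -ℤ M +ℤ E +ℤ (F⁻ +ℤ + 9 *ℤ (g +ℤ t) +ℤ M) ≡ F⁻ +ℤ + 9 *ℤ (g -ℤ t) +ℤ (Pl +ℤ E +ℤ + 18 *ℤ t)
      l₂ = ℤSolver.solve-∀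
      l₃ : ∀ S Pl E t → S +ℤ (Pl +ℤ E +ℤ + 18 *ℤ t) ≡ S +ℤ Pl +ℤ (E +ℤ + 18 *ℤ t)
      l₃ = ℤSolver.solve-∀
    lhs : + (sumℕ (λ i → (x i + y) / q) pos + sumℕ f minus + 1) ≡ S⁺ +ℤ M +ℤ + 1
    lhs = trans (ℤP.pos-+ (sumℕ (λ i → (x i + y) / q) pos + sumℕ f minus) 1) (cong (_+ℤ + 1) (ℤP.pos-+ (sumℕ (λ i → (x i + y) / q) pos) (sumℕ f minus)))
    rhs : + (sumℕ (λ i → (x i + y) / q) neg + sumℕ f plus + (8 * bonus + 18 * τ)) ≡ S⁻ +ℤ Pl +ℤ (E +ℤ + 18 *ℤ + τ)
    rhs = trans (ℤP.pos-+ (sumℕ (λ i → (x i + y) / q) neg + sumℕ f plus) (8 * bonus + 18 * τ)) (cong₂ _+ℤ_ (ℤP.pos-+ (sumℕ (λ i → (x i + y) / q) neg) (sumℕ f plus)) (trans (ℤP.pos-+ (8 * bonus) (18 * τ)) (cong (E +ℤ_) (ℤP.pos-* 18 τ))))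

  level : ∀ y → sumℕ (λ i → (x i + y) / q) pos + sumℕ f minus + 1 ≤ sumℕ (λ i → (x i + y) / q) neg + sumℕ f plus + (8 * bonus + 18 * τ)
  level y = level-at y (proj₁ best) (proj₁ (proj₁ (proj₂ best))) (proj₂ (proj₁ (proj₂ best))) (proj₂ (proj₂ best))
    where
    best : Σ ℕ λ c → (Slack c × c ≤ 72) × All (λ i → (x i + y) % q ≤ (x c + y) % q) neg
    best = argmax (λ i → (x i + y) % q) 24 (24 ∷ 24 ∷ 25 ∷ 26 ∷ 27 ∷ 28 ∷ 29 ∷ 72 ∷ []) slack-all

-- Blocks of zeros and poles

range : ℤ → ℕ → List ℤ
range A zero = []
range A (suc L) = A ∷ range (A +ℤ 1ℤ) L

rep : ℕ → List ℤ → List ℤ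
rep zero xs = []
rep (suc n) xs = xs ++ rep n xs

cntDiv-rep : ∀ q a n xs → cntDiv q a (rep n xs) ≡ n * cntDiv q a xs
cntDiv-rep q a zero xs = refl
cntDiv-rep q a (suc n) xs = trans (cntDiv-++ q a xs (rep n xs)) (cong (λ z → cntDiv q a xs + z) (cntDiv-rep q a n xs))

length-range : ∀ A L → length (range A L) ≡ L
length-range A zero = refl
length-range A (suc L) = cong suc (length-range (A +ℤ 1ℤ) L)

length-rep : ∀ n xs → length (rep n xs) ≡ n * length xs
length-rep zero xs = refl
length-rep (suc n) xs = trans (ListP.length-++ xs) (cong (λ z → length xs + z) (length-rep n xs))

abs-cases : ∀ a {n} → ∣ a ∣ℤ ≡ n → a ≡ + n ⊎ a ≡ -ℤ + n
abs-cases (+ n) refl = inj₁ refl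
abs-cases -[1+ n ] refl = inj₂ refl

ind-shift : ∀ q a h z → a ≡ + h -ℤ + (q * z) → ind q ∣ a ∣ℤ ≡ ind q h
ind-shift q a h z e with q ∣? h
... | yes (divides c ec) = ind-yes (subst (q ∣_) (sym (trans (cong ∣_∣ℤ eq) (ℤP.∣i*j∣≡∣i∣*∣j∣ (+ q) (+ c -ℤ + z)))) (∣m⇒∣m*n ∣ + c -ℤ + z ∣ℤ Div.∣-refl))
  where
  lem : ∀ q c z → c *ℤ q -ℤ q *ℤ z ≡ q *ℤ (c -ℤ z)
  lem = ℤSolver.solve-∀
  eq : a ≡ + q *ℤ (+ c -ℤ + z)
  eq = trans e (trans (cong₂ _-ℤ_ (trans (cong +_ ec) (ℤP.pos-* c q)) (ℤP.pos-* q z)) (lem (+ q) (+ c) (+ z)))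
... | no ¬d = ind-no λ { (divides c ec) → ¬d (div-h c ec) }
  where
  div-h : ∀ c → ∣ a ∣ℤ ≡ c * q → q ∣ h
  div-h c ec with abs-cases a ec
  ... | inj₁ p = subst (q ∣_) (ℤP.+-injective (trans (ℤP.pos-+ (c * q) (q * z)) (trans (cong (_+ℤ + (q * z)) (trans (sym p) e)) (lem (+ h) (+ (q * z)))))) (∣m∣n⇒∣m+n (divides c refl) (∣m⇒∣m*n z Div.∣-refl))
    where
    lem : ∀ h z → h -ℤ z +ℤ z ≡ h
    lem = ℤSolver.solve-∀
  ... | inj₂ p = ∣m+n∣m⇒∣n (subst (q ∣_) (sym (ℤP.+-injective (trans (ℤP.pos-+ (c * q) h) (trans (cong (_+ℤ + h) (trans (sym (ℤP.neg-involutive (+ (c * q)))) (cong -ℤ_ (trans (sym p) e)))) (lem (+ h) (+ (q * z))))))) (∣m⇒∣m*n z Div.∣-refl)) (divides c refl)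
    where
    lem : ∀ h z → -ℤ (h -ℤ z) +ℤ h ≡ z
    lem = ℤSolver.solve-∀

-- The multiples of `q` in an interval number a difference of floors; subtracting `q z` lets the
-- interval begin at a natural number.
cntDiv-range : ∀ q a A L h z .{{_ : NonZero q}} → a +ℤ A ≡ + suc h -ℤ + (q * z) → cntDiv q a (range A L) + h / q ≡ (h + L) / q
cntDiv-range q a A zero h z e = cong (_/ q) (sym (ℕP.+-identityʳ h))
cntDiv-range q a A (suc L) h z e = begin
  ind q ∣ a +ℤ A ∣ℤ + cntDiv q a (range (A +ℤ 1ℤ) L) + h / q     ≡⟨ cong (λ w → w + cntDiv q a (range (A +ℤ 1ℤ) L) + h / q) (ind-shift q (a +ℤ A) (suc h) z e) ⟩
  ind q (suc h) + cntDiv q a (range (A +ℤ 1ℤ) L) + h / q         ≡⟨ lem (ind q (suc h)) (cntDiv q a (range (A +ℤ 1ℤ) L)) (h / q) ⟩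
  cntDiv q a (range (A +ℤ 1ℤ) L) + (h / q + ind q (suc h))       ≡⟨ cong (λ w → cntDiv q a (range (A +ℤ 1ℤ) L) + w) (floor-suc q h) ⟨
  cntDiv q a (range (A +ℤ 1ℤ) L) + suc h / q                     ≡⟨ cntDiv-range q a (A +ℤ 1ℤ) L (suc h) z next ⟩
  (suc h + L) / q                                                ≡⟨ cong (_/ q) (ℕP.+-suc h L) ⟨
  (h + suc L) / q                                                ∎
  where
  open ≡-Reasoning
  lem : ∀ a b c → a + b + c ≡ b + (c + a)
  lem = ℕSolver.solve-∀
  lem₂ : ∀ a A → a +ℤ (A +ℤ + 1) ≡ a +ℤ A +ℤ + 1
  lem₂ = ℤSolver.solve-∀
  lem₃ : ∀ h z → h -ℤ z +ℤ + 1 ≡ + 1 +ℤ h -ℤ z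
  lem₃ = ℤSolver.solve-∀
  next : a +ℤ (A +ℤ 1ℤ) ≡ + suc (suc h) -ℤ + (q * z)
  next = trans (lem₂ a A) (trans (cong (_+ℤ + 1) e) (trans (lem₃ (+ suc h) (+ (q * z))) (cong (_-ℤ + (q * z)) (sym (ℤP.pos-+ 1 (suc h))))))

module Blocks (b m r : ℕ) where

  p : ℕ
  p = 24 * m + r

  inner : List ℤ
  inner = range 1ℤ (p ∸ 1)

  -- Length of the interval from `e m` to `p - e m`, both included.
  width : ℕ → ℕ
  width e = (24 ∸ 2 * e) * m + r + 1

  block : ℕ → List ℤ
  block e = range (+ (e * m)) (width e)

  blocks : List ℤ
  blocks = block 1 ++ block 2 ++ block 3 ++ block 4 ++ block 5

  us : List ℤ
  us = rep (2 * b) inner ++ rep b blocks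

  -- `inner` begins at 1 and the blocks at positive multiples of `m`, so 0 is a simple pole; the
  -- non-vanishing proof rests on this.
  dens : List ℤ
  dens = 0ℤ ∷ us

  leftZeros rightZeros vs : List ℤ
  leftZeros = range (-ℤ + (24 * m)) (24 * m)
  rightZeros = range (+ suc p) (24 * m)
  vs = rep b (leftZeros ++ rightZeros)

  module _ (0<m : 0 < m) (r≤23 : r ≤ 23) (q : ℕ) .{{_ : NonZero q}} (q≤p : q ≤ p) (k : ℕ) where
    open LevelAt m r q 0<m r≤23 q≤p

    private
      -- Since `y = q z - z`, adding `y` is translation by `-z` modulo `q` without leaving the
      -- natural numbers; position `u` seen from `-k` becomes `24 m + u + y + 1`.
      z y : ℕ
      z = k + 24 * m + 1
      y = z * (q ∸ 1)

      F : ℕ → ℕ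
      F i = (x i + y) / q

      cnt : List ℤ → ℕ
      cnt = cntDiv q (-ℤ + k)

      Q₁ : q ≡ q ∸ 1 + 1
      Q₁ = sym (ℕP.m∸n+n≡m (ℕ.>-nonZero⁻¹ q))

      count : ∀ i i′ A L → A ≡ + x i -ℤ + (24 * m) → x i + L ≡ x i′ → cnt (range A L) + F i ≡ F i′
      count i i′ A L e e′ = trans (cntDiv-range q (-ℤ + k) A L (x i + y) z start) (cong (_/ q) (trans (lem (x i) y L) (cong (_+ y) e′)))
        where
        lem : ∀ a y L → a + y + L ≡ a + L + y
        lem = ℕSolver.solve-∀
        lem₂ : ∀ k x t q′ → -ℤ k +ℤ (x -ℤ t) ≡ + 1 +ℤ (x +ℤ (k +ℤ t +ℤ + 1) *ℤ q′) -ℤ (q′ +ℤ + 1) *ℤ (k +ℤ t +ℤ + 1)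
        lem₂ = ℤSolver.solve-∀
        Z : + z ≡ + k +ℤ + (24 * m) +ℤ + 1
        Z = trans (ℤP.pos-+ (k + 24 * m) 1) (cong (_+ℤ + 1) (ℤP.pos-+ k (24 * m)))
        start : -ℤ + k +ℤ A ≡ + suc (x i + y) -ℤ + (q * z)
        start = trans (cong (-ℤ + k +ℤ_) e) (trans (lem₂ (+ k) (+ x i) (+ (24 * m)) (+ (q ∸ 1))) (sym (cong₂ _-ℤ_
          (trans (ℤP.pos-+ 1 (x i + y)) (cong (+ 1 +ℤ_) (trans (ℤP.pos-+ (x i) y) (cong (+ x i +ℤ_) (trans (ℤP.pos-* z (q ∸ 1)) (cong (_*ℤ + (q ∸ 1)) Z))))))
          (trans (ℤP.pos-* q z) (cong₂ _*ℤ_ (trans (cong +_ Q₁) (ℤP.pos-+ (q ∸ 1) 1)) Z)))))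

      mid-start : ∀ e → + (e * m) ≡ + ((24 + e) * m + 0) -ℤ + (24 * m)
      mid-start e = sym (trans (cong (_-ℤ + (24 * m)) (trans (cong +_ (lem e m)) (ℤP.pos-+ (24 * m) (e * m)))) (lem₂ (+ (24 * m)) (+ (e * m))))
        where
        lem : ∀ e m → (24 + e) * m + 0 ≡ 24 * m + e * m
        lem = ℕSolver.solve-∀
        lem₂ : ∀ a b → a +ℤ b -ℤ a ≡ b
        lem₂ = ℤSolver.solve-∀

      N₀ : cnt (range 0ℤ (suc p)) + F 24 ≡ F 48
      N₀ = count 24 48 0ℤ (suc p) (mid-start 0) (lem m r)
        where
        lem : ∀ m r → 24 * m + 0 + suc (24 * m + r) ≡ 48 * m + suc r
        lem = ℕSolver.solve-∀

      N₁ : cnt (block 1) + F 25 ≡ F 47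
      N₁ = count 25 47 _ (width 1) (mid-start 1) (lem m r)
        where
        lem : ∀ m r → 25 * m + 0 + (22 * m + r + 1) ≡ 47 * m + suc r
        lem = ℕSolver.solve-∀

      N₂ : cnt (block 2) + F 26 ≡ F 46
      N₂ = count 26 46 _ (width 2) (mid-start 2) (lem m r)
        where
        lem : ∀ m r → 26 * m + 0 + (20 * m + r + 1) ≡ 46 * m + suc r
        lem = ℕSolver.solve-∀

      N₃ : cnt (block 3) + F 27 ≡ F 45
      N₃ = count 27 45 _ (width 3) (mid-start 3) (lem m r)
        where
        lem : ∀ m r → 27 * m + 0 + (18 * m + r + 1) ≡ 45 * m + suc r
        lem = ℕSolver.solve-∀

      N₄ : cnt (block 4) + F 28 ≡ F 44
      N₄ = count 28 44 _ (width 4) (mid-start 4) (lem m r)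
        where
        lem : ∀ m r → 28 * m + 0 + (16 * m + r + 1) ≡ 44 * m + suc r
        lem = ℕSolver.solve-∀

      N₅ : cnt (block 5) + F 29 ≡ F 43
      N₅ = count 29 43 _ (width 5) (mid-start 5) (lem m r)
        where
        lem : ∀ m r → 29 * m + 0 + (14 * m + r + 1) ≡ 43 * m + suc r
        lem = ℕSolver.solve-∀

      Zˡ : cnt leftZeros + F 0 ≡ F 24
      Zˡ = count 0 24 _ (24 * m) (sym (ℤP.+-identityˡ (-ℤ + (24 * m)))) (sym (ℕP.+-identityʳ (24 * m)))

      Zʳ : cnt rightZeros + F 48 ≡ F 72
      Zʳ = count 48 72 _ (24 * m) (sym (trans (cong (_-ℤ + (24 * m)) (trans (cong +_ (lem m r)) (ℤP.pos-+ (24 * m) (suc p)))) (lem₂ (+ (24 * m)) (+ suc p)))) (lem₃ m r)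
        where
        lem : ∀ m r → 48 * m + suc r ≡ 24 * m + suc (24 * m + r)
        lem = ℕSolver.solve-∀
        lem₂ : ∀ a b → a +ℤ b -ℤ a ≡ b
        lem₂ = ℤSolver.solve-∀
        lem₃ : ∀ m r → 48 * m + suc r + 24 * m ≡ 72 * m + suc r
        lem₃ = ℕSolver.solve-∀

      n₀ n⁺ n₁ n₂ n₃ n₄ n₅ zˡ zʳ : ℕ
      n₀ = cnt (range 0ℤ (suc p))
      n⁺ = cnt (block 1) + (cnt (block 2) + (cnt (block 3) + (cnt (block 4) + cnt (block 5))))
      n₁ = cnt (block 1)
      n₂ = cnt (block 2)
      n₃ = cnt (block 3)
      n₄ = cnt (block 4)
      n₅ = cnt (block 5)
      zˡ = cnt leftZeros
      zʳ = cnt rightZeros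

      -- Each block of poles counts the floor at its end minus the floor at its start, each block of
      -- zeros the opposite.
      balance : sumℕ F pos + (zˡ + zʳ) ≡ sumℕ F neg + (2 * n₀ + n⁺)
      balance = trans (cong (_+ (zˡ + zʳ)) sp) (trans (lem (F 25) (F 26) (F 27) (F 28) (F 29) (F 0) zˡ zʳ n₀ n₁ n₂ n₃ n₄ n₅) (cong₂ (λ u v → u + (u + (u + (F 25 + (F 26 + (F 27 + (F 28 + (F 29 + (v + 0)))))))) + (2 * n₀ + n⁺)) Zˡ (trans (cong (λ w → zʳ + w) N₀′) Zʳ)))
        where
        N₀′ : n₀ + (zˡ + F 0) ≡ F 48
        N₀′ = trans (cong (λ w → n₀ + w) Zˡ) N₀
        sp : sumℕ F pos ≡ (n₀ + (zˡ + F 0)) + ((n₀ + (zˡ + F 0)) + ((n₀ + (zˡ + F 0)) + ((n₁ + F 25) + ((n₂ + F 26) + ((n₃ + F 27) + ((n₄ + F 28) + ((n₅ + F 29) + (F 0 + 0))))))))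
        sp = sym (cong₂ (λ u v → u + (u + (u + v))) N₀′ (cong₂ _+_ N₁ (cong₂ _+_ N₂ (cong₂ _+_ N₃ (cong₂ _+_ N₄ (cong₂ _+_ N₅ refl))))))
        lem : ∀ f25 f26 f27 f28 f29 f0 zl zr n₀ n₁ n₂ n₃ n₄ n₅ →
          (n₀ + (zl + f0)) + ((n₀ + (zl + f0)) + ((n₀ + (zl + f0)) + ((n₁ + f25) + ((n₂ + f26) + ((n₃ + f27) + ((n₄ + f28) + ((n₅ + f29) + (f0 + 0)))))))) + (zl + zr)
          ≡ (zl + f0) + ((zl + f0) + ((zl + f0) + (f25 + (f26 + (f27 + (f28 + (f29 + ((zr + (n₀ + (zl + f0))) + 0)))))))) + (2 * n₀ + (n₁ + (n₂ + (n₃ + (n₄ + n₅)))))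
        lem = ℕSolver.solve-∀

    extra : ℕ
    extra = 8 * bonus + 18 * τ

    private
     need-level : 2 * n₀ + n⁺ + sumℕ f minus + 1 ≤ zˡ + zʳ + sumℕ f plus + extra
     need-level = ℕP.+-cancelˡ-≤ (sumℕ F neg) _ _ (begin
       sumℕ F neg + (2 * n₀ + n⁺ + sumℕ f minus + 1)      ≡⟨ l₁ (sumℕ F neg) (2 * n₀ + n⁺) (sumℕ f minus) ⟩
       sumℕ F neg + (2 * n₀ + n⁺) + sumℕ f minus + 1      ≡⟨ cong (λ w → w + sumℕ f minus + 1) balance ⟨
       sumℕ F pos + (zˡ + zʳ) + sumℕ f minus + 1          ≡⟨ l₂ (sumℕ F pos) (zˡ + zʳ) (sumℕ f minus) ⟩
       zˡ + zʳ + (sumℕ F pos + sumℕ f minus + 1)          ≤⟨ ℕP.+-monoʳ-≤ (zˡ + zʳ) (level y) ⟩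
       zˡ + zʳ + (sumℕ F neg + sumℕ f plus + extra)       ≡⟨ l₃ (zˡ + zʳ) (sumℕ F neg) (sumℕ f plus) extra ⟩
       sumℕ F neg + (zˡ + zʳ + sumℕ f plus + extra)       ∎)
       where
       open ℕP.≤-Reasoning
       l₁ : ∀ s n f → s + (n + f + 1) ≡ s + n + f + 1
       l₁ = ℕSolver.solve-∀
       l₂ : ∀ s z f → s + z + f + 1 ≡ z + (s + f + 1)
       l₂ = ℕSolver.solve-∀
       l₃ : ∀ z s f e → z + (s + f + e) ≡ s + (z + f + e)
       l₃ = ℕSolver.solve-∀

    -- The endpoint 0 occurs once in the outer part and `p` not at all, but both are charged `2 b`
    -- times, so that `inner` becomes the full interval from 0 to `p`.
    cnt-dens : 1 ≤ b → cnt dens ≤ b * (2 * n₀ + n⁺)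
    cnt-dens 1≤b = begin
      i₀ + cnt us                                        ≡⟨ cong (λ w → i₀ + w) (trans (cntDiv-++ q (-ℤ + k) (rep (2 * b) inner) (rep b blocks)) (cong₂ _+_ (cntDiv-rep q (-ℤ + k) (2 * b) inner) (cntDiv-rep q (-ℤ + k) b blocks))) ⟩
      i₀ + (2 * b * cnt inner + b * cnt blocks)          ≤⟨ ℕP.+-monoˡ-≤ _ (subst (_≤ 2 * b * i₀) (ℕP.*-identityˡ i₀) (ℕP.*-monoˡ-≤ i₀ (ℕP.≤-trans 1≤b (ℕP.m≤n*m b 2)))) ⟩
      2 * b * i₀ + (2 * b * cnt inner + b * cnt blocks)  ≡⟨ l₁ b i₀ (cnt inner) (cnt blocks) ⟩
      b * (2 * (i₀ + cnt inner) + cnt blocks)            ≤⟨ ℕP.*-monoʳ-≤ b (ℕP.+-mono-≤ (ℕP.*-monoʳ-≤ 2 (ℕP.+-monoʳ-≤ i₀ (range-mono 1ℤ (ℕP.m∸n≤m p 1)))) (ℕP.≤-reflexive blocks-eq)) ⟩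
      b * (2 * n₀ + n⁺)                                  ∎
      where
      open ℕP.≤-Reasoning
      i₀ = ind q ∣ -ℤ + k +ℤ 0ℤ ∣ℤ
      l₁ : ∀ b i c d → 2 * b * i + (2 * b * c + b * d) ≡ b * (2 * (i + c) + d)
      l₁ = ℕSolver.solve-∀
      range-mono : ∀ A {L L′} → L ≤ L′ → cnt (range A L) ≤ cnt (range A L′)
      range-mono A z≤n = z≤n
      range-mono A (s≤s le) = ℕP.+-monoʳ-≤ _ (range-mono (A +ℤ 1ℤ) le)
      split : ∀ xs ys → cnt (xs ++ ys) ≡ cnt xs + cnt ys
      split = cntDiv-++ q (-ℤ + k)
      blocks-eq : cnt blocks ≡ n⁺
      blocks-eq = trans (split (block 1) _) (cong (λ w → n₁ + w) (trans (split (block 2) _) (cong (λ w → n₂ + w) (trans (split (block 3) _) (cong (λ w → n₃ + w) (split (block 4) (block 5)))))))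

    -- The exponent 26 of the rounding term is 18 from the boundaries plus 8 from the bonus; the `b`
    -- on the left is the reserve for the partial sums.
    cnt-level : 1 ≤ b → cnt dens + b * sumℕ f minus + b ≤ cnt vs + b * (sumℕ f plus + (8 * atMost q m + 26 * τ))
    cnt-level 1≤b = begin
      cnt dens + b * sumℕ f minus + b                    ≤⟨ ℕP.+-monoˡ-≤ b (ℕP.+-monoˡ-≤ (b * sumℕ f minus) (cnt-dens 1≤b)) ⟩
      b * (2 * n₀ + n⁺) + b * sumℕ f minus + b           ≡⟨ l₁ b (2 * n₀ + n⁺) (sumℕ f minus) ⟩
      b * (2 * n₀ + n⁺ + sumℕ f minus + 1)               ≤⟨ ℕP.*-monoʳ-≤ b need-level ⟩
      b * (zˡ + zʳ + sumℕ f plus + extra)                ≡⟨ l₂ b (zˡ + zʳ) (sumℕ f plus) (atMost q m) τ ⟩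
      b * (zˡ + zʳ) + b * (sumℕ f plus + (8 * atMost q m + 26 * τ)) ≡⟨ cong (_+ b * (sumℕ f plus + (8 * atMost q m + 26 * τ))) (trans (cntDiv-rep q (-ℤ + k) b (leftZeros ++ rightZeros)) (cong (b *_) (cntDiv-++ q (-ℤ + k) leftZeros rightZeros))) ⟨
      cnt vs + b * (sumℕ f plus + (8 * atMost q m + 26 * τ)) ∎
      where
      open ℕP.≤-Reasoning
      l₁ : ∀ b n f → b * n + b * f + b ≡ b * (n + f + 1)
      l₁ = ℕSolver.solve-∀
      l₂ : ∀ b z f a t → b * (z + f + (8 * (a + t) + 18 * t)) ≡ b * z + b * (f + (8 * a + 26 * t))
      l₂ = ℕSolver.solve-∀

-- The multiplier

factProd : ℕ → List ℕ → ℕ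
factProd m [] = 1
factProd m (j ∷ L) = (j * m) ! * factProd m L

tieProd : ℕ → ℕ → ℕ
tieProd z zero = z
tieProd z (suc s) = (z + suc s) * tieProd z s

-- The product of all integers `j m + s` with `1 ≤ j ≤ J` and `s ≤ 24`. At every prime power it
-- supplies the ties counted by `τ`, yet it is only polynomial in `m`.
tieAll : ℕ → ℕ → ℕ
tieAll m zero = 1
tieAll m (suc j) = tieProd (suc j * m) 24 * tieAll m j

central : ℕ → ℚ
central k = ν ((2 * k) !) ⊗ (inv (ν (k !)) ⊗ inv (ν (k !)))

-- A multiple of lcm(1,…,s): the prime powers in (⌈s/2⌉, s] divide the central binomial coefficient of ⌈s/2⌉. The first argument is fuel.
lcmBound : ℕ → ℕ → ℚ
lcmBound zero s = 1ℚ
lcmBound (suc n) zero = 1ℚ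
lcmBound (suc n) (suc zero) = 1ℚ
lcmBound (suc n) s@(suc (suc _)) = central ℕ.⌈ s /2⌉ ⊗ lcmBound n ℕ.⌈ s /2⌉

-- The exponents 8 and 26 are those of `atMost` and `τ` in `cnt-level`.
baseMultiplier : ℕ → ℚ
baseMultiplier m = ν (factProd m plus) ⊗ inv (ν (factProd m minus)) ⊗ (lcmBound m m ^ℚ 8 ⊗ ν (tieAll m 72) ^ℚ 26)

multiplier : ℕ → ℕ → ℚ
multiplier b m = baseMultiplier m ^ℚ b

^ℚ-inverse : ∀ {x y} s → x ⊗ y ≡ 1ℚ → x ^ℚ s ⊗ y ^ℚ s ≡ 1ℚ
^ℚ-inverse zero e = refl
^ℚ-inverse {x} {y} (suc s) e = trans (lem x (x ^ℚ s) y (y ^ℚ s)) (cong₂ _⊗_ e (^ℚ-inverse s e))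
  where
  lem : ∀ x X y Y → x ⊗ X ⊗ (y ⊗ Y) ≡ x ⊗ y ⊗ (X ⊗ Y)
  lem = solve-∀ ℚ-ring

invPow-power : ∀ n s → invPow n s ≡ inv (ν (suc n)) ^ℚ s
invPow-power n s = ⊗-cancelˡ (λ e → ν≢0 (ℕ.>-nonZero⁻¹ (suc n ^ s) {{ℕP.m^n≢0 (suc n) s}}) e) (trans (invPow-spec n s)
  (sym (trans (cong (_⊗ inv (ν (suc n)) ^ℚ s) (ν-^ (suc n) s)) (^ℚ-inverse s (inv-r (ν≢0 (s≤s z≤n)))))))

atMost-yes : ∀ {q m} → q ≤ m → atMost q m ≡ 1
atMost-yes {q} {m} le with q ℕP.≤? m
... | yes _ = refl
... | no n = contradiction le n

atMost-no : ∀ {q m} → m < q → atMost q m ≡ 0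
atMost-no {q} {m} lt with q ℕP.≤? m
... | yes le = contradiction le (ℕP.<⇒≱ lt)
... | no n = refl

1<π^ : ∀ π i → 1 < π → 1 ≤ i → 1 < π ^ i
1<π^ π (suc i) 1<π _ = ℕP.<-≤-trans 1<π (subst (_≤ π ^ suc i) (ℕP.*-identityʳ π) (ℕP.*-monoʳ-≤ π (ℕ.>-nonZero⁻¹ (π ^ i) {{ℕP.m^n≢0 π i {{ℕ.>-nonZero (ℕP.<-trans (s≤s z≤n) 1<π)}}}})))

module AdicSizes (π : ℕ) (pr : Prime π) (K : ℕ) where
  open Adic π pr

  1<π : 1 < π
  1<π = ℕ.nonTrivial⇒n>1 π {{prime⇒nonTrivial pr}}

  infixl 7 _÷_
  _÷_ : ℕ → ℕ → ℕ
  N ÷ i = _/_ N (π ^ i) {{π^≢0 i}}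

  -- Valuation exactly `w`; a lower bound alone would not allow passing to the inverse, as the
  -- factorials in denominators require.
  Exact : ℚ → ℕ → Set
  Exact x w = Σ ℕ λ u → (¬ π ∣ u) × (x ≡ P ^ℚ w ⊗ ν u)

  exact-* : ∀ {x y v w} → Exact x v → Exact y w → Exact (x ⊗ y) (v + w)
  exact-* {x} {y} {v} {w} (u , nu , e) (u′ , nu′ , e′) = u * u′ , π∤* nu nu′ , (begin
    x ⊗ y                                  ≡⟨ cong₂ _⊗_ e e′ ⟩
    P ^ℚ v ⊗ ν u ⊗ (P ^ℚ w ⊗ ν u′)         ≡⟨ lem (P ^ℚ v) (ν u) (P ^ℚ w) (ν u′) ⟩
    P ^ℚ v ⊗ P ^ℚ w ⊗ (ν u ⊗ ν u′)         ≡⟨ cong₂ _⊗_ (^ℚ-+ P v w) (ν-* u u′) ⟨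
    P ^ℚ (v + w) ⊗ ν (u * u′)              ∎)
    where
    open ≡-Reasoning
    lem : ∀ a b c d → a ⊗ b ⊗ (c ⊗ d) ≡ a ⊗ c ⊗ (b ⊗ d)
    lem = solve-∀ ℚ-ring

  exact-1 : Exact (ν 1) 0
  exact-1 = 1 , π∤1 , sym (ℚP.*-identityˡ (ν 1))

  exact-val : ∀ {x w} → Exact x w → Val w 0 x
  exact-val {x} (u , _ , e) = ν u , integral-ι (+ u) , trans (ℚP.*-identityˡ x) e

  exact-inv : ∀ {x w} → Exact x w → Val 0 w (inv x)
  exact-inv {x} {w} (u , nu , e) = inv (ν u) , integral-inv (+ u) nu , ⊗-cancelˡ u≢0 (begin
    ν u ⊗ (P ^ℚ w ⊗ inv x)     ≡⟨ lem (ν u) (P ^ℚ w) (inv x) ⟩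
    P ^ℚ w ⊗ ν u ⊗ inv x       ≡⟨ cong (_⊗ inv x) e ⟨
    x ⊗ inv x                  ≡⟨ inv-r x≢0 ⟩
    1ℚ                         ≡⟨ inv-r u≢0 ⟨
    ν u ⊗ inv (ν u)            ≡⟨ cong (ν u ⊗_) (ℚP.*-identityˡ (inv (ν u))) ⟨
    ν u ⊗ (1ℚ ⊗ inv (ν u))     ∎)
    where
    open ≡-Reasoning
    u≢0 : ν u ≢ 0ℚ
    u≢0 = ι≢0 λ { refl → nu (Div._∣0 π) }
    x≢0 : x ≢ 0ℚ
    x≢0 = subst (_≢ 0ℚ) (sym e) (⊗≢0 (P^≢0 w) u≢0)
    lem : ∀ u p x → u ⊗ (p ⊗ x) ≡ p ⊗ u ⊗ x
    lem = solve-∀ ℚ-ring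

  val-weaken : ∀ a b a′ b′ x → a′ + b ≤ a + b′ → Val a b x → Val a′ b′ x
  val-weaken a b a′ b′ x le h = val-mono {a} {b} {a′} {b′} {x} le h

  val-prod : ∀ a b c d x y → Val a b x → Val c d y → Val (a + c) (b + d) (x ⊗ y)
  val-prod a b c d x y h h′ = val-* {a} {b} {c} {d} {x} {y} h h′

  val-pow : ∀ n {a b x} → Val a b x → Val (n * a) (n * b) (x ^ℚ n)
  val-pow zero h = val-integral integral-1
  val-pow (suc n) {a} {b} {x} h = val-prod a b (n * a) (n * b) x (x ^ℚ n) h (val-pow n {a} {b} {x} h)

  exact-number : ∀ n → 0 < n → n < π ^ suc K → Exact (ν n) (weight K n)
  exact-number n 0<n lt = ∣ u ∣ℤ , proj₂ uf , trans (cong ν abs-eq) (trans (ν-* (π ^ w) ∣ u ∣ℤ) (cong (_⊗ ν ∣ u ∣ℤ) (ν-^ π w)))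
    where
    w = weight K n
    uf = unit-factor K (+ n) (λ e → ℕP.<-irrefl (sym (ℤP.+-injective e)) 0<n) lt
    u = Factor.cofactor (proj₁ uf)
    abs-eq : n ≡ π ^ w * ∣ u ∣ℤ
    abs-eq = trans (cong ∣_∣ℤ (ι-injective (trans (Factor.factored (proj₁ uf)) (trans (cong (_⊗ ι u) (sym (ν-^ π w))) (sym (ι-* (+ (π ^ w)) u)))))) (ℤP.∣i*j∣≡∣i∣*∣j∣ (+ (π ^ w)) u)

  legendre : ℕ → ℕ
  legendre N = sumTo K (λ i → N ÷ i)

  -- Legendre's formula; the levels beyond `K` contribute nothing to `N!`.
  exact-fact : ∀ N → N < π ^ suc K → Exact (ν (N !)) (legendre N)
  exact-fact zero lt = subst (Exact (ν 1)) (sym (trans (sumTo-cong K _ (λ _ → 0) (λ i _ _ → DM.m<n⇒m/n≡0 {{π^≢0 i}} (ℕ.>-nonZero⁻¹ (π ^ i) {{π^≢0 i}}))) (trans (sumTo-const K 0) (ℕP.*-zeroʳ K)))) exact-1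
  exact-fact (suc N) lt = subst₂ Exact (sym (ν-* (suc N) (N !))) eq (exact-* {v = weight K (suc N)} {w = legendre N} (exact-number (suc N) (s≤s z≤n) lt) (exact-fact N (ℕP.<-trans (ℕP.n<1+n N) lt)))
    where
    eq : weight K (suc N) + legendre N ≡ legendre (suc N)
    eq = trans (sym (sumTo-+ K (λ i → ind (π ^ i) (suc N)) (λ i → N ÷ i))) (sumTo-cong K _ _ (λ i _ _ → trans (ℕP.+-comm (ind (π ^ i) (suc N)) (N ÷ i)) (sym (floor-suc (π ^ i) N {{π^≢0 i}}))))

  legendreList : ℕ → List ℕ → ℕ
  legendreList m L = sumTo K (λ i → sumℕ (λ j → (j * m) ÷ i) L)

  exact-factProd : ∀ m L → All (λ j → j * m < π ^ suc K) L → Exact (ν (factProd m L)) (legendreList m L)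
  exact-factProd m [] [] = subst (Exact (ν 1)) (sym (trans (sumTo-const K 0) (ℕP.*-zeroʳ K))) exact-1
  exact-factProd m (j ∷ L) (lt ∷ lts) = subst₂ Exact (sym (ν-* ((j * m) !) (factProd m L))) (sym (sumTo-+ K (λ i → (j * m) ÷ i) (λ i → sumℕ (λ j → (j * m) ÷ i) L))) (exact-* {v = legendre (j * m)} {w = legendreList m L} (exact-fact (j * m) lt) (exact-factProd m L lts))

  val-number : ∀ n → Val (weight K n) 0 (ν n)
  val-number n with ∣∣-factor (weight K n) (+ n) (proj₁ (proj₂ (weight-spec K n)))
  ... | factor u e = ι u , integral-ι u , trans (ℚP.*-identityˡ (ν n)) e

  val-tieProd : ∀ z s → Val (sumTo K (λ i → ties (π ^ i) z s)) 0 (ν (tieProd z s))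
  val-tieProd z zero = val-number z
  val-tieProd z (suc s) = subst₂ (λ a x → Val a 0 x) (sym (sumTo-+ K (λ i → ind (π ^ i) (z + suc s)) (λ i → ties (π ^ i) z s))) (sym (ν-* (z + suc s) (tieProd z s))) (val-prod (weight K (z + suc s)) 0 _ 0 (ν (z + suc s)) (ν (tieProd z s)) (val-number (z + suc s)) (val-tieProd z s))

  val-tieAll : ∀ m J → Val (sumTo K (λ i → sumTo J (λ j → ties (π ^ i) (j * m) 24))) 0 (ν (tieAll m J))
  val-tieAll m zero = val-weaken 0 0 (sumTo K (λ _ → 0)) 0 (ν 1) (ℕP.≤-reflexive (trans (ℕP.+-identityʳ (sumTo K (λ _ → 0))) (trans (sumTo-const K 0) (ℕP.*-zeroʳ K)))) (val-integral (integral-ι (+ 1)))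
  val-tieAll m (suc J) = subst₂ (λ a x → Val a 0 x) (sym (sumTo-+ K (λ i → ties (π ^ i) (suc J * m) 24) (λ i → sumTo J (λ j → ties (π ^ i) (j * m) 24)))) (sym (ν-* (tieProd (suc J * m) 24) (tieAll m J))) (val-prod (sumTo K (λ i → ties (π ^ i) (suc J * m) 24)) 0 (sumTo K (λ i → sumTo J (λ j → ties (π ^ i) (j * m) 24))) 0 (ν (tieProd (suc J * m) 24)) (ν (tieAll m J)) (val-tieProd (suc J * m) 24) (val-tieAll m J))

  floor-double : ∀ q k .{{_ : NonZero q}} → k / q + k / q ≤ (2 * k) / q
  floor-double q k = subst (_≤ (2 * k) / q) (DM.m*n/n≡m (k / q + k / q) q) (DM./-monoˡ-≤ q (begin
    (k / q + k / q) * q         ≡⟨ lem (k / q) q ⟩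
    2 * (k / q * q)             ≤⟨ ℕP.*-monoʳ-≤ 2 (DM.m/n*n≤m k q) ⟩
    2 * k                       ∎))
    where
    open ℕP.≤-Reasoning
    lem : ∀ a q → (a + a) * q ≡ 2 * (a * q)
    lem = ℕSolver.solve-∀

  ≤-double-half : ∀ s → s ≤ 2 * ℕ.⌈ s /2⌉
  ≤-double-half s = subst₂ _≤_ (ℕP.⌊n/2⌋+⌈n/2⌉≡n s) (cong (λ z → ℕ.⌈ s /2⌉ + z) (sym (ℕP.+-identityʳ ℕ.⌈ s /2⌉))) (ℕP.+-monoˡ-≤ ℕ.⌈ s /2⌉ (ℕP.⌊n/2⌋≤⌈n/2⌉ s))

  -- The essential case is `k < q ≤ s ≤ 2 k`, where `⌊2 k / q⌋ ≥ 1` while `⌊k / q⌋ = 0`: such prime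
  -- powers divide the central binomial coefficient.
  half-step : ∀ q s k .{{_ : NonZero q}} → k ≤ s → s ≤ 2 * k → atMost q s + (k / q + k / q) ≤ (2 * k) / q + atMost q k
  half-step q s k k≤s s≤2k = go (q ℕP.≤? k) (q ℕP.≤? s)
    where
    go : Dec (q ≤ k) → Dec (q ≤ s) → atMost q s + (k / q + k / q) ≤ (2 * k) / q + atMost q k
    go (yes q≤k) _ = subst₂ (λ u v → u + (k / q + k / q) ≤ (2 * k) / q + v) (sym (atMost-yes (ℕP.≤-trans q≤k k≤s))) (sym (atMost-yes q≤k))
      (subst (1 + (k / q + k / q) ≤_) (ℕP.+-comm 1 ((2 * k) / q)) (s≤s (floor-double q k)))
    go (no q≰k) (no q≰s) = subst (λ u → u + (k / q + k / q) ≤ (2 * k) / q + atMost q k) (sym (atMost-no (ℕP.≰⇒> q≰s))) (ℕP.≤-trans (floor-double q k) (ℕP.m≤m+n ((2 * k) / q) (atMost q k)))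
    go (no q≰k) (yes q≤s) = subst₂ (λ u v → u + (v + v) ≤ (2 * k) / q + atMost q k) (sym (atMost-yes q≤s)) (sym (DM.m<n⇒m/n≡0 (ℕP.≰⇒> q≰k))) (ℕP.≤-trans (DM.m≥n⇒m/n>0 (ℕP.≤-trans q≤s s≤2k)) (ℕP.m≤m+n ((2 * k) / q) (atMost q k)))

  val-central : ∀ k → 2 * k < π ^ suc K → Val (legendre (2 * k)) (legendre k + legendre k) (central k)
  val-central k lt = subst (λ a → Val a (legendre k + legendre k) (central k)) (ℕP.+-identityʳ (legendre (2 * k)))
    (val-prod (legendre (2 * k)) 0 0 (legendre k + legendre k) (ν ((2 * k) !)) (inv (ν (k !)) ⊗ inv (ν (k !))) (exact-val {w = legendre (2 * k)} (exact-fact (2 * k) lt)) (val-prod 0 (legendre k) 0 (legendre k) (inv (ν (k !))) (inv (ν (k !))) (exact-inv {w = legendre k} ek) (exact-inv {w = legendre k} ek)))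
    where ek = exact-fact k (ℕP.≤-<-trans (ℕP.m≤n*m k 2) lt)

  atMosts : ℕ → ℕ
  atMosts s = sumTo K (λ i → atMost (π ^ i) s)

  atMosts-small : ∀ s → s ≤ 1 → atMosts s ≡ 0
  atMosts-small s s≤1 = trans (sumTo-cong K _ (λ _ → 0) (λ i 1≤i _ → atMost-no (ℕP.≤-<-trans s≤1 (1<π^ π i 1<π 1≤i)))) (trans (sumTo-const K 0) (ℕP.*-zeroʳ K))

  val-lcmBound : ∀ n s → s ≤ n → suc s < π ^ suc K → Val (atMosts s) 0 (lcmBound n s)
  val-lcmBound zero zero le lt = subst (λ a → Val a 0 1ℚ) (sym (atMosts-small 0 z≤n)) (val-integral integral-1)
  val-lcmBound (suc n) zero le lt = subst (λ a → Val a 0 1ℚ) (sym (atMosts-small 0 z≤n)) (val-integral integral-1)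
  val-lcmBound (suc n) (suc zero) le lt = subst (λ a → Val a 0 1ℚ) (sym (atMosts-small 1 ℕP.≤-refl)) (val-integral integral-1)
  val-lcmBound (suc n) s@(suc (suc s′)) (s≤s le) lt = val-weaken _ _ (atMosts s) 0 (lcmBound (suc n) s) cond (val-prod (legendre (2 * k)) (legendre k + legendre k) (atMosts k) 0 (central k) (lcmBound n k) (val-central k (ℕP.≤-<-trans 2k≤ lt)) (val-lcmBound n k k≤n (ℕP.≤-<-trans k<s (ℕP.<-trans (ℕP.n<1+n s) lt))))
    where
    k = ℕ.⌈ s /2⌉
    k<s : suc k ≤ s
    k<s = ℕP.⌈n/2⌉<n s′
    k≤n : k ≤ n
    k≤n = ℕP.≤-trans (ℕP.≤-pred k<s) le
    2k≤ : 2 * k ≤ suc s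
    2k≤ = subst₂ _≤_ (cong (λ z → k + z) (sym (ℕP.+-identityʳ k))) (trans (cong suc (ℕP.+-comm ℕ.⌈ s /2⌉ ℕ.⌊ s /2⌋)) (cong suc (ℕP.⌊n/2⌋+⌈n/2⌉≡n s))) (subst (k + k ≤_) (ℕP.+-suc k ℕ.⌊ s /2⌋) (ℕP.+-monoʳ-≤ k (ceil≤ s)))
      where
      ceil≤ : ∀ s → ℕ.⌈ s /2⌉ ≤ suc ℕ.⌊ s /2⌋
      ceil≤ zero = z≤n
      ceil≤ (suc zero) = s≤s z≤n
      ceil≤ (suc (suc s)) = s≤s (ceil≤ s)
    cond : atMosts s + (legendre k + legendre k + 0) ≤ legendre (2 * k) + atMosts k + 0
    cond = subst₂ _≤_ (trans (sumTo-+ K _ _) (cong (λ z → atMosts s + z) (trans (sumTo-+ K _ _) (sym (ℕP.+-identityʳ (legendre k + legendre k)))))) (trans (sumTo-+ K _ _) (sym (ℕP.+-identityʳ (legendre (2 * k) + atMosts k))))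
      (sumTo-mono K (λ i → atMost (π ^ i) s + (k ÷ i + k ÷ i)) (λ i → (2 * k) ÷ i + atMost (π ^ i) k) (λ i _ _ → half-step (π ^ i) s k {{π^≢0 i}} (ℕP.⌈n/2⌉≤n s) (≤-double-half s)))

  tieSum : ℕ → ℕ
  tieSum m = sumTo K (λ i → sumTo 72 (λ j → ties (π ^ i) (j * m) 24))

  gain : ℕ → ℕ
  gain m = legendreList m plus + (8 * atMosts m + 26 * tieSum m)

  val-baseMultiplier : ∀ m → 0 < m → 24 * m < π ^ suc K → Val (gain m) (legendreList m minus) (baseMultiplier m)
  val-baseMultiplier m 0<m lt = val-weaken _ _ (gain m) (legendreList m minus) (baseMultiplier m) cond
    (val-prod (legendreList m plus + 0) (0 + legendreList m minus) (8 * atMosts m + 26 * tieSum m) 0 (ν (factProd m plus) ⊗ inv (ν (factProd m minus))) (lcmBound m m ^ℚ 8 ⊗ ν (tieAll m 72) ^ℚ 26)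
      (val-prod (legendreList m plus) 0 0 (legendreList m minus) (ν (factProd m plus)) (inv (ν (factProd m minus)))
        (exact-val {w = legendreList m plus} (exact-factProd m plus (All.map below (all≤ 24 plus)))) (exact-inv {w = legendreList m minus} (exact-factProd m minus (All.map below (all≤ 24 minus)))))
      (val-prod (8 * atMosts m) (8 * 0) (26 * tieSum m) (26 * 0) (lcmBound m m ^ℚ 8) (ν (tieAll m 72) ^ℚ 26)
        (val-pow 8 {atMosts m} {0} {lcmBound m m} (val-lcmBound m m ℕP.≤-refl (ℕP.≤-<-trans suc-m≤ lt))) (val-pow 26 {tieSum m} {0} {ν (tieAll m 72)} (val-tieAll m 72))))
    where
    below : ∀ {j} → j ≤ 24 → j * m < π ^ suc K
    below le = ℕP.≤-<-trans (ℕP.*-monoˡ-≤ m le) lt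
    suc-m≤ : suc m ≤ 24 * m
    suc-m≤ = subst (_≤ 24 * m) (ℕP.+-comm m 1) (ℕP.+-monoʳ-≤ m (ℕP.≤-trans 0<m (ℕP.m≤n*m m 23)))
    cond : gain m + (0 + legendreList m minus + 0) ≤ legendreList m plus + 0 + (8 * atMosts m + 26 * tieSum m) + legendreList m minus
    cond = ℕP.≤-reflexive (lem₂ (legendreList m plus) (8 * atMosts m + 26 * tieSum m) (legendreList m minus))
      where
      lem₂ : ∀ a b l → a + b + (0 + l + 0) ≡ a + 0 + b + l
      lem₂ = ℕSolver.solve-∀

  val-multiplier : ∀ b m → 0 < m → 24 * m < π ^ suc K → Val (b * gain m) (b * legendreList m minus) (multiplier b m)
  val-multiplier b m 0<m lt = val-pow b {gain m} {legendreList m minus} {baseMultiplier m} (val-baseMultiplier m 0<m lt)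

  val-invPow : ∀ n s → suc n < π ^ suc K → Val 0 (K * s) (invPow n s)
  val-invPow n s lt = subst (Val 0 (K * s)) (sym (invPow-power n s)) (val-weaken (s * 0) (s * K) 0 (K * s) (e ^ℚ s) (ℕP.≤-reflexive (trans (ℕP.*-comm s K) (cong (_+ K * s) (sym (ℕP.*-zeroʳ s)))))
      (val-pow s {0} {K} {e} (val-weaken 0 (weight K (suc n)) 0 K e (proj₁ (weight-spec K (suc n))) (exact-inv {w = weight K (suc n)} (exact-number (suc n) (s≤s z≤n) lt)))))
    where e = inv (ν (suc n))

  val-zetaPartial : ∀ s n → n < π ^ suc K → Val 0 (K * s) (zetaPartial s n)
  val-zetaPartial s zero lt = val-0 0 (K * s)
  val-zetaPartial s (suc n) lt = val-+ {0} {K * s} {zetaPartial s n} {invPow n s} (val-zetaPartial s n (ℕP.<-trans (ℕP.n<1+n n) lt)) (val-invPow n s lt)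

-- The linear form and its integrality.

log-exists : ∀ π → 1 < π → ∀ n → Σ ℕ λ K → π ^ K ≤ suc n × suc n < π ^ suc K
log-exists π 1<π zero = 0 , s≤s z≤n , subst (1 <_) (sym (ℕP.*-identityʳ π)) 1<π
log-exists π 1<π (suc n) with log-exists π 1<π n
... | K , lo , hi with suc (suc n) ℕP.<? π ^ suc K
...   | yes lt = K , ℕP.m≤n⇒m≤1+n lo , lt
...   | no nlt = suc K , ℕP.≮⇒≥ nlt , ℕP.≤-<-trans hi grow
  where
  grow : π ^ suc K < π ^ suc (suc K)
  grow = ℕP.^-monoʳ-< π 1<π (ℕP.n<1+n (suc K))

cntℤ-++ : ∀ k xs ys → cntℤ k (xs ++ ys) ≡ cntℤ k xs + cntℤ k ys
cntℤ-++ k [] ys = refl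
cntℤ-++ k (x ∷ xs) ys with k ≟ℤ x
... | yes _ = cong suc (cntℤ-++ k xs ys)
... | no _ = cntℤ-++ k xs ys

cntℤ-rep : ∀ k n xs → cntℤ k (rep n xs) ≡ n * cntℤ k xs
cntℤ-rep k zero xs = refl
cntℤ-rep k (suc n) xs = trans (cntℤ-++ k xs (rep n xs)) (cong (λ z → cntℤ k xs + z) (cntℤ-rep k n xs))

cntℤ-below : ∀ k A L → k <ℤ A → cntℤ k (range A L) ≡ 0
cntℤ-below k A zero lt = refl
cntℤ-below k A (suc L) lt = trans (cntℤ-there k A _ (λ e → ℤP.<-irrefl e lt)) (cntℤ-below k (A +ℤ 1ℤ) L (ℤP.<-trans lt (next A)))
  where
  next : ∀ A → A <ℤ A +ℤ 1ℤ
  next A = subst (_<ℤ A +ℤ 1ℤ) (ℤP.+-identityʳ A) (ℤP.+-monoʳ-< A (ℤ.+<+ (s≤s z≤n)))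

cntℤ-range : ∀ k A L → cntℤ k (range A L) ≤ 1
cntℤ-range k A zero = z≤n
cntℤ-range k A (suc L) with k ≟ℤ A
... | no _ = cntℤ-range k (A +ℤ 1ℤ) L
... | yes refl = s≤s (ℕP.≤-reflexive (cntℤ-below k (k +ℤ 1ℤ) L (subst (_<ℤ k +ℤ 1ℤ) (ℤP.+-identityʳ k) (ℤP.+-monoʳ-< k (ℤ.+<+ (s≤s z≤n))))))

Below : ℕ → ℤ → Set
Below p u = Σ ℕ λ n → u ≡ + n × n < p

range-below : ∀ p a L → a + L ≤ p → All (Below p) (range (+ a) L)
range-below p a zero le = []
range-below p a (suc L) le = (a , refl , ℕP.≤-trans (s≤s (ℕP.m≤m+n a L)) le′) ∷ subst (λ z → All (Below p) (range z L)) (trans (cong +_ (ℕP.+-comm 1 a)) (ℤP.pos-+ a 1)) (range-below p (suc a) L le′)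
  where
  le′ : suc (a + L) ≤ p
  le′ = subst (_≤ p) (ℕP.+-suc a L) le

rep-All : ∀ {P : ℤ → Set} n xs → All P xs → All P (rep n xs)
rep-All zero xs h = []
rep-All (suc n) xs h = AllP.++⁺ h (rep-All n xs h)

cntℤ-member : ∀ {P : ℤ → Set} k us → All P us → 1 ≤ cntℤ k us → P k
cntℤ-member k (u ∷ us) (h ∷ hs) le with k ≟ℤ u
... | yes refl = h
... | no _ = cntℤ-member k us hs le

module Form (b₀ m r : ℕ) (0<m : 0 < m) (r≤23 : r ≤ 23) where
  b : ℕ
  b = suc b₀

  open Blocks b m r public

  F : PF
  F = muls vs (divs dens)

  N : ℕ
  N = length dens

  block-end : ∀ e c → 24 ∸ 2 * e ≡ c → e + c ≤ 23 → e * m + width e ≤ p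
  block-end e c refl le = begin
    e * m + ((24 ∸ 2 * e) * m + r + 1)   ≡⟨ lem e (24 ∸ 2 * e) m r ⟩
    (e + (24 ∸ 2 * e)) * m + r + 1       ≤⟨ ℕP.+-monoʳ-≤ ((e + (24 ∸ 2 * e)) * m + r) 0<m ⟩
    (e + (24 ∸ 2 * e)) * m + r + m       ≤⟨ ℕP.+-monoˡ-≤ m (ℕP.+-monoˡ-≤ r (ℕP.*-monoˡ-≤ m le)) ⟩
    23 * m + r + m                       ≡⟨ lem₂ m r ⟩
    p                                    ∎
    where
    open ℕP.≤-Reasoning
    lem : ∀ e c m r → e * m + (c * m + r + 1) ≡ (e + c) * m + r + 1
    lem = ℕSolver.solve-∀
    lem₂ : ∀ m r → 23 * m + r + m ≡ 24 * m + r
    lem₂ = ℕSolver.solve-∀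

  0<p : 0 < p
  0<p = ℕP.≤-trans 0<m (ℕP.≤-trans (ℕP.m≤n*m m 24) (ℕP.m≤m+n (24 * m) r))

  dens-below : All (Below p) dens
  dens-below = (0 , refl , 0<p) ∷ AllP.++⁺ (rep-All (2 * b) inner (range-below p 1 (p ∸ 1) (ℕP.≤-reflexive (ℕP.m+[n∸m]≡n 0<p))))
    (rep-All b blocks (AllP.++⁺ (blk 1 22 refl (ℕP.≤ᵇ⇒≤ 23 23 tt)) (AllP.++⁺ (blk 2 20 refl (ℕP.≤ᵇ⇒≤ 22 23 tt)) (AllP.++⁺ (blk 3 18 refl (ℕP.≤ᵇ⇒≤ 21 23 tt)) (AllP.++⁺ (blk 4 16 refl (ℕP.≤ᵇ⇒≤ 20 23 tt)) (blk 5 14 refl (ℕP.≤ᵇ⇒≤ 19 23 tt)))))))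
    where
    blk : ∀ e c → 24 ∸ 2 * e ≡ c → e + c ≤ 23 → All (Below p) (block e)
    blk e c eq le = range-below p (e * m) (width e) (block-end e c eq le)

  rest : ℕ
  rest = width 1 + (width 2 + (width 3 + (width 4 + width 5)))

  len-vs : length vs ≡ b * (24 * m + 24 * m)
  len-vs = trans (length-rep b (leftZeros ++ rightZeros)) (cong (b *_) (trans (ListP.length-++ leftZeros) (cong₂ _+_ (length-range _ (24 * m)) (length-range _ (24 * m)))))

  len-blocks : length blocks ≡ rest
  len-blocks = trans (ListP.length-++ (block 1)) (cong₂ _+_ (length-range _ (width 1)) (trans (ListP.length-++ (block 2)) (cong₂ _+_ (length-range _ (width 2)) (trans (ListP.length-++ (block 3)) (cong₂ _+_ (length-range _ (width 3)) (trans (ListP.length-++ (block 4)) (cong₂ _+_ (length-range _ (width 4)) (length-range _ (width 5)))))))))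

  len-us : length us ≡ 2 * b * (p ∸ 1) + b * rest
  len-us = trans (ListP.length-++ (rep (2 * b) inner)) (cong₂ _+_ (trans (length-rep (2 * b) inner) (cong (2 * b *_) (length-range 1ℤ (p ∸ 1)))) (trans (length-rep b blocks) (cong (b *_) len-blocks)))

  -- Order at least two at infinity makes the residues sum to zero, which removes `ζ(b)` later.
  degree : length vs + 2 ≤ length dens
  degree = begin
    length vs + 2                                           ≡⟨ cong (_+ 2) len-vs ⟩
    b * (24 * m + 24 * m) + 2                               ≤⟨ ℕP.m≤m+n (b * (24 * m + 24 * m) + 2) slack ⟩
    b * (24 * m + 24 * m) + 2 + slack                       ≡⟨ lem b₀ m r ⟩
    suc (2 * b * (24 * m + r) + b * rest) ∸ 2 * b           ≡⟨ cong (_∸ 2 * b) (cong (λ z → suc (2 * b * z + b * rest)) (sym (ℕP.m∸n+n≡m 0<p))) ⟩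
    suc (2 * b * (p ∸ 1 + 1) + b * rest) ∸ 2 * b            ≡⟨ cong (_∸ 2 * b) (lem₂ b (p ∸ 1) rest) ⟩
    suc (2 * b * (p ∸ 1) + b * rest) + 2 * b ∸ 2 * b        ≡⟨ ℕP.m+n∸n≡m (suc (2 * b * (p ∸ 1) + b * rest)) (2 * b) ⟩
    suc (2 * b * (p ∸ 1) + b * rest)                        ≡⟨ cong suc len-us ⟨
    length dens                                             ∎
    where
    open ℕP.≤-Reasoning
    slack = 2 + 3 * b₀ + b * (90 * m + 7 * r)
    lem : ∀ b₀ m r → suc b₀ * (24 * m + 24 * m) + 2 + (2 + 3 * b₀ + suc b₀ * (90 * m + 7 * r))
      ≡ suc (2 * suc b₀ * (24 * m + r) + suc b₀ * ((22 * m + r + 1) + ((20 * m + r + 1) + ((18 * m + r + 1) + ((16 * m + r + 1) + (14 * m + r + 1)))))) ∸ 2 * suc b₀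
    lem b₀ m r = sym (trans (cong (_∸ 2 * suc b₀) (l b₀ m r)) (ℕP.m+n∸n≡m (suc b₀ * (24 * m + 24 * m) + 2 + (2 + 3 * b₀ + suc b₀ * (90 * m + 7 * r))) (2 * suc b₀)))
      where
      l : ∀ b₀ m r → suc (2 * suc b₀ * (24 * m + r) + suc b₀ * ((22 * m + r + 1) + ((20 * m + r + 1) + ((18 * m + r + 1) + ((16 * m + r + 1) + (14 * m + r + 1))))))
        ≡ suc b₀ * (24 * m + 24 * m) + 2 + (2 + 3 * b₀ + suc b₀ * (90 * m + 7 * r)) + 2 * suc b₀
      l = ℕSolver.solve-∀
    lem₂ : ∀ b x y → suc (2 * b * (x + 1) + b * y) ≡ suc (2 * b * x + b * y) + 2 * b
    lem₂ = ℕSolver.solve-∀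

  F-bounded : All (Bounded dens) F
  F-bounded = muls-bounded dens vs (divs dens) (divs-bounded dens)

  F-proper : All Proper F
  F-proper = muls-proper vs (divs dens) (divPF-proper 0ℤ (divs us))

  F-poles : All (λ (c , k , j) → Below p k) F
  F-poles = All.map (λ {(c , k , j)} (bd , pr) → cntℤ-member k dens dens-below (ℕP.≤-trans pr bd)) (All.zip (F-bounded , F-proper))

  -- A point lies in `inner` and in each of the five blocks at most once, and these are repeated
  -- `2 b` and `b` times.
  order-bound : ∀ k → cntℤ k dens ≤ 7 * b
  order-bound k = go (k ≟ℤ 0ℤ)
    where
    open ℕP.≤-Reasoning
    blocks≤5 : cntℤ k blocks ≤ 5
    blocks≤5 = subst (_≤ 5) (sym (trans (cntℤ-++ k (block 1) _) (cong (λ z → cntℤ k (block 1) + z) (trans (cntℤ-++ k (block 2) _) (cong (λ z → cntℤ k (block 2) + z) (trans (cntℤ-++ k (block 3) _) (cong (λ z → cntℤ k (block 3) + z) (cntℤ-++ k (block 4) (block 5)))))))))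
      (ℕP.+-mono-≤ (cntℤ-range k _ (width 1)) (ℕP.+-mono-≤ (cntℤ-range k _ (width 2)) (ℕP.+-mono-≤ (cntℤ-range k _ (width 3)) (ℕP.+-mono-≤ (cntℤ-range k _ (width 4)) (cntℤ-range k _ (width 5))))))
    us-eq : cntℤ k us ≡ 2 * b * cntℤ k inner + b * cntℤ k blocks
    us-eq = trans (cntℤ-++ k (rep (2 * b) inner) (rep b blocks)) (cong₂ _+_ (cntℤ-rep k (2 * b) inner) (cntℤ-rep k b blocks))
    lem : ∀ b → 2 * b * 1 + b * 5 ≡ 7 * b
    lem = ℕSolver.solve-∀
    lem₀ : ∀ b₀ → 1 + (2 * suc b₀ * 0 + suc b₀ * 5) + (2 * b₀ + 1) ≡ 7 * suc b₀
    lem₀ = ℕSolver.solve-∀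
    go : Dec (k ≡ 0ℤ) → cntℤ k dens ≤ 7 * b
    go (no ne) = begin
      cntℤ k dens                                  ≡⟨ cntℤ-there k 0ℤ us ne ⟩
      cntℤ k us                                    ≡⟨ us-eq ⟩
      2 * b * cntℤ k inner + b * cntℤ k blocks     ≤⟨ ℕP.+-mono-≤ (ℕP.*-monoʳ-≤ (2 * b) (cntℤ-range k 1ℤ (p ∸ 1))) (ℕP.*-monoʳ-≤ b blocks≤5) ⟩
      2 * b * 1 + b * 5                            ≡⟨ lem b ⟩
      7 * b                                        ∎
    go (yes refl) = begin
      cntℤ 0ℤ dens                                 ≡⟨ cntℤ-here 0ℤ us ⟩
      suc (cntℤ 0ℤ us)                             ≡⟨ cong suc us-eq ⟩
      suc (2 * b * cntℤ 0ℤ inner + b * cntℤ 0ℤ blocks) ≤⟨ s≤s (ℕP.+-mono-≤ (ℕP.≤-reflexive (cong (2 * b *_) (cntℤ-below 0ℤ 1ℤ (p ∸ 1) (ℤ.+<+ (s≤s z≤n))))) (ℕP.*-monoʳ-≤ b blocks≤5)) ⟩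
      1 + (2 * b * 0 + b * 5)                      ≤⟨ ℕP.m≤m+n (1 + (2 * b * 0 + b * 5)) (2 * b₀ + 1) ⟩
      1 + (2 * b * 0 + b * 5) + (2 * b₀ + 1)       ≡⟨ lem₀ b₀ ⟩
      7 * b                                        ∎

  module AtPrime (π : ℕ) (pr : Prime π) where
    open Adic π pr

    private
      -- `K` is the largest exponent with `π^K ≤ p`: the floor inequality applies at all levels up
      -- to `K`, and no nonzero difference of two poles reaches level `K + 1`.
      lg = log-exists π (ℕ.nonTrivial⇒n>1 π {{prime⇒nonTrivial pr}}) (p ∸ 1)
      K : ℕ
      K = proj₁ lg
      suc-p : suc (p ∸ 1) ≡ p
      suc-p = ℕP.m+[n∸m]≡n 0<p
      π^K≤p : π ^ K ≤ p
      π^K≤p = subst (π ^ K ≤_) suc-p (proj₁ (proj₂ lg))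
      p<π^K : p < π ^ suc K
      p<π^K = subst (_< π ^ suc K) suc-p (proj₂ (proj₂ lg))

    open AdicSizes π pr K

    -- The sum of `cnt-level` over the prime powers `π, ..., π^K`.
    balance : ∀ k → total K (-ℤ + k) dens + b * legendreList m minus + b * K ≤ total K (-ℤ + k) vs + b * gain m
    balance k = subst₂ _≤_ lhs rhs (sumTo-mono K (λ i → cntDiv (π ^ i) (-ℤ + k) dens + b * sumℕ (λ j → (j * m) ÷ i) minus + b)
        (λ i → cntDiv (π ^ i) (-ℤ + k) vs + b * (sumℕ (λ j → (j * m) ÷ i) plus + (8 * atMost (π ^ i) m + 26 * sumTo 72 (λ j → ties (π ^ i) (j * m) 24)))) at)
      where
      at : ∀ i → 1 ≤ i → i ≤ K → cntDiv (π ^ i) (-ℤ + k) dens + b * sumℕ (λ j → (j * m) ÷ i) minus + b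
        ≤ cntDiv (π ^ i) (-ℤ + k) vs + b * (sumℕ (λ j → (j * m) ÷ i) plus + (8 * atMost (π ^ i) m + 26 * sumTo 72 (λ j → ties (π ^ i) (j * m) 24)))
      at i _ i≤K = subst (λ t → cntDiv (π ^ i) (-ℤ + k) dens + b * sumℕ (λ j → (j * m) ÷ i) minus + b ≤ cntDiv (π ^ i) (-ℤ + k) vs + b * (sumℕ (λ j → (j * m) ÷ i) plus + (8 * atMost (π ^ i) m + 26 * t)))
          (LevelAt.τ-def m r (π ^ i) {{π^≢0 i}} 0<m r≤23 q≤p) (cnt-level 0<m r≤23 (π ^ i) {{π^≢0 i}} q≤p k (s≤s z≤n))
        where
        q≤p : π ^ i ≤ p
        q≤p = ℕP.≤-trans (ℕP.^-monoʳ-≤ π i≤K) π^K≤p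
      lhs : sumTo K (λ i → cntDiv (π ^ i) (-ℤ + k) dens + b * sumℕ (λ j → (j * m) ÷ i) minus + b) ≡ total K (-ℤ + k) dens + b * legendreList m minus + b * K
      lhs = trans (sumTo-+ K _ _) (cong₂ _+_ (trans (sumTo-+ K _ _) (cong (λ z → total K (-ℤ + k) dens + z) (sumTo-* K b _))) (trans (sumTo-const K b) (ℕP.*-comm K b)))
      rhs : sumTo K (λ i → cntDiv (π ^ i) (-ℤ + k) vs + b * (sumℕ (λ j → (j * m) ÷ i) plus + (8 * atMost (π ^ i) m + 26 * sumTo 72 (λ j → ties (π ^ i) (j * m) 24)))) ≡ total K (-ℤ + k) vs + b * gain m
      rhs = trans (sumTo-+ K _ _) (cong (λ z → total K (-ℤ + k) vs + z) (trans (sumTo-* K b _) (cong (b *_) (trans (sumTo-+ K _ _) (cong (λ z → legendreList m plus + z) (trans (sumTo-+ K _ _) (cong₂ _+_ (sumTo-* K 8 _) (sumTo-* K 26 _))))))))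

    close : ∀ k → k < p → All (λ u → ∣ -ℤ + k +ℤ u ∣ℤ < π ^ suc K) dens
    close k k<p = All.map (λ { {u} (n , refl , n<p) → ℕP.≤-<-trans (subst (_≤ p) (cong ∣_∣ℤ (trans (sym (ℤP.m-n≡m⊖n n k)) (ℤP.+-comm (+ n) (-ℤ + k)))) (ℕP.≤-trans (ℤP.∣m⊝n∣≤m⊔n n k) (ℕP.⊔-lub (ℕP.<⇒≤ n<p) (ℕP.<⇒≤ k<p)))) p<π^K }) dens-below

    24m<π^K : 24 * m < π ^ suc K
    24m<π^K = ℕP.≤-<-trans (ℕP.m≤m+n (24 * m) r) p<π^K

    -- The partial sum costs `K (j + b - 1)`. The part `K j` comes back from `val-coef`, and the
    -- rest is covered by the reserve `b K` in `balance`.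
    integral-term : ∀ k j n → k < p → 1 ≤ j → j ≤ N → n ≤ p → Integral (multiplier b m ⊗ (coef F (+ k) j ⊗ zetaPartial (j + b₀) n))
    integral-term k j n k<p 1≤j j≤N n≤p = integral-val cond
      (val-prod (b * gain m) (b * legendreList m minus) _ _ (multiplier b m) (coef F (+ k) j ⊗ zetaPartial (j + b₀) n) (val-multiplier b m 0<m 24m<π^K)
        (val-prod (total K (-ℤ + k) vs + K * j) (total K (-ℤ + k) dens) 0 (K * (j + b₀)) (coef F (+ k) j) (zetaPartial (j + b₀) n)
          (val-coef K 0ℤ us vs (+ k) j degree (close k k<p) 1≤j j≤N) (val-zetaPartial (j + b₀) n (ℕP.≤-<-trans n≤p p<π^K))))
      where
      open ℕP.≤-Reasoning
      td = total K (-ℤ + k) dens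
      tv = total K (-ℤ + k) vs
      l₁ : ∀ b₀ lm td K j → (suc b₀ * lm + (td + K * (j + b₀))) + K ≡ td + suc b₀ * lm + suc b₀ * K + K * j
      l₁ = ℕSolver.solve-∀
      l₂ : ∀ tv g K j → tv + g + K * j ≡ g + (tv + K * j + 0)
      l₂ = ℕSolver.solve-∀
      cond : b * legendreList m minus + (td + K * (j + b₀)) ≤ b * gain m + (tv + K * j + 0)
      cond = begin
        b * legendreList m minus + (td + K * (j + b₀))          ≤⟨ ℕP.m≤m+n _ K ⟩
        b * legendreList m minus + (td + K * (j + b₀)) + K      ≡⟨ l₁ b₀ (legendreList m minus) td K j ⟩
        td + b * legendreList m minus + b * K + K * j           ≤⟨ ℕP.+-monoˡ-≤ (K * j) (balance k) ⟩
        tv + b * gain m + K * j                                 ≡⟨ l₂ tv (b * gain m) K j ⟩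
        b * gain m + (tv + K * j + 0)                           ∎

    integral-coef : ∀ k j → k < p → 1 ≤ j → j ≤ N → Integral (multiplier b m ⊗ coef F (+ k) j)
    integral-coef k j k<p 1≤j j≤N = integral-val cond
      (val-prod (b * gain m) (b * legendreList m minus) (total K (-ℤ + k) vs + K * j) (total K (-ℤ + k) dens) (multiplier b m) (coef F (+ k) j) (val-multiplier b m 0<m 24m<π^K)
          (val-coef K 0ℤ us vs (+ k) j degree (close k k<p) 1≤j j≤N))
      where
      open ℕP.≤-Reasoning
      td = total K (-ℤ + k) dens
      tv = total K (-ℤ + k) vs
      l₂ : ∀ tv g x → tv + g + x ≡ g + (tv + x)
      l₂ = ℕSolver.solve-∀
      cond : b * legendreList m minus + td ≤ b * gain m + (tv + K * j)
      cond = begin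
        b * legendreList m minus + td                  ≡⟨ ℕP.+-comm (b * legendreList m minus) td ⟩
        td + b * legendreList m minus                  ≤⟨ ℕP.m≤m+n _ (b * K) ⟩
        td + b * legendreList m minus + b * K          ≤⟨ balance k ⟩
        tv + b * gain m                                ≤⟨ ℕP.m≤m+n _ (K * j) ⟩
        tv + b * gain m + K * j                        ≡⟨ l₂ tv (b * gain m) (K * j) ⟩
        b * gain m + (tv + K * j)                      ∎

-- Size estimates

-- The rising factorial `x (x + 1) ... (x + L - 1)`.
rise : ℕ → ℕ → ℕ
rise x zero = 1
rise x (suc L) = x * rise (suc x) L

rise-+ : ∀ x a b → rise x (a + b) ≡ rise x a * rise (x + a) b
rise-+ x zero b = trans (cong (λ z → rise z b) (sym (ℕP.+-identityʳ x))) (sym (ℕP.+-identityʳ _))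
rise-+ x (suc a) b = trans (cong (x *_) (rise-+ (suc x) a b)) (trans (sym (ℕP.*-assoc x (rise (suc x) a) _)) (cong (λ z → x * rise (suc x) a * rise z b) (sym (ℕP.+-suc x a))))

rise-last : ∀ x L → rise x (suc L) ≡ rise x L * (x + L)
rise-last x L = trans (cong (rise x) (ℕP.+-comm 1 L)) (trans (rise-+ x L 1) (cong (rise x L *_) (ℕP.*-identityʳ (x + L))))

rise-shift : ∀ x L → rise (suc x) L * x ≡ rise x L * (x + L)
rise-shift x L = trans (ℕP.*-comm (rise (suc x) L) x) (rise-last x L)

rise-pos : ∀ x L → 0 < x → 0 < rise x L
rise-pos x zero _ = s≤s z≤n
rise-pos x (suc L) p = ℕP.*-mono-≤ p (rise-pos (suc x) L (s≤s z≤n))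

rise-mono : ∀ {x y} L → x ≤ y → rise x L ≤ rise y L
rise-mono zero le = ℕP.≤-refl
rise-mono (suc L) le = ℕP.*-mono-≤ le (rise-mono L (s≤s le))

rise-fact : ∀ x L → x ! * rise (suc x) L ≡ (x + L) !
rise-fact x zero = trans (ℕP.*-identityʳ (x !)) (cong _! (sym (ℕP.+-identityʳ x)))
rise-fact x (suc L) = begin
  x ! * (suc x * rise (suc (suc x)) L)   ≡⟨ lem (x !) (suc x) (rise (suc (suc x)) L) ⟩
  suc x * x ! * rise (suc (suc x)) L     ≡⟨ rise-fact (suc x) L ⟩
  (suc x + L) !                          ≡⟨ cong _! (sym (ℕP.+-suc x L)) ⟩
  (x + suc L) !                          ∎
  where
  open ≡-Reasoning
  lem : ∀ a b c → a * (b * c) ≡ b * a * c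
  lem = ℕSolver.solve-∀

-- A single term of the binomial expansion of (1 + 23)^(n + v).
rise-binomial : ∀ n v → rise (suc v) n * 23 ^ n ≤ n ! * 24 ^ (n + v)
rise-binomial zero v = subst (_≤ 1 * 24 ^ v) refl (ℕP.≤-trans (ℕP.m^n>0 24 v) (ℕP.≤-reflexive (sym (ℕP.*-identityˡ (24 ^ v)))))
rise-binomial (suc n) zero = begin
  rise 1 (suc n) * 23 ^ suc n            ≡⟨ cong (_* 23 ^ suc n) (trans (sym (ℕP.*-identityˡ (rise 1 (suc n)))) (rise-fact 0 (suc n))) ⟩
  suc n ! * 23 ^ suc n                   ≤⟨ ℕP.*-monoʳ-≤ (suc n !) (ℕP.^-monoˡ-≤ (suc n) (ℕP.n≤1+n 23)) ⟩
  suc n ! * 24 ^ suc n                   ≡⟨ cong (λ z → suc n ! * 24 ^ z) (sym (ℕP.+-identityʳ (suc n))) ⟩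
  suc n ! * 24 ^ (suc n + 0)             ∎
  where open ℕP.≤-Reasoning
rise-binomial (suc n) (suc v) = begin
  rise (2 + v) (suc n) * 23 ^ suc n                                          ≡⟨ cong (_* 23 ^ suc n) pascal ⟩
  (rise (suc v) (suc n) + suc n * rise (2 + v) n) * 23 ^ suc n               ≡⟨ l₁ (rise (suc v) (suc n)) n (rise (2 + v) n) (23 ^ n) ⟩
  rise (suc v) (suc n) * 23 ^ suc n + suc n * 23 * (rise (2 + v) n * 23 ^ n) ≤⟨ ℕP.+-mono-≤ (rise-binomial (suc n) v) (ℕP.*-monoʳ-≤ (suc n * 23) (rise-binomial n (suc v))) ⟩
  suc n ! * 24 ^ (suc n + v) + suc n * 23 * (n ! * 24 ^ (n + suc v))         ≡⟨ cong (λ z → suc n ! * 24 ^ (suc n + v) + suc n * 23 * (n ! * 24 ^ z)) (ℕP.+-suc n v) ⟩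
  suc n ! * 24 ^ (suc n + v) + suc n * 23 * (n ! * 24 ^ (suc n + v))         ≡⟨ l₂ n (n !) (24 ^ (n + v)) ⟩
  suc n ! * (24 * 24 ^ (suc n + v))                                          ≡⟨ cong (λ z → suc n ! * (24 * 24 ^ z)) (sym (ℕP.+-suc n v)) ⟩
  suc n ! * 24 ^ (suc n + suc v)                                             ∎
  where
  open ℕP.≤-Reasoning
  pascal : rise (2 + v) (suc n) ≡ rise (suc v) (suc n) + suc n * rise (2 + v) n
  pascal = trans (rise-last (2 + v) n) (l (rise (2 + v) n) v n)
    where
    l : ∀ R v n → R * (2 + v + n) ≡ suc v * R + suc n * R
    l = ℕSolver.solve-∀
  l₁ : ∀ a n b c → (a + suc n * b) * (23 * c) ≡ a * (23 * c) + suc n * 23 * (b * c)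
  l₁ = ℕSolver.solve-∀
  l₂ : ∀ n f c → (f + n * f) * (24 * c) + suc n * 23 * (f * (24 * c)) ≡ (f + n * f) * (24 * (24 * c))
  l₂ = ℕSolver.solve-∀

cross-* : ∀ {a b c d x y z w} → a * x ≤ b * y → c * z ≤ d * w → (a * c) * (x * z) ≤ (b * d) * (y * w)
cross-* {a} {b} {c} {d} {x} {y} {z} {w} p q = subst₂ _≤_ (lem a x c z) (lem b y d w) (ℕP.*-mono-≤ p q)
  where
  lem : ∀ a x c z → a * x * (c * z) ≡ (a * c) * (x * z)
  lem = ℕSolver.solve-∀

cross-≡ : ∀ {a b c d x y z w} → a * x ≡ b * y → c * z ≡ d * w → (a * c) * (x * z) ≡ (b * d) * (y * w)
cross-≡ {a} {b} {c} {d} {x} {y} {z} {w} p q = trans (sym (lem a x c z)) (trans (cong₂ _*_ p q) (lem b y d w))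
  where
  lem : ∀ a x c z → a * x * (c * z) ≡ (a * c) * (x * z)
  lem = ℕSolver.solve-∀

cross-8 : ∀ k a₁ a₂ a₃ a₄ a₅ a₆ a₇ a₈ c₁ c₂ c₃ c₄ c₅ c₆ c₇ c₈ {x₁ x₂ x₃ x₄ x₅ x₆ x₇ x₈ y₁ y₂ y₃ y₄ y₅ y₆ y₇ y₈} →
  0 < c₁ * (c₂ * (c₃ * (c₄ * (c₅ * (c₆ * (c₇ * c₈)))))) →
  c₁ * (c₂ * (c₃ * (c₄ * (c₅ * (c₆ * (c₇ * c₈)))))) * k ≤ a₁ * (a₂ * (a₃ * (a₄ * (a₅ * (a₆ * (a₇ * a₈)))))) →
  a₁ * x₁ ≤ c₁ * y₁ → a₂ * x₂ ≤ c₂ * y₂ → a₃ * x₃ ≤ c₃ * y₃ → a₄ * x₄ ≤ c₄ * y₄ → a₅ * x₅ ≤ c₅ * y₅ → a₆ * x₆ ≤ c₆ * y₆ → a₇ * x₇ ≤ c₇ * y₇ → a₈ * x₈ ≤ c₈ * y₈ →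
  k * (x₁ * (x₂ * (x₃ * (x₄ * (x₅ * (x₆ * (x₇ * x₈))))))) ≤ y₁ * (y₂ * (y₃ * (y₄ * (y₅ * (y₆ * (y₇ * y₈))))))
cross-8 k a₁ a₂ a₃ a₄ a₅ a₆ a₇ a₈ c₁ c₂ c₃ c₄ c₅ c₆ c₇ c₈ {x₁} {x₂} {x₃} {x₄} {x₅} {x₆} {x₇} {x₈} {y₁} {y₂} {y₃} {y₄} {y₅} {y₆} {y₇} {y₈} 0<C le h₁ h₂ h₃ h₄ h₅ h₆ h₇ h₈ = ℕP.*-cancelˡ-≤ C {{ℕ.>-nonZero 0<C}} (begin
  C * (k * x)       ≡⟨ ℕP.*-assoc C k x ⟨
  C * k * x         ≤⟨ ℕP.*-monoˡ-≤ x le ⟩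
  A * x             ≤⟨ cross-* {a₁} {c₁} h₁ (cross-* {a₂} {c₂} h₂ (cross-* {a₃} {c₃} h₃ (cross-* {a₄} {c₄} h₄ (cross-* {a₅} {c₅} h₅ (cross-* {a₆} {c₆} h₆ (cross-* {a₇} {c₇} h₇ h₈)))))) ⟩
  C * y             ∎)
  where
  open ℕP.≤-Reasoning
  A = a₁ * (a₂ * (a₃ * (a₄ * (a₅ * (a₆ * (a₇ * a₈))))))
  C = c₁ * (c₂ * (c₃ * (c₄ * (c₅ * (c₆ * (c₇ * c₈))))))
  x = x₁ * (x₂ * (x₃ * (x₄ * (x₅ * (x₆ * (x₇ * x₈))))))
  y = y₁ * (y₂ * (y₃ * (y₄ * (y₅ * (y₆ * (y₇ * y₈))))))

suc*-pos : ∀ n {k} → 0 < k → 0 < suc n * k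
suc*-pos n {k} p = ℕP.≤-trans p (ℕP.m≤m+n k (n * k))

form₄ : ℕ → ℕ → ℕ → ℕ → ℕ → ℕ → ℕ → ℕ
form₄ c₄ c₃ c₂ c₁ c₀ m w = c₄ * (m * m * m * m) + (c₃ * (m * m * m * w) + (c₂ * (m * m * w * w) + (c₁ * (m * w * w * w) + c₀ * (w * w * w * w))))

form₄-mono : ∀ {a₄ a₃ a₂ a₁ a₀ b₄ b₃ b₂ b₁ b₀} m w → a₄ ≤ b₄ → a₃ ≤ b₃ → a₂ ≤ b₂ → a₁ ≤ b₁ → a₀ ≤ b₀ → form₄ a₄ a₃ a₂ a₁ a₀ m w ≤ form₄ b₄ b₃ b₂ b₁ b₀ m w
form₄-mono m w h₄ h₃ h₂ h₁ h₀ = ℕP.+-mono-≤ (ℕP.*-monoˡ-≤ (m * m * m * m) h₄) (ℕP.+-mono-≤ (ℕP.*-monoˡ-≤ (m * m * m * w) h₃) (ℕP.+-mono-≤ (ℕP.*-monoˡ-≤ (m * m * w * w) h₂) (ℕP.+-mono-≤ (ℕP.*-monoˡ-≤ (m * w * w * w) h₁) (ℕP.*-monoˡ-≤ (w * w * w * w) h₀))))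

-- Comparison of the coefficients of two quartic forms; the coefficients stay symbolic until the end.
quartic-hom-general : ∀ α β ρ σ δ k m w → k ≤ m →
  let q₂ = β * β + 5 * δ * β + 10 * δ * δ ; q₁ = 2 * β + 5 * δ in
  k * (α * β * (α * β)) + ρ * q₂ ≤ k * (σ * ρ * q₂) →
  k * (2 * (α * β) * (α + β)) + (ρ * q₁ + q₂) ≤ k * (σ * ρ * q₁ + (σ + ρ) * q₂) →
  k * ((α + β) * (α + β) + 2 * (α * β)) + (ρ + q₁) ≤ k * (σ * ρ + (σ + ρ) * q₁ + q₂) →
  k * (2 * (α + β)) + 1 ≤ k * (σ + ρ + q₁) → k * 1 + 0 ≤ k * 1 → 0 < k →
  let A = β * m + w ; d = δ * m ; Q = A * A + 5 * d * A + 10 * d * d in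
  (α * m + w) * (α * m + w) * (A * A) + (ρ * m + w) * Q ≤ (σ * m + w) * (ρ * m + w) * Q
quartic-hom-general α β ρ σ δ k m w k≤m h₄ h₃ h₂ h₁ h₀ 0<k = ℕP.*-cancelˡ-≤ k {{ℕ.>-nonZero 0<k}} (begin
  k * (U + R)            ≡⟨ ℕP.*-distribˡ-+ k U R ⟩
  k * U + k * R          ≤⟨ ℕP.+-monoʳ-≤ (k * U) (ℕP.*-monoˡ-≤ R k≤m) ⟩
  k * U + m * R          ≡⟨ e₁ k α β ρ δ m w ⟩
  form₄ (k * (α * β * (α * β)) + ρ * q₂) (k * (2 * (α * β) * (α + β)) + (ρ * q₁ + q₂)) (k * ((α + β) * (α + β) + 2 * (α * β)) + (ρ + q₁)) (k * (2 * (α + β)) + 1) (k * 1 + 0) m w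
                         ≤⟨ form₄-mono m w h₄ h₃ h₂ h₁ h₀ ⟩
  form₄ (k * (σ * ρ * q₂)) (k * (σ * ρ * q₁ + (σ + ρ) * q₂)) (k * (σ * ρ + (σ + ρ) * q₁ + q₂)) (k * (σ + ρ + q₁)) (k * 1) m w
                         ≡⟨ e₂ k β ρ σ δ m w ⟨
  k * ((σ * m + w) * (ρ * m + w) * Q) ∎)
  where
  open ℕP.≤-Reasoning
  q₂ = β * β + 5 * δ * β + 10 * δ * δ
  q₁ = 2 * β + 5 * δ
  A = β * m + w
  d = δ * m
  Q = A * A + 5 * d * A + 10 * d * d
  U = (α * m + w) * (α * m + w) * (A * A)
  R = (ρ * m + w) * Q
  e₁ : ∀ k α β ρ δ m w →
    k * ((α * m + w) * (α * m + w) * ((β * m + w) * (β * m + w))) + m * ((ρ * m + w) * ((β * m + w) * (β * m + w) + 5 * (δ * m) * (β * m + w) + 10 * (δ * m) * (δ * m)))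
    ≡ (k * (α * β * (α * β)) + ρ * (β * β + 5 * δ * β + 10 * δ * δ)) * (m * m * m * m) + ((k * (2 * (α * β) * (α + β)) + (ρ * (2 * β + 5 * δ) + (β * β + 5 * δ * β + 10 * δ * δ))) * (m * m * m * w) + ((k * ((α + β) * (α + β) + 2 * (α * β)) + (ρ + (2 * β + 5 * δ))) * (m * m * w * w) + ((k * (2 * (α + β)) + 1) * (m * w * w * w) + (k * 1 + 0) * (w * w * w * w))))
  e₁ = ℕSolver.solve-∀
  e₂ : ∀ k β ρ σ δ m w →
    k * ((σ * m + w) * (ρ * m + w) * ((β * m + w) * (β * m + w) + 5 * (δ * m) * (β * m + w) + 10 * (δ * m) * (δ * m)))
    ≡ k * (σ * ρ * (β * β + 5 * δ * β + 10 * δ * δ)) * (m * m * m * m) + (k * (σ * ρ * (2 * β + 5 * δ) + (σ + ρ) * (β * β + 5 * δ * β + 10 * δ * δ)) * (m * m * m * w) + (k * (σ * ρ + (σ + ρ) * (2 * β + 5 * δ) + (β * β + 5 * δ * β + 10 * δ * δ)) * (m * m * w * w) + (k * (σ + ρ + (2 * β + 5 * δ)) * (m * w * w * w) + k * 1 * (w * w * w * w))))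
  e₂ = ℕSolver.solve-∀

-- The constants are those of `late`: 27 where that range begins, 3 = 27 - 24, 32 = 27 + 5, 51 = 27
-- + 24, 14 = 19 - 5. The correction `(51 m + w) Q` has degree three, so `10 ≤ m` makes it at most a
-- tenth of a quartic form.
quartic-hom : ∀ m w → 10 ≤ m → let A = 32 * m + w ; d = 14 * m ; Q = A * A + 5 * d * A + 10 * d * d in
  (27 * m + w) * (27 * m + w) * (A * A) + (51 * m + w) * Q ≤ (3 * m + w) * (51 * m + w) * Q
quartic-hom m w 10≤m = quartic-hom-general 27 32 51 3 14 10 m w 10≤m (ℕP.≤ᵇ⇒≤ _ _ tt) (ℕP.≤ᵇ⇒≤ _ _ tt) (ℕP.≤ᵇ⇒≤ _ _ tt) (ℕP.≤ᵇ⇒≤ _ _ tt) (ℕP.≤ᵇ⇒≤ _ _ tt) (s≤s z≤n)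

module Size (m : ℕ) (10≤m : 10 ≤ m) where
  L : ℕ
  L = 24 * m

  0<m : 0 < m
  0<m = ℕP.≤-trans (s≤s z≤n) 10≤m

  Bk : ℕ → ℕ → ℕ → ℕ
  Bk e w t = rise (suc (t + e * m)) (w * m)

  -- `Gn / Gd` models `f` with `p` replaced by `24 m` and without the zeros `t - l`; at `t = L + v`
  -- those zeros multiply to `rise v L`.
  Gn Gd : ℕ → ℕ
  Gn t = rise (suc (t + L)) L
  Gd t = rise (suc t) L * (rise (suc t) L * (Bk 1 22 t * (Bk 2 20 t * (Bk 3 18 t * (Bk 4 16 t * Bk 5 14 t)))))

  -- `X t / Y t` is the quotient of consecutive values of `Gn / Gd`, only the end factors of each
  -- rising factorial surviving.
  X Y : ℕ → ℕ
  X t = (suc (t + L) + L) * (suc t * (suc t * (suc (t + 1 * m) * (suc (t + 2 * m) * (suc (t + 3 * m) * (suc (t + 4 * m) * suc (t + 5 * m)))))))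
  Y t = suc (t + L) * ((suc t + L) * ((suc t + L) * ((suc (t + 1 * m) + 22 * m) * ((suc (t + 2 * m) + 20 * m) * ((suc (t + 3 * m) + 18 * m) * ((suc (t + 4 * m) + 16 * m) * (suc (t + 5 * m) + 14 * m)))))))

  step : ∀ t → Gn (suc t) * Gd t * Y t ≡ Gn t * Gd (suc t) * X t
  step t = trans (l₁ (Gn (suc t)) (Gd t) (suc (t + L)) y) (trans (cross-≡ {Gn (suc t)} {Gn t} {Gd t} {Gd (suc t)} (rise-shift (suc (t + L)) L) (sym den)) (l₂ (Gn t) (Gd (suc t)) (suc (t + L) + L) x))
    where
    x = suc t * (suc t * (suc (t + 1 * m) * (suc (t + 2 * m) * (suc (t + 3 * m) * (suc (t + 4 * m) * suc (t + 5 * m))))))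
    y = (suc t + L) * ((suc t + L) * ((suc (t + 1 * m) + 22 * m) * ((suc (t + 2 * m) + 20 * m) * ((suc (t + 3 * m) + 18 * m) * ((suc (t + 4 * m) + 16 * m) * (suc (t + 5 * m) + 14 * m))))))
    l₁ : ∀ a b c d → a * b * (c * d) ≡ (a * b) * (c * d)
    l₁ a b c d = refl
    l₂ : ∀ a b c d → (a * b) * (c * d) ≡ a * b * (c * d)
    l₂ a b c d = refl
    sh : ∀ e w → Bk e w (suc t) * suc (t + e * m) ≡ Bk e w t * (suc (t + e * m) + w * m)
    sh e w = rise-shift (suc (t + e * m)) (w * m)
    den : Gd (suc t) * x ≡ Gd t * y
    den = cross-≡ {rise (suc (suc t)) L} {rise (suc t) L} (rise-shift (suc t) L) (cross-≡ {rise (suc (suc t)) L} {rise (suc t) L} (rise-shift (suc t) L) (cross-≡ {Bk 1 22 (suc t)} {Bk 1 22 t} (sh 1 22) (cross-≡ {Bk 2 20 (suc t)} {Bk 2 20 t} (sh 2 20) (cross-≡ {Bk 3 18 (suc t)} {Bk 3 18 t} (sh 3 18) (cross-≡ {Bk 4 16 (suc t)} {Bk 4 16 t} (sh 4 16) (sh 5 14))))))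

  X-pos : ∀ t → 0 < X t
  X-pos t = suc*-pos (t + L + L) (suc*-pos t (suc*-pos t (suc*-pos (t + 1 * m) (suc*-pos (t + 2 * m) (suc*-pos (t + 3 * m) (suc*-pos (t + 4 * m) {suc (t + 5 * m)} (s≤s z≤n)))))))

  Y-pos : ∀ t → 0 < Y t
  Y-pos t = suc*-pos (t + L) (suc*-pos (t + L) (suc*-pos (t + L) (suc*-pos (t + 1 * m + 22 * m) (suc*-pos (t + 2 * m + 20 * m) (suc*-pos (t + 3 * m + 18 * m) (suc*-pos (t + 4 * m + 16 * m) {suc (t + 5 * m) + 14 * m} (s≤s z≤n)))))))

  Gd-pos : ∀ t → 0 < Gd t
  Gd-pos t = ℕP.*-mono-≤ (rise-pos (suc t) L (s≤s z≤n)) (ℕP.*-mono-≤ (rise-pos (suc t) L (s≤s z≤n)) (ℕP.*-mono-≤ (bp 1 22) (ℕP.*-mono-≤ (bp 2 20) (ℕP.*-mono-≤ (bp 3 18) (ℕP.*-mono-≤ (bp 4 16) (bp 5 14))))))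
    where
    bp : ∀ e w → 0 < Bk e w t
    bp e w = rise-pos (suc (t + e * m)) (w * m) (s≤s z≤n)

  -- For t + 1 ≤ 27.1 m each quotient (t + 1 + e m) / (t + 1 + (24 - e) m) is at most (271 + 10 e) / (511 - 10 e).
  early : ∀ t → L ≤ t → t < 27 * m → 24 * X t ≤ Y t
  early t lo hi = cross-8 24 2 511 511 501 491 481 471 461 3 271 271 281 291 301 311 321
      {suc (t + L) + L} {suc t} {suc t} {suc (t + 1 * m)} {suc (t + 2 * m)} {suc (t + 3 * m)} {suc (t + 4 * m)} {suc (t + 5 * m)}
      {suc (t + L)} {suc t + L} {suc t + L} {suc (t + 1 * m) + 22 * m} {suc (t + 2 * m) + 20 * m} {suc (t + 3 * m) + 18 * m} {suc (t + 4 * m) + 16 * m} {suc (t + 5 * m) + 14 * m}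
      (ℕP.≤ᵇ⇒≤ 1 _ tt) (ℕP.≤ᵇ⇒≤ _ _ tt)
      fr₃ fr₀ fr₀ (fr 1 22 501 281 refl refl) (fr 2 20 491 291 refl refl) (fr 3 18 481 301 refl refl) (fr 4 16 471 311 refl refl) (fr 5 14 461 321 refl refl)
    where
    open ℕP.≤-Reasoning
    u≤ : 10 * suc t ≤ 271 * m
    u≤ = begin
      10 * suc t          ≤⟨ ℕP.*-monoʳ-≤ 10 hi ⟩
      10 * (27 * m)       ≡⟨ ℕP.*-assoc 10 27 m ⟨
      270 * m             ≤⟨ ℕP.*-monoˡ-≤ m (ℕP.n≤1+n 270) ⟩
      271 * m             ∎
    frac : ∀ e w a c → (∀ u m → a * (u + e * m) + w * (271 * m) ≡ a * u + (a * e + w * 271) * m) → (∀ u m → c * (u + e * m + w * m) + w * (10 * u) ≡ (c + w * 10) * u + c * (e + w) * m) →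
      a ≡ c + w * 10 → a * e + w * 271 ≡ c * (e + w) → a * (suc (t + e * m)) ≤ c * (suc (t + e * m) + w * m)
    frac e w a c h₁ h₂ q₁ q₂ = ℕP.+-cancelʳ-≤ (w * (10 * suc t)) (a * (suc t + e * m)) (c * (suc t + e * m + w * m)) (begin
      a * (suc t + e * m) + w * (10 * suc t)      ≤⟨ ℕP.+-monoʳ-≤ (a * (suc t + e * m)) (ℕP.*-monoʳ-≤ w u≤) ⟩
      a * (suc t + e * m) + w * (271 * m)         ≡⟨ h₁ (suc t) m ⟩
      a * suc t + (a * e + w * 271) * m           ≡⟨ cong₂ (λ x y → x * suc t + y * m) q₁ q₂ ⟩
      (c + w * 10) * suc t + c * (e + w) * m      ≡⟨ h₂ (suc t) m ⟨
      c * (suc t + e * m + w * m) + w * (10 * suc t) ∎)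
    gen₁ : ∀ a e w u m → a * (u + e * m) + w * (271 * m) ≡ a * u + (a * e + w * 271) * m
    gen₁ = ℕSolver.solve-∀
    gen₂ : ∀ c e w u m → c * (u + e * m + w * m) + w * (10 * u) ≡ (c + w * 10) * u + c * (e + w) * m
    gen₂ = ℕSolver.solve-∀
    fr : ∀ e w a c → a ≡ c + w * 10 → a * e + w * 271 ≡ c * (e + w) → a * (suc (t + e * m)) ≤ c * (suc (t + e * m) + w * m)
    fr e w a c = frac e w a c (gen₁ a e w) (gen₂ c e w)
    fr₀ : 511 * suc t ≤ 271 * (suc t + L)
    fr₀ = subst (λ z → 511 * suc z ≤ 271 * (suc z + L)) (ℕP.+-identityʳ t) (fr 0 24 511 271 refl refl)
    fr₃ : 2 * (suc (t + L) + L) ≤ 3 * suc (t + L)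
    fr₃ = subst₂ _≤_ (sym (l₁ t L)) (sym (l₂ t L)) (ℕP.+-monoʳ-≤ (2 + 2 * t + 3 * L) (ℕP.≤-trans lo (ℕP.n≤1+n t)))
      where
      l₁ : ∀ t L → 2 * (suc (t + L) + L) ≡ 2 + 2 * t + 3 * L + L
      l₁ = ℕSolver.solve-∀
      l₂ : ∀ t L → 3 * suc (t + L) ≡ 2 + 2 * t + 3 * L + suc t
      l₂ = ℕSolver.solve-∀

  G-early : ∀ t → L ≤ t → t < 27 * m → 24 * (Gn (suc t) * Gd t) ≤ Gn t * Gd (suc t)
  G-early t lo hi = ℕP.*-cancelʳ-≤ _ _ (X t) {{ℕ.>-nonZero (X-pos t)}} (begin
    24 * N * X t       ≡⟨ l N (X t) ⟩
    N * (24 * X t)     ≤⟨ ℕP.*-monoʳ-≤ N (early t lo hi) ⟩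
    N * Y t            ≡⟨ step t ⟩
    Gn t * Gd (suc t) * X t ∎)
    where
    open ℕP.≤-Reasoning
    N = Gn (suc t) * Gd t
    l : ∀ n x → 24 * n * x ≡ n * (24 * x)
    l = ℕSolver.solve-∀

  G-power : ∀ v → v ≤ 3 * m → 24 ^ v * (Gn (L + v) * Gd L) ≤ Gn L * Gd (L + v)
  G-power zero le = subst (λ t → 1 * (Gn t * Gd L) ≤ Gn L * Gd t) (sym (ℕP.+-identityʳ L)) (ℕP.≤-reflexive (ℕP.*-identityˡ (Gn L * Gd L)))
  G-power (suc v) le = subst (λ t → 24 ^ suc v * (Gn t * Gd L) ≤ Gn L * Gd t) (sym (ℕP.+-suc L v)) (ℕP.*-cancelʳ-≤ _ _ (Gd τ₀) {{ℕ.>-nonZero (Gd-pos τ₀)}} (begin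
    24 ^ suc v * (Gn (suc τ₀) * Gd L) * Gd τ₀          ≡⟨ l₁ (24 ^ v) (Gn (suc τ₀)) (Gd L) (Gd τ₀) ⟩
    24 * (Gn (suc τ₀) * Gd τ₀) * (24 ^ v * Gd L)       ≤⟨ ℕP.*-monoˡ-≤ (24 ^ v * Gd L) (G-early τ₀ (ℕP.m≤m+n L v) (subst (τ₀ <_) (sym (ℕP.*-distribʳ-+ m 24 3)) (ℕP.+-monoʳ-< L le))) ⟩
    Gn τ₀ * Gd (suc τ₀) * (24 ^ v * Gd L)              ≡⟨ l₂ (Gn τ₀) (Gd (suc τ₀)) (24 ^ v) (Gd L) ⟩
    24 ^ v * (Gn τ₀ * Gd L) * Gd (suc τ₀)              ≤⟨ ℕP.*-monoˡ-≤ (Gd (suc τ₀)) (G-power v (ℕP.<⇒≤ le)) ⟩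
    Gn L * Gd τ₀ * Gd (suc τ₀)                         ≡⟨ l₃ (Gn L) (Gd τ₀) (Gd (suc τ₀)) ⟩
    Gn L * Gd (suc τ₀) * Gd τ₀                         ∎))
    where
    open ℕP.≤-Reasoning
    τ₀ = L + v
    l₁ : ∀ a g h k → 24 * a * (g * h) * k ≡ 24 * (g * k) * (a * h)
    l₁ = ℕSolver.solve-∀
    l₂ : ∀ g k a h → g * k * (a * h) ≡ a * (g * h) * k
    l₂ = ℕSolver.solve-∀
    l₃ : ∀ a b c → a * b * c ≡ a * c * b
    l₃ = ℕSolver.solve-∀

  -- As `rise (v + 1) L / rise v L = t / v`, this says that the complete product
  -- `rise v L * Gn / Gd` no longer increases once `t ≥ 27 m`.
  late : ∀ w → let v = 3 * m + w ; t = L + v in t * X t ≤ v * Y t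
  late w = subst (λ t → t * X t ≤ v * Y t) tt-eq goal
    where
    open ℕP.≤-Reasoning
    v t u a c : ℕ
    v = 3 * m + w
    t = 27 * m + w
    tt-eq : 27 * m + w ≡ L + (3 * m + w)
    tt-eq = l m w
      where
      l : ∀ m w → 27 * m + w ≡ 24 * m + (3 * m + w)
      l = ℕSolver.solve-∀
    u = suc t
    a = u + 5 * m
    c = a + 14 * m
    d = 14 * m
    Q = a * a + 5 * d * a + 10 * d * d
    -- What remains after `amgm` has balanced the right zeros against one copy of `inner` and every
    -- block quotient has been bounded by `a / c`; `a^3 Q` consists of the first three terms of
    -- `c^5 = (a + d)^5`.
    quartic : t * u * (a * a) ≤ v * (u + 24 * m) * Q
    quartic = ℕP.+-cancelʳ-≤ ((u + 24 * m) * Q) _ _ (begin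
      t * u * (a * a) + (u + 24 * m) * Q                          ≤⟨ ℕP.+-monoˡ-≤ ((u + 24 * m) * Q) (ℕP.*-monoˡ-≤ (a * a) (ℕP.*-monoˡ-≤ u (ℕP.n≤1+n t))) ⟩
      u * u * (a * a) + (u + 24 * m) * Q                          ≡⟨ cong₂ (λ x y → x * x * (y * y) + (x + 24 * m) * (y * y + 5 * d * y + 10 * d * d)) ue ae ⟩
      U * U * (A * A) + (U + 24 * m) * Q′                         ≡⟨ cong (λ x → U * U * (A * A) + x * Q′) ve ⟩
      U * U * (A * A) + (51 * m + suc w) * Q′                     ≤⟨ quartic-hom m (suc w) 10≤m ⟩
      (3 * m + suc w) * (51 * m + suc w) * Q′                     ≡⟨ cong (λ x → (3 * m + suc w) * x * Q′) ve ⟨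
      (3 * m + suc w) * (U + 24 * m) * Q′                         ≡⟨ cong₂ (λ x y → (3 * m + suc w) * (x + 24 * m) * (y * y + 5 * d * y + 10 * d * d)) ue ae ⟨
      (3 * m + suc w) * (u + 24 * m) * Q                          ≡⟨ l₃ m w (u + 24 * m) Q ⟩
      v * (u + 24 * m) * Q + (u + 24 * m) * Q                     ∎)
      where
      U A Q′ : ℕ
      U = 27 * m + suc w
      A = 32 * m + suc w
      Q′ = A * A + 5 * d * A + 10 * d * d
      ue : u ≡ U
      ue = sym (ℕP.+-suc (27 * m) w)
      ae : a ≡ A
      ae = l m w
        where
        l : ∀ m w → suc (27 * m + w) + 5 * m ≡ 32 * m + suc w
        l = ℕSolver.solve-∀
      ve : U + 24 * m ≡ 51 * m + suc w
      ve = l m w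
        where
        l : ∀ m w → 27 * m + suc w + 24 * m ≡ 51 * m + suc w
        l = ℕSolver.solve-∀
      l₃ : ∀ m w x q → (3 * m + suc w) * x * q ≡ (3 * m + w) * x * q + x * q
      l₃ = ℕSolver.solve-∀
    fifth : a * a * a * Q ≤ c * c * c * c * c
    fifth = ℕP.≤-trans (ℕP.m≤m+n (a * a * a * Q) (10 * a * a * d * d * d + 5 * a * d * d * d * d + d * d * d * d * d)) (ℕP.≤-reflexive (sym (l a d)))
      where
      l : ∀ a d → (a + d) * (a + d) * (a + d) * (a + d) * (a + d) ≡ a * a * a * (a * a + 5 * d * a + 10 * d * d) + (10 * a * a * d * d * d + 5 * a * d * d * d * d + d * d * d * d * d)
      l = ℕSolver.solve-∀
    amgm : (suc (t + L) + L) * u ≤ suc (t + L) * (u + L)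
    amgm = ℕP.≤-trans (ℕP.m≤m+n _ (L * L)) (ℕP.≤-reflexive (sym (l t L)))
      where
      l : ∀ t L → suc (t + L) * (suc t + L) ≡ (suc (t + L) + L) * suc t + L * L
      l = ℕSolver.solve-∀
    xe : ∀ e → e ≤ 5 → suc (t + e * m) ≤ a
    xe e le = s≤s (ℕP.+-monoʳ-≤ t (ℕP.*-monoˡ-≤ m le))
    ye : ∀ e w′ → 19 ≤ e + w′ → c ≤ suc (t + e * m) + w′ * m
    ye e w′ le = subst₂ _≤_ (l₁ t m) (l₂ t e w′ m) (ℕP.+-monoʳ-≤ (suc t) (ℕP.*-monoˡ-≤ m le))
      where
      l₁ : ∀ t m → suc t + 19 * m ≡ suc t + 5 * m + 14 * m
      l₁ = ℕSolver.solve-∀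
      l₂ : ∀ t e w m → suc t + (e + w) * m ≡ suc (t + e * m) + w * m
      l₂ = ℕSolver.solve-∀
    le : ∀ i j → {T (i ≤ᵇ j)} → i ≤ j
    le i j {ok} = ℕP.≤ᵇ⇒≤ i j ok
    xs = suc (t + 1 * m) * (suc (t + 2 * m) * (suc (t + 3 * m) * (suc (t + 4 * m) * suc (t + 5 * m))))
    ys = (suc (t + 1 * m) + 22 * m) * ((suc (t + 2 * m) + 20 * m) * ((suc (t + 3 * m) + 18 * m) * ((suc (t + 4 * m) + 16 * m) * (suc (t + 5 * m) + 14 * m))))
    xs≤ : xs ≤ a * (a * (a * (a * a)))
    xs≤ = ℕP.*-mono-≤ (xe 1 (le 1 5)) (ℕP.*-mono-≤ (xe 2 (le 2 5)) (ℕP.*-mono-≤ (xe 3 (le 3 5)) (ℕP.*-mono-≤ (xe 4 (le 4 5)) (xe 5 (le 5 5)))))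
    ys≥ : c * (c * (c * (c * c))) ≤ ys
    ys≥ = ℕP.*-mono-≤ (ye 1 22 (le 19 23)) (ℕP.*-mono-≤ (ye 2 20 (le 19 22)) (ℕP.*-mono-≤ (ye 3 18 (le 19 21)) (ℕP.*-mono-≤ (ye 4 16 (le 19 20)) (ye 5 14 (le 19 19)))))
    inner-bound : t * (u * xs) ≤ v * ((u + L) * ys)
    inner-bound = begin
      t * (u * xs)                                ≤⟨ ℕP.*-monoʳ-≤ t (ℕP.*-monoʳ-≤ u xs≤) ⟩
      t * (u * (a * (a * (a * (a * a)))))         ≡⟨ l₁ t u a ⟩
      a * a * a * (t * u * (a * a))               ≤⟨ ℕP.*-monoʳ-≤ (a * a * a) quartic ⟩
      a * a * a * (v * (u + 24 * m) * Q)          ≡⟨ l₂ (a * a * a) v (u + 24 * m) Q ⟩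
      v * ((u + 24 * m) * (a * a * a * Q))        ≤⟨ ℕP.*-monoʳ-≤ v (ℕP.*-monoʳ-≤ (u + L) (ℕP.≤-trans fifth (ℕP.≤-trans (ℕP.≤-reflexive (l₃ c)) ys≥))) ⟩
      v * ((u + L) * ys)                          ∎
      where
      l₁ : ∀ t u a → t * (u * (a * (a * (a * (a * a))))) ≡ a * a * a * (t * u * (a * a))
      l₁ = ℕSolver.solve-∀
      l₂ : ∀ a v u q → a * (v * u * q) ≡ v * (u * (a * q))
      l₂ = ℕSolver.solve-∀
      l₃ : ∀ c → c * c * c * c * c ≡ c * (c * (c * (c * c)))
      l₃ = ℕSolver.solve-∀
    goal : t * X t ≤ v * Y t
    goal = begin
      t * X t                                             ≡⟨ l₁ t (suc (t + L) + L) u xs ⟩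
      (suc (t + L) + L) * u * (t * (u * xs))              ≤⟨ ℕP.*-mono-≤ amgm inner-bound ⟩
      suc (t + L) * (u + L) * (v * ((u + L) * ys))        ≡⟨ l₂ (suc (t + L)) (u + L) v ys ⟩
      v * Y t                                             ∎
      where
      l₁ : ∀ t z u x → t * (z * (u * (u * x))) ≡ z * u * (t * (u * x))
      l₁ = ℕSolver.solve-∀
      l₂ : ∀ z u v y → z * u * (v * (u * y)) ≡ v * (z * (u * (u * y)))
      l₂ = ℕSolver.solve-∀

  G-late : ∀ w → let v = 3 * m + w ; t = L + v in rise (suc v) L * (Gn (suc t) * Gd t) ≤ rise v L * (Gn t * Gd (suc t))
  G-late w = ℕP.*-cancelʳ-≤ _ _ (v * Y t) {{ℕ.>-nonZero (ℕP.*-mono-≤ 0<v (Y-pos t))}} (begin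
    rise (suc v) L * N * (v * Y t)                ≡⟨ l₁ (rise (suc v) L) N v (Y t) ⟩
    rise (suc v) L * v * (N * Y t)                ≡⟨ cong₂ _*_ (trans (rise-shift v L) (cong (rise v L *_) (ℕP.+-comm v L))) (step t) ⟩
    rise v L * t * (M * X t)                      ≡⟨ l₂ (rise v L) t M (X t) ⟩
    rise v L * M * (t * X t)                      ≤⟨ ℕP.*-monoʳ-≤ (rise v L * M) (late w) ⟩
    rise v L * M * (v * Y t)                      ∎)
    where
    open ℕP.≤-Reasoning
    v t N M : ℕ
    v = 3 * m + w
    t = L + v
    N = Gn (suc t) * Gd t
    M = Gn t * Gd (suc t)
    0<v : 0 < v
    0<v = ℕP.≤-trans 0<m (ℕP.≤-trans (ℕP.m≤n*m m 3) (ℕP.m≤m+n (3 * m) w))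
    l₁ : ∀ r n v y → r * n * (v * y) ≡ r * v * (n * y)
    l₁ = ℕSolver.solve-∀
    l₂ : ∀ r t n x → r * t * (n * x) ≡ r * n * (t * x)
    l₂ = ℕSolver.solve-∀

  -- Bounds the product at `t = L + v` by `(24/23)^L * L!` times `Gn L / Gd L`. For `v ≤ 3 m` the
  -- factor `24^v` of the binomial estimate is paid by the decay of `Gn / Gd`; afterwards the
  -- product decreases.
  Peak : ℕ → Set
  Peak v = rise v L * 23 ^ L * (Gn (L + v) * Gd L) ≤ L ! * 24 ^ L * (Gn L * Gd (L + v))

  peak-early : ∀ v → v ≤ 3 * m → Peak v
  peak-early v le = begin
    rise v L * 23 ^ L * (Gn (L + v) * Gd L)                  ≤⟨ ℕP.*-monoˡ-≤ (Gn (L + v) * Gd L) (ℕP.≤-trans (ℕP.*-monoˡ-≤ (23 ^ L) (rise-mono L (ℕP.n≤1+n v))) (rise-binomial L v)) ⟩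
    L ! * 24 ^ (L + v) * (Gn (L + v) * Gd L)                 ≡⟨ cong (λ z → L ! * z * (Gn (L + v) * Gd L)) (ℕP.^-distribˡ-+-* 24 L v) ⟩
    L ! * (24 ^ L * 24 ^ v) * (Gn (L + v) * Gd L)            ≡⟨ l (L !) (24 ^ L) (24 ^ v) (Gn (L + v) * Gd L) ⟩
    L ! * 24 ^ L * (24 ^ v * (Gn (L + v) * Gd L))            ≤⟨ ℕP.*-monoʳ-≤ (L ! * 24 ^ L) (G-power v le) ⟩
    L ! * 24 ^ L * (Gn L * Gd (L + v))                       ∎
    where
    open ℕP.≤-Reasoning
    l : ∀ a b c d → a * (b * c) * d ≡ a * b * (c * d)
    l = ℕSolver.solve-∀

  peak-late : ∀ w → Peak (3 * m + w)
  peak-late zero = subst Peak (sym (ℕP.+-identityʳ (3 * m))) (peak-early (3 * m) ℕP.≤-refl)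
  peak-late (suc w) = subst Peak (sym (ℕP.+-suc (3 * m) w)) (subst (λ t → rise (suc v) L * 23 ^ L * (Gn t * Gd L) ≤ L ! * 24 ^ L * (Gn L * Gd t)) (sym (ℕP.+-suc L v))
    (ℕP.*-cancelʳ-≤ _ _ (Gd t) {{ℕ.>-nonZero (Gd-pos t)}} (begin
      rise (suc v) L * 23 ^ L * (Gn (suc t) * Gd L) * Gd t         ≡⟨ l₁ (rise (suc v) L) (23 ^ L) (Gn (suc t)) (Gd L) (Gd t) ⟩
      rise (suc v) L * (Gn (suc t) * Gd t) * (23 ^ L * Gd L)       ≤⟨ ℕP.*-monoˡ-≤ (23 ^ L * Gd L) (G-late w) ⟩
      rise v L * (Gn t * Gd (suc t)) * (23 ^ L * Gd L)             ≡⟨ l₂ (rise v L) (Gn t) (Gd (suc t)) (23 ^ L) (Gd L) ⟩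
      rise v L * 23 ^ L * (Gn t * Gd L) * Gd (suc t)               ≤⟨ ℕP.*-monoˡ-≤ (Gd (suc t)) (peak-late w) ⟩
      L ! * 24 ^ L * (Gn L * Gd t) * Gd (suc t)                    ≡⟨ l₃ (L ! * 24 ^ L) (Gn L) (Gd t) (Gd (suc t)) ⟩
      L ! * 24 ^ L * (Gn L * Gd (suc t)) * Gd t                    ∎)))
    where
    open ℕP.≤-Reasoning
    v t : ℕ
    v = 3 * m + w
    t = L + v
    l₁ : ∀ r p g h k → r * p * (g * h) * k ≡ r * (g * k) * (p * h)
    l₁ = ℕSolver.solve-∀
    l₂ : ∀ r g k p h → r * (g * k) * (p * h) ≡ r * p * (g * h) * k
    l₂ = ℕSolver.solve-∀
    l₃ : ∀ a b c d → a * (b * c) * d ≡ a * (b * d) * c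
    l₃ = ℕSolver.solve-∀

  peak : ∀ v → Peak v
  peak v with v ℕP.≤? 3 * m
  ... | yes le = peak-early v le
  ... | no nle = subst Peak (ℕP.m+[n∸m]≡n (ℕP.<⇒≤ (ℕP.≰⇒> nle))) (peak-late (v ∸ 3 * m))

-- Polynomial factors and factorial quotients.

PolyBounded : (ℕ → ℕ) → Set
PolyBounded f = Σ ℕ λ C → Σ ℕ λ D → ∀ m → 1 ≤ m → f m ≤ C * m ^ D

poly-const : ∀ c → PolyBounded (λ _ → c)
poly-const c = c , 0 , λ m _ → ℕP.≤-reflexive (sym (ℕP.*-identityʳ c))

poly-* : ∀ {f g} → PolyBounded f → PolyBounded g → PolyBounded (λ m → f m * g m)
poly-* {f} {g} (C , D , h) (C′ , D′ , h′) = C * C′ , D + D′ , λ m 1≤m → begin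
  f m * g m                        ≤⟨ ℕP.*-mono-≤ (h m 1≤m) (h′ m 1≤m) ⟩
  C * m ^ D * (C′ * m ^ D′)        ≡⟨ lem C (m ^ D) C′ (m ^ D′) ⟩
  C * C′ * (m ^ D * m ^ D′)        ≡⟨ cong (C * C′ *_) (sym (ℕP.^-distribˡ-+-* m D D′)) ⟩
  C * C′ * m ^ (D + D′)            ∎
  where
  open ℕP.≤-Reasoning
  lem : ∀ a b c d → a * b * (c * d) ≡ a * c * (b * d)
  lem = ℕSolver.solve-∀

poly-^ : ∀ {f} n → PolyBounded f → PolyBounded (λ m → f m ^ n)
poly-^ zero h = poly-const 1
poly-^ (suc n) h = poly-* h (poly-^ n h)

poly-linear : ∀ a c → PolyBounded (λ m → a * m + c)
poly-linear a c = a + c , 1 , λ m 1≤m → begin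
  a * m + c                 ≤⟨ ℕP.+-monoʳ-≤ (a * m) (subst (_≤ c * m) (ℕP.*-identityʳ c) (ℕP.*-monoʳ-≤ c 1≤m)) ⟩
  a * m + c * m             ≡⟨ lem a c m ⟩
  (a + c) * (m * 1)         ∎
  where
  open ℕP.≤-Reasoning
  lem : ∀ a c m → a * m + c * m ≡ (a + c) * (m * 1)
  lem = ℕSolver.solve-∀

poly-mono : ∀ {f g} → (∀ m → f m ≤ g m) → PolyBounded g → PolyBounded f
poly-mono le (C , D , h) = C , D , λ m 1≤m → ℕP.≤-trans (le m) (h m 1≤m)

poly-tieProd : ∀ j s → PolyBounded (λ m → tieProd (j * m) s)
poly-tieProd j zero = poly-mono (λ m → ℕP.≤-reflexive (sym (ℕP.+-identityʳ (j * m)))) (poly-linear j 0)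
poly-tieProd j (suc s) = poly-* (poly-linear j (suc s)) (poly-tieProd j s)

poly-tieAll : ∀ J → PolyBounded (λ m → tieAll m J)
poly-tieAll zero = poly-const 1
poly-tieAll (suc J) = poly-* (poly-tieProd (suc J) 24) (poly-tieAll J)

powProd : List ℕ → ℕ
powProd [] = 1
powProd (j ∷ js) = j ^ j * powProd js

linProd : ℕ → List ℕ → ℕ
linProd m [] = 1
linProd m (j ∷ js) = (j * m) ^ j * linProd m js

poly-linProd : ∀ js → PolyBounded (λ m → linProd m js)
poly-linProd [] = poly-const 1
poly-linProd (j ∷ js) = poly-* (poly-^ j (poly-mono (λ m → ℕP.≤-reflexive (sym (ℕP.+-identityʳ (j * m)))) (poly-linear j 0))) (poly-linProd js)

^-distrib : ∀ a b n → (a * b) ^ n ≡ a ^ n * b ^ n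
^-distrib a b zero = refl
^-distrib a b (suc n) = trans (cong (a * b *_) (^-distrib a b n)) (lem a b (a ^ n) (b ^ n))
  where
  lem : ∀ a b c d → a * b * (c * d) ≡ a * c * (b * d)
  lem = ℕSolver.solve-∀

rise-upper : ∀ x L B → x + L ≤ suc B → rise x L ≤ B ^ L
rise-upper x zero B le = ℕP.≤-refl
rise-upper x (suc L) B le = ℕP.*-mono-≤ (ℕP.≤-pred (ℕP.≤-trans (s≤s (ℕP.m≤m+n x L)) le′)) (rise-upper (suc x) L B le′)
  where
  le′ : suc x + L ≤ suc B
  le′ = subst (_≤ suc B) (ℕP.+-suc x L) le

rise-lower : ∀ x L → x ^ L ≤ rise (suc x) L
rise-lower x zero = ℕP.≤-refl
rise-lower x (suc L) = ℕP.*-mono-≤ (ℕP.n≤1+n x) (ℕP.≤-trans (rise-lower x L) (rise-mono L (ℕP.n≤1+n (suc x))))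

fact-split : ∀ j m → (j * suc m) ! ≡ (j * m) ! * rise (suc (j * m)) j
fact-split j m = sym (trans (rise-fact (j * m) j) (cong _! (trans (ℕP.+-comm (j * m) j) (sym (ℕP.*-suc j m)))))

block-power : ∀ j m → (j ^ j) ^ suc m * (suc m !) ^ j ≡ (j ^ j) ^ m * (m !) ^ j * (j * suc m) ^ j
block-power j m = begin
  j ^ j * (j ^ j) ^ m * (suc m * m !) ^ j              ≡⟨ cong (j ^ j * (j ^ j) ^ m *_) (^-distrib (suc m) (m !) j) ⟩
  j ^ j * (j ^ j) ^ m * (suc m ^ j * (m !) ^ j)        ≡⟨ lem (j ^ j) ((j ^ j) ^ m) (suc m ^ j) ((m !) ^ j) ⟩
  (j ^ j) ^ m * (m !) ^ j * (j ^ j * suc m ^ j)        ≡⟨ cong ((j ^ j) ^ m * (m !) ^ j *_) (sym (^-distrib j (suc m) j)) ⟩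
  (j ^ j) ^ m * (m !) ^ j * (j * suc m) ^ j            ∎
  where
  open ≡-Reasoning
  lem : ∀ a b c d → a * b * (c * d) ≡ b * d * (a * c)
  lem = ℕSolver.solve-∀

-- With `fact-lower` an elementary substitute for Stirling's formula: `(j m)!` is `j^(j m) (m!)^j`
-- up to a polynomial factor.
fact-upper : ∀ j m → (j * m) ! ≤ (j ^ j) ^ m * (m !) ^ j
fact-upper j zero = ℕP.≤-reflexive (trans (cong _! (ℕP.*-zeroʳ j)) (sym (trans (ℕP.*-identityˡ (1 ^ j)) (ℕP.^-zeroˡ j))))
fact-upper j (suc m) = begin
  (j * suc m) !                                ≡⟨ fact-split j m ⟩
  (j * m) ! * rise (suc (j * m)) j             ≤⟨ ℕP.*-mono-≤ (fact-upper j m) (rise-upper (suc (j * m)) j (j * suc m) (ℕP.≤-reflexive (cong suc (trans (ℕP.+-comm (j * m) j) (sym (ℕP.*-suc j m)))))) ⟩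
  (j ^ j) ^ m * (m !) ^ j * (j * suc m) ^ j    ≡⟨ sym (block-power j m) ⟩
  (j ^ j) ^ suc m * (suc m !) ^ j              ∎
  where open ℕP.≤-Reasoning

fact-lower : ∀ j m → (j ^ j) ^ suc m * (suc m !) ^ j ≤ (j * suc m) ! * (j * suc m) ^ j
fact-lower j zero = begin
  j ^ j * 1 * 1 ^ j             ≡⟨ trans (cong (j ^ j * 1 *_) (ℕP.^-zeroˡ j)) (trans (ℕP.*-identityʳ (j ^ j * 1)) (ℕP.*-identityʳ (j ^ j))) ⟩
  j ^ j                         ≡⟨ cong (_^ j) (sym (ℕP.*-identityʳ j)) ⟩
  (j * 1) ^ j                   ≤⟨ ℕP.m≤n*m ((j * 1) ^ j) ((j * 1) !) {{ℕ.>-nonZero (ℕP.1≤n! (j * 1))}} ⟩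
  (j * 1) ! * (j * 1) ^ j       ∎
  where open ℕP.≤-Reasoning
fact-lower j (suc m) = begin
  (j ^ j) ^ suc (suc m) * (suc (suc m) !) ^ j                          ≡⟨ block-power j (suc m) ⟩
  (j ^ j) ^ suc m * (suc m !) ^ j * (j * suc (suc m)) ^ j              ≤⟨ ℕP.*-monoˡ-≤ ((j * suc (suc m)) ^ j) (fact-lower j m) ⟩
  (j * suc m) ! * (j * suc m) ^ j * (j * suc (suc m)) ^ j              ≤⟨ ℕP.*-monoˡ-≤ ((j * suc (suc m)) ^ j) (ℕP.*-monoʳ-≤ ((j * suc m) !) (rise-lower (j * suc m) j)) ⟩
  (j * suc m) ! * rise (suc (j * suc m)) j * (j * suc (suc m)) ^ j     ≡⟨ cong (_* (j * suc (suc m)) ^ j) (sym (fact-split j (suc m))) ⟩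
  (j * suc (suc m)) ! * (j * suc (suc m)) ^ j                          ∎
  where open ℕP.≤-Reasoning

factProd-upper : ∀ m js → factProd m js ≤ powProd js ^ m * (m !) ^ sum js
factProd-upper m [] = ℕP.≤-reflexive (sym (trans (ℕP.*-identityʳ (1 ^ m)) (ℕP.^-zeroˡ m)))
factProd-upper m (j ∷ js) = begin
  (j * m) ! * factProd m js                                          ≤⟨ ℕP.*-mono-≤ (fact-upper j m) (factProd-upper m js) ⟩
  (j ^ j) ^ m * (m !) ^ j * (powProd js ^ m * (m !) ^ sum js)        ≡⟨ lem ((j ^ j) ^ m) ((m !) ^ j) (powProd js ^ m) ((m !) ^ sum js) ⟩
  (j ^ j) ^ m * powProd js ^ m * ((m !) ^ j * (m !) ^ sum js)        ≡⟨ cong₂ _*_ (sym (^-distrib (j ^ j) (powProd js) m)) (sym (ℕP.^-distribˡ-+-* (m !) j (sum js))) ⟩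
  (j ^ j * powProd js) ^ m * (m !) ^ (j + sum js)                    ∎
  where
  open ℕP.≤-Reasoning
  lem : ∀ a b c d → a * b * (c * d) ≡ a * c * (b * d)
  lem = ℕSolver.solve-∀

factProd-lower : ∀ m js → 1 ≤ m → powProd js ^ m * (m !) ^ sum js ≤ factProd m js * linProd m js
factProd-lower m [] _ = ℕP.≤-reflexive (trans (ℕP.*-identityʳ (1 ^ m)) (ℕP.^-zeroˡ m))
factProd-lower m@(suc m′) (j ∷ js) 1≤m = begin
  (j ^ j * powProd js) ^ m * (m !) ^ (j + sum js)                    ≡⟨ cong₂ _*_ (^-distrib (j ^ j) (powProd js) m) (ℕP.^-distribˡ-+-* (m !) j (sum js)) ⟩
  (j ^ j) ^ m * powProd js ^ m * ((m !) ^ j * (m !) ^ sum js)        ≡⟨ lem ((j ^ j) ^ m) (powProd js ^ m) ((m !) ^ j) ((m !) ^ sum js) ⟩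
  (j ^ j) ^ m * (m !) ^ j * (powProd js ^ m * (m !) ^ sum js)        ≤⟨ ℕP.*-mono-≤ (fact-lower j m′) (factProd-lower m js 1≤m) ⟩
  (j * m) ! * (j * m) ^ j * (factProd m js * linProd m js)           ≡⟨ lem ((j * m) !) ((j * m) ^ j) (factProd m js) (linProd m js) ⟩
  (j * m) ! * factProd m js * ((j * m) ^ j * linProd m js)           ∎
  where
  open ℕP.≤-Reasoning
  lem : ∀ a b c d → a * b * (c * d) ≡ a * c * (b * d)
  lem = ℕSolver.solve-∀

-- Equal sums cancel the powers of `m!`, which leaves the `m`th power of one numerical inequality
-- between products of `j^j`.
balanced : ∀ m P M x y → 1 ≤ m → sum P ≡ sum M → powProd P * x ≤ powProd M * y → factProd m P * x ^ m ≤ linProd m M * (factProd m M * y ^ m)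
balanced m P M x y 1≤m eq le = begin
  factProd m P * x ^ m                                     ≤⟨ ℕP.*-monoˡ-≤ (x ^ m) (factProd-upper m P) ⟩
  powProd P ^ m * (m !) ^ sum P * x ^ m                    ≡⟨ l₁ (powProd P ^ m) ((m !) ^ sum P) (x ^ m) ⟩
  powProd P ^ m * x ^ m * (m !) ^ sum P                    ≡⟨ cong₂ _*_ (sym (^-distrib (powProd P) x m)) (cong ((m !) ^_) eq) ⟩
  (powProd P * x) ^ m * (m !) ^ sum M                      ≤⟨ ℕP.*-monoˡ-≤ ((m !) ^ sum M) (ℕP.^-monoˡ-≤ m le) ⟩
  (powProd M * y) ^ m * (m !) ^ sum M                      ≡⟨ cong (_* (m !) ^ sum M) (^-distrib (powProd M) y m) ⟩
  powProd M ^ m * y ^ m * (m !) ^ sum M                    ≡⟨ l₁ (powProd M ^ m) (y ^ m) ((m !) ^ sum M) ⟩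
  powProd M ^ m * (m !) ^ sum M * y ^ m                    ≤⟨ ℕP.*-monoˡ-≤ (y ^ m) (factProd-lower m M 1≤m) ⟩
  factProd m M * linProd m M * y ^ m                       ≡⟨ l₂ (factProd m M) (linProd m M) (y ^ m) ⟩
  linProd m M * (factProd m M * y ^ m)                     ∎
  where
  open ℕP.≤-Reasoning
  l₁ : ∀ a b c → a * b * c ≡ a * c * b
  l₁ = ℕSolver.solve-∀
  l₂ : ∀ a b c → a * b * c ≡ b * (a * c)
  l₂ = ℕSolver.solve-∀

-- The factorials of `L! * Gn L / Gd L`, as identified in `G-ratio`.
upper₀ lower₀ : List ℕ
upper₀ = 24 ∷ 72 ∷ 24 ∷ 24 ∷ 25 ∷ 26 ∷ 27 ∷ 28 ∷ 29 ∷ []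
lower₀ = 48 ∷ 48 ∷ 48 ∷ 47 ∷ 46 ∷ 45 ∷ 44 ∷ 43 ∷ []

factProd-++ : ∀ m js ks → factProd m (js ++ ks) ≡ factProd m js * factProd m ks
factProd-++ m [] ks = sym (ℕP.+-identityʳ (factProd m ks))
factProd-++ m (j ∷ js) ks = trans (cong ((j * m) ! *_) (factProd-++ m js ks)) (sym (ℕP.*-assoc ((j * m) !) (factProd m js) (factProd m ks)))

-- The single numerical estimate of the size: `4^8` comes from the eighth power of the lcm,
-- `(24/23)^24` from `Peak`, and the 2 is the exponential gain that remains.
numeric : ∀ m → 1 ≤ m → factProd m (plus ++ upper₀) * (4 ^ 8 * 2 * 24 ^ 24) ^ m ≤ linProd m (minus ++ lower₀) * (factProd m (minus ++ lower₀) * (23 ^ 24) ^ m)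
numeric m 1≤m = balanced m (plus ++ upper₀) (minus ++ lower₀) (4 ^ 8 * 2 * 24 ^ 24) (23 ^ 24) 1≤m refl (ℕP.≤ᵇ⇒≤ _ _ tt)

module Assembled (m : ℕ) (10≤m : 10 ≤ m) where
  open Size m 10≤m

  fact-Bk : ∀ e w → ((24 + e) * m) ! * Bk e w L ≡ ((24 + e + w) * m) !
  fact-Bk e w = trans (cong (λ z → ((24 + e) * m) ! * rise (suc z) (w * m)) (sym (ℕP.*-distribʳ-+ m 24 e))) (trans (rise-fact ((24 + e) * m) (w * m)) (cong _! (sym (ℕP.*-distribʳ-+ m (24 + e) w))))

  fact-Gn : (48 * m) ! * Gn L ≡ (72 * m) !
  fact-Gn = trans (cong (λ z → (48 * m) ! * rise (suc z) L) (sym (ℕP.*-distribʳ-+ m 24 24))) (trans (rise-fact (48 * m) L) (cong _! (sym (ℕP.*-distribʳ-+ m 48 24))))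

  fact-R : (24 * m) ! * rise (suc L) L ≡ (48 * m) !
  fact-R = trans (rise-fact L L) (cong _! (sym (ℕP.*-distribʳ-+ m 24 24)))

  G-ratio : Gn L * factProd m lower₀ * L ! ≡ Gd L * factProd m upper₀
  G-ratio = sym (begin
    r * (r * (b₁ * (b₂ * (b₃ * (b₄ * b₅))))) * (f24 * (f72 * (f24 * (f24 * (f25 * (f26 * (f27 * (f28 * (f29 * 1)))))))))
      ≡⟨ lem r b₁ b₂ b₃ b₄ b₅ f24 f72 f25 f26 f27 f28 f29 ⟩
    f24 * (f72 * ((f24 * r) * ((f24 * r) * ((f25 * b₁) * ((f26 * b₂) * ((f27 * b₃) * ((f28 * b₄) * (f29 * b₅))))))))
      ≡⟨ cong₂ (λ x y → f24 * (x * y)) (sym fact-Gn) (cong₂ _*_ fact-R (cong₂ _*_ fact-R (cong₂ _*_ (fact-Bk 1 22) (cong₂ _*_ (fact-Bk 2 20) (cong₂ _*_ (fact-Bk 3 18) (cong₂ _*_ (fact-Bk 4 16) (fact-Bk 5 14))))))) ⟩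
    f24 * (f48 * Gn L * (f48 * (f48 * (f47 * (f46 * (f45 * (f44 * f43)))))))
      ≡⟨ lem₂ f24 f48 (Gn L) f47 f46 f45 f44 f43 ⟩
    Gn L * (f48 * (f48 * (f48 * (f47 * (f46 * (f45 * (f44 * (f43 * 1)))))))) * f24 ∎)
    where
    open ≡-Reasoning
    r = rise (suc L) L
    b₁ = Bk 1 22 L
    b₂ = Bk 2 20 L
    b₃ = Bk 3 18 L
    b₄ = Bk 4 16 L
    b₅ = Bk 5 14 L
    f24 = (24 * m) !
    f25 = (25 * m) !
    f26 = (26 * m) !
    f27 = (27 * m) !
    f28 = (28 * m) !
    f29 = (29 * m) !
    f43 = (43 * m) !
    f44 = (44 * m) !
    f45 = (45 * m) !
    f46 = (46 * m) !
    f47 = (47 * m) !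
    f48 = (48 * m) !
    f72 = (72 * m) !
    lem : ∀ r b₁ b₂ b₃ b₄ b₅ f24 f72 f25 f26 f27 f28 f29 → r * (r * (b₁ * (b₂ * (b₃ * (b₄ * b₅))))) * (f24 * (f72 * (f24 * (f24 * (f25 * (f26 * (f27 * (f28 * (f29 * 1)))))))))
      ≡ f24 * (f72 * ((f24 * r) * ((f24 * r) * ((f25 * b₁) * ((f26 * b₂) * ((f27 * b₃) * ((f28 * b₄) * (f29 * b₅))))))))
    lem = ℕSolver.solve-∀
    lem₂ : ∀ f24 f48 g f47 f46 f45 f44 f43 → f24 * (f48 * g * (f48 * (f48 * (f47 * (f46 * (f45 * (f44 * f43))))))) ≡ g * (f48 * (f48 * (f48 * (f47 * (f46 * (f45 * (f44 * (f43 * 1)))))))) * f24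
    lem₂ = ℕSolver.solve-∀

-- Comparison of the model with the true zeros and poles.

rise-length : ∀ x {L L′} → 0 < x → L ≤ L′ → rise x L ≤ rise x L′
rise-length x {L′ = L′} 0<x z≤n = rise-pos x L′ 0<x
rise-length x 0<x (s≤s le) = ℕP.*-monoʳ-≤ x (rise-length (suc x) (s≤s z≤n) le)

rise-double : ∀ x y r → y ≤ 2 * x → rise y r ≤ 2 ^ r * rise x r
rise-double x y zero le = ℕP.≤-refl
rise-double x y (suc r) le = begin
  y * rise (suc y) r                  ≤⟨ ℕP.*-mono-≤ le (rise-double (suc x) (suc y) r (ℕP.≤-trans (s≤s le) (subst (suc (2 * x) ≤_) (l x) (ℕP.n≤1+n (suc (2 * x)))))) ⟩
  2 * x * (2 ^ r * rise (suc x) r)    ≡⟨ l₂ x (2 ^ r) (rise (suc x) r) ⟩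
  2 ^ suc r * (x * rise (suc x) r)    ∎
  where
  open ℕP.≤-Reasoning
  l : ∀ x → suc (suc (2 * x)) ≡ 2 * suc x
  l = ℕSolver.solve-∀
  l₂ : ∀ x a b → 2 * x * (a * b) ≡ 2 * a * (x * b)
  l₂ = ℕSolver.solve-∀

abstract
  -- A bound for `2^r` uniform in `r`, opaque so that the numeral is not expanded.
  2²⁴ : ℕ
  2²⁴ = 2 ^ 24

  2^r≤2²⁴ : ∀ {r} → r ≤ 23 → 2 ^ r ≤ 2²⁴
  2^r≤2²⁴ le = ℕP.^-monoʳ-≤ 2 (ℕP.m≤n⇒m≤1+n le)

zeroProduct : ℕ → ℕ → ℕ → ℕ
zeroProduct m r v = rise v (24 * m) * rise (suc (24 * m + v + (24 * m + r))) (24 * m)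

poleBlock : ℕ → ℕ → ℕ → ℕ → ℕ
poleBlock m r t e = rise (t + e * m) ((24 ∸ 2 * e) * m + r + 1)

poleProduct : ℕ → ℕ → ℕ → ℕ
poleProduct m r t = let R = rise (suc t) (24 * m + r ∸ 1) in
  R * (R * (poleBlock m r t 1 * (poleBlock m r t 2 * (poleBlock m r t 3 * (poleBlock m r t 4 * poleBlock m r t 5)))))

module Natural (m : ℕ) (10≤m : 10 ≤ m) where
  open Size m 10≤m
  open Assembled m 10≤m

  fact-pos : ∀ js → 0 < factProd m js
  fact-pos [] = s≤s z≤n
  fact-pos (j ∷ js) = ℕP.*-mono-≤ (ℕP.1≤n! (j * m)) (fact-pos js)

  core : ∀ v → factProd m plus * (4 ^ 8 * 2) ^ m * (rise v L * Gn (L + v)) ≤ linProd m (minus ++ lower₀) * (factProd m minus * Gd (L + v))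
  core v = ℕP.*-cancelʳ-≤ _ _ X₀ {{ℕ.>-nonZero (ℕP.*-mono-≤ (ℕP.*-mono-≤ (ℕP.m^n>0 23 L) (Gd-pos L)) (fact-pos lower₀))}} (begin
    A * S * (rv * gn) * (p23 * gdL * Lo)                 ≡⟨ l₁ A S rv gn p23 gdL Lo ⟩
    A * S * (rv * p23 * (gn * gdL)) * Lo                 ≤⟨ ℕP.*-monoˡ-≤ Lo (ℕP.*-monoʳ-≤ (A * S) (peak v)) ⟩
    A * S * (L ! * p24 * (gnL * gd)) * Lo                ≡⟨ l₂ A S (L !) p24 gnL gd Lo ⟩
    A * (S * p24) * gd * (gnL * Lo * L !)                ≡⟨ cong (A * (S * p24) * gd *_) G-ratio ⟩
    A * (S * p24) * gd * (gdL * Up)                      ≡⟨ l₃ A (S * p24) gd gdL Up ⟩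
    A * Up * (S * p24) * (gd * gdL)                      ≤⟨ ℕP.*-monoˡ-≤ (gd * gdL) num ⟩
    lin₀ * (B * Lo * p23) * (gd * gdL)                   ≡⟨ l₄ lin₀ B Lo p23 gd gdL ⟩
    lin₀ * (B * gd) * (p23 * gdL * Lo)                   ∎)
    where
    open ℕP.≤-Reasoning
    A B Lo Up S p23 p24 lin₀ rv gn gd gnL gdL X₀ : ℕ
    A = factProd m plus
    B = factProd m minus
    Lo = factProd m lower₀
    Up = factProd m upper₀
    S = (4 ^ 8 * 2) ^ m
    p23 = 23 ^ L
    p24 = 24 ^ L
    lin₀ = linProd m (minus ++ lower₀)
    rv = rise v L
    gn = Gn (L + v)
    gd = Gd (L + v)
    gnL = Gn L
    gdL = Gd L
    X₀ = p23 * gdL * Lo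
    powers : ∀ a c k → (a * c ^ k) ^ m ≡ a ^ m * c ^ (k * m)
    powers a c k = trans (^-distrib a (c ^ k) m) (cong (a ^ m *_) (ℕP.^-*-assoc c k m))
    num : A * Up * (S * p24) ≤ lin₀ * (B * Lo * p23)
    num = subst₂ _≤_ (cong₂ _*_ (factProd-++ m plus upper₀) (powers (4 ^ 8 * 2) 24 24)) (cong (lin₀ *_) (cong₂ _*_ (factProd-++ m minus lower₀) (ℕP.^-*-assoc 23 24 m))) (numeric m 0<m)
    l₁ : ∀ A S rv gn p g Lo → A * S * (rv * gn) * (p * g * Lo) ≡ A * S * (rv * p * (gn * g)) * Lo
    l₁ = ℕSolver.solve-∀
    l₂ : ∀ A S f p g h Lo → A * S * (f * p * (g * h)) * Lo ≡ A * (S * p) * h * (g * Lo * f)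
    l₂ = ℕSolver.solve-∀
    l₃ : ∀ A S g h U → A * S * g * (h * U) ≡ A * U * S * (g * h)
    l₃ = ℕSolver.solve-∀
    l₄ : ∀ l B Lo p g h → l * (B * Lo * p) * (g * h) ≡ l * (B * g) * (p * h * Lo)
    l₄ = ℕSolver.solve-∀

  module _ (r v : ℕ) (1≤r : 1 ≤ r) (r≤23 : r ≤ 23) where

    t x : ℕ
    t = L + v
    x = suc (t + L)

    -- The true right zeros begin `r` places later than those of `Gn`. The overlap cancels and
    -- leaves two products of length `r`, whose quotient is at most `2^r`.
    right-zeros : rise (suc (t + (L + r))) L ≤ 2²⁴ * Gn t
    right-zeros = ℕP.*-cancelʳ-≤ _ _ (rise x r) {{ℕ.>-nonZero (rise-pos x r (s≤s z≤n))}} (begin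
      rise (suc (t + (L + r))) L * rise x r       ≡⟨ cong (λ z → rise (suc z) L * rise x r) (sym (ℕP.+-assoc t L r)) ⟩
      rise (x + r) L * rise x r                   ≡⟨ ℕP.*-comm (rise (x + r) L) (rise x r) ⟩
      rise x r * rise (x + r) L                   ≡⟨ rise-+ x r L ⟨
      rise x (r + L)                              ≡⟨ cong (rise x) (ℕP.+-comm r L) ⟩
      rise x (L + r)                              ≡⟨ rise-+ x L r ⟩
      rise x L * rise (x + L) r                   ≤⟨ ℕP.*-monoʳ-≤ (rise x L) (rise-double x (x + L) r (subst (x + L ≤_) (cong (λ z → x + z) (sym (ℕP.+-identityʳ x))) (ℕP.+-monoʳ-≤ x (ℕP.≤-trans (ℕP.m≤n+m L t) (ℕP.n≤1+n (t + L)))))) ⟩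
      rise x L * (2 ^ r * rise x r)               ≤⟨ ℕP.*-monoʳ-≤ (rise x L) (ℕP.*-monoˡ-≤ (rise x r) (2^r≤2²⁴ r≤23)) ⟩
      rise x L * (2²⁴ * rise x r)              ≡⟨ l (rise x L) (2²⁴) (rise x r) ⟩
      2²⁴ * Gn t * rise x r                    ∎)
      where
      open ℕP.≤-Reasoning
      l : ∀ a c b → a * (c * b) ≡ c * a * b
      l = ℕSolver.solve-∀

    0<t : 0 < t
    0<t = ℕP.≤-trans 0<m (ℕP.≤-trans (ℕP.m≤n*m m 24) (ℕP.m≤m+n L v))

    pole-block : ∀ e w → 24 ∸ 2 * e ≡ w → Bk e w t ≤ poleBlock m r t e
    pole-block e w refl = begin
      rise (suc (t + e * m)) (w * m)                      ≤⟨ rise-length (suc (t + e * m)) (s≤s z≤n) (ℕP.m≤m+n (w * m) r) ⟩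
      rise (suc (t + e * m)) (w * m + r)                  ≤⟨ ℕP.m≤n*m _ (t + e * m) {{ℕ.>-nonZero (ℕP.≤-trans 0<t (ℕP.m≤m+n t (e * m)))}} ⟩
      (t + e * m) * rise (suc (t + e * m)) (w * m + r)    ≡⟨ cong (rise (t + e * m)) (ℕP.+-comm 1 (w * m + r)) ⟩
      rise (t + e * m) (w * m + r + 1)                    ∎
      where open ℕP.≤-Reasoning

    -- The first factor `t + 5 m` of the last block, absent from `Gd`, supplies the extra `t` that
    -- later makes the series over `t` converge.
    poles : t * Gd t ≤ poleProduct m r t
    poles = subst (_≤ poleProduct m r t) (l (rise (suc t) L) (Bk 1 22 t) (Bk 2 20 t) (Bk 3 18 t) (Bk 4 16 t) t (Bk 5 14 t)) (ℕP.*-mono-≤ inner-le (ℕP.*-mono-≤ inner-le (ℕP.*-mono-≤ (pole-block 1 22 refl) (ℕP.*-mono-≤ (pole-block 2 20 refl) (ℕP.*-mono-≤ (pole-block 3 18 refl) (ℕP.*-mono-≤ (pole-block 4 16 refl) last-block))))))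
      where
      l : ∀ r a b c d t e → r * (r * (a * (b * (c * (d * (t * e)))))) ≡ t * (r * (r * (a * (b * (c * (d * e))))))
      l = ℕSolver.solve-∀
      last-block : t * Bk 5 14 t ≤ poleBlock m r t 5
      last-block = subst (t * Bk 5 14 t ≤_) (cong (rise (t + 5 * m)) (ℕP.+-comm 1 (14 * m + r))) (ℕP.*-mono-≤ (ℕP.m≤m+n t (5 * m)) (rise-length (suc (t + 5 * m)) (s≤s z≤n) (ℕP.m≤m+n (14 * m) r)))
      inner-le : rise (suc t) L ≤ rise (suc t) (L + r ∸ 1)
      inner-le = rise-length (suc t) (s≤s z≤n) (subst (L ≤_) (sym (ℕP.+-∸-assoc L 1≤r)) (ℕP.m≤m+n L (r ∸ 1)))

    natural-size : factProd m plus * (4 ^ 8 * 2) ^ m * (zeroProduct m r v * t) ≤ 2²⁴ * linProd m (minus ++ lower₀) * (factProd m minus * poleProduct m r t)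
    natural-size = begin
      A * S * (rise v L * rise (suc (t + (L + r))) L * t) ≤⟨ ℕP.*-monoʳ-≤ (A * S) (ℕP.*-monoˡ-≤ t (ℕP.*-monoʳ-≤ (rise v L) right-zeros)) ⟩
      A * S * (rise v L * (c * Gn t) * t)                 ≡⟨ l₁ (A * S) (rise v L) c (Gn t) t ⟩
      c * (A * S * (rise v L * Gn t)) * t                 ≤⟨ ℕP.*-monoˡ-≤ t (ℕP.*-monoʳ-≤ c (core v)) ⟩
      c * (lin₀ * (B * Gd t)) * t                         ≡⟨ l₂ c lin₀ B (Gd t) t ⟩
      c * (lin₀ * (B * (t * Gd t)))                       ≤⟨ ℕP.*-monoʳ-≤ c (ℕP.*-monoʳ-≤ lin₀ (ℕP.*-monoʳ-≤ B poles)) ⟩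
      c * (lin₀ * (B * poleProduct m r t))                ≡⟨ ℕP.*-assoc c lin₀ _ ⟨
      c * lin₀ * (B * poleProduct m r t)                  ∎
      where
      open ℕP.≤-Reasoning
      A B S c lin₀ : ℕ
      A = factProd m plus
      B = factProd m minus
      S = (4 ^ 8 * 2) ^ m
      c = 2²⁴
      lin₀ = linProd m (minus ++ lower₀)
      l₁ : ∀ a r c g t → a * (r * (c * g) * t) ≡ c * (a * (r * g)) * t
      l₁ = ℕSolver.solve-∀
      l₂ : ∀ c l b g t → c * (l * (b * g)) * t ≡ c * (l * (b * (t * g)))
      l₂ = ℕSolver.solve-∀

^ℚ-nonneg : ∀ {x} n → 0ℚ ≤ℚ x → 0ℚ ≤ℚ x ^ℚ n
^ℚ-nonneg zero _ = ℚP.<⇒≤ 0<1ℚ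
^ℚ-nonneg (suc n) h = 0≤⊗ h (^ℚ-nonneg n h)

^ℚ-mono : ∀ {x y} n → 0ℚ ≤ℚ x → x ≤ℚ y → x ^ℚ n ≤ℚ y ^ℚ n
^ℚ-mono zero _ _ = ℚP.≤-refl
^ℚ-mono (suc n) 0≤x le = ⊗-mono-≤ 0≤x (^ℚ-nonneg n (ℚP.≤-trans 0≤x le)) le (^ℚ-mono n 0≤x le)

fact>0 : ∀ n → 0 < n !
fact>0 n = ℕP.1≤n! n

0<central : ∀ k → 0ℚ <ℚ central k
0<central k = 0<⊗ (0<ν (fact>0 (2 * k))) (0<⊗ (0<inv (0<ν (fact>0 k))) (0<inv (0<ν (fact>0 k))))

central≤ : ∀ k → central k ≤ℚ ν (4 ^ k)
central≤ k = ℚP.≤-trans (ℚP.*-monoʳ-≤-nonNeg (i ⊗ i) {{ℚ.nonNegative (0≤⊗ 0≤i 0≤i)}} (ν-mono-≤ le)) (ℚP.≤-reflexive (begin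
  ν (4 ^ k * (k ! * k !)) ⊗ (i ⊗ i)              ≡⟨ cong (_⊗ (i ⊗ i)) (trans (ν-* (4 ^ k) (k ! * k !)) (cong (ν (4 ^ k) ⊗_) (ν-* (k !) (k !)))) ⟩
  ν (4 ^ k) ⊗ (ν (k !) ⊗ ν (k !)) ⊗ (i ⊗ i)      ≡⟨ lem (ν (4 ^ k)) (ν (k !)) i ⟩
  ν (4 ^ k) ⊗ ((ν (k !) ⊗ i) ⊗ (ν (k !) ⊗ i))    ≡⟨ cong (λ z → ν (4 ^ k) ⊗ (z ⊗ z)) (inv-r (ν≢0 (fact>0 k))) ⟩
  ν (4 ^ k) ⊗ (1ℚ ⊗ 1ℚ)                          ≡⟨ ℚP.*-identityʳ (ν (4 ^ k)) ⟩
  ν (4 ^ k)                                      ∎))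
  where
  open ≡-Reasoning
  i = inv (ν (k !))
  0≤i = ℚP.<⇒≤ (0<inv (0<ν (fact>0 k)))
  le : (2 * k) ! ≤ 4 ^ k * (k ! * k !)
  le = subst (λ z → (2 * k) ! ≤ 4 ^ k * (k ! * z)) (ℕP.*-identityʳ (k !)) (fact-upper 2 k)
  lem : ∀ a b i → a ⊗ (b ⊗ b) ⊗ (i ⊗ i) ≡ a ⊗ ((b ⊗ i) ⊗ (b ⊗ i))
  lem = solve-∀ ℚ-ring

0≤lcmBound : ∀ n s → 0ℚ ≤ℚ lcmBound n s
0≤lcmBound zero s = ℚP.<⇒≤ 0<1ℚ
0≤lcmBound (suc n) zero = ℚP.<⇒≤ 0<1ℚ
0≤lcmBound (suc n) (suc zero) = ℚP.<⇒≤ 0<1ℚ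
0≤lcmBound (suc n) s@(suc (suc _)) = 0≤⊗ (ℚP.<⇒≤ (0<central ℕ.⌈ s /2⌉)) (0≤lcmBound n ℕ.⌈ s /2⌉)

-- Each halving with rounding up may cost a factor 4; since `2 (⌈s/2⌉ - 1) ≤ s - 1`, the square of
-- `s - 1` grows fourfold and pays for it.
lcmPoly : ℕ → ℕ
lcmPoly s = 4 * ((s ∸ 1) * (s ∸ 1))

1≤ν : ∀ {n} → 1 ≤ n → 1ℚ ≤ℚ ν n
1≤ν {n} le = subst (_≤ℚ ν n) ι-1 (ν-mono-≤ le)

lcmBound≤ : ∀ n s → 2 ≤ s → lcmBound n s ≤ℚ ν (4 ^ s * lcmPoly s)
lcmBound≤ n (suc zero) (s≤s ())
lcmBound≤ zero (suc (suc s)) _ = 1≤ν (ℕP.*-mono-≤ (ℕP.m^n>0 4 (2 + s)) (s≤s z≤n))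
lcmBound≤ (suc n) s@(suc (suc s′)) _ = go ℕ.⌈ s /2⌉ refl
  where
  go : ∀ k → k ≡ ℕ.⌈ s /2⌉ → central k ⊗ lcmBound n k ≤ℚ ν (4 ^ s * lcmPoly s)
  go zero ()
  go (suc zero) e = ℚP.≤-trans (subst (λ z → central 1 ⊗ z ≤ℚ ν 4) (sym (one n)) (subst (_≤ℚ ν 4) (sym (ℚP.*-identityʳ (central 1))) (central≤ 1))) (ν-mono-≤ (ℕP.*-mono-≤ {1} (ℕP.m^n>0 4 s) (ℕP.*-monoʳ-≤ 4 {1} (s≤s z≤n))))
    where
    one : ∀ n → lcmBound n 1 ≡ 1ℚ
    one zero = refl
    one (suc n) = refl
  go k@(suc (suc k′)) e = ℚP.≤-trans (⊗-mono-≤ (ℚP.<⇒≤ (0<central k)) (0≤ν _) (central≤ k) (lcmBound≤ n k (s≤s (s≤s z≤n)))) (subst (_≤ℚ ν (4 ^ s * lcmPoly s)) (ν-* (4 ^ k) (4 ^ k * lcmPoly k)) (ν-mono-≤ le))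
    where
    open ℕP.≤-Reasoning
    ceil≤ : ∀ s → ℕ.⌈ s /2⌉ + ℕ.⌈ s /2⌉ ≤ suc s
    ceil≤ zero = z≤n
    ceil≤ (suc zero) = ℕP.≤-refl
    ceil≤ (suc (suc s)) = s≤s (subst (_≤ suc (suc s)) (sym (ℕP.+-suc ℕ.⌈ s /2⌉ ℕ.⌈ s /2⌉)) (s≤s (ceil≤ s)))
    2k≤ : k + k ≤ suc s
    2k≤ = subst (λ z → z + z ≤ suc s) (sym e) (ceil≤ s)
    twice : 2 * suc k′ ≤ suc s′
    twice = ℕP.≤-pred (ℕP.≤-pred (subst (_≤ suc s) (l k′) 2k≤))
      where
      l : ∀ k → suc (suc k) + suc (suc k) ≡ suc (suc (2 * suc k))
      l = ℕSolver.solve-∀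
    le : 4 ^ k * (4 ^ k * lcmPoly k) ≤ 4 ^ s * lcmPoly s
    le = begin
      4 ^ k * (4 ^ k * lcmPoly k)                    ≡⟨ ℕP.*-assoc (4 ^ k) (4 ^ k) (lcmPoly k) ⟨
      4 ^ k * 4 ^ k * lcmPoly k                      ≡⟨ cong (_* lcmPoly k) (ℕP.^-distribˡ-+-* 4 k k) ⟨
      4 ^ (k + k) * lcmPoly k                        ≤⟨ ℕP.*-monoˡ-≤ (lcmPoly k) (ℕP.^-monoʳ-≤ 4 2k≤) ⟩
      4 * 4 ^ s * (4 * (suc k′ * suc k′))            ≡⟨ l (4 ^ s) (suc k′) ⟩
      4 ^ s * (4 * (2 * suc k′ * (2 * suc k′)))      ≤⟨ ℕP.*-monoʳ-≤ (4 ^ s) (ℕP.*-monoʳ-≤ 4 (ℕP.*-mono-≤ twice twice)) ⟩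
      4 ^ s * lcmPoly s                              ∎
      where
      l : ∀ a k → 4 * a * (4 * (k * k)) ≡ a * (4 * (2 * k * (2 * k)))
      l = ℕSolver.solve-∀

poly-lcmPoly : PolyBounded lcmPoly
poly-lcmPoly = poly-* (poly-const 4) (poly-* pred pred)
  where
  pred : PolyBounded (λ s → s ∸ 1)
  pred = 1 , 1 , λ m _ → ℕP.≤-trans (ℕP.m∸n≤m m 1) (ℕP.≤-reflexive (sym (trans (ℕP.*-identityˡ (m * 1)) (ℕP.*-identityʳ m))))

sizePoly : ℕ → ℕ
sizePoly m = 2²⁴ * linProd m (minus ++ lower₀) * (lcmPoly m ^ 8 * tieAll m 72 ^ 26)

poly-sizePoly : PolyBounded sizePoly
poly-sizePoly = poly-* (poly-* (poly-const (2²⁴)) (poly-linProd (minus ++ lower₀))) (poly-* (poly-^ 8 poly-lcmPoly) (poly-^ 26 (poly-tieAll 72)))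

sizeBound : ∀ m r v → 10 ≤ m → 1 ≤ r → r ≤ 23 →
  baseMultiplier m ⊗ (ν (2 ^ m) ⊗ ν (zeroProduct m r v * (24 * m + v))) ≤ℚ ν (sizePoly m) ⊗ ν (poleProduct m r (24 * m + v))
sizeBound m r v 10≤m 1≤r r≤23 = ℚP.≤-trans step₁ (subst₂ _≤ℚ_ eq₁ eq₂ step₂)
  where
  A B c q ti Z Dn : ℕ
  A = factProd m plus
  B = factProd m minus
  c = 2²⁴ * linProd m (minus ++ lower₀)
  q = lcmPoly m ^ 8
  ti = tieAll m 72 ^ 26
  Z = zeroProduct m r v * (24 * m + v)
  Dn = poleProduct m r (24 * m + v)
  iB = inv (ν B)
  0<B : 0ℚ <ℚ ν B
  0<B = 0<ν (Natural.fact-pos m 10≤m minus)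
  0≤iB = ℚP.<⇒≤ (0<inv 0<B)
  V≤ : lcmBound m m ^ℚ 8 ≤ℚ ν ((4 ^ 8) ^ m * q)
  V≤ = subst (lcmBound m m ^ℚ 8 ≤ℚ_) (trans (sym (ν-^ (4 ^ m * lcmPoly m) 8)) (cong ν (trans (^-distrib (4 ^ m) (lcmPoly m) 8) (cong (_* q) (trans (ℕP.^-*-assoc 4 m 8) (trans (cong (4 ^_) (ℕP.*-comm m 8)) (sym (ℕP.^-*-assoc 4 8 m))))))))
    (^ℚ-mono 8 (0≤lcmBound m m) (lcmBound≤ m m (ℕP.≤-trans (s≤s (s≤s z≤n)) 10≤m)))
  E = (4 ^ 8) ^ m
  step₁ : baseMultiplier m ⊗ (ν (2 ^ m) ⊗ ν Z) ≤ℚ ν A ⊗ iB ⊗ (ν (E * q) ⊗ ν (tieAll m 72) ^ℚ 26) ⊗ (ν (2 ^ m) ⊗ ν Z)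
  step₁ = ℚP.*-monoʳ-≤-nonNeg (ν (2 ^ m) ⊗ ν Z) {{ℚ.nonNegative (0≤⊗ (0≤ν (2 ^ m)) (0≤ν Z))}} (⊗-monoˡ (0≤⊗ (0≤ν A) 0≤iB) (ℚP.*-monoʳ-≤-nonNeg (ν (tieAll m 72) ^ℚ 26) {{ℚ.nonNegative (^ℚ-nonneg 26 (0≤ν (tieAll m 72)))}} V≤))
  step₂ : iB ⊗ (ν (q * ti) ⊗ ν (A * (4 ^ 8 * 2) ^ m * Z)) ≤ℚ iB ⊗ (ν (q * ti) ⊗ ν (c * (B * Dn)))
  step₂ = ⊗-monoˡ 0≤iB (⊗-monoˡ (0≤ν (q * ti)) (ν-mono-≤ (Natural.natural-size m 10≤m r v 1≤r r≤23)))
  open ≡-Reasoning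
  eq₁ : iB ⊗ (ν (q * ti) ⊗ ν (A * (4 ^ 8 * 2) ^ m * Z)) ≡ ν A ⊗ iB ⊗ (ν (E * q) ⊗ ν (tieAll m 72) ^ℚ 26) ⊗ (ν (2 ^ m) ⊗ ν Z)
  eq₁ = begin
    iB ⊗ (ν (q * ti) ⊗ ν (A * (4 ^ 8 * 2) ^ m * Z))
      ≡⟨ cong₂ (λ x y → iB ⊗ (x ⊗ y)) (ν-* q ti) (trans (ν-* (A * (4 ^ 8 * 2) ^ m) Z) (cong (_⊗ ν Z) (trans (ν-* A ((4 ^ 8 * 2) ^ m)) (cong (ν A ⊗_) (trans (cong ν (^-distrib (4 ^ 8) 2 m)) (ν-* E (2 ^ m))))))) ⟩
    iB ⊗ (ν q ⊗ ν ti ⊗ (ν A ⊗ (ν E ⊗ ν (2 ^ m)) ⊗ ν Z))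
      ≡⟨ lem iB (ν q) (ν ti) (ν A) (ν E) (ν (2 ^ m)) (ν Z) ⟩
    ν A ⊗ iB ⊗ (ν E ⊗ ν q ⊗ ν ti) ⊗ (ν (2 ^ m) ⊗ ν Z)
      ≡⟨ cong₂ (λ x y → ν A ⊗ iB ⊗ (x ⊗ y) ⊗ (ν (2 ^ m) ⊗ ν Z)) (sym (ν-* E q)) (ν-^ (tieAll m 72) 26) ⟩
    ν A ⊗ iB ⊗ (ν (E * q) ⊗ ν (tieAll m 72) ^ℚ 26) ⊗ (ν (2 ^ m) ⊗ ν Z) ∎
    where
    lem : ∀ i q t a e s z → i ⊗ (q ⊗ t ⊗ (a ⊗ (e ⊗ s) ⊗ z)) ≡ a ⊗ i ⊗ (e ⊗ q ⊗ t) ⊗ (s ⊗ z)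
    lem = solve-∀ ℚ-ring
  eq₂ : iB ⊗ (ν (q * ti) ⊗ ν (c * (B * Dn))) ≡ ν (sizePoly m) ⊗ ν Dn
  eq₂ = begin
    iB ⊗ (ν (q * ti) ⊗ ν (c * (B * Dn)))          ≡⟨ cong (λ x → iB ⊗ (ν (q * ti) ⊗ x)) (trans (ν-* c (B * Dn)) (cong (ν c ⊗_) (ν-* B Dn))) ⟩
    iB ⊗ (ν (q * ti) ⊗ (ν c ⊗ (ν B ⊗ ν Dn)))      ≡⟨ lem iB (ν (q * ti)) (ν c) (ν B) (ν Dn) ⟩
    ν B ⊗ iB ⊗ (ν c ⊗ ν (q * ti) ⊗ ν Dn)          ≡⟨ cong₂ (λ x y → x ⊗ (y ⊗ ν Dn)) (inv-r (0<⇒≢0 0<B)) (sym (ν-* c (q * ti))) ⟩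
    1ℚ ⊗ (ν (c * (q * ti)) ⊗ ν Dn)                ≡⟨ ℚP.*-identityˡ (ν (c * (q * ti)) ⊗ ν Dn) ⟩
    ν (c * (q * ti)) ⊗ ν Dn                       ∎
    where
    lem : ∀ i q c b d → i ⊗ (q ⊗ (c ⊗ (b ⊗ d))) ≡ b ⊗ i ⊗ (c ⊗ q ⊗ d)
    lem = solve-∀ ℚ-ring

-- Taylor coefficients

absProd : ℤ → List ℤ → ℕ
absProd a [] = 1
absProd a (u ∷ us) = ∣ a +ℤ u ∣ℤ * absProd a us

absProd-++ : ∀ a xs ys → absProd a (xs ++ ys) ≡ absProd a xs * absProd a ys
absProd-++ a [] ys = sym (ℕP.+-identityʳ (absProd a ys))
absProd-++ a (x ∷ xs) ys = trans (cong (∣ a +ℤ x ∣ℤ *_) (absProd-++ a xs ys)) (sym (ℕP.*-assoc ∣ a +ℤ x ∣ℤ (absProd a xs) (absProd a ys)))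

absProd-rep : ∀ a n xs → absProd a (rep n xs) ≡ absProd a xs ^ n
absProd-rep a zero xs = refl
absProd-rep a (suc n) xs = trans (absProd-++ a xs (rep n xs)) (cong (absProd a xs *_) (absProd-rep a n xs))

absProd-up : ∀ a A L x → a +ℤ A ≡ + x → absProd a (range A L) ≡ rise x L
absProd-up a A zero x e = refl
absProd-up a A (suc L) x e = cong₂ _*_ (cong ∣_∣ℤ e) (absProd-up a (A +ℤ 1ℤ) L (suc x) (trans (sym (ℤP.+-assoc a A 1ℤ)) (trans (cong (_+ℤ 1ℤ) e) (trans (sym (ℤP.pos-+ x 1)) (cong +_ (ℕP.+-comm x 1))))))

absProd-down : ∀ a A L y → a +ℤ A ≡ 1ℤ -ℤ + (y + L) → absProd a (range A L) ≡ rise y L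
absProd-down a A zero y e = refl
absProd-down a A (suc L) y e = trans (cong₂ _*_ head (absProd-down a (A +ℤ 1ℤ) L y next)) (trans (ℕP.*-comm (y + L) (rise y L)) (sym (rise-last y L)))
  where
  e′ : a +ℤ A ≡ -ℤ + (y + L)
  e′ = trans e (trans (cong (λ z → 1ℤ -ℤ z) (trans (cong +_ (ℕP.+-suc y L)) (ℤP.pos-+ 1 (y + L)))) (lem (+ (y + L))))
    where
    lem : ∀ z → + 1 -ℤ (+ 1 +ℤ z) ≡ -ℤ z
    lem = ℤSolver.solve-∀
  head : ∣ a +ℤ A ∣ℤ ≡ y + L
  head = trans (cong ∣_∣ℤ e′) (ℤP.∣-i∣≡∣i∣ (+ (y + L)))
  next : a +ℤ (A +ℤ 1ℤ) ≡ 1ℤ -ℤ + (y + L)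
  next = trans (sym (ℤP.+-assoc a A 1ℤ)) (trans (cong (_+ℤ 1ℤ) e′) (ℤP.+-comm (-ℤ + (y + L)) 1ℤ))

-- Removes the factor `x^N` of `ev`; at a regular point nothing is lost.
dropped : ℕ → Series → Series
dropped N g i = g (N + i)

dropped-shiftMul : ∀ N d g i → OrderAtLeast N g → dropped N (shiftMul d g) i ≡ shiftMul d (dropped N g) i
dropped-shiftMul zero d g zero low = refl
dropped-shiftMul (suc N) d g zero low = trans (cong (d ⊗ g (suc (N + 0)) ⊕_) (low (N + 0) (s≤s (ℕP.≤-reflexive (ℕP.+-identityʳ N))))) (ℚP.+-identityʳ (d ⊗ g (suc (N + 0))))
dropped-shiftMul N d g (suc i) low = trans (cong (shiftMul d g) (ℕP.+-suc N i)) (cong (λ z → d ⊗ g z ⊕ g (N + i)) (sym (ℕP.+-suc N i)))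

-- The series is majorised by `(Q / P) / (1 - n x)`, with `n` the number of linear factors used so
-- far. Because every `|d| ≥ 1`, a Taylor coefficient of fixed degree exceeds the value only by a
-- power of `n`, which is polynomial in `m`.
Growth : ℕ → ℕ → ℕ → Series → Set
Growth P Q n h = ∀ i → ν P ⊗ ∣ h i ∣ℚ ≤ℚ ν (Q * n ^ i)

pow-step : ∀ n i → n ^ suc i + suc n ^ i ≤ suc n ^ suc i
pow-step n i = subst (n * n ^ i + suc n ^ i ≤_) (ℕP.+-comm (n * suc n ^ i) (suc n ^ i)) (ℕP.+-monoˡ-≤ (suc n ^ i) (ℕP.*-monoʳ-≤ n (ℕP.^-monoˡ-≤ i (ℕP.n≤1+n n))))

growth-div : ∀ {P Q n h h′} d → 1 ≤ ∣ d ∣ℤ → (∀ i → shiftMul (ι d) h′ i ≡ h i) → Growth P Q n h → Growth (∣ d ∣ℤ * P) Q (suc n) h′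
growth-div {P} {Q} {n} {h} {h′} d 1≤d eq gr = go
  where
  open ℚP.≤-Reasoning
  D = ∣ d ∣ℤ
  lem : ∀ a b c → a ⊗ b ⊗ c ≡ b ⊗ (a ⊗ c)
  lem = solve-∀ ℚ-ring
  pull : ∀ x → ν (D * P) ⊗ ∣ x ∣ℚ ≡ ν P ⊗ ∣ ι d ⊗ x ∣ℚ
  pull x = trans (cong (_⊗ ∣ x ∣ℚ) (ν-* D P)) (trans (lem (ν D) (ν P) ∣ x ∣ℚ) (cong (ν P ⊗_) (trans (cong (_⊗ ∣ x ∣ℚ) (sym (∣ι∣ d))) (sym (∣⊗∣ (ι d) x)))))
  go : Growth (D * P) Q (suc n) h′
  go zero = subst₂ _≤ℚ_ (trans (cong (λ z → ν P ⊗ ∣ z ∣ℚ) (sym (eq 0))) (sym (pull (h′ 0)))) refl (gr 0)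
  go (suc i) = begin
    ν (D * P) ⊗ ∣ h′ (suc i) ∣ℚ                            ≡⟨ pull (h′ (suc i)) ⟩
    ν P ⊗ ∣ ι d ⊗ h′ (suc i) ∣ℚ                            ≡⟨ cong (λ z → ν P ⊗ ∣ z ∣ℚ) (trans (lem₂ (ι d ⊗ h′ (suc i)) (h′ i)) (cong (_⊝ h′ i) (eq (suc i)))) ⟩
    ν P ⊗ ∣ h (suc i) ⊝ h′ i ∣ℚ                            ≤⟨ ⊗-monoˡ (0≤ν P) (ℚP.∣p-q∣≤∣p∣+∣q∣ (h (suc i)) (h′ i)) ⟩
    ν P ⊗ (∣ h (suc i) ∣ℚ ⊕ ∣ h′ i ∣ℚ)                     ≡⟨ ℚP.*-distribˡ-+ (ν P) ∣ h (suc i) ∣ℚ ∣ h′ i ∣ℚ ⟩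
    ν P ⊗ ∣ h (suc i) ∣ℚ ⊕ ν P ⊗ ∣ h′ i ∣ℚ                 ≤⟨ ⊕-mono (gr (suc i)) (ℚP.≤-trans (ℚP.*-monoʳ-≤-nonNeg ∣ h′ i ∣ℚ {{ℚP.∣-∣-nonNeg (h′ i)}} (ν-mono-≤ (subst (_≤ D * P) (ℕP.*-identityˡ P) (ℕP.*-monoˡ-≤ P 1≤d)))) (go i)) ⟩
    ν (Q * n ^ suc i) ⊕ ν (Q * suc n ^ i)                  ≡⟨ ν-+ (Q * n ^ suc i) (Q * suc n ^ i) ⟨
    ν (Q * n ^ suc i + Q * suc n ^ i)                      ≤⟨ ν-mono-≤ (subst (_≤ Q * suc n ^ suc i) (ℕP.*-distribˡ-+ Q (n ^ suc i) (suc n ^ i)) (ℕP.*-monoʳ-≤ Q (pow-step n i))) ⟩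
    ν (Q * suc n ^ suc i)                                  ∎
    where
    lem₂ : ∀ a b → a ≡ a ⊕ b ⊝ b
    lem₂ = solve-∀ ℚ-ring

growth-mul : ∀ {P Q n h} d → 1 ≤ ∣ d ∣ℤ → Growth P Q n h → Growth P (∣ d ∣ℤ * Q) (suc n) (shiftMul (ι d) h)
growth-mul {P} {Q} {n} {h} d 1≤d gr = go
  where
  open ℚP.≤-Reasoning
  D = ∣ d ∣ℤ
  lem : ∀ a b c → a ⊗ (b ⊗ c) ≡ b ⊗ (a ⊗ c)
  lem = solve-∀ ℚ-ring
  scaled : ∀ i → ν P ⊗ ∣ ι d ⊗ h i ∣ℚ ≤ℚ ν (D * (Q * n ^ i))
  scaled i = begin
    ν P ⊗ ∣ ι d ⊗ h i ∣ℚ          ≡⟨ cong (ν P ⊗_) (trans (∣⊗∣ (ι d) (h i)) (cong (_⊗ ∣ h i ∣ℚ) (∣ι∣ d))) ⟩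
    ν P ⊗ (ν D ⊗ ∣ h i ∣ℚ)        ≡⟨ lem (ν P) (ν D) ∣ h i ∣ℚ ⟩
    ν D ⊗ (ν P ⊗ ∣ h i ∣ℚ)        ≤⟨ ⊗-monoˡ (0≤ν D) (gr i) ⟩
    ν D ⊗ ν (Q * n ^ i)           ≡⟨ ν-* D (Q * n ^ i) ⟨
    ν (D * (Q * n ^ i))           ∎
  go : Growth P (D * Q) (suc n) (shiftMul (ι d) h)
  go zero = subst (ν P ⊗ ∣ ι d ⊗ h 0 ∣ℚ ≤ℚ_) (cong ν (sym (ℕP.*-assoc D Q 1))) (scaled 0)
  go (suc i) = begin
    ν P ⊗ ∣ ι d ⊗ h (suc i) ⊕ h i ∣ℚ                       ≤⟨ ⊗-monoˡ (0≤ν P) (ℚP.∣p+q∣≤∣p∣+∣q∣ (ι d ⊗ h (suc i)) (h i)) ⟩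
    ν P ⊗ (∣ ι d ⊗ h (suc i) ∣ℚ ⊕ ∣ h i ∣ℚ)                ≡⟨ ℚP.*-distribˡ-+ (ν P) ∣ ι d ⊗ h (suc i) ∣ℚ ∣ h i ∣ℚ ⟩
    ν P ⊗ ∣ ι d ⊗ h (suc i) ∣ℚ ⊕ ν P ⊗ ∣ h i ∣ℚ            ≤⟨ ⊕-mono (scaled (suc i)) (gr i) ⟩
    ν (D * (Q * n ^ suc i)) ⊕ ν (Q * n ^ i)                ≡⟨ ν-+ (D * (Q * n ^ suc i)) (Q * n ^ i) ⟨
    ν (D * (Q * n ^ suc i) + Q * n ^ i)                    ≤⟨ ν-mono-≤ nat ⟩
    ν (D * Q * suc n ^ suc i)                              ∎
    where
    nat : D * (Q * n ^ suc i) + Q * n ^ i ≤ D * Q * suc n ^ suc i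
    nat = ℕP.≤-trans (ℕP.+-mono-≤ (ℕP.≤-reflexive (sym (ℕP.*-assoc D Q (n ^ suc i)))) (ℕP.*-mono-≤ (subst (_≤ D * Q) (ℕP.*-identityˡ Q) (ℕP.*-monoˡ-≤ Q 1≤d)) (ℕP.^-monoˡ-≤ i (ℕP.n≤1+n n))))
      (subst (_≤ D * Q * suc n ^ suc i) (ℕP.*-distribˡ-+ (D * Q) (n ^ suc i) (suc n ^ i)) (ℕP.*-monoʳ-≤ (D * Q) (pow-step n i)))

1≤∣∣ : ∀ d → d ≢ 0ℤ → 1 ≤ ∣ d ∣ℤ
1≤∣∣ d ne = ℕP.n≢0⇒n>0 (λ e → ne (ℤP.∣i∣≡0⇒i≡0 e))

module Taylor (a : ℤ) (u₀ : ℤ) (us₀ : List ℤ) (regular : All (λ u → a +ℤ u ≢ 0ℤ) (u₀ ∷ us₀)) where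

  all-dens : List ℤ
  all-dens = u₀ ∷ us₀

  M : ℕ
  M = length all-dens

  low-pf : ∀ us f → All (λ u → a +ℤ u ≢ 0ℤ) us → All (Bounded us) f → All Proper f → OrderAtLeast M (ev a M f)
  low-pf us f reg bd pr i lt = lin-zero f (All.map (λ {(c , k , j)} (bj , pj) → laurent-low a M k j i (cntℤ-member k us reg (ℕP.≤-trans pj bj)) lt) (All.zip (bd , pr)))

  growth-divs : ∀ us → length us ≤ M → All (λ u → a +ℤ u ≢ 0ℤ) us → Growth (absProd a us) 1 (length us) (dropped M (ev a M (divs us)))
  growth-divs [] le reg zero = ℚP.≤-reflexive (trans (cong (λ z → ν 1 ⊗ ∣ z ∣ℚ) (trans (ev-unit a M (M + 0)) (trans (cong (δ M) (ℕP.+-identityʳ M)) (δ-diag M)))) (trans (ℚP.*-identityʳ (ν 1)) refl))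
  growth-divs [] le reg (suc i) = ℚP.≤-reflexive (trans (cong (λ z → ν 1 ⊗ ∣ z ∣ℚ) (trans (ev-unit a M (M + suc i)) (δ-off M (M + suc i) (λ p → ℕP.<-irrefl p (ℕP.m<m+n M (s≤s z≤n)))))) (trans (ℚP.*-zeroʳ (ν 1)) (sym ι-0)))
  growth-divs (u ∷ us) le (r ∷ rs) = growth-div {absProd a us} {1} {length us} {dropped M (ev a M (divs us))} (a +ℤ u) (1≤∣∣ (a +ℤ u) r)
    (λ i → trans (sym (dropped-shiftMul M (ι (a +ℤ u)) (ev a M (divs (u ∷ us))) i (low-pf (u ∷ us) _ (r ∷ rs) (divs-bounded (u ∷ us)) (divPF-proper u (divs us))))) (ev-div a M u us le (M + i)))
    (growth-divs us (ℕP.<⇒≤ le) rs)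

  low-muls : ∀ vs → OrderAtLeast M (ev a M (muls vs (divs all-dens)))
  low-muls vs = low-pf all-dens _ regular (muls-bounded all-dens vs _ (divs-bounded all-dens)) (muls-proper vs _ (divPF-proper u₀ (divs us₀)))

  unfold-mul : ∀ v vs → suc (length vs) + 2 ≤ M → ∀ i → dropped M (ev a M (muls (v ∷ vs) (divs all-dens))) i ≡ shiftMul (ι (a +ℤ v)) (dropped M (ev a M (muls vs (divs all-dens)))) i
  unfold-mul v vs le i = trans (ev-mul a u₀ us₀ v vs le (M + i)) (dropped-shiftMul M (ι (a +ℤ v)) (ev a M (muls vs (divs all-dens))) i (low-muls vs))

  growth-muls : ∀ vs → length vs + 2 ≤ M → All (λ v → a +ℤ v ≢ 0ℤ) vs → Growth (absProd a all-dens) (absProd a vs) (length vs + M) (dropped M (ev a M (muls vs (divs all-dens))))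
  growth-muls [] le reg = growth-divs all-dens ℕP.≤-refl regular
  growth-muls (v ∷ vs) le (r ∷ rs) i = subst (λ z → ν (absProd a all-dens) ⊗ ∣ z ∣ℚ ≤ℚ ν (absProd a (v ∷ vs) * (suc (length vs) + M) ^ i)) (sym (unfold-mul v vs le i))
    (growth-mul {absProd a all-dens} {absProd a vs} {length vs + M} (a +ℤ v) (1≤∣∣ (a +ℤ v) r) (growth-muls vs (ℕP.<⇒≤ le) rs) i)

  shiftMul-order : ∀ d g k → OrderAtLeast k g → OrderAtLeast k (shiftMul d g)
  shiftMul-order d g k h zero lt = trans (cong (d ⊗_) (h 0 lt)) (ℚP.*-zeroʳ d)
  shiftMul-order d g k h (suc i) lt = trans (cong₂ (λ x y → d ⊗ x ⊕ y) (h (suc i) lt) (h i (ℕP.<⇒≤ lt))) (trans (ℚP.+-identityʳ (d ⊗ 0ℚ)) (ℚP.*-zeroʳ d))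

  shiftMul-order-0 : ∀ g k → OrderAtLeast k g → OrderAtLeast (suc k) (shiftMul 0ℚ g)
  shiftMul-order-0 g k h zero lt = ℚP.*-zeroˡ (g 0)
  shiftMul-order-0 g k h (suc i) (s≤s lt) = trans (cong₂ _⊕_ (ℚP.*-zeroˡ (g (suc i))) (h i lt)) refl

  order-muls : ∀ vs → length vs + 2 ≤ M → OrderAtLeast (cntℤ (-ℤ a) vs) (dropped M (ev a M (muls vs (divs all-dens))))
  order-muls [] le i ()
  order-muls (v ∷ vs) le i lt with (-ℤ a) ≟ℤ v
  ... | yes e = trans (unfold-mul v vs le i) (trans (cong (λ z → shiftMul z (dropped M (ev a M (muls vs (divs all-dens)))) i) (trans (cong ι (trans (cong (a +ℤ_) (sym e)) (ℤP.+-inverseʳ a))) ι-0)) (shiftMul-order-0 _ _ (order-muls vs (ℕP.<⇒≤ le)) i lt))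
  ... | no _ = trans (unfold-mul v vs le i) (shiftMul-order (ι (a +ℤ v)) _ _ (order-muls vs (ℕP.<⇒≤ le)) i lt)

cntℤ-range-member : ∀ A L i → i < L → 1 ≤ cntℤ (A +ℤ + i) (range A L)
cntℤ-range-member A (suc L) zero lt = subst (λ z → 1 ≤ cntℤ z (A ∷ range (A +ℤ 1ℤ) L)) (sym (ℤP.+-identityʳ A)) (subst (1 ≤_) (sym (cntℤ-here A _)) (s≤s z≤n))
cntℤ-range-member A (suc L) (suc i) (s≤s lt) with (A +ℤ + suc i) ≟ℤ A
... | yes _ = s≤s z≤n
... | no _ = subst (λ z → 1 ≤ cntℤ z (range (A +ℤ 1ℤ) L)) (trans (ℤP.+-assoc A 1ℤ (+ i)) (cong (A +ℤ_) (sym (ℤP.pos-+ 1 i)))) (cntℤ-range-member (A +ℤ 1ℤ) L i lt)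

-- Bounds for the terms of the sum.

module FormBounds (b₀ m r : ℕ) (10≤m : 10 ≤ m) (1≤r : 1 ≤ r) (r≤23 : r ≤ 23) where

  0<m : 0 < m
  0<m = ℕP.≤-trans (s≤s z≤n) 10≤m

  open Form b₀ m r 0<m r≤23 public

  -- The coefficient of `x^(b-1)` in `g(a + x)`.
  taylor : ℤ → ℚ
  taylor a = ev a N F (N + b₀)

  -- The second half is expanded in `x` instead of `-x`; for even `b - 1` the coefficient of
  -- `x^(b-1)` is the same.
  Right Left : ℕ → ℤ
  Right t = + t
  Left t = -ℤ + (p + t)

  regular-right : ∀ t → 1 ≤ t → All (λ u → Right t +ℤ u ≢ 0ℤ) dens
  regular-right t 1≤t = All.map (λ { (n , refl , _) e → ℕP.<⇒≢ (ℕP.≤-trans 1≤t (ℕP.m≤m+n t n)) (sym (ℤP.+-injective (trans (ℤP.pos-+ t n) e))) }) dens-below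

  regular-left : ∀ t → All (λ u → Left t +ℤ u ≢ 0ℤ) dens
  regular-left t = All.map (λ { (n , refl , n<p) e → ℕP.<⇒≢ (ℕP.≤-trans n<p (ℕP.m≤m+n p t)) (ℤP.+-injective (ℤP.i-j≡0⇒i≡j (+ n) (+ (p + t)) (trans (ℤP.+-comm (+ n) (Left t)) e))) }) dens-below

  -- The zero has order at least `b`, one more than the degree `b₀` of the coefficient.
  vanish : ∀ a → All (λ u → a +ℤ u ≢ 0ℤ) dens → 1 ≤ cntℤ (-ℤ a) (leftZeros ++ rightZeros) → taylor a ≡ 0ℚ
  vanish a reg mem = Taylor.order-muls a 0ℤ us reg vs degree b₀ (subst (b₀ <_) (sym (cntℤ-rep (-ℤ a) b (leftZeros ++ rightZeros))) (subst (_≤ b * cntℤ (-ℤ a) (leftZeros ++ rightZeros)) (ℕP.*-identityʳ b) (ℕP.*-monoʳ-≤ b mem)))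

  vanish-right : ∀ t → 1 ≤ t → t ≤ 24 * m → taylor (Right t) ≡ 0ℚ
  vanish-right t 1≤t t≤ = vanish (Right t) (regular-right t 1≤t) (subst (1 ≤_) (sym (cntℤ-++ (-ℤ + t) leftZeros rightZeros)) (ℕP.≤-trans (subst (λ z → 1 ≤ cntℤ z leftZeros) eq (cntℤ-range-member (-ℤ + (24 * m)) (24 * m) (24 * m ∸ t) (ℕP.∸-monoʳ-< 1≤t t≤))) (ℕP.m≤m+n _ _)))
    where
    eq : -ℤ + (24 * m) +ℤ + (24 * m ∸ t) ≡ -ℤ + t
    eq = trans (cong (-ℤ + (24 * m) +ℤ_) (pos-∸ t≤)) (lem (+ (24 * m)) (+ t))
      where
      lem : ∀ a t → -ℤ a +ℤ (a -ℤ t) ≡ -ℤ t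
      lem = ℤSolver.solve-∀

  vanish-left : ∀ t → 1 ≤ t → t ≤ 24 * m → taylor (Left t) ≡ 0ℚ
  vanish-left (suc t) _ t< = vanish (Left (suc t)) (regular-left (suc t)) (subst (1 ≤_) (sym (cntℤ-++ (-ℤ Left (suc t)) leftZeros rightZeros)) (ℕP.≤-trans (subst (λ z → 1 ≤ cntℤ z rightZeros) eq (cntℤ-range-member (+ suc p) (24 * m) t t<)) (ℕP.m≤n+m _ (cntℤ (-ℤ Left (suc t)) leftZeros))))
    where
    eq : + suc p +ℤ + t ≡ -ℤ Left (suc t)
    eq = trans (sym (ℤP.pos-+ (suc p) t)) (trans (cong +_ (sym (ℕP.+-suc p t))) (sym (ℤP.neg-involutive (+ (p + suc t)))))

  steps : ℕ
  steps = length vs + N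

  size : ℕ
  size = sizePoly m ^ b * steps ^ b₀

  scale : ℚ
  scale = multiplier b m ⊗ ν (2 ^ m) ^ℚ b

  module _ (v : ℕ) (1≤v : 1 ≤ v) where
    private
      t Z Pp : ℕ
      t = 24 * m + v
      Z = zeroProduct m r v
      Pp = poleProduct m r t
      B w s : ℚ
      B = baseMultiplier m
      w = ν (2 ^ m)
      s = ν (sizePoly m)

    1≤t : 1 ≤ t
    1≤t = ℕP.≤-trans 1≤v (ℕP.m≤n+m v (24 * m))

    ^ℚ-⊗ : ∀ x y n → (x ⊗ y) ^ℚ n ≡ x ^ℚ n ⊗ y ^ℚ n
    ^ℚ-⊗ x y zero = refl
    ^ℚ-⊗ x y (suc n) = trans (cong (x ⊗ y ⊗_) (^ℚ-⊗ x y n)) (lem x y (x ^ℚ n) (y ^ℚ n))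
      where
      lem : ∀ x y X Y → x ⊗ y ⊗ (X ⊗ Y) ≡ x ⊗ X ⊗ (y ⊗ Y)
      lem = solve-∀ ℚ-ring

    0≤B : 0ℚ ≤ℚ B
    0≤B = 0≤⊗ (0≤⊗ (0≤ν (factProd m plus)) (ℚP.<⇒≤ (0<inv (0<ν (Natural.fact-pos m 10≤m minus))))) (0≤⊗ (^ℚ-nonneg 8 (0≤lcmBound m m)) (^ℚ-nonneg 26 (0≤ν (tieAll m 72))))

    0<Pp : 0 < Pp
    0<Pp = ℕP.*-mono-≤ ri (ℕP.*-mono-≤ ri (ℕP.*-mono-≤ (bl 1) (ℕP.*-mono-≤ (bl 2) (ℕP.*-mono-≤ (bl 3) (ℕP.*-mono-≤ (bl 4) (bl 5))))))
      where
      ri = rise-pos (suc t) (24 * m + r ∸ 1) (s≤s z≤n)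
      bl : ∀ e → 0 < poleBlock m r t e
      bl e = rise-pos (t + e * m) ((24 ∸ 2 * e) * m + r + 1) (ℕP.≤-trans 1≤t (ℕP.m≤m+n t (e * m)))

    powered : B ^ℚ b ⊗ (w ^ℚ b ⊗ ν (Z ^ b)) ⊗ ν (t ^ b) ≤ℚ ν (sizePoly m ^ b) ⊗ ν (Pp ^ b)
    powered = subst₂ _≤ℚ_ eq₁ eq₂ (^ℚ-mono b (0≤⊗ 0≤B (0≤⊗ (0≤ν (2 ^ m)) (0≤ν (Z * t)))) (sizeBound m r v 10≤m 1≤r r≤23))
      where
      eq₁ : (B ⊗ (w ⊗ ν (Z * t))) ^ℚ b ≡ B ^ℚ b ⊗ (w ^ℚ b ⊗ ν (Z ^ b)) ⊗ ν (t ^ b)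
      eq₁ = trans (^ℚ-⊗ B (w ⊗ ν (Z * t)) b) (trans (cong (B ^ℚ b ⊗_) (trans (^ℚ-⊗ w (ν (Z * t)) b) (cong (w ^ℚ b ⊗_) (trans (sym (ν-^ (Z * t) b)) (trans (cong ν (^-distrib Z t b)) (ν-* (Z ^ b) (t ^ b))))))) (lem (B ^ℚ b) (w ^ℚ b) (ν (Z ^ b)) (ν (t ^ b))))
        where
        lem : ∀ a b c d → a ⊗ (b ⊗ (c ⊗ d)) ≡ a ⊗ (b ⊗ c) ⊗ d
        lem = solve-∀ ℚ-ring
      eq₂ : (s ⊗ ν Pp) ^ℚ b ≡ ν (sizePoly m ^ b) ⊗ ν (Pp ^ b)
      eq₂ = trans (^ℚ-⊗ s (ν Pp) b) (cong₂ _⊗_ (sym (ν-^ (sizePoly m) b)) (sym (ν-^ Pp b)))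

    -- The pole at 0 gives one factor `t` and the `b` copies of `f` give `t^b`; as `b ≥ 1`, this
    -- yields the decay `1 / t^2`.
    term-bound : ∀ a → All (λ u → a +ℤ u ≢ 0ℤ) dens → All (λ u → a +ℤ u ≢ 0ℤ) vs → t ≤ ∣ a +ℤ 0ℤ ∣ℤ →
      absProd a us ≡ Pp ^ b → absProd a vs ≡ Z ^ b → scale ⊗ (ν (t * t) ⊗ ∣ taylor a ∣ℚ) ≤ℚ ν size
    term-bound a reg regv t≤a eu ev′ = ⊗-cancelˡ-≤ (0<ν (ℕP.m^n>0 Pp {{ℕ.>-nonZero 0<Pp}} b)) (begin
      pb ⊗ (B ^ℚ b ⊗ w ^ℚ b ⊗ (ν (t * t) ⊗ x))             ≡⟨ lem₁ pb (B ^ℚ b) (w ^ℚ b) (ν (t * t)) x ⟩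
      B ^ℚ b ⊗ w ^ℚ b ⊗ (pb ⊗ x) ⊗ ν (t * t)                ≤⟨ ⊗-monoˡ (0≤⊗ 0≤Bw (0≤⊗ (0≤ν (Pp ^ b)) 0≤x)) (ν-mono-≤ tt≤) ⟩
      B ^ℚ b ⊗ w ^ℚ b ⊗ (pb ⊗ x) ⊗ ν (A * t ^ b)            ≡⟨ cong (B ^ℚ b ⊗ w ^ℚ b ⊗ (pb ⊗ x) ⊗_) (ν-* A (t ^ b)) ⟩
      B ^ℚ b ⊗ w ^ℚ b ⊗ (pb ⊗ x) ⊗ (ν A ⊗ ν (t ^ b))        ≡⟨ lem₂ (B ^ℚ b) (w ^ℚ b) pb x (ν A) (ν (t ^ b)) ⟩
      B ^ℚ b ⊗ w ^ℚ b ⊗ ν (t ^ b) ⊗ (ν A ⊗ pb ⊗ x)          ≤⟨ ⊗-monoˡ (0≤⊗ 0≤Bw (0≤ν (t ^ b))) growth ⟩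
      B ^ℚ b ⊗ w ^ℚ b ⊗ ν (t ^ b) ⊗ (ν (Z ^ b) ⊗ ν n)       ≡⟨ lem₃ (B ^ℚ b) (w ^ℚ b) (ν (t ^ b)) (ν (Z ^ b)) (ν n) ⟩
      ν n ⊗ (B ^ℚ b ⊗ (w ^ℚ b ⊗ ν (Z ^ b)) ⊗ ν (t ^ b))     ≤⟨ ⊗-monoˡ (0≤ν n) powered ⟩
      ν n ⊗ (ν (sizePoly m ^ b) ⊗ pb)                       ≡⟨ lem₄ (ν n) (ν (sizePoly m ^ b)) pb ⟩
      pb ⊗ (ν (sizePoly m ^ b) ⊗ ν n)                       ≡⟨ cong (pb ⊗_) (sym (ν-* (sizePoly m ^ b) n)) ⟩
      pb ⊗ ν size                                           ∎)
      where
      open ℚP.≤-Reasoning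
      A n : ℕ
      A = ∣ a +ℤ 0ℤ ∣ℤ
      n = steps ^ b₀
      x pb : ℚ
      x = ∣ taylor a ∣ℚ
      pb = ν (Pp ^ b)
      0≤x = ℚP.0≤∣p∣ (taylor a)
      0≤Bw = 0≤⊗ (^ℚ-nonneg b 0≤B) (^ℚ-nonneg b (0≤ν (2 ^ m)))
      tt≤ : t * t ≤ A * t ^ b
      tt≤ = ℕP.*-mono-≤ t≤a (subst (_≤ t ^ b) (ℕP.*-identityʳ t) (ℕP.*-monoʳ-≤ t (ℕP.m^n>0 t {{ℕ.>-nonZero 1≤t}} b₀)))
      growth : ν A ⊗ pb ⊗ x ≤ℚ ν (Z ^ b) ⊗ ν n
      growth = subst₂ (λ y z → y ⊗ x ≤ℚ z) (trans (cong (λ q → ν (A * q)) eu) (ν-* A (Pp ^ b))) (trans (cong (λ q → ν (q * n)) ev′) (ν-* (Z ^ b) n)) (Taylor.growth-muls a 0ℤ us reg vs degree regv b₀)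
      lem₁ : ∀ p B w t x → p ⊗ (B ⊗ w ⊗ (t ⊗ x)) ≡ B ⊗ w ⊗ (p ⊗ x) ⊗ t
      lem₁ = solve-∀ ℚ-ring
      lem₂ : ∀ B w p x A t → B ⊗ w ⊗ (p ⊗ x) ⊗ (A ⊗ t) ≡ B ⊗ w ⊗ t ⊗ (A ⊗ p ⊗ x)
      lem₂ = solve-∀ ℚ-ring
      lem₃ : ∀ B w t z n → B ⊗ w ⊗ t ⊗ (z ⊗ n) ≡ n ⊗ (B ⊗ (w ⊗ z) ⊗ t)
      lem₃ = solve-∀ ℚ-ring
      lem₄ : ∀ n s p → n ⊗ (s ⊗ p) ≡ p ⊗ (s ⊗ n)
      lem₄ = solve-∀ ℚ-ring

    private
      R : ℕ
      R = rise (suc t) (24 * m + r ∸ 1)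

      us-product : ∀ a → absProd a inner ≡ R → (∀ e → 2 * e ≤ 24 → absProd a (block e) ≡ poleBlock m r t e) → absProd a us ≡ Pp ^ b
      us-product a ei eb = begin
        absProd a us                                              ≡⟨ trans (absProd-++ a (rep (2 * b) inner) (rep b blocks)) (cong₂ _*_ (absProd-rep a (2 * b) inner) (absProd-rep a b blocks)) ⟩
        absProd a inner ^ (2 * b) * absProd a blocks ^ b          ≡⟨ cong₂ (λ x y → x ^ (2 * b) * y ^ b) ei blocks-eq ⟩
        R ^ (2 * b) * bl ^ b                                      ≡⟨ cong (_* bl ^ b) (sym (ℕP.^-*-assoc R 2 b)) ⟩
        (R ^ 2) ^ b * bl ^ b                                      ≡⟨ sym (^-distrib (R ^ 2) bl b) ⟩
        (R ^ 2 * bl) ^ b                                          ≡⟨ cong (_^ b) (lem R bl) ⟩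
        Pp ^ b                                                    ∎
        where
        open ≡-Reasoning
        bl = poleBlock m r t 1 * (poleBlock m r t 2 * (poleBlock m r t 3 * (poleBlock m r t 4 * poleBlock m r t 5)))
        lem : ∀ R c → R * (R * 1) * c ≡ R * (R * c)
        lem = ℕSolver.solve-∀
        le : ∀ i → {T (2 * i ≤ᵇ 24)} → 2 * i ≤ 24
        le i {ok} = ℕP.≤ᵇ⇒≤ (2 * i) 24 ok
        blocks-eq : absProd a blocks ≡ bl
        blocks-eq = trans (absProd-++ a (block 1) _) (cong₂ _*_ (eb 1 (le 1)) (trans (absProd-++ a (block 2) _) (cong₂ _*_ (eb 2 (le 2)) (trans (absProd-++ a (block 3) _) (cong₂ _*_ (eb 3 (le 3)) (trans (absProd-++ a (block 4) (block 5)) (cong₂ _*_ (eb 4 (le 4)) (eb 5 (le 5)))))))))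

      vs-product : ∀ a → absProd a leftZeros * absProd a rightZeros ≡ Z → absProd a vs ≡ Z ^ b
      vs-product a e = trans (absProd-rep a b (leftZeros ++ rightZeros)) (cong (_^ b) (trans (absProd-++ a leftZeros rightZeros) e))

      nonzero-from-product : ∀ a xs → 0 < absProd a xs → All (λ u → a +ℤ u ≢ 0ℤ) xs
      nonzero-from-product a [] _ = []
      nonzero-from-product a (u ∷ us) lt = (λ e → ℕP.<⇒≢ lt (sym (cong (λ z → ∣ z ∣ℤ * absProd a us) e))) ∷ nonzero-from-product a us (ℕP.n≢0⇒n>0 (λ e → ℕP.<⇒≢ lt (sym (trans (cong (∣ a +ℤ u ∣ℤ *_) e) (ℕP.*-zeroʳ ∣ a +ℤ u ∣ℤ)))))

      0<Z : 0 < Z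
      0<Z = ℕP.*-mono-≤ (rise-pos v (24 * m) 1≤v) (rise-pos (suc (24 * m + v + (24 * m + r))) (24 * m) (s≤s z≤n))

      0<Z^b : 0 < Z ^ b
      0<Z^b = ℕP.m^n>0 Z {{ℕ.>-nonZero 0<Z}} b

    right-bound : scale ⊗ (ν (t * t) ⊗ ∣ taylor (Right t) ∣ℚ) ≤ℚ ν size
    right-bound = term-bound (Right t) (regular-right t 1≤t) (nonzero-from-product (Right t) vs (subst (0 <_) (sym vp) 0<Z^b)) (ℕP.≤-reflexive (cong ∣_∣ℤ (sym (ℤP.+-identityʳ (+ t)))))
        (us-product (Right t) (absProd-up (Right t) 1ℤ (p ∸ 1) (suc t) (trans (sym (ℤP.pos-+ t 1)) (cong +_ (ℕP.+-comm t 1)))) (λ e _ → absProd-up (Right t) (+ (e * m)) (width e) (t + e * m) (sym (ℤP.pos-+ t (e * m)))))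
        vp
      where
      vp : absProd (Right t) vs ≡ Z ^ b
      vp = vs-product (Right t) (cong₂ _*_ (absProd-up (Right t) (-ℤ + (24 * m)) (24 * m) v (trans (cong (_-ℤ + (24 * m)) (ℤP.pos-+ (24 * m) v)) (lem (+ (24 * m)) (+ v)))) (absProd-up (Right t) (+ suc p) (24 * m) (suc (t + p)) (trans (sym (ℤP.pos-+ t (suc p))) (cong +_ (ℕP.+-suc t p)))))
        where
        lem : ∀ a v → a +ℤ v -ℤ a ≡ v
        lem = ℤSolver.solve-∀

    left-bound : scale ⊗ (ν (t * t) ⊗ ∣ taylor (Left t) ∣ℚ) ≤ℚ ν size
    left-bound = term-bound (Left t) (regular-left t) (nonzero-from-product (Left t) vs (subst (0 <_) (sym vp) 0<Z^b))
        (subst (t ≤_) (sym (trans (cong ∣_∣ℤ (ℤP.+-identityʳ (Left t))) (ℤP.∣-i∣≡∣i∣ (+ (p + t))))) (ℕP.m≤n+m t p))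
        (us-product (Left t) inner-eq block-eq)
        vp
      where
      down : ∀ A L y → A +ℤ + (y + L) ≡ 1ℤ +ℤ + (p + t) → absProd (Left t) (range A L) ≡ rise y L
      down A L y e = absProd-down (Left t) A L y (trans (lem A (+ (y + L)) (+ (p + t))) (cong (λ z → z -ℤ + (p + t) -ℤ + (y + L)) e ⟨trans⟩ lem₂ (+ (p + t)) (+ (y + L))))
        where
        infixl 1 _⟨trans⟩_
        _⟨trans⟩_ : ∀ {x y z : ℤ} → x ≡ y → y ≡ z → x ≡ z
        _⟨trans⟩_ = trans
        lem : ∀ A y q → -ℤ q +ℤ A ≡ A +ℤ y -ℤ q -ℤ y
        lem = ℤSolver.solve-∀
        lem₂ : ∀ q y → + 1 +ℤ q -ℤ q -ℤ y ≡ + 1 -ℤ y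
        lem₂ = ℤSolver.solve-∀
      nat : ∀ {A} α β → A ≡ + α → α + β ≡ suc (p + t) → A +ℤ + β ≡ 1ℤ +ℤ + (p + t)
      nat α β refl e = trans (sym (ℤP.pos-+ α β)) (trans (cong +_ e) (ℤP.pos-+ 1 (p + t)))
      inner-eq : absProd (Left t) inner ≡ R
      inner-eq = down 1ℤ (p ∸ 1) (suc t) (nat 1 (suc t + (p ∸ 1)) refl (cong suc (trans (cong suc (ℕP.+-comm t (p ∸ 1))) (cong (_+ t) (ℕP.m+[n∸m]≡n 0<p)))))
      block-eq : ∀ e → 2 * e ≤ 24 → absProd (Left t) (block e) ≡ poleBlock m r t e
      block-eq e le = down (+ (e * m)) (width e) (t + e * m) (nat (e * m) (t + e * m + width e) refl (trans (lem₁ e (24 ∸ 2 * e) m r t) (trans (cong (λ z → suc (z * m + r + t)) (ℕP.m+[n∸m]≡n le)) refl)))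
        where
        lem₁ : ∀ e c m r t → e * m + (t + e * m + (c * m + r + 1)) ≡ suc ((2 * e + c) * m + r + t)
        lem₁ = ℕSolver.solve-∀
      vp : absProd (Left t) vs ≡ Z ^ b
      vp = vs-product (Left t) (trans (cong₂ _*_ leftZ rightZ) (ℕP.*-comm (rise (suc (t + p)) (24 * m)) (rise v (24 * m))))
        where
        leftZ : absProd (Left t) leftZeros ≡ rise (suc (t + p)) (24 * m)
        leftZ = down (-ℤ + (24 * m)) (24 * m) (suc (t + p)) (trans (cong (-ℤ + (24 * m) +ℤ_) (ℤP.pos-+ (suc (t + p)) (24 * m))) (trans (lem (+ (24 * m)) (+ suc (t + p))) (trans (cong +_ (cong suc (ℕP.+-comm t p))) (ℤP.pos-+ 1 (p + t)))))
          where
          lem : ∀ a z → -ℤ a +ℤ (z +ℤ a) ≡ z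
          lem = ℤSolver.solve-∀
        rightZ : absProd (Left t) rightZeros ≡ rise v (24 * m)
        rightZ = down (+ suc p) (24 * m) v (nat (suc p) (v + 24 * m) refl (cong (λ z → suc (p + z)) (ℕP.+-comm v (24 * m))))

-- The limit

Tends0 : (ℕ → ℚ) → Set
Tends0 f = ∀ ε → 0ℚ <ℚ ε → ∃ λ n₀ → ∀ n → n₀ ≤ n → ∣ f n ∣ℚ <ℚ ε

½ : ℚ
½ = inv (ν 2)

½+½ : ∀ ε → ε ⊗ ½ ⊕ ε ⊗ ½ ≡ ε
½+½ ε = trans (lem ε ½) (trans (cong (ε ⊗_) two) (ℚP.*-identityʳ ε))
  where
  lem : ∀ e h → e ⊗ h ⊕ e ⊗ h ≡ e ⊗ ((1ℚ ⊕ 1ℚ) ⊗ h)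
  lem = solve-∀ ℚ-ring
  two : (1ℚ ⊕ 1ℚ) ⊗ ½ ≡ 1ℚ
  two = trans (cong (_⊗ ½) (trans (cong₂ _⊕_ (sym ι-1) (sym ι-1)) (sym (ν-+ 1 1)))) (inv-r (ν≢0 (s≤s z≤n)))

tends-cong : ∀ {f g} → (∀ n → f n ≡ g n) → Tends0 f → Tends0 g
tends-cong eq h ε 0<ε with h ε 0<ε
... | n₀ , p = n₀ , λ n le → subst (λ z → ∣ z ∣ℚ <ℚ ε) (eq n) (p n le)

tends-+ : ∀ {f g} → Tends0 f → Tends0 g → Tends0 (λ n → f n ⊕ g n)
tends-+ {f} {g} hf hg ε 0<ε = n₁ ⊔ n₂ , λ n le → ℚP.≤-<-trans (ℚP.∣p+q∣≤∣p∣+∣q∣ (f n) (g n)) (subst (∣ f n ∣ℚ ⊕ ∣ g n ∣ℚ <ℚ_) (½+½ ε) (ℚP.+-mono-< (proj₂ F′ n (ℕP.≤-trans (ℕP.m≤m⊔n n₁ n₂) le)) (proj₂ G′ n (ℕP.≤-trans (ℕP.m≤n⊔m n₁ n₂) le))))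
  where
  0<h : 0ℚ <ℚ ε ⊗ ½
  0<h = 0<⊗ 0<ε (0<inv (0<ν (s≤s z≤n)))
  F′ = hf (ε ⊗ ½) 0<h
  G′ = hg (ε ⊗ ½) 0<h
  n₁ = proj₁ F′
  n₂ = proj₁ G′

tends-⊗ : ∀ c {f} → Tends0 f → Tends0 (λ n → c ⊗ f n)
tends-⊗ c {f} h ε 0<ε = proj₁ H , λ n le → ℚP.≤-<-trans (bound n) (subst (C ⊗ ∣ f n ∣ℚ <ℚ_) cancel (ℚP.*-monoʳ-<-pos C {{ℚ.positive 0<C}} (proj₂ H n le)))
  where
  C = ∣ c ∣ℚ ⊕ 1ℚ
  0<C : 0ℚ <ℚ C
  0<C = ℚP.+-mono-≤-< (ℚP.0≤∣p∣ c) 0<1ℚ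
  H = h (ε ⊗ inv C) (0<⊗ 0<ε (0<inv 0<C))
  bound : ∀ n → ∣ c ⊗ f n ∣ℚ ≤ℚ C ⊗ ∣ f n ∣ℚ
  bound n = subst (_≤ℚ C ⊗ ∣ f n ∣ℚ) (sym (∣⊗∣ c (f n))) (ℚP.*-monoʳ-≤-nonNeg ∣ f n ∣ℚ {{ℚP.∣-∣-nonNeg (f n)}} (subst (_≤ℚ C) (ℚP.+-identityʳ ∣ c ∣ℚ) (ℚP.+-monoʳ-≤ ∣ c ∣ℚ (ℚP.<⇒≤ 0<1ℚ))))
  lem : ∀ C e i → C ⊗ (e ⊗ i) ≡ e ⊗ (C ⊗ i)
  lem = solve-∀ ℚ-ring
  cancel : C ⊗ (ε ⊗ inv C) ≡ ε
  cancel = trans (lem C ε (inv C)) (trans (cong (ε ⊗_) (inv-r (0<⇒≢0 0<C))) (ℚP.*-identityʳ ε))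

tends-zero : Tends0 (λ _ → 0ℚ)
tends-zero ε 0<ε = 0 , λ _ _ → 0<ε

tends-neg : ∀ {f} → Tends0 f → Tends0 (λ n → ⊖ f n)
tends-neg {f} h ε 0<ε = proj₁ (h ε 0<ε) , λ n le → subst (_<ℚ ε) (sym (ℚP.∣-p∣≡∣p∣ (f n))) (proj₂ (h ε 0<ε) n le)

tends-lin : ∀ (φ : ℕ → ℤ → ℕ → ℚ) f → All (λ (c , k , j) → Tends0 (λ n → φ n k j)) f → Tends0 (λ n → lin (φ n) f)
tends-lin φ [] [] = tends-zero
tends-lin φ ((c , k , j) ∷ f) (h ∷ hs) = tends-+ (tends-⊗ c h) (tends-lin φ f hs)

converges-shift : ∀ {f x} k → ConvergesTo f x → Tends0 (λ n → f (n + k) ⊝ x)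
converges-shift k h ε 0<ε = proj₁ (h ε 0<ε) , λ n le → proj₂ (h ε 0<ε) (n + k) (ℕP.≤-trans le (ℕP.m≤m+n n k))

denominator-scaled : ∀ x → ν (↧ₙ x) ⊗ x ≡ ι (↥ x)
denominator-scaled x@(ℚ.mkℚ n d _) = ℚP.toℚᵘ-injective (begin
  toℚᵘ (ν (suc d) ⊗ x)                                 ≈⟨ ℚP.toℚᵘ-homo-* (ν (suc d)) x ⟩
  toℚᵘ (ν (suc d)) ℚᵘ.* ℚᵘ.mkℚᵘ n d                    ≈⟨ ℚᵘP.*-cong {toℚᵘ (ν (suc d))} {ℚᵘ.mkℚᵘ (+ suc d) 0} {ℚᵘ.mkℚᵘ n d} {ℚᵘ.mkℚᵘ n d} (ι-toℚᵘ (+ suc d)) ℚᵘP.≃-refl ⟩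
  ℚᵘ.mkℚᵘ (+ suc d) 0 ℚᵘ.* ℚᵘ.mkℚᵘ n d                 ≈⟨ ℚᵘ.*≡* (trans (lem (+ suc d) n) (cong (λ z → n *ℤ + suc z) (sym (ℕP.+-identityʳ d)))) ⟩
  ℚᵘ.mkℚᵘ n 0                                          ≈⟨ ι-toℚᵘ n ⟨
  toℚᵘ (ι n)                                           ∎)
  where
  open import Relation.Binary.Reasoning.Setoid ℚᵘP.≃-setoid
  lem : ∀ d n → d *ℤ n *ℤ + 1 ≡ n *ℤ d
  lem = ℤSolver.solve-∀

archimedean : ∀ ε → 0ℚ <ℚ ε → ∀ n → ↧ₙ ε ≤ n → inv (ν (suc n)) <ℚ ε
archimedean ε 0<ε n le = ℚP.*-cancelˡ-<-nonNeg (ν (suc n)) {{ℚ.nonNegative (0≤ν (suc n))}} (subst (_<ℚ ν (suc n) ⊗ ε) (sym (inv-r (ν≢0 (s≤s z≤n)))) (ℚP.≤-<-trans one (ℚP.*-monoˡ-<-pos ε {{ℚ.positive 0<ε}} (ν-mono-< (s≤s le)))))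
  where
  scaled : ν (↧ₙ ε) ⊗ ε ≡ ι (↥ ε)
  scaled = denominator-scaled ε
  one : 1ℚ ≤ℚ ν (↧ₙ ε) ⊗ ε
  one = subst₂ _≤ℚ_ ι-1 (sym scaled) (ι-mono-≤ (ℤP.i<j⇒suc[i]≤j (ι-cancel-< (subst₂ _<ℚ_ (trans (ℚP.*-zeroʳ (ν (↧ₙ ε))) (sym ι-0)) scaled (ℚP.*-monoʳ-<-pos (ν (↧ₙ ε)) {{ℚ.positive (0<ν (s≤s z≤n))}} 0<ε)))))

tends-invPow : ∀ k s → Tends0 (λ n → invPow (n + k) (suc s))
tends-invPow k s ε 0<ε = ↧ₙ ε , λ n le → ℚP.≤-<-trans (small n) (archimedean ε 0<ε n le)
  where
  e≤1 : ∀ n → inv (ν (suc n)) ≤ℚ 1ℚ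
  e≤1 n = ⊗-cancelˡ-≤ (0<ν {suc n} (s≤s z≤n)) (subst₂ _≤ℚ_ (trans ι-1 (sym (inv-r (ν≢0 (s≤s z≤n))))) (sym (ℚP.*-identityʳ (ν (suc n)))) (ν-mono-≤ {1} {suc n} (s≤s z≤n)))
  anti : ∀ n → inv (ν (suc (n + k))) ≤ℚ inv (ν (suc n))
  anti n = ⊗-cancelˡ-≤ (0<ν {suc (n + k)} (s≤s z≤n)) (subst (_≤ℚ ν (suc (n + k)) ⊗ inv (ν (suc n))) (trans (inv-r (ν≢0 (s≤s z≤n))) (sym (inv-r (ν≢0 (s≤s z≤n)))))
    (ℚP.*-monoʳ-≤-nonNeg (inv (ν (suc n))) {{ℚ.nonNegative (ℚP.<⇒≤ (0<inv (0<ν (s≤s z≤n))))}} (ν-mono-≤ (s≤s (ℕP.m≤m+n n k)))))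
  small : ∀ n → ∣ invPow (n + k) (suc s) ∣ℚ ≤ℚ inv (ν (suc n))
  small n = subst (λ z → ∣ z ∣ℚ ≤ℚ inv (ν (suc n))) (sym (invPow-power (n + k) (suc s))) (subst (_≤ℚ inv (ν (suc n))) (sym (ℚP.0≤p⇒∣p∣≡p (^ℚ-nonneg (suc s) 0≤e)))
      (ℚP.≤-trans (subst (e ⊗ e ^ℚ s ≤ℚ_) (ℚP.*-identityʳ e) (⊗-monoˡ 0≤e (power s))) (anti n)))
    where
    e = inv (ν (suc (n + k)))
    0≤e = ℚP.<⇒≤ (0<inv (0<ν {suc (n + k)} (s≤s z≤n)))
    power : ∀ s → e ^ℚ s ≤ℚ 1ℚ
    power zero = ℚP.≤-refl
    power (suc s) = ℚP.≤-trans (subst (e ⊗ e ^ℚ s ≤ℚ_) (ℚP.*-identityʳ e) (⊗-monoˡ 0≤e (power s))) (e≤1 (n + k))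

-- A fixed number of terms tending to 0; convergence of the series itself does not enter, so the
-- harmonic series is included.
tends-tail : ∀ k s → Tends0 (λ n → zetaPartial (suc s) (n + k) ⊝ zetaPartial (suc s) n)
tends-tail zero s = tends-cong (λ n → sym (trans (cong (λ z → zetaPartial (suc s) z ⊝ zetaPartial (suc s) n) (ℕP.+-identityʳ n)) (ℚP.+-inverseʳ (zetaPartial (suc s) n)))) tends-zero
tends-tail (suc k) s = tends-cong eq (tends-+ (tends-tail k s) (tends-invPow k s))
  where
  lem : ∀ a b c → a ⊝ b ⊕ c ≡ a ⊕ c ⊝ b
  lem = solve-∀ ℚ-ring
  eq : ∀ n → zetaPartial (suc s) (n + k) ⊝ zetaPartial (suc s) n ⊕ invPow (n + k) (suc s) ≡ zetaPartial (suc s) (n + suc k) ⊝ zetaPartial (suc s) n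
  eq n = trans (lem (zetaPartial (suc s) (n + k)) (zetaPartial (suc s) n) (invPow (n + k) (suc s))) (cong (λ z → zetaPartial (suc s) z ⊝ zetaPartial (suc s) n) (sym (ℕP.+-suc n k)))

sgn : ℕ → ℚ
sgn zero = 1ℚ
sgn (suc n) = ⊖ sgn n

sgn-power : ∀ y s → (⊖ y) ^ℚ s ≡ sgn s ⊗ y ^ℚ s
sgn-power y zero = refl
sgn-power y (suc s) = trans (cong ((⊖ y) ⊗_) (sgn-power y s)) (lem y (sgn s) (y ^ℚ s))
  where
  lem : ∀ y g p → (⊖ y) ⊗ (g ⊗ p) ≡ (⊖ g) ⊗ (y ⊗ p)
  lem = solve-∀ ℚ-ring

sgn-+2 : ∀ c n → sgn (n + 2 * c) ≡ sgn n
sgn-+2 zero n = cong sgn (ℕP.+-identityʳ n)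
sgn-+2 (suc c) n = trans (cong sgn (lem n c)) (trans (neg-neg (sgn (n + 2 * c))) (sgn-+2 c n))
  where
  lem : ∀ n c → n + 2 * suc c ≡ suc (suc (n + 2 * c))
  lem = ℕSolver.solve-∀
  neg-neg : ∀ x → ⊖ (⊖ x) ≡ x
  neg-neg = solve-∀ ℚ-ring

inv-neg : ∀ {x} → x ≢ 0ℚ → inv (⊖ x) ≡ ⊖ inv x
inv-neg {x} x≢0 = ⊗-cancelˡ -x≢0 (trans (inv-r -x≢0) (sym (trans (lem x (inv x)) (inv-r x≢0))))
  where
  lem : ∀ x i → (⊖ x) ⊗ (⊖ i) ≡ x ⊗ i
  lem = solve-∀ ℚ-ring
  lem₂ : ∀ x → ⊖ (⊖ x) ≡ x
  lem₂ = solve-∀ ℚ-ring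
  -x≢0 : ⊖ x ≢ 0ℚ
  -x≢0 e = x≢0 (trans (sym (lem₂ x)) (cong ⊖_ e))

lin-⊝ : ∀ φ ψ f → lin (λ k j → φ k j ⊝ ψ k j) f ≡ lin φ f ⊝ lin ψ f
lin-⊝ φ ψ [] = refl
lin-⊝ φ ψ ((c , k , j) ∷ f) = trans (cong (c ⊗ (φ k j ⊝ ψ k j) ⊕_) (lin-⊝ φ ψ f)) (lem c (φ k j) (ψ k j) (lin φ f) (lin ψ f))
  where
  lem : ∀ c x y u v → c ⊗ (x ⊝ y) ⊕ (u ⊝ v) ≡ c ⊗ x ⊕ u ⊝ (c ⊗ y ⊕ v)
  lem = solve-∀ ℚ-ring

module Sums (b₀ c₀ m r : ℕ) (even : b₀ ≡ 2 * c₀) (10≤m : 10 ≤ m) (1≤r : 1 ≤ r) (r≤23 : r ≤ 23) where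
  open FormBounds b₀ m r 10≤m 1≤r r≤23 public

  partialSum : ℕ → ℚ
  partialSum zero = 0ℚ
  partialSum (suc T) = partialSum T ⊕ (taylor (Right (suc T)) ⊝ taylor (Left (suc T)))

  B : ℕ → ℚ
  B j = ι (bin j b₀)

  Z : ℕ → ℕ → ℚ
  Z j n = zetaPartial (j + b₀) n

  -- Summing the powers of `1 / (t + n)` over `1 ≤ t ≤ T` gives a difference of partial zeta sums;
  -- under the reflection `n` becomes `p - n` and the sign `(-1)^j` appears.
  summand : ℕ → ℤ → ℕ → ℚ
  summand T k j = let n = ∣ k ∣ℤ in B j ⊗ ((Z j (T + n) ⊝ Z j n) ⊝ sgn j ⊗ (Z j (T + (p ∸ n)) ⊝ Z j (p ∸ n)))

  taylor-right : ∀ T → taylor (Right (suc T)) ≡ lin (λ k j → B j ⊗ invPow (T + ∣ k ∣ℤ) (j + b₀)) F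
  taylor-right T = lin-cong F (All.map (λ {(c , k , j)} → at k j) F-poles)
    where
    at : ∀ k j → Below p k → laurent (Right (suc T)) N k j (N + b₀) ≡ B j ⊗ invPow (T + ∣ k ∣ℤ) (j + b₀)
    at .(+ n) j (n , refl , n<p) = trans (laurent-explicit (+ suc T) N (+ n) j b₀ (λ e → ℕP.<⇒≢ {0} {suc T + n} (s≤s z≤n) (sym (ℤP.+-injective (trans (ℤP.pos-+ (suc T) n) e)))))
      (cong (B j ⊗_) (trans (cong (λ z → inv (ι z) ^ℚ (j + b₀)) (sym (ℤP.pos-+ (suc T) n))) (sym (invPow-power (T + n) (j + b₀)))))

  taylor-left : ∀ T → taylor (Left (suc T)) ≡ lin (λ k j → B j ⊗ (sgn j ⊗ invPow (T + (p ∸ ∣ k ∣ℤ)) (j + b₀))) F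
  taylor-left T = lin-cong F (All.map (λ {(c , k , j)} → at k j) F-poles)
    where
    at : ∀ k j → Below p k → laurent (Left (suc T)) N k j (N + b₀) ≡ B j ⊗ (sgn j ⊗ invPow (T + (p ∸ ∣ k ∣ℤ)) (j + b₀))
    at .(+ n) j (n , refl , n<p) = trans (laurent-explicit (Left (suc T)) N (+ n) j b₀ nz)
        (cong (B j ⊗_) (begin
          inv (ι (Left (suc T) +ℤ + n)) ^ℚ s      ≡⟨ cong (λ z → inv (ι z) ^ℚ s) eq ⟩
          inv (ι (-ℤ + suc q)) ^ℚ s               ≡⟨ cong (λ z → inv z ^ℚ s) (ι-neg (+ suc q)) ⟩
          inv (⊖ ν (suc q)) ^ℚ s                  ≡⟨ cong (_^ℚ s) (inv-neg (ν≢0 (s≤s z≤n))) ⟩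
          (⊖ inv (ν (suc q))) ^ℚ s                ≡⟨ sgn-power (inv (ν (suc q))) s ⟩
          -- The evenness of `b₀`, that is the oddness of `b`, turns the sign of `j + b₀` into that
          -- of `j`.
          sgn s ⊗ inv (ν (suc q)) ^ℚ s            ≡⟨ cong₂ _⊗_ (trans (cong (λ z → sgn (j + z)) even) (sgn-+2 c₀ j)) (sym (invPow-power q s)) ⟩
          sgn j ⊗ invPow q s                      ∎))
      where
      open ≡-Reasoning
      s = j + b₀
      q = T + (p ∸ n)
      lem : ∀ p T n → -ℤ (p +ℤ T) +ℤ n ≡ -ℤ (T +ℤ (p -ℤ n))
      lem = ℤSolver.solve-∀
      eq : Left (suc T) +ℤ + n ≡ -ℤ + suc q
      eq = trans (cong (λ z → -ℤ z +ℤ + n) (ℤP.pos-+ p (suc T))) (trans (lem (+ p) (+ suc T) (+ n)) (cong -ℤ_ (trans (cong (+ suc T +ℤ_) (sym (pos-∸ (ℕP.<⇒≤ n<p)))) (sym (ℤP.pos-+ (suc T) (p ∸ n))))))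
      nz : Left (suc T) +ℤ + n ≢ 0ℤ
      nz e = contradiction (trans (sym eq) e) (λ ())

  partialSum-lin : ∀ T → partialSum T ≡ lin (summand T) F
  partialSum-lin zero = sym (lin-zero F (All.map (λ {(c , k , j)} _ → lem (B j) (Z j ∣ k ∣ℤ) (sgn j) (Z j (p ∸ ∣ k ∣ℤ))) F-poles))
    where
    lem : ∀ b x g y → b ⊗ ((x ⊝ x) ⊝ g ⊗ (y ⊝ y)) ≡ 0ℚ
    lem = solve-∀ ℚ-ring
  partialSum-lin (suc T) = begin
    partialSum T ⊕ (taylor (Right (suc T)) ⊝ taylor (Left (suc T)))   ≡⟨ cong₂ _⊕_ (partialSum-lin T) (trans (cong₂ _⊝_ (taylor-right T) (taylor-left T)) (sym (lin-⊝ _ _ F))) ⟩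
    lin (summand T) F ⊕ lin _ F                                       ≡⟨ lin-+ _ _ F ⟨
    lin _ F                                                           ≡⟨ lin-cong F (All.map (λ {(c , k , j)} _ → lem (B j) (Z j (T + ∣ k ∣ℤ)) (Z j ∣ k ∣ℤ) (sgn j) (Z j (T + (p ∸ ∣ k ∣ℤ))) (Z j (p ∸ ∣ k ∣ℤ)) (invPow (T + ∣ k ∣ℤ) (j + b₀)) (invPow (T + (p ∸ ∣ k ∣ℤ)) (j + b₀))) F-poles) ⟩
    lin (summand (suc T)) F                                           ∎
    where
    open ≡-Reasoning
    lem : ∀ b x x₀ g y y₀ i i′ → b ⊗ ((x ⊝ x₀) ⊝ g ⊗ (y ⊝ y₀)) ⊕ (b ⊗ i ⊝ b ⊗ (g ⊗ i′)) ≡ b ⊗ ((x ⊕ i ⊝ x₀) ⊝ g ⊗ (y ⊕ i′ ⊝ y₀))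
    lem = solve-∀ ℚ-ring

  0≤scale : 0ℚ ≤ℚ scale
  0≤scale = 0≤⊗ (^ℚ-nonneg b (0≤B 1 (s≤s z≤n))) (^ℚ-nonneg b (0≤ν (2 ^ m)))

  term : ℕ → ℚ
  term t = ∣ taylor (Right t) ⊝ taylor (Left t) ∣ℚ

  term-small : ∀ T → let i = inv (ν (suc T)) in scale ⊗ term (suc T) ≤ℚ ν (2 * size) ⊗ (i ⊗ i)
  term-small T = go (suc T ℕP.≤? 24 * m)
    where
    t = suc T
    i = inv (ν t)
    0≤i = ℚP.<⇒≤ (0<inv (0<ν {t} (s≤s z≤n)))
    0≤ii = 0≤⊗ 0≤i 0≤i
    open ℚP.≤-Reasoning
    single : ∀ a → scale ⊗ (ν (t * t) ⊗ ∣ taylor a ∣ℚ) ≤ℚ ν size → scale ⊗ ∣ taylor a ∣ℚ ≤ℚ ν size ⊗ (i ⊗ i)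
    single a h = subst (_≤ℚ ν size ⊗ (i ⊗ i)) eq (ℚP.*-monoʳ-≤-nonNeg (i ⊗ i) {{ℚ.nonNegative 0≤ii}} h)
      where
      x = ∣ taylor a ∣ℚ
      lem : ∀ s t x i → s ⊗ (t ⊗ t ⊗ x) ⊗ (i ⊗ i) ≡ s ⊗ x ⊗ ((t ⊗ i) ⊗ (t ⊗ i))
      lem = solve-∀ ℚ-ring
      eq : scale ⊗ (ν (t * t) ⊗ x) ⊗ (i ⊗ i) ≡ scale ⊗ x
      eq = trans (cong (λ z → scale ⊗ (z ⊗ x) ⊗ (i ⊗ i)) (ν-* t t)) (trans (lem scale (ν t) x i) (trans (cong (λ z → scale ⊗ x ⊗ (z ⊗ z)) (inv-r (ν≢0 {t} (s≤s z≤n)))) (ℚP.*-identityʳ (scale ⊗ x))))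
    go : Dec (t ≤ 24 * m) → scale ⊗ term t ≤ℚ ν (2 * size) ⊗ (i ⊗ i)
    go (yes le) = subst (_≤ℚ ν (2 * size) ⊗ (i ⊗ i)) (sym (trans (cong (scale ⊗_) (cong ∣_∣ℚ (cong₂ _⊝_ (vanish-right t (s≤s z≤n) le) (vanish-left t (s≤s z≤n) le)))) (ℚP.*-zeroʳ scale))) (0≤⊗ (0≤ν (2 * size)) 0≤ii)
    go (no nle) = begin
      scale ⊗ term t                                               ≤⟨ ⊗-monoˡ 0≤scale (ℚP.∣p-q∣≤∣p∣+∣q∣ (taylor (Right t)) (taylor (Left t))) ⟩
      scale ⊗ (∣ taylor (Right t) ∣ℚ ⊕ ∣ taylor (Left t) ∣ℚ)       ≡⟨ ℚP.*-distribˡ-+ scale ∣ taylor (Right t) ∣ℚ ∣ taylor (Left t) ∣ℚ ⟩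
      scale ⊗ ∣ taylor (Right t) ∣ℚ ⊕ scale ⊗ ∣ taylor (Left t) ∣ℚ ≤⟨ ⊕-mono (single (Right t) (subst (λ z → scale ⊗ (ν (z * z) ⊗ ∣ taylor (Right z) ∣ℚ) ≤ℚ ν size) te (right-bound v 1≤v))) (single (Left t) (subst (λ z → scale ⊗ (ν (z * z) ⊗ ∣ taylor (Left z) ∣ℚ) ≤ℚ ν size) te (left-bound v 1≤v))) ⟩
      ν size ⊗ (i ⊗ i) ⊕ ν size ⊗ (i ⊗ i)                          ≡⟨ lem (ν size) (i ⊗ i) ⟩
      (ν size ⊕ ν size) ⊗ (i ⊗ i)                                  ≡⟨ cong (_⊗ (i ⊗ i)) (trans (sym (ν-+ size size)) (cong ν (cong (λ z → size + z) (sym (ℕP.+-identityʳ size))))) ⟩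
      ν (2 * size) ⊗ (i ⊗ i)                                       ∎
      where
      v = t ∸ 24 * m
      24m<t = ℕP.≰⇒> nle
      te : 24 * m + v ≡ t
      te = ℕP.m+[n∸m]≡n (ℕP.<⇒≤ 24m<t)
      1≤v : 1 ≤ v
      1≤v = ℕP.m<n⇒0<n∸m 24m<t
      lem : ∀ s i → s ⊗ i ⊕ s ⊗ i ≡ (s ⊕ s) ⊗ i
      lem = solve-∀ ℚ-ring

  -- 1/(T+1)² ≤ 1/T - 1/(T+1) makes the sum telescope.
  inv-step : ∀ T → let i = inv (ν (suc (suc T))) in i ⊗ i ⊕ i ≤ℚ inv (ν (suc T))
  inv-step T = ⊗-cancelˡ-≤ (0<⊗ (0<ν {suc T} (s≤s z≤n)) (0<⊗ (0<ν {suc (suc T)} (s≤s z≤n)) (0<ν {suc (suc T)} (s≤s z≤n)))) (subst₂ _≤ℚ_ (sym lhs) (sym rhs) (ν-mono-≤ nat))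
    where
    x = ν (suc T)
    y = ν (suc (suc T))
    i = inv y
    k = inv x
    yi : y ⊗ i ≡ 1ℚ
    yi = inv-r (ν≢0 {suc (suc T)} (s≤s z≤n))
    xk : x ⊗ k ≡ 1ℚ
    xk = inv-r (ν≢0 {suc T} (s≤s z≤n))
    l₁ : ∀ x y i → x ⊗ (y ⊗ y) ⊗ (i ⊗ i ⊕ i) ≡ x ⊗ ((y ⊗ i) ⊗ (y ⊗ i) ⊕ (y ⊗ i) ⊗ y)
    l₁ = solve-∀ ℚ-ring
    l₂ : ∀ x y k → x ⊗ (y ⊗ y) ⊗ k ≡ x ⊗ k ⊗ (y ⊗ y)
    l₂ = solve-∀ ℚ-ring
    lhs : x ⊗ (y ⊗ y) ⊗ (i ⊗ i ⊕ i) ≡ ν (suc T * (1 + suc (suc T)))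
    lhs = trans (l₁ x y i) (trans (cong (λ z → x ⊗ (z ⊗ z ⊕ z ⊗ y)) yi) (trans (cong (x ⊗_) (trans (cong (1ℚ ⊗ 1ℚ ⊕_) (ℚP.*-identityˡ y)) (trans (cong (_⊕ y) (sym ι-1)) (sym (ν-+ 1 (suc (suc T))))))) (sym (ν-* (suc T) (1 + suc (suc T))))))
    rhs : x ⊗ (y ⊗ y) ⊗ k ≡ ν (suc (suc T) * suc (suc T))
    rhs = trans (l₂ x y k) (trans (cong (_⊗ (y ⊗ y)) xk) (trans (ℚP.*-identityˡ (y ⊗ y)) (sym (ν-* (suc (suc T)) (suc (suc T))))))
    nat : suc T * (1 + suc (suc T)) ≤ suc (suc T) * suc (suc T)
    nat = ℕP.≤-trans (ℕP.n≤1+n _) (ℕP.≤-reflexive (l T))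
      where
      l : ∀ T → suc (suc T * (1 + suc (suc T))) ≡ suc (suc T) * suc (suc T)
      l = ℕSolver.solve-∀

  -- The second summand on the left is the reserve for the terms still to come, which `inv-step`
  -- consumes; it begins at full size because the first term vanishes.
  partialSum-bound : ∀ T → scale ⊗ ∣ partialSum (suc T) ∣ℚ ⊕ ν (2 * size) ⊗ inv (ν (suc T)) ≤ℚ ν (2 * size)
  partialSum-bound zero = ℚP.≤-reflexive (begin
    scale ⊗ ∣ partialSum 1 ∣ℚ ⊕ S ⊗ inv (ν 1)       ≡⟨ cong₂ (λ x y → scale ⊗ ∣ x ∣ℚ ⊕ S ⊗ y) zero-sum inv1 ⟩
    scale ⊗ 0ℚ ⊕ S ⊗ 1ℚ                             ≡⟨ lem scale S ⟩
    S                                               ∎)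
    where
    open ≡-Reasoning
    S = ν (2 * size)
    1≤24m : 1 ≤ 24 * m
    1≤24m = ℕP.≤-trans 0<m (ℕP.m≤n*m m 24)
    zero-sum : partialSum 1 ≡ 0ℚ
    zero-sum = trans (cong₂ (λ x y → 0ℚ ⊕ (x ⊝ y)) (vanish-right 1 (s≤s z≤n) 1≤24m) (vanish-left 1 (s≤s z≤n) 1≤24m)) refl
    inv1 : inv (ν 1) ≡ 1ℚ
    inv1 = trans (sym (ℚP.*-identityˡ (inv (ν 1)))) (trans (cong (_⊗ inv (ν 1)) (sym ι-1)) (inv-r (ν≢0 (s≤s z≤n))))
    lem : ∀ s z → s ⊗ 0ℚ ⊕ z ⊗ 1ℚ ≡ z
    lem = solve-∀ ℚ-ring
  partialSum-bound (suc T) = begin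
    scale ⊗ ∣ partialSum (suc T) ⊕ d ∣ℚ ⊕ S ⊗ i                ≤⟨ ℚP.+-monoˡ-≤ (S ⊗ i) (ℚP.≤-trans (⊗-monoˡ 0≤scale (ℚP.∣p+q∣≤∣p∣+∣q∣ (partialSum (suc T)) d)) (ℚP.≤-reflexive (ℚP.*-distribˡ-+ scale ∣ partialSum (suc T) ∣ℚ ∣ d ∣ℚ))) ⟩
    scale ⊗ ∣ partialSum (suc T) ∣ℚ ⊕ scale ⊗ ∣ d ∣ℚ ⊕ S ⊗ i    ≤⟨ ℚP.+-monoˡ-≤ (S ⊗ i) (ℚP.+-monoʳ-≤ (scale ⊗ ∣ partialSum (suc T) ∣ℚ) (term-small (suc T))) ⟩
    scale ⊗ ∣ partialSum (suc T) ∣ℚ ⊕ S ⊗ (i ⊗ i) ⊕ S ⊗ i       ≡⟨ lem (scale ⊗ ∣ partialSum (suc T) ∣ℚ) S i ⟩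
    scale ⊗ ∣ partialSum (suc T) ∣ℚ ⊕ S ⊗ (i ⊗ i ⊕ i)           ≤⟨ ℚP.+-monoʳ-≤ (scale ⊗ ∣ partialSum (suc T) ∣ℚ) (⊗-monoˡ (0≤ν (2 * size)) (inv-step T)) ⟩
    scale ⊗ ∣ partialSum (suc T) ∣ℚ ⊕ S ⊗ inv (ν (suc T))       ≤⟨ partialSum-bound T ⟩
    S                                                           ∎
    where
    open ℚP.≤-Reasoning
    S = ν (2 * size)
    d = taylor (Right (suc (suc T))) ⊝ taylor (Left (suc (suc T)))
    i = inv (ν (suc (suc T)))
    lem : ∀ a s i → a ⊕ s ⊗ (i ⊗ i) ⊕ s ⊗ i ≡ a ⊕ s ⊗ (i ⊗ i ⊕ i)
    lem = solve-∀ ℚ-ring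

  partialSum≤ : ∀ T → scale ⊗ ∣ partialSum (suc T) ∣ℚ ≤ℚ ν (2 * size)
  partialSum≤ T = ℚP.≤-trans (subst (_≤ℚ scale ⊗ ∣ partialSum (suc T) ∣ℚ ⊕ ν (2 * size) ⊗ inv (ν (suc T))) (ℚP.+-identityʳ (scale ⊗ ∣ partialSum (suc T) ∣ℚ)) (ℚP.+-monoʳ-≤ (scale ⊗ ∣ partialSum (suc T) ∣ℚ) (0≤⊗ (0≤ν (2 * size)) (ℚP.<⇒≤ (0<inv (0<ν {suc T} (s≤s z≤n))))))) (partialSum-bound T)

-- Reduction of the sum to a linear form in odd zeta values.

parity : ∀ j → (∃ λ i → j ≡ 2 * i) ⊎ (∃ λ i → j ≡ suc (2 * i))
parity zero = inj₁ (0 , refl)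
parity (suc j) with parity j
... | inj₁ (i , e) = inj₂ (i , cong suc e)
... | inj₂ (i , e) = inj₁ (suc i , trans (cong suc e) (lem i))
  where
  lem : ∀ i → suc (suc (2 * i)) ≡ 2 * suc i
  lem = ℕSolver.solve-∀

sgn-even : ∀ i → sgn (2 * i) ≡ 1ℚ
sgn-even i = sgn-+2 i 0

rsum : ℕ → (ℕ → ℚ) → ℚ
rsum zero f = 0ℚ
rsum (suc n) f = rsum n f ⊕ f n

rsum-cong : ∀ n {f g} → (∀ i → i < n → f i ≡ g i) → rsum n f ≡ rsum n g
rsum-cong zero h = refl
rsum-cong (suc n) h = cong₂ _⊕_ (rsum-cong n (λ i lt → h i (ℕP.m<n⇒m<1+n lt))) (h n ℕP.≤-refl)

rsum-0 : ∀ n → rsum n (λ _ → 0ℚ) ≡ 0ℚ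
rsum-0 zero = refl
rsum-0 (suc n) = trans (ℚP.+-identityʳ (rsum n (λ _ → 0ℚ))) (rsum-0 n)

rsum-+ : ∀ n f g → rsum n (λ i → f i ⊕ g i) ≡ rsum n f ⊕ rsum n g
rsum-+ zero f g = refl
rsum-+ (suc n) f g = trans (cong (_⊕ (f n ⊕ g n)) (rsum-+ n f g)) (lem (rsum n f) (rsum n g) (f n) (g n))
  where
  lem : ∀ a b c d → a ⊕ b ⊕ (c ⊕ d) ≡ a ⊕ c ⊕ (b ⊕ d)
  lem = solve-∀ ℚ-ring

rsum-single : ∀ n f i₀ → i₀ < n → (∀ i → i ≢ i₀ → f i ≡ 0ℚ) → rsum n f ≡ f i₀
rsum-single (suc n) f i₀ lt h with i₀ ℕP.≟ n
... | yes refl = trans (cong (_⊕ f n) (trans (rsum-cong n (λ i i<n → h i (λ e → ℕP.<-irrefl e i<n))) (rsum-0 n))) (ℚP.+-identityˡ (f n))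
... | no ne = trans (cong₂ _⊕_ (rsum-single n f i₀ (ℕP.≤∧≢⇒< (ℕP.≤-pred lt) ne) h) (h n (λ e → ne (sym e)))) (ℚP.+-identityʳ (f i₀))

rsum-closed : ∀ (P : ℚ → Set) → P 0ℚ → (∀ {x y} → P x → P y → P (x ⊕ y)) → ∀ n f → (∀ i → i < n → P (f i)) → P (rsum n f)
rsum-closed P z a zero f h = z
rsum-closed P z a (suc n) f h = a (rsum-closed P z a n f (λ i lt → h i (ℕP.m<n⇒m<1+n lt))) (h n ℕP.≤-refl)

indicator-here : ∀ k j j′ → indicator k j k j′ ≡ δ j j′
indicator-here k j j′ with k ≟ℤ k
... | yes _ = refl
... | no ne = contradiction refl ne

indicator-other : ∀ k k′ j j′ → k ≢ k′ → indicator k j k′ j′ ≡ 0ℚ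
indicator-other k k′ j j′ ne with k ≟ℤ k′
... | yes e = contradiction e ne
... | no _ = refl

-- Integrality is known for collected coefficients only, not for single list entries.
regroup : ∀ p M φ f → All (λ (c , k , j) → Below p k × (1 ≤ j × j ≤ M)) f →
  lin φ f ≡ rsum p (λ k → rsum M (λ j → coef f (+ k) (suc j) ⊗ φ (+ k) (suc j)))
regroup p M φ [] [] = sym (trans (rsum-cong p (λ k _ → trans (rsum-cong M (λ j _ → ℚP.*-zeroˡ (φ (+ k) (suc j)))) (rsum-0 M))) (rsum-0 p))
regroup p M φ ((c , .(+ n) , suc j₀) ∷ f) (((n , refl , n<p) , _ , j≤M) ∷ h) = sym (begin
  rsum p (λ k → rsum M (λ j → (c ⊗ I k j ⊕ coef f (+ k) (suc j)) ⊗ φ (+ k) (suc j)))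
    ≡⟨ rsum-cong p (λ k _ → trans (rsum-cong M (λ j _ → lem c (I k j) (coef f (+ k) (suc j)) (φ (+ k) (suc j)))) (rsum-+ M _ _)) ⟩
  rsum p (λ k → rsum M (λ j → c ⊗ (I k j ⊗ φ (+ k) (suc j))) ⊕ rsum M (λ j → coef f (+ k) (suc j) ⊗ φ (+ k) (suc j)))
    ≡⟨ rsum-+ p _ _ ⟩
  rsum p (λ k → rsum M (λ j → c ⊗ (I k j ⊗ φ (+ k) (suc j)))) ⊕ rsum p (λ k → rsum M (λ j → coef f (+ k) (suc j) ⊗ φ (+ k) (suc j)))
    ≡⟨ cong₂ _⊕_ first (sym (regroup p M φ f h)) ⟩
  c ⊗ φ (+ n) (suc j₀) ⊕ lin φ f ∎)
  where
  open ≡-Reasoning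
  I : ℕ → ℕ → ℚ
  I k j = indicator (+ k) (suc j) (+ n) (suc j₀)
  lem : ∀ c i a x → (c ⊗ i ⊕ a) ⊗ x ≡ c ⊗ (i ⊗ x) ⊕ a ⊗ x
  lem = solve-∀ ℚ-ring
  zero-term : ∀ c x → c ⊗ (0ℚ ⊗ x) ≡ 0ℚ
  zero-term = solve-∀ ℚ-ring
  first : rsum p (λ k → rsum M (λ j → c ⊗ (I k j ⊗ φ (+ k) (suc j)))) ≡ c ⊗ φ (+ n) (suc j₀)
  first = trans (rsum-single p _ n n<p (λ k ne → trans (rsum-cong M (λ j _ → trans (cong (λ z → c ⊗ (z ⊗ φ (+ k) (suc j))) (indicator-other (+ k) (+ n) (suc j) (suc j₀) (λ e → ne (ℤP.+-injective e)))) (zero-term c (φ (+ k) (suc j))))) (rsum-0 M)))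
    (trans (rsum-single M _ j₀ j≤M (λ j ne → trans (cong (λ z → c ⊗ (z ⊗ φ (+ n) (suc j))) (trans (indicator-here (+ n) (suc j) (suc j₀)) (δ-off j j₀ ne))) (zero-term c (φ (+ n) (suc j)))))
      (cong (c ⊗_) (trans (cong (_⊗ φ (+ n) (suc j₀)) (trans (indicator-here (+ n) (suc j₀) (suc j₀)) (δ-diag j₀))) (ℚP.*-identityˡ (φ (+ n) (suc j₀))))))

-- Starts at `j = 3`, since `j = 1` is `ζ(b)`, which is not among the given values and for `b = 1`
-- diverges.
OddZetaValues : ℕ → (ℕ → ℚ) → Set
OddZetaValues b₀ ρ = ∀ i → let j = suc (2 * suc i) in j ≤ 7 * suc b₀ → ConvergesTo (zetaPartial (j + b₀)) (ρ j)

module Limit (b₀ c₀ m r : ℕ) (even : b₀ ≡ 2 * c₀) (10≤m : 10 ≤ m) (1≤r : 1 ≤ r) (r≤23 : r ≤ 23)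
  (ρ : ℕ → ℚ) (conv : OddZetaValues b₀ ρ) where
  open Sums b₀ c₀ m r even 10≤m 1≤r r≤23 public

  -- What the two halves of a pole of order `j` leave in the limit: `1 - (-1)^j` times the zeta
  -- value, with the share of `j = 1` taken out.
  ξ : ℕ → ℚ
  ξ j with parity j
  ... | inj₁ _ = 0ℚ
  ... | inj₂ (zero , _) = 0ℚ
  ... | inj₂ (suc i , _) = ρ j ⊕ ρ j

  weightX : ℤ → ℕ → ℚ
  weightX k j = B j ⊗ (ξ j ⊝ Z j ∣ k ∣ℤ ⊕ sgn j ⊗ Z j (p ∸ ∣ k ∣ℤ))

  X : ℚ
  X = lin weightX F

  -- For `j = 1` the same quantity `2 Z 1 T` is subtracted at every pole. Its total weight is the
  -- sum of the residues, namely 0, so it may be removed at each finite `T`.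
  err : ℕ → ℤ → ℕ → ℚ
  err T k j = Z j (T + ∣ k ∣ℤ) ⊝ sgn j ⊗ Z j (T + (p ∸ ∣ k ∣ℤ)) ⊝ ξ j ⊝ δ 1 j ⊗ (Z 1 T ⊕ Z 1 T)

  err-tends : ∀ n q j → 1 ≤ j → j ≤ 7 * b → Tends0 (λ T → Z j (T + n) ⊝ sgn j ⊗ Z j (T + q) ⊝ ξ j ⊝ δ 1 j ⊗ (Z 1 T ⊕ Z 1 T))
  err-tends n q j@(suc j′) 1≤j j≤ with parity j
  ... | inj₁ (zero , ())
  ... | inj₁ (suc i , e) = tends-cong eq (tends-+ (tends-tail n (j′ + b₀)) (tends-neg (tends-tail q (j′ + b₀))))
    where
    not1 : δ 1 j ≡ 0ℚ
    not1 = δ-off 1 j λ { refl → contradiction (trans e (lem i)) (λ ()) }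
      where
      lem : ∀ i → 2 * suc i ≡ suc (suc (2 * i))
      lem = ℕSolver.solve-∀
    lem : ∀ x y t w → x ⊝ t ⊕ (⊖ (y ⊝ t)) ≡ x ⊝ 1ℚ ⊗ y ⊝ 0ℚ ⊝ 0ℚ ⊗ w
    lem = solve-∀ ℚ-ring
    eq : ∀ T → Z j (T + n) ⊝ Z j T ⊕ (⊖ (Z j (T + q) ⊝ Z j T)) ≡ Z j (T + n) ⊝ sgn j ⊗ Z j (T + q) ⊝ 0ℚ ⊝ δ 1 j ⊗ (Z 1 T ⊕ Z 1 T)
    eq T = trans (lem (Z j (T + n)) (Z j (T + q)) (Z j T) (Z 1 T ⊕ Z 1 T)) (cong₂ (λ s d → Z j (T + n) ⊝ s ⊗ Z j (T + q) ⊝ 0ℚ ⊝ d ⊗ (Z 1 T ⊕ Z 1 T)) (sym (trans (cong sgn e) (sgn-even (suc i)))) (sym not1))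
  ... | inj₂ (zero , refl) = tends-cong eq (tends-+ (tends-tail n (j′ + b₀)) (tends-tail q (j′ + b₀)))
    where
    lem : ∀ x y t → x ⊝ t ⊕ (y ⊝ t) ≡ x ⊝ (⊖ 1ℚ) ⊗ y ⊝ 0ℚ ⊝ 1ℚ ⊗ (t ⊕ t)
    lem = solve-∀ ℚ-ring
    eq : ∀ T → Z 1 (T + n) ⊝ Z 1 T ⊕ (Z 1 (T + q) ⊝ Z 1 T) ≡ Z 1 (T + n) ⊝ (⊖ 1ℚ) ⊗ Z 1 (T + q) ⊝ 0ℚ ⊝ 1ℚ ⊗ (Z 1 T ⊕ Z 1 T)
    eq T = lem (Z 1 (T + n)) (Z 1 (T + q)) (Z 1 T)
  ... | inj₂ (suc i , refl) = tends-cong eq (tends-+ {λ T → Z j (T + n) ⊝ ρ j} {λ T → Z j (T + q) ⊝ ρ j} (converges-shift {zetaPartial (j + b₀)} {ρ j} n (conv i j≤)) (converges-shift {zetaPartial (j + b₀)} {ρ j} q (conv i j≤)))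
    where
    not1 : δ 1 j ≡ 0ℚ
    not1 = δ-off 1 j (λ ())
    lem : ∀ x y t w → x ⊝ t ⊕ (y ⊝ t) ≡ x ⊝ (⊖ 1ℚ) ⊗ y ⊝ (t ⊕ t) ⊝ 0ℚ ⊗ w
    lem = solve-∀ ℚ-ring
    eq : ∀ T → Z j (T + n) ⊝ ρ j ⊕ (Z j (T + q) ⊝ ρ j) ≡ Z j (T + n) ⊝ sgn j ⊗ Z j (T + q) ⊝ (ρ j ⊕ ρ j) ⊝ δ 1 j ⊗ (Z 1 T ⊕ Z 1 T)
    eq T = trans (lem (Z j (T + n)) (Z j (T + q)) (ρ j) (Z 1 T ⊕ Z 1 T)) (cong₂ (λ s d → Z j (T + n) ⊝ s ⊗ Z j (T + q) ⊝ (ρ j ⊕ ρ j) ⊝ d ⊗ (Z 1 T ⊕ Z 1 T)) (sym (cong ⊖_ (sgn-even (suc i)))) (sym not1))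

  difference : ∀ T → lin (λ k j → B j ⊗ err T k j) F ≡ partialSum T ⊝ X
  difference T = sym (begin
    partialSum T ⊝ X                                         ≡⟨ cong (_⊝ X) (partialSum-lin T) ⟩
    lin (summand T) F ⊝ lin weightX F                        ≡⟨ lin-⊝ (summand T) weightX F ⟨
    lin (λ k j → summand T k j ⊝ weightX k j) F              ≡⟨ lin-cong F (All.map (λ {(c , k , j)} _ → at k j) F-poles) ⟩
    lin (λ k j → B j ⊗ err T k j ⊕ C ⊗ δ 1 j) F              ≡⟨ lin-+ (λ k j → B j ⊗ err T k j) (λ k j → C ⊗ δ 1 j) F ⟩
    lin (λ k j → B j ⊗ err T k j) F ⊕ lin (λ k j → C ⊗ δ 1 j) F ≡⟨ cong (lin (λ k j → B j ⊗ err T k j) F ⊕_) (trans (lin-⊗ C (λ _ j → δ 1 j) F) (trans (cong (C ⊗_) (muls-residueSum 0ℤ us vs degree)) (ℚP.*-zeroʳ C))) ⟩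
    lin (λ k j → B j ⊗ err T k j) F ⊕ 0ℚ                     ≡⟨ ℚP.+-identityʳ (lin (λ k j → B j ⊗ err T k j) F) ⟩
    lin (λ k j → B j ⊗ err T k j) F                          ∎)
    where
    open ≡-Reasoning
    C = B 1 ⊗ (Z 1 T ⊕ Z 1 T)
    l₁ : ∀ b x x₀ g y y₀ ξ d w → b ⊗ ((x ⊝ x₀) ⊝ g ⊗ (y ⊝ y₀)) ⊝ b ⊗ (ξ ⊝ x₀ ⊕ g ⊗ y₀) ≡ b ⊗ (x ⊝ g ⊗ y ⊝ ξ ⊝ d ⊗ w) ⊕ b ⊗ d ⊗ w
    l₁ = solve-∀ ℚ-ring
    l₂ : ∀ b d w → b ⊗ d ⊗ w ≡ b ⊗ w ⊗ d
    l₂ = solve-∀ ℚ-ring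
    B-δ : ∀ j → B j ⊗ δ 1 j ≡ B 1 ⊗ δ 1 j
    B-δ j with 1 ℕP.≟ j
    ... | yes refl = refl
    ... | no ne = trans (cong (B j ⊗_) (δ-off 1 j ne)) (trans (ℚP.*-zeroʳ (B j)) (sym (trans (cong (B 1 ⊗_) (δ-off 1 j ne)) (ℚP.*-zeroʳ (B 1)))))
    at : ∀ k j → summand T k j ⊝ weightX k j ≡ B j ⊗ err T k j ⊕ C ⊗ δ 1 j
    at k j = trans (l₁ (B j) (Z j (T + ∣ k ∣ℤ)) (Z j ∣ k ∣ℤ) (sgn j) (Z j (T + (p ∸ ∣ k ∣ℤ))) (Z j (p ∸ ∣ k ∣ℤ)) (ξ j) (δ 1 j) (Z 1 T ⊕ Z 1 T))
      (cong (B j ⊗ err T k j ⊕_) (trans (cong (_⊗ (Z 1 T ⊕ Z 1 T)) (B-δ j)) (l₂ (B 1) (δ 1 j) (Z 1 T ⊕ Z 1 T))))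

  F-orders : All (λ (c , k , j) → 1 ≤ j × j ≤ 7 * b) F
  F-orders = All.map (λ {(c , k , j)} (pr , bd) → pr , ℕP.≤-trans bd (order-bound k)) (All.zip (F-proper , F-bounded))

  limit : Tends0 (λ T → partialSum T ⊝ X)
  limit = tends-cong difference (tends-lin (λ T k j → B j ⊗ err T k j) F (All.map (λ {(c , k , j)} (lo , hi) → tends-⊗ (B j) (err-tends ∣ k ∣ℤ (p ∸ ∣ k ∣ℤ) j lo hi)) F-orders))

  X-bound : scale ⊗ ∣ X ∣ℚ ≤ℚ ν (2 * size)
  X-bound = ℚP.≮⇒≥ absurd
    where
    absurd : ¬ (ν (2 * size) <ℚ scale ⊗ ∣ X ∣ℚ)
    absurd lt = ℚP.<-irrefl refl chain
      where
      open ℚP.≤-Reasoning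
      ε = scale ⊗ ∣ X ∣ℚ ⊝ ν (2 * size)
      0<ε : 0ℚ <ℚ ε
      0<ε = subst (_<ℚ ε) (ℚP.+-inverseʳ (ν (2 * size))) (ℚP.+-monoˡ-< (⊖ ν (2 * size)) lt)
      L = tends-⊗ scale limit ε 0<ε
      T₁ = suc (proj₁ L)
      S = partialSum T₁
      split : ∀ s x → x ≡ s ⊕ (⊖ (s ⊝ x))
      split = solve-∀ ℚ-ring
      re : ∀ a b → a ⊕ (b ⊝ a) ≡ b
      re = solve-∀ ℚ-ring
      chain : scale ⊗ ∣ X ∣ℚ <ℚ scale ⊗ ∣ X ∣ℚ
      chain = begin-strict
        scale ⊗ ∣ X ∣ℚ                                  ≡⟨ cong (λ z → scale ⊗ ∣ z ∣ℚ) (split S X) ⟩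
        scale ⊗ ∣ S ⊕ (⊖ (S ⊝ X)) ∣ℚ                    ≤⟨ ⊗-monoˡ 0≤scale (ℚP.∣p+q∣≤∣p∣+∣q∣ S (⊖ (S ⊝ X))) ⟩
        scale ⊗ (∣ S ∣ℚ ⊕ ∣ ⊖ (S ⊝ X) ∣ℚ)               ≡⟨ trans (cong (λ z → scale ⊗ (∣ S ∣ℚ ⊕ z)) (ℚP.∣-p∣≡∣p∣ (S ⊝ X))) (ℚP.*-distribˡ-+ scale ∣ S ∣ℚ ∣ S ⊝ X ∣ℚ) ⟩
        scale ⊗ ∣ S ∣ℚ ⊕ scale ⊗ ∣ S ⊝ X ∣ℚ             ≡⟨ cong (scale ⊗ ∣ S ∣ℚ ⊕_) (trans (cong (_⊗ ∣ S ⊝ X ∣ℚ) (sym (ℚP.0≤p⇒∣p∣≡p 0≤scale))) (sym (∣⊗∣ scale (S ⊝ X)))) ⟩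
        scale ⊗ ∣ S ∣ℚ ⊕ ∣ scale ⊗ (S ⊝ X) ∣ℚ           <⟨ ℚP.+-mono-≤-< (partialSum≤ (proj₁ L)) (proj₂ L T₁ (ℕP.n≤1+n (proj₁ L))) ⟩
        ν (2 * size) ⊕ ε                                ≡⟨ re (ν (2 * size)) (scale ⊗ ∣ X ∣ℚ) ⟩
        scale ⊗ ∣ X ∣ℚ                                  ∎

-- Primes and integrality

prime-divisor : ∀ n → 2 ≤ n → ∃ λ π → Prime π × π ∣ n
prime-divisor n 2≤n = go (factorise n {{ℕ.>-nonZero (ℕP.<⇒≤ 2≤n)}})
  where
  go : PrimeFactorisation n → ∃ λ π → Prime π × π ∣ n
  go record { factors = [] ; isFactorisation = e } = contradiction (subst (2 ≤_) e 2≤n) λ { (s≤s ()) }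
  go record { factors = π ∷ πs ; isFactorisation = e ; factorsPrime = pr ∷ _ } = π , pr , subst (π ∣_) (sym e) (∣m⇒∣m*n (product πs) Div.∣-refl)

primes-unbounded : ∀ n → ∃ λ π → Prime π × n < π
primes-unbounded n = go (prime-divisor (suc (n !)) (s≤s (ℕP.1≤n! n)))
  where
  go : (∃ λ π → Prime π × π ∣ suc (n !)) → ∃ λ π → Prime π × n < π
  go (π , pr , dv) = π , pr , ℕP.≰⇒> λ π≤n → Adic.π∤1 π pr (∣m+n∣m⇒∣n (subst (π ∣_) (ℕP.+-comm 1 (n !)) dv) (∣-trans (self π (ℕ.>-nonZero⁻¹ π {{prime⇒nonZero pr}})) (Div.m≤n⇒m!∣n! π≤n)))
    where
    self : ∀ k → 0 < k → k ∣ k !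
    self (suc k) _ = ∣m⇒∣m*n (k !) Div.∣-refl

-- A prime dividing the reduced denominator would, by integrality at that prime, divide the
-- numerator as well.
integral-everywhere : ∀ x → (∀ π (pr : Prime π) → Adic.Integral π pr x) → x ≡ ι (↥ x)
integral-everywhere x h = go (2 ℕP.≤? ↧ₙ x)
  where
  coprime : ∀ x {π} → π ∣ ∣ ↥ x ∣ℤ → π ∣ ↧ₙ x → π ≡ 1
  coprime (ℚ.mkℚ _ _ c) p q = Coprimality.recompute c (p , q)
  go : Dec (2 ≤ ↧ₙ x) → x ≡ ι (↥ x)
  go (no small) = trans (sym (trans (cong (λ d → ν d ⊗ x) one) (trans (cong (_⊗ x) ι-1) (ℚP.*-identityˡ x)))) (denominator-scaled x)
    where
    one : ↧ₙ x ≡ 1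
    one = ℕP.≤-antisym (ℕP.≤-pred (ℕP.≰⇒> small)) (s≤s z≤n)
  go (yes big) = absurd (prime-divisor (↧ₙ x) big)
    where
    absurd : (∃ λ π → Prime π × π ∣ ↧ₙ x) → x ≡ ι (↥ x)
    absurd (π , pr , dv) = conflict (h π pr)
      where
      open Adic π pr
      conflict : Integral x → x ≡ ι (↥ x)
      conflict (n , d , π∤d , e) = ⊥-elim (split (euclidsLemma d ∣ ↥ x ∣ℤ pr (subst (π ∣_) (sym abs-eq) (∣m⇒∣m*n ∣ n ∣ℤ dv))))
        where
        open ≡-Reasoning
        lem : ∀ a b x → a ⊗ (b ⊗ x) ≡ b ⊗ (a ⊗ x)
        lem = solve-∀ ℚ-ring
        eq : + d *ℤ ↥ x ≡ + ↧ₙ x *ℤ n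
        eq = ι-injective (begin
          ι (+ d *ℤ ↥ x)            ≡⟨ ι-* (+ d) (↥ x) ⟩
          ν d ⊗ ι (↥ x)             ≡⟨ cong (ν d ⊗_) (denominator-scaled x) ⟨
          ν d ⊗ (ν (↧ₙ x) ⊗ x)      ≡⟨ lem (ν d) (ν (↧ₙ x)) x ⟩
          ν (↧ₙ x) ⊗ (ν d ⊗ x)      ≡⟨ cong (ν (↧ₙ x) ⊗_) e ⟩
          ν (↧ₙ x) ⊗ ι n            ≡⟨ ι-* (+ ↧ₙ x) n ⟨
          ι (+ ↧ₙ x *ℤ n)           ∎)
        abs-eq : d * ∣ ↥ x ∣ℤ ≡ ↧ₙ x * ∣ n ∣ℤ
        abs-eq = trans (sym (ℤP.∣i*j∣≡∣i∣*∣j∣ (+ d) (↥ x))) (trans (cong ∣_∣ℤ eq) (ℤP.∣i*j∣≡∣i∣*∣j∣ (+ ↧ₙ x) n))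
        split : π ∣ d ⊎ π ∣ ∣ ↥ x ∣ℤ → ⊥
        split (inj₁ q) = π∤d q
        split (inj₂ q) = π∤1 (subst (π ∣_) (coprime x q dv) Div.∣-refl)

n<2^n : ∀ n → n < 2 ^ n
n<2^n zero = s≤s z≤n
n<2^n (suc n) = begin
  suc (suc n)          ≤⟨ ℕP.+-mono-≤ (ℕP.≤-trans (s≤s z≤n) (n<2^n n)) (n<2^n n) ⟩
  2 ^ n + 2 ^ n        ≡⟨ cong (λ z → 2 ^ n + z) (sym (ℕP.+-identityʳ (2 ^ n))) ⟩
  2 ^ suc n            ∎
  where open ℕP.≤-Reasoning

-- With `q = m / (D + 1)` one has `m ≤ (D + 1) (q + 1)` and `q + 1 ≤ 2^q`.
power≤exp : ∀ D m → m ^ suc D ≤ suc D ^ suc D * 2 ^ m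
power≤exp D m = begin
  m ^ suc D                          ≤⟨ ℕP.^-monoˡ-≤ (suc D) m≤ ⟩
  (suc D * suc q) ^ suc D            ≡⟨ ^-distrib (suc D) (suc q) (suc D) ⟩
  suc D ^ suc D * suc q ^ suc D      ≤⟨ ℕP.*-monoʳ-≤ (suc D ^ suc D) exp ⟩
  suc D ^ suc D * 2 ^ m              ∎
  where
  open ℕP.≤-Reasoning
  q = m / suc D
  m≤ : m ≤ suc D * suc q
  m≤ = begin
    m                          ≡⟨ DM.m≡m%n+[m/n]*n m (suc D) ⟩
    m % suc D + q * suc D      ≤⟨ ℕP.+-monoˡ-≤ (q * suc D) (ℕP.<⇒≤ (DM.m%n<n m (suc D))) ⟩
    suc D + q * suc D          ≡⟨ ℕP.*-comm (suc q) (suc D) ⟩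
    suc D * suc q              ∎
  exp : suc q ^ suc D ≤ 2 ^ m
  exp = begin
    suc q ^ suc D              ≤⟨ ℕP.^-monoˡ-≤ (suc D) (n<2^n q) ⟩
    (2 ^ q) ^ suc D            ≡⟨ ℕP.^-*-assoc 2 q (suc D) ⟩
    2 ^ (q * suc D)            ≤⟨ ℕP.^-monoʳ-≤ 2 (DM.m/n*n≤m m (suc D)) ⟩
    2 ^ m                      ∎

poly<exp : ∀ {f} → PolyBounded f → ∃ λ m₀ → ∀ m → m₀ ≤ m → f m < 2 ^ m
poly<exp {f} (C , D , h) = suc (C * K) , λ m le → ℕP.*-cancelˡ-< K (f m) (2 ^ m) (begin-strict
    K * f m                ≤⟨ ℕP.*-monoʳ-≤ K (h m (ℕP.≤-trans (s≤s z≤n) le)) ⟩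
    K * (C * m ^ D)        ≡⟨ lem K C (m ^ D) ⟩
    C * K * m ^ D          <⟨ ℕP.*-monoˡ-< (m ^ D) {{ℕP.m^n≢0 m D {{ℕ.>-nonZero (ℕP.≤-trans (s≤s z≤n) le)}}}} le ⟩
    m * m ^ D              ≤⟨ power≤exp D m ⟩
    K * 2 ^ m              ∎)
  where
  open ℕP.≤-Reasoning
  K = suc D ^ suc D
  lem : ∀ K C x → K * (C * x) ≡ C * K * x
  lem = ℕSolver.solve-∀

-- Leading Laurent coefficients up to sign, as quotients `V / U`.

LeadsWith : ℕ → ℕ → ℕ → Series → Set
LeadsWith M U V g = OrderAtLeast M g × ν U ⊗ ∣ g M ∣ℚ ≡ ν V

leads-mul : ∀ {M U V g} d → LeadsWith M U V g → LeadsWith M U (∣ d ∣ℤ * V) (shiftMul (ι d) g)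
leads-mul {M} {U} {V} {g} d (low , top) = low′ , trans (cong (λ z → ν U ⊗ ∣ z ∣ℚ) (lead M low)) (begin
  ν U ⊗ ∣ ι d ⊗ g M ∣ℚ            ≡⟨ cong (ν U ⊗_) (trans (∣⊗∣ (ι d) (g M)) (cong (_⊗ ∣ g M ∣ℚ) (∣ι∣ d))) ⟩
  ν U ⊗ (ν ∣ d ∣ℤ ⊗ ∣ g M ∣ℚ)     ≡⟨ lem (ν U) (ν ∣ d ∣ℤ) ∣ g M ∣ℚ ⟩
  ν ∣ d ∣ℤ ⊗ (ν U ⊗ ∣ g M ∣ℚ)     ≡⟨ cong (ν ∣ d ∣ℤ ⊗_) top ⟩
  ν ∣ d ∣ℤ ⊗ ν V                  ≡⟨ ν-* ∣ d ∣ℤ V ⟨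
  ν (∣ d ∣ℤ * V)                  ∎)
  where
  open ≡-Reasoning
  lem : ∀ a b c → a ⊗ (b ⊗ c) ≡ b ⊗ (a ⊗ c)
  lem = solve-∀ ℚ-ring
  low′ : OrderAtLeast M (shiftMul (ι d) g)
  low′ zero lt = trans (cong (ι d ⊗_) (low 0 lt)) (ℚP.*-zeroʳ (ι d))
  low′ (suc i) lt = trans (cong₂ (λ x y → ι d ⊗ x ⊕ y) (low (suc i) lt) (low i (ℕP.<⇒≤ lt))) (trans (ℚP.+-identityʳ (ι d ⊗ 0ℚ)) (ℚP.*-zeroʳ (ι d)))
  lead : ∀ M → OrderAtLeast M g → shiftMul (ι d) g M ≡ ι d ⊗ g M
  lead zero low = refl
  lead (suc M) low = trans (cong (ι d ⊗ g (suc M) ⊕_) (low M ℕP.≤-refl)) (ℚP.+-identityʳ (ι d ⊗ g (suc M)))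

leads-div : ∀ {M U V g g′} d → d ≢ 0ℤ → (∀ i → shiftMul (ι d) g′ i ≡ g i) → LeadsWith M U V g → LeadsWith M (∣ d ∣ℤ * U) V g′
leads-div {M} {U} {V} {g} {g′} d d≢0 eq (low , top) = low′ , (begin
  ν (∣ d ∣ℤ * U) ⊗ ∣ g′ M ∣ℚ      ≡⟨ cong (_⊗ ∣ g′ M ∣ℚ) (ν-* ∣ d ∣ℤ U) ⟩
  ν ∣ d ∣ℤ ⊗ ν U ⊗ ∣ g′ M ∣ℚ      ≡⟨ lem (ν ∣ d ∣ℤ) (ν U) ∣ g′ M ∣ℚ ⟩
  ν U ⊗ (ν ∣ d ∣ℤ ⊗ ∣ g′ M ∣ℚ)    ≡⟨ cong (ν U ⊗_) (trans (cong (_⊗ ∣ g′ M ∣ℚ) (sym (∣ι∣ d))) (sym (∣⊗∣ (ι d) (g′ M)))) ⟩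
  ν U ⊗ ∣ ι d ⊗ g′ M ∣ℚ           ≡⟨ cong (λ z → ν U ⊗ ∣ z ∣ℚ) (lead M low′) ⟩
  ν U ⊗ ∣ g M ∣ℚ                  ≡⟨ top ⟩
  ν V                             ∎)
  where
  open ≡-Reasoning
  lem : ∀ a b c → a ⊗ b ⊗ c ≡ b ⊗ (a ⊗ c)
  lem = solve-∀ ℚ-ring
  zero-factor : ∀ x → ι d ⊗ x ≡ 0ℚ → x ≡ 0ℚ
  zero-factor x e = ⊗-cancelˡ (ι≢0 d≢0) (trans e (sym (ℚP.*-zeroʳ (ι d))))
  low′ : OrderAtLeast M g′
  low′ zero lt = zero-factor (g′ 0) (trans (eq 0) (low 0 lt))
  low′ (suc i) lt = zero-factor (g′ (suc i)) (begin
    ι d ⊗ g′ (suc i)           ≡⟨ ℚP.+-identityʳ (ι d ⊗ g′ (suc i)) ⟨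
    ι d ⊗ g′ (suc i) ⊕ 0ℚ      ≡⟨ cong (ι d ⊗ g′ (suc i) ⊕_) (low′ i (ℕP.<⇒≤ lt)) ⟨
    ι d ⊗ g′ (suc i) ⊕ g′ i    ≡⟨ eq (suc i) ⟩
    g (suc i)                  ≡⟨ low (suc i) lt ⟩
    0ℚ                         ∎)
  lead : ∀ M → OrderAtLeast M g′ → ι d ⊗ g′ M ≡ g M
  lead zero low′ = eq 0
  lead (suc M) low′ = trans (sym (trans (cong (ι d ⊗ g′ (suc M) ⊕_) (low′ M ℕP.≤-refl)) (ℚP.+-identityʳ (ι d ⊗ g′ (suc M))))) (eq (suc M))

leads-divs : ∀ a N us → length us ≤ N → All (λ u → a +ℤ u ≢ 0ℤ) us → LeadsWith N (absProd a us) 1 (ev a N (divs us))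
leads-divs a N [] _ _ = (λ i lt → trans (ev-unit a N i) (δ-off N i (λ e → ℕP.<-irrefl (sym e) lt))) , trans (cong (λ z → ν 1 ⊗ ∣ z ∣ℚ) (trans (ev-unit a N N) (δ-diag N))) (ℚP.*-identityʳ (ν 1))
leads-divs a N (u ∷ us) le (ne ∷ nes) = leads-div {N} {absProd a us} {1} {ev a N (divs us)} {ev a N (divs (u ∷ us))} (a +ℤ u) ne (ev-div a N u us le) (leads-divs a N us (ℕP.<⇒≤ le) nes)

-- At a simple pole t = a the Laurent expansion starts at x⁻¹.
leads-muls : ∀ a u us vs → a +ℤ u ≡ 0ℤ → All (λ u → a +ℤ u ≢ 0ℤ) us → length vs + 2 ≤ length (u ∷ us) →
  LeadsWith (length us) (absProd a us) (absProd a vs) (ev a (length (u ∷ us)) (muls vs (divs (u ∷ us))))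
leads-muls a u us [] e nes le = (λ i lt → trans (shift i) (proj₁ base (suc i) (s≤s lt))) , trans (cong (λ z → ν (absProd a us) ⊗ ∣ z ∣ℚ) (shift (length us))) (proj₂ base)
  where
  N = length (u ∷ us)
  base = leads-divs a N us (ℕP.n≤1+n (length us)) nes
  g = ev a N (divs (u ∷ us))
  lem : ∀ x y → 0ℚ ⊗ x ⊕ y ≡ y
  lem = solve-∀ ℚ-ring
  shift : ∀ i → g i ≡ ev a N (divs us) (suc i)
  shift i = trans (sym (trans (cong (λ z → z ⊗ g (suc i) ⊕ g i) (trans (cong ι e) ι-0)) (lem (g (suc i)) (g i)))) (ev-div a N u us ℕP.≤-refl (suc i))
leads-muls a u us (v ∷ vs) e nes le = (λ i lt → trans (ev-mul a u us v vs le i) (proj₁ step i lt)) , trans (cong (λ z → ν (absProd a us) ⊗ ∣ z ∣ℚ) (ev-mul a u us v vs le (length us))) (proj₂ step)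
  where
  step = leads-mul {length us} {absProd a us} {absProd a vs} {ev a (length (u ∷ us)) (muls vs (divs (u ∷ us)))} (a +ℤ v) (leads-muls a u us vs e nes (ℕP.<⇒≤ le))

-- Non-vanishing

rsum-first : ∀ (P : ℚ → Set) → P 0ℚ → (∀ {x y} → P x → P y → P (x ⊕ y)) → ∀ n f → (∀ i → i < n → P (f (suc i))) → Σ ℚ λ y → P y × rsum (suc n) f ≡ f 0 ⊕ y
rsum-first P z a zero f h = 0ℚ , z , ℚP.+-comm 0ℚ (f 0)
rsum-first P z a (suc n) f h with rsum-first P z a n f (λ i lt → h i (ℕP.m<n⇒m<1+n lt))
... | y , py , e = y ⊕ f (suc n) , a py (h n ℕP.≤-refl) , trans (cong (_⊕ f (suc n)) e) (ℚP.+-assoc (f 0) y (f (suc n)))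

coef-beyond : ∀ us f k j → All (Bounded us) f → cntℤ k us < j → coef f k j ≡ 0ℚ
coef-beyond us f k j bd lt = lin-zero f (All.map (λ {(c , k′ , j′)} → at k′ j′) bd)
  where
  at : ∀ k′ j′ → j′ ≤ cntℤ k′ us → indicator k j k′ j′ ≡ 0ℚ
  at k′ j′ le with k ≟ℤ k′
  ... | yes refl = δ-off j j′ (λ e → ℕP.<⇒≱ lt (subst (_≤ cntℤ k us) (sym e) le))
  ... | no _ = refl

range-positive : ∀ a L → 1 ≤ a → All (λ u → 0ℤ +ℤ u ≢ 0ℤ) (range (+ a) L)
range-positive a zero _ = []
range-positive (suc a) (suc L) 1≤a = (λ ()) ∷ subst (λ z → All (λ u → 0ℤ +ℤ u ≢ 0ℤ) (range z L)) (trans (cong +_ (ℕP.+-comm 1 (suc a))) (ℤP.pos-+ (suc a) 1)) (range-positive (suc (suc a)) L (s≤s z≤n))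

integral-sgn : ∀ π (pr : Prime π) j → Adic.Integral π pr (sgn j)
integral-sgn π pr zero = Adic.integral-1 π pr
integral-sgn π pr (suc j) = Adic.integral-neg π pr (integral-sgn π pr j)

rise-indivisible : ∀ π → Prime π → ∀ x L → (∀ i → i < L → ¬ π ∣ x + i) → ¬ π ∣ rise x L
rise-indivisible π pr x zero h = Adic.π∤1 π pr
rise-indivisible π pr x (suc L) h = Adic.π∤* π pr (subst (λ z → ¬ π ∣ z) (ℕP.+-identityʳ x) (h 0 (s≤s z≤n))) (rise-indivisible π pr (suc x) L (λ i lt → subst (λ z → ¬ π ∣ z) (ℕP.+-suc x i) (h (suc i) (s≤s lt))))

power-indivisible : ∀ π → Prime π → ∀ x n → ¬ π ∣ x → ¬ π ∣ x ^ n
power-indivisible π pr x zero h = Adic.π∤1 π pr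
power-indivisible π pr x (suc n) h = Adic.π∤* π pr h (power-indivisible π pr x n h)

module Arithmetic (b₀ c₀ m r : ℕ) (even : b₀ ≡ 2 * c₀) (10≤m : 10 ≤ m) (1≤r : 1 ≤ r) (r≤23 : r ≤ 23)
  (ρ : ℕ → ℚ) (conv : OddZetaValues b₀ ρ)
  (D : ℕ) (clear : ∀ j → ∃ λ z → ν D ⊗ ρ j ≡ ι z) where
  open Limit b₀ c₀ m r even 10≤m 1≤r r≤23 ρ conv public

  ξ-closed : ∀ (P : ℚ → Set) → P 0ℚ → (∀ {x y} → P x → P y → P (x ⊕ y)) → ∀ j → P (ρ j) → P (ξ j)
  ξ-closed P z a j h with parity j
  ... | inj₁ _ = z
  ... | inj₂ (zero , _) = z
  ... | inj₂ (suc i , _) = a h h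

  cell : ℕ → ℕ → ℚ
  cell k j = coef F (+ k) (suc j) ⊗ weightX (+ k) (suc j)

  X-cells : X ≡ rsum p (λ k → rsum N (cell k))
  X-cells = regroup p N weightX F (All.map (λ {(c , k , j)} (po , pr , bd) → po , pr , ℕP.≤-trans bd (cntℤ≤length k dens)) (All.zip (F-poles , All.zip (F-proper , F-bounded))))

  integral-X : ∀ π (pr : Prime π) → Adic.Integral π pr (ν D ⊗ (multiplier b m ⊗ X))
  integral-X π pr = subst P (sym X-cells) (rsum-closed P P-0 P-+ p _ λ k k<p → rsum-closed P P-0 P-+ N (cell k) λ j j<N → at k j k<p j<N)
    where
    open Adic π pr using (Integral; integral-0; integral-+; integral-*; integral-neg; integral-ι)
    open AtPrime π pr
    w = multiplier b m
    P : ℚ → Set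
    P x = Integral (ν D ⊗ (w ⊗ x))
    P-0 : P 0ℚ
    P-0 = subst Integral (sym (lem (ν D) w)) integral-0
      where
      lem : ∀ a w → a ⊗ (w ⊗ 0ℚ) ≡ 0ℚ
      lem = solve-∀ ℚ-ring
    P-+ : ∀ {x y} → P x → P y → P (x ⊕ y)
    P-+ {x} {y} h h′ = subst Integral (lem (ν D) w x y) (integral-+ h h′)
      where
      lem : ∀ a w x y → a ⊗ (w ⊗ x) ⊕ a ⊗ (w ⊗ y) ≡ a ⊗ (w ⊗ (x ⊕ y))
      lem = solve-∀ ℚ-ring
    integral-ξ : ∀ j → Integral (ν D ⊗ ξ j)
    integral-ξ j = ξ-closed (λ x → Integral (ν D ⊗ x)) (subst Integral (sym (ℚP.*-zeroʳ (ν D))) integral-0)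
      (λ {x} {y} h h′ → subst Integral (sym (ℚP.*-distribˡ-+ (ν D) x y)) (integral-+ h h′)) j (subst Integral (sym (proj₂ (clear j))) (integral-ι (proj₁ (clear j))))
    lem : ∀ D w c B ξ x g y → B ⊗ ((w ⊗ c) ⊗ (D ⊗ ξ) ⊕ (⊖ (D ⊗ (w ⊗ (c ⊗ x)))) ⊕ g ⊗ (D ⊗ (w ⊗ (c ⊗ y)))) ≡ D ⊗ (w ⊗ (c ⊗ (B ⊗ (ξ ⊝ x ⊕ g ⊗ y))))
    lem = solve-∀ ℚ-ring
    at : ∀ k j → k < p → j < N → P (cell k j)
    at k j k<p j<N = subst Integral (lem (ν D) w (coef F (+ k) (suc j)) (B (suc j)) (ξ (suc j)) (Z (suc j) k) (sgn (suc j)) (Z (suc j) (p ∸ k)))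
      (integral-* (integral-ι (bin (suc j) b₀)) (integral-+ (integral-+ (integral-* (integral-coef k (suc j) k<p (s≤s z≤n) j<N) (integral-ξ (suc j)))
        (integral-neg (integral-* (integral-ι (+ D)) (integral-term k (suc j) k k<p (s≤s z≤n) j<N (ℕP.<⇒≤ k<p)))))
        (integral-* (integral-sgn π pr (suc j)) (integral-* (integral-ι (+ D)) (integral-term k (suc j) (p ∸ k) k<p (s≤s z≤n) j<N (ℕP.m∸n≤m p k))))))

  us-nonzero : All (λ u → 0ℤ +ℤ u ≢ 0ℤ) us
  us-nonzero = AllP.++⁺ (rep-All (2 * b) inner (range-positive 1 (p ∸ 1) ℕP.≤-refl)) (rep-All b blocks (AllP.++⁺ (blk 0) (AllP.++⁺ (blk 1) (AllP.++⁺ (blk 2) (AllP.++⁺ (blk 3) (blk 4))))))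
    where
    blk : ∀ e → All (λ u → 0ℤ +ℤ u ≢ 0ℤ) (block (suc e))
    blk e = range-positive (suc e * m) (width (suc e)) (ℕP.≤-trans 0<m (ℕP.m≤m+n m (e * m)))

  simple-pole : cntℤ 0ℤ dens ≡ 1
  simple-pole = trans (cntℤ-here 0ℤ us) (cong suc (none us us-nonzero))
    where
    none : ∀ us → All (λ u → 0ℤ +ℤ u ≢ 0ℤ) us → cntℤ 0ℤ us ≡ 0
    none [] [] = refl
    none (u ∷ us) (h ∷ hs) = trans (cntℤ-there 0ℤ u us (λ e → h (trans (ℤP.+-identityˡ u) (sym e)))) (none us hs)

  residue : ν (absProd 0ℤ us) ⊗ ∣ coef F 0ℤ 1 ∣ℚ ≡ ν (absProd 0ℤ vs)
  residue = trans (cong (λ z → ν (absProd 0ℤ us) ⊗ ∣ z ∣ℚ) (coef-ev N F 0ℤ 1 ℕP.≤-refl (s≤s z≤n) (All.map (λ {(c , k , j)} bd → ℕP.≤-trans bd (cntℤ≤length k dens)) F-bounded)))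
    (proj₂ (leads-muls 0ℤ 0ℤ us vs refl us-nonzero degree))

  24m<p : 24 * m < p
  24m<p = subst (_≤ p) (ℕP.+-comm (24 * m) 1) (ℕP.+-monoʳ-≤ (24 * m) 1≤r)

  module _ (prime-p : Prime p) (p∤D : ¬ p ∣ D) where
    open Adic p prime-p
    -- Level 0 suffices: apart from the polar term, all distances of poles and all summation lengths
    -- stay below `p`, so no power of `p` has to be counted.
    open AdicSizes p prime-p 0

    -- Modulo `p` the zeros are `±1, ..., ±24 m`, and `24 m < p`.
    vs-indivisible : ¬ p ∣ absProd 0ℤ vs
    vs-indivisible = subst (λ z → ¬ p ∣ z) (sym (trans (absProd-rep 0ℤ b (leftZeros ++ rightZeros)) (cong (_^ b) (trans (absProd-++ 0ℤ leftZeros rightZeros) (cong₂ _*_ left right)))))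
      (power-indivisible p prime-p (rise 1 (24 * m) * rise (suc p) (24 * m)) b
        (π∤* (rise-indivisible p prime-p 1 (24 * m) small) (rise-indivisible p prime-p (suc p) (24 * m) λ i lt dv → small i lt (∣m+n∣m⇒∣n (subst (p ∣_) (sym (ℕP.+-suc p i)) dv) Div.∣-refl))))
      where
      small : ∀ i → i < 24 * m → ¬ p ∣ suc i
      small i lt dv = ℕP.<⇒≱ (ℕP.≤-<-trans lt 24m<p) (Div.∣⇒≤ dv)
      lem : ∀ L → + 0 +ℤ (-ℤ L) ≡ + 1 -ℤ (+ 1 +ℤ L)
      lem = ℤSolver.solve-∀
      left : absProd 0ℤ leftZeros ≡ rise 1 (24 * m)
      left = absProd-down 0ℤ (-ℤ + (24 * m)) (24 * m) 1 (trans (lem (+ (24 * m))) (cong (λ z → 1ℤ -ℤ z) (sym (ℤP.pos-+ 1 (24 * m)))))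
      right : absProd 0ℤ rightZeros ≡ rise (suc p) (24 * m)
      right = absProd-up 0ℤ (+ suc p) (24 * m) (suc p) (ℤP.+-identityˡ (+ suc p))

    p<p¹ : ∀ {n} → n < p → n < p ^ 1
    p<p¹ {n} = subst (n <_) (sym (ℕP.*-identityʳ p))

    coef-integral : ∀ k j → k < p → j < N → Integral (coef F (+ k) (suc j))
    coef-integral k j k<p j<N = integral-val {0} {0} z≤n (val-coef 0 0ℤ us vs (+ k) (suc j) degree (All.map close₀ dens-below) (s≤s z≤n) j<N)
      where
      close₀ : ∀ {u} → Below p u → ∣ -ℤ + k +ℤ u ∣ℤ < p ^ 1
      close₀ (n , refl , n<p) = p<p¹ (ℕP.≤-<-trans (subst (_≤ n ⊔ k) (cong ∣_∣ℤ (trans (sym (ℤP.m-n≡m⊖n n k)) (ℤP.+-comm (+ n) (-ℤ + k)))) (ℤP.∣m⊝n∣≤m⊔n n k)) (ℕP.⊔-lub n<p k<p))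

    Z-integral : ∀ j n → n < p → Integral (Z j n)
    Z-integral j n n<p = integral-val {0} {0} z≤n (val-zetaPartial (j + b₀) n (p<p¹ n<p))

    ξ-integral : ∀ j → Integral (ξ j)
    ξ-integral j = ξ-closed Integral integral-0 integral-+ j (proj₁ (clear j) , D , p∤D , proj₂ (clear j))

    cell-integral : ∀ k j → 0 < k → k < p → j < N → Integral (cell k j)
    cell-integral k j 0<k k<p j<N = integral-* (coef-integral k j k<p j<N) (integral-* (integral-ι (bin (suc j) b₀))
      (integral-+ (integral-+ (ξ-integral (suc j)) (integral-neg (Z-integral (suc j) k k<p))) (integral-* (integral-sgn p prime-p (suc j)) (Z-integral (suc j) (p ∸ k) (ℕP.∸-monoʳ-< 0<k (ℕP.<⇒≤ k<p))))))

    cell-0 : ∀ j → Integral (cell 0 (suc j))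
    cell-0 j = subst Integral (sym (trans (cong (_⊗ weightX 0ℤ (suc (suc j))) (coef-beyond dens F 0ℤ (suc (suc j)) F-bounded (subst (_< suc (suc j)) (sym simple-pole) (s≤s (s≤s z≤n))))) (ℚP.*-zeroˡ (weightX 0ℤ (suc (suc j)))))) integral-0

    -- Carries the summand `1 / p^b` of `Z 1 p`. Only `k = 0` needs a partial sum of length
    -- `p - k = p`, and its pole is simple, so this is the sole place where `p` enters a
    -- denominator.
    polar : ℚ
    polar = coef F 0ℤ 1 ⊗ (B 1 ⊗ invPow (p ∸ 1) b)

    suc-p : suc (p ∸ 1) ≡ p
    suc-p = ℕP.m+[n∸m]≡n 0<p

    cell-00 : Σ ℚ λ y → Integral y × cell 0 0 ≡ y ⊝ polar
    cell-00 = coef F 0ℤ 1 ⊗ (B 1 ⊗ (⊖ Z 1 (p ∸ 1))) , integral-* (coef-integral 0 0 0<p (s≤s z≤n)) (integral-* (integral-ι (bin 1 b₀)) (integral-neg (Z-integral 1 (p ∸ 1) (subst (p ∸ 1 <_) suc-p ℕP.≤-refl)))) ,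
      trans (cong (λ n → coef F 0ℤ 1 ⊗ (B 1 ⊗ (0ℚ ⊝ 0ℚ ⊕ (⊖ 1ℚ) ⊗ Z 1 n))) (sym suc-p)) (lem (coef F 0ℤ 1) (B 1) (Z 1 (p ∸ 1)) (invPow (p ∸ 1) b))
      where
      lem : ∀ c B z i → c ⊗ (B ⊗ (0ℚ ⊝ 0ℚ ⊕ (⊖ 1ℚ) ⊗ (z ⊕ i))) ≡ c ⊗ (B ⊗ (⊖ z)) ⊝ c ⊗ (B ⊗ i)
      lem = solve-∀ ℚ-ring

    X+polar : Integral (X ⊕ polar)
    X+polar = subst Integral (sym eq) (integral-+ (integral-+ (proj₁ (proj₂ cell-00)) (proj₁ (proj₂ row))) (proj₁ (proj₂ rows)))
      where
      open ≡-Reasoning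
      row = rsum-first Integral integral-0 integral-+ (length us) (cell 0) (λ j _ → cell-0 j)
      rows = rsum-first Integral integral-0 integral-+ (p ∸ 1) (λ k → rsum N (cell k)) (λ k lt → rsum-closed Integral integral-0 integral-+ N (cell (suc k)) (λ j j<N → cell-integral (suc k) j (s≤s z≤n) (subst (suc k <_) suc-p (s≤s lt)) j<N))
      a = proj₁ cell-00
      lem : ∀ a q y z → a ⊝ q ⊕ y ⊕ z ⊕ q ≡ a ⊕ y ⊕ z
      lem = solve-∀ ℚ-ring
      eq : X ⊕ polar ≡ a ⊕ proj₁ row ⊕ proj₁ rows
      eq = begin
        X ⊕ polar                                                     ≡⟨ cong (_⊕ polar) (trans X-cells (cong (λ n → rsum n (λ k → rsum N (cell k))) (sym suc-p))) ⟩
        rsum (suc (p ∸ 1)) (λ k → rsum N (cell k)) ⊕ polar            ≡⟨ cong (_⊕ polar) (proj₂ (proj₂ rows)) ⟩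
        rsum N (cell 0) ⊕ proj₁ rows ⊕ polar                          ≡⟨ cong (λ z → z ⊕ proj₁ rows ⊕ polar) (trans (proj₂ (proj₂ row)) (cong (_⊕ proj₁ row) (proj₂ (proj₂ cell-00)))) ⟩
        a ⊝ polar ⊕ proj₁ row ⊕ proj₁ rows ⊕ polar                    ≡⟨ lem a polar (proj₁ row) (proj₁ rows) ⟩
        a ⊕ proj₁ row ⊕ proj₁ rows                                    ∎

    -- If `d * polar = n`, the value of the residue gives `d V = p^b U |n|` up to sign, although `p`
    -- divides neither `d` nor the product `V` of the zeros.
    polar-not-integral : ¬ Integral polar
    polar-not-integral (n , d , p∤d , e) = π∤* p∤d vs-indivisible (subst (p ∣_) (sym (ℕ-eq)) (∣m⇒∣m*n (absProd 0ℤ us * ∣ n ∣ℤ) (∣m⇒∣m*n (p ^ b₀) Div.∣-refl)))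
      where
      open ≡-Reasoning
      U = absProd 0ℤ us
      V = absProd 0ℤ vs
      c = coef F 0ℤ 1
      I = invPow (p ∸ 1) b
      q = p ^ b
      unit : ν q ⊗ I ≡ 1ℚ
      unit = trans (cong (λ z → ν (z ^ b) ⊗ I) (sym suc-p)) (invPow-spec (p ∸ 1) b)
      0≤I : 0ℚ ≤ℚ I
      0≤I = ℚP.<⇒≤ (ℚP.*-cancelˡ-<-nonNeg (ν q) {{ℚ.nonNegative (0≤ν q)}} (subst₂ _<ℚ_ (sym (ℚP.*-zeroʳ (ν q))) (sym unit) 0<1ℚ))
      abs-polar : ∣ polar ∣ℚ ≡ ∣ c ∣ℚ ⊗ I
      abs-polar = trans (∣⊗∣ c (B 1 ⊗ I)) (cong (∣ c ∣ℚ ⊗_) (trans (∣⊗∣ (B 1) I) (trans (cong₂ _⊗_ (trans (∣ι∣ (bin 1 b₀)) (trans (cong ν (bin-1 b₀)) ι-1)) (ℚP.0≤p⇒∣p∣≡p 0≤I)) (ℚP.*-identityˡ I))))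
      abs-eq : ν d ⊗ (∣ c ∣ℚ ⊗ I) ≡ ν ∣ n ∣ℤ
      abs-eq = trans (cong₂ _⊗_ (sym (ℚP.0≤p⇒∣p∣≡p (0≤ν d))) (sym abs-polar)) (trans (sym (∣⊗∣ (ν d) polar)) (trans (cong ∣_∣ℚ e) (∣ι∣ n)))
      lem : ∀ d c U q I → d ⊗ (U ⊗ c) ⊗ (q ⊗ I) ≡ q ⊗ (U ⊗ (d ⊗ (c ⊗ I)))
      lem = solve-∀ ℚ-ring
      ℕ-eq : d * V ≡ p ^ b * (U * ∣ n ∣ℤ)
      ℕ-eq = ℤP.+-injective (ι-injective (begin
        ν (d * V)                               ≡⟨ ν-* d V ⟩
        ν d ⊗ ν V                               ≡⟨ cong (ν d ⊗_) residue ⟨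
        ν d ⊗ (ν U ⊗ ∣ c ∣ℚ)                    ≡⟨ ℚP.*-identityʳ (ν d ⊗ (ν U ⊗ ∣ c ∣ℚ)) ⟨
        ν d ⊗ (ν U ⊗ ∣ c ∣ℚ) ⊗ 1ℚ               ≡⟨ cong (ν d ⊗ (ν U ⊗ ∣ c ∣ℚ) ⊗_) unit ⟨
        ν d ⊗ (ν U ⊗ ∣ c ∣ℚ) ⊗ (ν q ⊗ I)        ≡⟨ lem (ν d) ∣ c ∣ℚ (ν U) (ν q) I ⟩
        ν q ⊗ (ν U ⊗ (ν d ⊗ (∣ c ∣ℚ ⊗ I)))      ≡⟨ cong (λ z → ν q ⊗ (ν U ⊗ z)) abs-eq ⟩
        ν q ⊗ (ν U ⊗ ν ∣ n ∣ℤ)                  ≡⟨ trans (ν-* q (U * ∣ n ∣ℤ)) (cong (ν q ⊗_) (ν-* U ∣ n ∣ℤ)) ⟨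
        ν (q * (U * ∣ n ∣ℤ))                    ∎))

    X≢0 : X ≢ 0ℚ
    X≢0 e = polar-not-integral (subst Integral (trans (cong (_⊕ polar) e) (ℚP.+-identityˡ polar)) X+polar)

-- The contradiction for a large prime.

0<^ℚ : ∀ n {x} → 0ℚ <ℚ x → 0ℚ <ℚ x ^ℚ n
0<^ℚ zero h = 0<1ℚ
0<^ℚ (suc n) h = 0<⊗ h (0<^ℚ n h)

0<lcmBound : ∀ n s → 0ℚ <ℚ lcmBound n s
0<lcmBound zero s = 0<1ℚ
0<lcmBound (suc n) zero = 0<1ℚ
0<lcmBound (suc n) (suc zero) = 0<1ℚ
0<lcmBound (suc n) s@(suc (suc _)) = 0<⊗ (0<central ℕ.⌈ s /2⌉) (0<lcmBound n ℕ.⌈ s /2⌉)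

tieProd-pos : ∀ z s → 0 < z → 0 < tieProd z s
tieProd-pos z zero 0<z = 0<z
tieProd-pos z (suc s) 0<z = ℕP.*-mono-≤ (ℕP.≤-trans 0<z (ℕP.m≤m+n z (suc s))) (tieProd-pos z s 0<z)

tieAll-pos : ∀ m J → 0 < m → 0 < tieAll m J
tieAll-pos m zero 0<m = s≤s z≤n
tieAll-pos m (suc J) 0<m = ℕP.*-mono-≤ (tieProd-pos (suc J * m) 24 (ℕP.≤-trans 0<m (ℕP.m≤m+n m (J * m)))) (tieAll-pos m J 0<m)

0<multiplier : ∀ b m → 10 ≤ m → 0ℚ <ℚ multiplier b m
0<multiplier b m 10≤m = 0<^ℚ b (0<⊗ (0<⊗ (0<ν (Natural.fact-pos m 10≤m plus)) (0<inv (0<ν (Natural.fact-pos m 10≤m minus)))) (0<⊗ (0<^ℚ 8 (0<lcmBound m m)) (0<^ℚ 26 (0<ν (tieAll-pos m 72 (ℕP.≤-trans (s≤s z≤n) 10≤m))))))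

-- `b (186 m + 167)` bounds the number of linear factors for every `r ≤ 23` (186 = 48 + 48 + 90 and
-- 167 = 46 + 120 + 1), so the majorant no longer depends on `r`.
sizeMajorant : ℕ → ℕ → ℕ → ℕ
sizeMajorant b₀ D m = D * (2 * (sizePoly m ^ suc b₀ * (suc b₀ * (186 * m + 167)) ^ b₀))

poly-sizeMajorant : ∀ b₀ D → PolyBounded (sizeMajorant b₀ D)
poly-sizeMajorant b₀ D = poly-* (poly-const D) (poly-* (poly-const 2) (poly-* (poly-^ (suc b₀) poly-sizePoly) (poly-^ b₀ (poly-* (poly-const (suc b₀)) (poly-linear 186 167)))))

module Contradiction (b₀ c₀ m r : ℕ) (even : b₀ ≡ 2 * c₀) (10≤m : 10 ≤ m) (1≤r : 1 ≤ r) (r≤23 : r ≤ 23)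
  (ρ : ℕ → ℚ) (conv : OddZetaValues b₀ ρ)
  (D : ℕ) (clear : ∀ j → ∃ λ z → ν D ⊗ ρ j ≡ ι z) where
  open Arithmetic b₀ c₀ m r even 10≤m 1≤r r≤23 ρ conv D clear

  steps≤ : steps ≤ b * (186 * m + 167)
  steps≤ = begin
    length vs + suc (length us)                                       ≡⟨ cong₂ (λ x y → x + suc y) len-vs len-us ⟩
    b * (24 * m + 24 * m) + suc (2 * b * (p ∸ 1) + b * rest)          ≤⟨ ℕP.+-monoʳ-≤ (b * (24 * m + 24 * m)) (s≤s (ℕP.+-mono-≤ (ℕP.*-monoʳ-≤ (2 * b) p-1≤) (ℕP.*-monoʳ-≤ b rest≤))) ⟩
    b * (24 * m + 24 * m) + suc (2 * b * (24 * m + 23) + b * (90 * m + 120)) ≤⟨ ℕP.m≤m+n _ b₀ ⟩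
    b * (24 * m + 24 * m) + suc (2 * b * (24 * m + 23) + b * (90 * m + 120)) + b₀ ≡⟨ lem b₀ m ⟩
    b * (186 * m + 167)                                               ∎
    where
    open ℕP.≤-Reasoning
    p-1≤ : p ∸ 1 ≤ 24 * m + 23
    p-1≤ = ℕP.≤-trans (ℕP.m∸n≤m p 1) (ℕP.+-monoʳ-≤ (24 * m) r≤23)
    l : ∀ m r → (22 * m + r + 1) + ((20 * m + r + 1) + ((18 * m + r + 1) + ((16 * m + r + 1) + (14 * m + r + 1)))) ≡ 90 * m + (5 * r + 5)
    l = ℕSolver.solve-∀
    rest≤ : rest ≤ 90 * m + 120
    rest≤ = ℕP.≤-trans (ℕP.≤-reflexive (l m r)) (ℕP.+-monoʳ-≤ (90 * m) (ℕP.+-monoˡ-≤ 5 (ℕP.*-monoʳ-≤ 5 r≤23)))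
    lem : ∀ b₀ m → suc b₀ * (24 * m + 24 * m) + suc (2 * suc b₀ * (24 * m + 23) + suc b₀ * (90 * m + 120)) + b₀ ≡ suc b₀ * (186 * m + 167)
    lem = ℕSolver.solve-∀

  size≤ : D * (2 * size) ≤ sizeMajorant b₀ D m
  size≤ = ℕP.*-monoʳ-≤ D (ℕP.*-monoʳ-≤ 2 (ℕP.*-monoʳ-≤ (sizePoly m ^ b) (ℕP.^-monoˡ-≤ b₀ steps≤)))

  Y : ℚ
  Y = ν D ⊗ (multiplier b m ⊗ X)

  Y-integer : Y ≡ ι (↥ Y)
  Y-integer = integral-everywhere Y integral-X

  Y-bound : ν (2 ^ m) ^ℚ b ⊗ ∣ Y ∣ℚ ≤ℚ ν (D * (2 * size))
  Y-bound = begin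
    W ⊗ ∣ ν D ⊗ (w ⊗ X) ∣ℚ         ≡⟨ cong (W ⊗_) (trans (∣⊗∣ (ν D) (w ⊗ X)) (cong₂ _⊗_ (ℚP.0≤p⇒∣p∣≡p (0≤ν D)) (trans (∣⊗∣ w X) (cong (_⊗ ∣ X ∣ℚ) (ℚP.0≤p⇒∣p∣≡p (ℚP.<⇒≤ (0<multiplier b m 10≤m))))))) ⟩
    W ⊗ (ν D ⊗ (w ⊗ ∣ X ∣ℚ))       ≡⟨ lem W (ν D) w ∣ X ∣ℚ ⟩
    ν D ⊗ (w ⊗ W ⊗ ∣ X ∣ℚ)         ≤⟨ ⊗-monoˡ (0≤ν D) X-bound ⟩
    ν D ⊗ ν (2 * size)             ≡⟨ ν-* D (2 * size) ⟨
    ν (D * (2 * size))             ∎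
    where
    open ℚP.≤-Reasoning
    W = ν (2 ^ m) ^ℚ b
    w = multiplier b m
    lem : ∀ W D w x → W ⊗ (D ⊗ (w ⊗ x)) ≡ D ⊗ (w ⊗ W ⊗ x)
    lem = solve-∀ ℚ-ring

  impossible : Prime p → 0 < D → D < p → sizeMajorant b₀ D m < 2 ^ m → ⊥
  impossible prime-p 0<D D<p small = absurd (∣ ↥ Y ∣ℤ ℕP.≟ 0)
    where
    Y≢0 : Y ≢ 0ℚ
    Y≢0 = ⊗≢0 (ν≢0 0<D) (⊗≢0 (0<⇒≢0 (0<multiplier b m 10≤m)) (X≢0 prime-p (λ dv → ℕP.<⇒≱ D<p (Div.∣⇒≤ {{ℕ.>-nonZero 0<D}} dv))))
    absurd : Dec (∣ ↥ Y ∣ℤ ≡ 0) → ⊥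
    absurd (yes e) = Y≢0 (trans Y-integer (trans (cong ι (ℤP.∣i∣≡0⇒i≡0 e)) ι-0))
    absurd (no ne) = ℕP.<-irrefl refl (begin-strict
      2 ^ m                        ≤⟨ ℕP.m≤m*n (2 ^ m) ((2 ^ m) ^ b₀) {{ℕP.m^n≢0 (2 ^ m) b₀ {{ℕP.m^n≢0 2 m}}}} ⟩
      (2 ^ m) ^ b                  ≤⟨ ℕP.m≤m*n ((2 ^ m) ^ b) ∣ ↥ Y ∣ℤ {{ℕ.≢-nonZero ne}} ⟩
      (2 ^ m) ^ b * ∣ ↥ Y ∣ℤ       ≤⟨ ν-cancel-≤ (subst (_≤ℚ ν (D * (2 * size))) (sym eq) Y-bound) ⟩
      D * (2 * size)               ≤⟨ size≤ ⟩
      sizeMajorant b₀ D m          <⟨ small ⟩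
      2 ^ m                        ∎)
      where
      open ℕP.≤-Reasoning
      ν-cancel-≤ : ∀ {x y} → ν x ≤ℚ ν y → x ≤ y
      ν-cancel-≤ le = ℕP.≮⇒≥ (λ lt → ℚP.<-irrefl refl (ℚP.<-≤-trans (ν-mono-< lt) le))
      eq : ν ((2 ^ m) ^ b * ∣ ↥ Y ∣ℤ) ≡ ν (2 ^ m) ^ℚ b ⊗ ∣ Y ∣ℚ
      eq = trans (ν-* ((2 ^ m) ^ b) ∣ ↥ Y ∣ℤ) (cong₂ _⊗_ (ν-^ (2 ^ m) b) (trans (sym (∣ι∣ (↥ Y))) (cong ∣_∣ℚ (sym Y-integer))))

common-denominator : ∀ (ρ : ℕ → ℚ) n → ∃ λ D → 0 < D × (∀ j → j < n → ∃ λ z → ν D ⊗ ρ j ≡ ι z)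
common-denominator ρ zero = 1 , s≤s z≤n , λ _ ()
common-denominator ρ (suc n) = extend (common-denominator ρ n)
  where
  extend : (∃ λ D → 0 < D × (∀ j → j < n → ∃ λ z → ν D ⊗ ρ j ≡ ι z)) → ∃ λ D → 0 < D × (∀ j → j < suc n → ∃ λ z → ν D ⊗ ρ j ≡ ι z)
  extend (D , 0<D , h) = D * d , ℕP.*-mono-≤ 0<D (s≤s z≤n) , λ j lt → at j (ℕP.m<1+n⇒m<n∨m≡n lt)
    where
    d = ↧ₙ (ρ n)
    lem : ∀ D d x → D ⊗ d ⊗ x ≡ d ⊗ (D ⊗ x)
    lem = solve-∀ ℚ-ring
    at : ∀ j → j < n ⊎ j ≡ n → ∃ λ z → ν (D * d) ⊗ ρ j ≡ ι z
    at j (inj₁ lt) = + d *ℤ proj₁ (h j lt) , trans (cong (_⊗ ρ j) (ν-* D d)) (trans (lem (ν D) (ν d) (ρ j)) (trans (cong (ν d ⊗_) (proj₂ (h j lt))) (sym (ι-* (+ d) (proj₁ (h j lt))))))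
    at j (inj₂ refl) = + D *ℤ ↥ (ρ n) , trans (cong (_⊗ ρ n) (ν-* D d)) (trans (ℚP.*-assoc (ν D) (ν d) (ρ n)) (trans (cong (ν D ⊗_) (denominator-scaled (ρ n))) (sym (ι-* (+ D) (↥ (ρ n))))))

-- ζ(j + 2 c₀) for the admissible j, and 0 for the others.
values : ∀ c₀ → let b = suc (2 * c₀) in ((s : ℕ) → Odd s → b + 2 ≤ s → s ≤ 8 * b ∸ 1 → ZetaRational s) →
  ∀ j → Σ ℚ λ x → (∀ i → j ≡ suc (2 * suc i) → j ≤ 7 * b → ConvergesTo (zetaPartial (j + 2 * c₀)) x) × (7 * b < j → x ≡ 0ℚ)
values c₀ h j = go (parity j) (j ℕP.≤? 7 * b)
  where
  b = suc (2 * c₀)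
  Goal = Σ ℚ λ x → (∀ i → j ≡ suc (2 * suc i) → j ≤ 7 * b → ConvergesTo (zetaPartial (j + 2 * c₀)) x) × (7 * b < j → x ≡ 0ℚ)
  go : (∃ λ i → j ≡ 2 * i) ⊎ (∃ λ i → j ≡ suc (2 * i)) → Dec (j ≤ 7 * b) → Goal
  go _ (no large) = 0ℚ , (λ i _ le → contradiction le large) , (λ _ → refl)
  go (inj₁ (i , e)) (yes le) = 0ℚ , (λ i′ e′ _ → contradiction (trans (sym e) e′) (ℕP.even≢odd i (suc i′))) , (λ _ → refl)
  go (inj₂ (zero , refl)) (yes le) = 0ℚ , (λ i ()) , (λ _ → refl)
  go (inj₂ (suc i , refl)) (yes le) = proj₁ z , (λ _ _ _ → proj₂ z) , (λ gt → contradiction le (ℕP.<⇒≱ gt))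
    where
    l₁ : ∀ i c → suc (2 * suc i) + 2 * c ≡ suc (2 * (suc i + c))
    l₁ = ℕSolver.solve-∀
    l₂ : ∀ i c → suc (2 * c) + 2 + 2 * i ≡ suc (2 * suc i) + 2 * c
    l₂ = ℕSolver.solve-∀
    l₃ : ∀ c → suc (7 * suc (2 * c) + 2 * c) ≡ 8 * suc (2 * c)
    l₃ = ℕSolver.solve-∀
    z = h (suc (2 * suc i) + 2 * c₀) (suc i + c₀ , l₁ i c₀) (ℕP.≤-trans (ℕP.m≤m+n (b + 2) (2 * i)) (ℕP.≤-reflexive (l₂ i c₀)))
      (ℕP.≤-trans (ℕP.+-monoˡ-≤ (2 * c₀) le) (ℕP.∸-monoˡ-≤ 1 (ℕP.≤-reflexive (l₃ c₀))))

irrational : ∀ c₀ → let b = suc (2 * c₀) in ¬ ((s : ℕ) → Odd s → b + 2 ≤ s → s ≤ 8 * b ∸ 1 → ZetaRational s)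
-- This bound gives `p > D`, hence `p` does not divide `D`, and also `m ≥ m₀ + 10`.
irrational c₀ h = choose (primes-unbounded (24 * (m₀ + 10) + D))
  where
  b₀ = 2 * c₀
  ρ : ℕ → ℚ
  ρ j = proj₁ (values c₀ h j)
  conv : OddZetaValues b₀ ρ
  conv i = proj₁ (proj₂ (values c₀ h (suc (2 * suc i)))) i refl
  cd = common-denominator ρ (suc (7 * suc b₀))
  D = proj₁ cd
  clear : ∀ j → ∃ λ z → ν D ⊗ ρ j ≡ ι z
  clear j = go (j ℕP.≤? 7 * suc b₀)
    where
    go : Dec (j ≤ 7 * suc b₀) → ∃ λ z → ν D ⊗ ρ j ≡ ι z
    go (yes le) = proj₂ (proj₂ cd) j (s≤s le)
    go (no nle) = 0ℤ , trans (cong (ν D ⊗_) (proj₂ (proj₂ (values c₀ h j)) (ℕP.≰⇒> nle))) (trans (ℚP.*-zeroʳ (ν D)) (sym ι-0))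
  threshold = poly<exp {sizeMajorant b₀ D} (poly-sizeMajorant b₀ D)
  m₀ = proj₁ threshold
  choose : (∃ λ π → Prime π × 24 * (m₀ + 10) + D < π) → ⊥
  choose (π , pr , lt) = Contradiction.impossible b₀ c₀ m r refl 10≤m (ℕP.n≢0⇒n>0 r≢0) (ℕP.≤-pred (DM.m%n<n π 24)) ρ conv D clear
      (subst Prime π-eq pr) (proj₁ (proj₂ cd)) (subst (D <_) π-eq (ℕP.≤-<-trans (ℕP.m≤n+m D (24 * (m₀ + 10))) lt)) (proj₂ threshold m (ℕP.≤-trans (ℕP.m≤m+n m₀ 10) m-large))
    where
    m = π / 24
    r = π % 24
    24m₀<π : 24 * (m₀ + 10) < π
    24m₀<π = ℕP.≤-<-trans (ℕP.m≤m+n (24 * (m₀ + 10)) D) lt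
    m-large : m₀ + 10 ≤ m
    m-large = subst (_≤ m) (trans (cong (_/ 24) (ℕP.*-comm 24 (m₀ + 10))) (DM.m*n/n≡m (m₀ + 10) 24)) (DM./-monoˡ-≤ 24 (ℕP.<⇒≤ 24m₀<π))
    10≤m : 10 ≤ m
    10≤m = ℕP.≤-trans (ℕP.m≤n+m 10 m₀) m-large
    π-eq : π ≡ 24 * m + r
    π-eq = trans (DM.m≡m%n+[m/n]*n π 24) (trans (ℕP.+-comm r (m * 24)) (cong (_+ r) (ℕP.*-comm m 24)))
    -- Gives `24 m < p`; a multiple of 24 is not prime.
    r≢0 : r ≢ 0
    r≢0 e = not-both (prime⇒irreducible pr (Div.m%n≡0⇒n∣m π 24 e))
      where
      not-both : 24 ≡ 1 ⊎ 24 ≡ π → ⊥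
      not-both (inj₂ 24≡π) = ℕP.<⇒≢ (ℕP.≤-<-trans (ℕP.m≤m*n 24 (m₀ + 10) {{ℕ.>-nonZero (ℕP.≤-trans (s≤s z≤n) (ℕP.m≤n+m 10 m₀))}}) 24m₀<π) 24≡π

theorem2 : (b : ℕ) → Odd b → 1 ≤ b →
    ¬ ((s : ℕ) → Odd s → b + 2 ≤ s → s ≤ 8 * b ∸ 1 → ZetaRational s)
theorem2 _ (c₀ , refl) _ = irrational c₀
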